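{- Let $G$ be a minimally $2$-connected graph of order $n$. Then \[ \overline{\kappa}(G)\leq 2+\frac{(n-2)^2}{4n(n-1)}<\frac{9}{4}. \] Moreover, let $n=4k+\ell$, where $k,\ell\in\mathbb{Z}$ and $0\leq \ell<4$. (a) If $k\geq 8$ and $\ell=0$, then \[ \overline{\kappa}(G)\leq 2+\frac{n^2-4n}{4n(n-1)}=2+\frac{n-4}{4(n-1)}, \] with equality if and only if $G$ is obtained from an ideally connected $6$-regular graph of order $k$ by subdividing every edge. (b) If $k\geq 30$ and $\ell=1$, then \[ \overline{\kappa}(G)\leq 2+\frac{n^2-6n+13}{4n(n-1)}, \] with equality if and only if $G$ is obtained from an ideally connected nearly regular (multi)graph of order $k$ and size $n-k=3k+1$ by subdividing every edge. (c) If $k\geq 68$ and $\ell=2$, then \[ \overline{\kappa}(G)\leq 2+\frac{n^2-8n+60}{4n(n-1)}, \] with equality if and only if $G$ is obtained from an ideally connected nearly regular graph of either order $k$ and size $n-k=3k+2$, or order $k+1$ and size $n-k-1=3k+1$, by subdividing every edge. (d) If $k\geq 30$ and $\ell=3$, then \[ \overline{\kappa}(G)\leq 2+\frac{n^2-6n+17}{4n(n-1)}, \] with equality if and only if $G$ is obtained from an ideally connected nearly regular graph of order $k+1$ and size $n-k-1=3k+2$ by subdividing every edge.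
   Context: Graphs are finite and may have multiple edges but no loops; the degree of a vertex counts edges with multiplicity, the order of a graph is its number of vertices and its size is its number of edges (with multiplicity). For distinct vertices $u,v$ of a graph $G$, $\kappa_G(u,v)$ denotes the maximum number of internally disjoint $u$--$v$ paths in $G$ (a set of $u$--$v$ paths is internally disjoint if no two of them share an edge or a vertex other than $u,v$; parallel edges between $u$ and $v$ give different paths). The average connectivity of a graph $G$ of order $n$ is $\overline{\kappa}(G)=\sum_{\{u,v\}\subseteq V(G)}\kappa_G(u,v)/\binom{n}{2}$. The connectivity $\kappa(G)$ of a non-trivial graph $G$ is the smallest number of vertices whose removal disconnects $G$ or produces the trivial (one-vertex) graph. A graph $G$ is minimally $2$-connected if $\kappa(G)=2$ and $\kappa(G-e)<2$ for every edge $e$ of $G$. A graph $G$ is ideally connected if $\kappa_G(u,v)=\min\{\deg(u),\deg(v)\}$ for all pairs of distinct vertices $u,v$ of $G$. A graph is nearly regular if the difference between its maximum degree and its minimum degree is at most $1$. Subdividing an edge means replacing it by a path of length $2$ through a new vertex of degree $2$ (every edge, including each of several parallel edges, is subdivided exactly once). -}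

module Defs where

open import Data.Bool.Base using (if_then_else_)
open import Data.Empty using (⊥-elim)
open import Data.Fin.Base using (Fin; zero; suc; punchIn; splitAt; _↑ˡ_; _↑ʳ_)
open import Data.Fin.Properties using (_≟_; _<?_; any?; injective⇒≤; splitAt-↑ˡ; splitAt-↑ʳ)
open import Data.Fin.Subset using (Subset; ∣_∣; ∁) renaming (_∉_ to _∉ₛ_)
open import Data.Fin.Subset.Properties using (∣p∣≤n)
open import Data.Integer.Base using (+_)
open import Data.List.Base using (List; []; _∷_; length; map; filter; allFin; cartesianProduct; lookup)
open import Data.List.Extrema.Nat using (max; min)
open import Data.List.Membership.Propositional using (_∈_; _∉_)
open import Data.List.Membership.Propositional.Properties using (∈-lookup)
open import Data.List.Properties using (length-map)
open import Data.List.Relation.Unary.All as All using (All; []; _∷_)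
open import Data.List.Relation.Unary.AllPairs as AllPairs using (AllPairs; []; _∷_; allPairs?)
import Data.List.Relation.Unary.AllPairs.Properties as AllPairsP
open import Data.List.Relation.Unary.Any using (here; there)
open import Data.List.Relation.Unary.Unique.Propositional using (Unique)
open import Data.Nat.Base using (ℕ; zero; suc; _+_; _*_; _∸_; _≤_; _<_; _⊓_; z≤n; s≤s; NonZero; NonTrivial; n>1⇒nonTrivial)
open import Data.Nat.Combinatorics using (_C_; nC1≡n; nCk+nC[k+1]≡[n+1]C[k+1])
open import Data.Nat.ListAction using (sum)
open import Data.Nat.Properties using (≤-trans; ≤-reflexive; ≤-pred; n≤1+n; m≤n⇒m<n∨m≡n)
open import Data.Product.Base using (∃; _×_; _,_; proj₁; proj₂; uncurry)
open import Data.Product.Properties using (≡-dec)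
open import Data.Rational.Base using (ℚ; _/_)
open import Data.Sum.Base using (_⊎_; inj₁; inj₂; [_,_])
open import Function.Base using (_∘_)
open import Function.Bundles using (_↔_; Inverse)
open import Relation.Binary.Definitions using (DecidableEquality)
open import Relation.Binary.PropositionalEquality.Core using (_≡_; _≢_; refl; sym; trans; cong; subst)
open import Relation.Nullary using (¬_; Dec; yes; no; does; ¬?; map′; _×-dec_; _⊎-dec_; _→-dec_)
open import Relation.Unary using (Decidable)

-- Finite multigraphs without loops.  Edges are labelled, so parallel edges are
-- different edges with the same ends; the order of the two ends is irrelevant.

record Graph : Set where
  field
    order    : ℕ
    size     : ℕ
    ends     : Fin size → Fin order × Fin order
    loopless : ∀ e → proj₁ (ends e) ≢ proj₂ (ends e)

  V : Set
  V = Fin order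

  E : Set
  E = Fin size

  Joins : E → V → V → Set
  Joins e u v = ends e ≡ (u , v) ⊎ ends e ≡ (v , u)

open Graph public

module _ (G : Graph) where

  Incident : V G → E G → Set
  Incident v e = v ≡ proj₁ (ends G e) ⊎ v ≡ proj₂ (ends G e)

  incident? : ∀ v → Decidable (Incident v)
  incident? v e = v ≟ proj₁ (ends G e) ⊎-dec v ≟ proj₂ (ends G e)

  degree : V G → ℕ
  degree v = length (filter (incident? v) (allFin (size G)))

  degrees : List ℕ
  degrees = map degree (allFin (order G))

  maxDegree : ℕ
  maxDegree = max 0 degrees

  -- The first argument of min is its value on the empty list, and an upper
  -- bound on its value otherwise.
  minDegree : ℕ
  minDegree = min maxDegree degrees

  NearlyRegular : Set
  NearlyRegular = maxDegree ∸ minDegree ≤ 1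

  Regular : ℕ → Set
  Regular d = ∀ v → degree v ≡ d

  data Walk : V G → V G → Set where
    []   : ∀ {u} → Walk u u
    step : ∀ {u w v} (e : E G) → Joins G e u w → Walk w v → Walk u v

module _ {G : Graph} where

  vertices : ∀ {u v} → Walk G u v → List (V G)
  vertices {u} []           = u ∷ []
  vertices {u} (step _ _ w) = u ∷ vertices w

  edges : ∀ {u v} → Walk G u v → List (E G)
  edges []           = []
  edges (step e _ w) = e ∷ edges w

  IsPath : ∀ {u v} → Walk G u v → Set
  IsPath w = Unique (vertices w)

  InternallyDisjoint : ∀ {u v} → Walk G u v → Walk G u v → Set
  InternallyDisjoint {u} {v} p q =
    All (λ e → e ∉ edges q) (edges p) ×
    All (λ x → x ∈ vertices q → x ≡ u ⊎ x ≡ v) (vertices p)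

-- For u ≢ v every path has an edge, so pairwise disjoint paths are distinct and
-- these lists are sets of k paths.
DisjointPaths : (G : Graph) → V G → V G → ℕ → Set
DisjointPaths G u v k =
  ∃ λ (ps : List (Walk G u v)) → length ps ≡ k × All IsPath ps × AllPairs InternallyDisjoint ps

IsMaximum : (ℕ → Set) → ℕ → Set
IsMaximum P m = P m × (∀ k → P k → k ≤ m)

IsMinimum : (ℕ → Set) → ℕ → Set
IsMinimum P m = P m × (∀ k → P k → m ≤ k)

private

  searchEq : ∀ {A : Set} → DecidableEquality A → ∀ {x y : A} {Q : x ≡ y → Set} →
             Decidable Q → Dec (∃ Q)
  searchEq _≟′_ {x} {y} Q? with x ≟′ y
  ... | no x≢y   = no λ (p , _) → x≢y p
  ... | yes refl = map′ (refl ,_) (λ { (refl , q) → q }) (Q? refl)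

  unique⇒length≤ : ∀ {n} {xs : List (Fin n)} → Unique xs → length xs ≤ n
  unique⇒length≤ {xs = xs} u = injective⇒≤ (λ {i} {j} → inj u i j)
    where
    inj : ∀ {xs} → Unique xs → ∀ i j → lookup xs i ≡ lookup xs j → i ≡ j
    inj (x ∷ u) zero    zero    _  = refl
    inj (x ∷ u) zero    (suc j) eq = ⊥-elim (All.lookup x (∈-lookup j) eq)
    inj (x ∷ u) (suc i) zero    eq = ⊥-elim (All.lookup x (∈-lookup i) (sym eq))
    inj (x ∷ u) (suc i) (suc j) eq = cong suc (inj u i j eq)

module _ {G : Graph} where

  open import Data.List.Membership.DecPropositional (_≟_ {n = order G}) using ()
    renaming (_∈?_ to _∈V?_)
  open import Data.List.Membership.DecPropositional (_≟_ {n = size G}) using ()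
    renaming (_∈?_ to _∈E?_)
  open import Data.List.Relation.Unary.Unique.DecPropositional (_≟_ {n = order G}) using (unique?)

  isPath? : ∀ {u v} → Decidable (IsPath {G} {u} {v})
  isPath? w = unique? (vertices w)

  internallyDisjoint? : ∀ {u v} (p q : Walk G u v) → Dec (InternallyDisjoint p q)
  internallyDisjoint? {u} {v} p q =
    All.all? (λ e → ¬? (e ∈E? edges q)) (edges p) ×-dec
    All.all? (λ x → (x ∈V? vertices q) →-dec (x ≟ u ⊎-dec x ≟ v)) (vertices p)

  private

    _≟²_ : DecidableEquality (V G × V G)
    _≟²_ = ≡-dec _≟_ _≟_

    searchJoins : ∀ {e u w} {Q : Joins G e u w → Set} → Decidable Q → Dec (∃ Q)
    searchJoins Q? =
      map′ [ (λ (p , q) → inj₁ p , q) , (λ (p , q) → inj₂ p , q) ]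
           (λ { (inj₁ p , q) → inj₁ (p , q) ; (inj₂ p , q) → inj₂ (p , q) })
           (searchEq _≟²_ (Q? ∘ inj₁) ⊎-dec searchEq _≟²_ (Q? ∘ inj₂))

    searchNil : ∀ {u v} {P : Walk G u v → Set} → Decidable P →
                Dec (∃ λ (eq : u ≡ v) → P (subst (Walk G u) eq []))
    searchNil P? = searchEq _≟_ (λ eq → P? (subst (Walk G _) eq []))

    searchWalk : ∀ b {u v} {P : Walk G u v → Set} → Decidable P →
                 Dec (∃ λ w → length (edges w) ≤ b × P w)
    searchWalk zero P? =
      map′ (λ { (refl , p) → [] , z≤n , p })
           (λ { ([] , _ , p) → refl , p ; (step _ _ _ , () , _) })
           (searchNil P?)
    searchWalk (suc b) P? =
      map′ [ (λ { (refl , p) → [] , z≤n , p })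
           , (λ (e , x , j , w , l , p) → step e j w , s≤s l , p) ]
           (λ { ([] , _ , p) → inj₁ (refl , p)
              ; (step e j w , s≤s l , p) → inj₂ (e , _ , j , w , l , p) })
           (searchNil P? ⊎-dec
            any? λ e → any? λ x → searchJoins λ (j : Joins G e _ x) → searchWalk b λ w → P? (step e j w))

    length-vertices : ∀ {u v} (w : Walk G u v) → length (vertices w) ≡ suc (length (edges w))
    length-vertices []           = refl
    length-vertices (step _ _ w) = cong suc (length-vertices w)

    path-length : ∀ {u v} (w : Walk G u v) → IsPath w → length (edges w) ≤ order G
    path-length w p = ≤-trans (n≤1+n _)
      (≤-trans (≤-reflexive (sym (length-vertices w))) (unique⇒length≤ p))

    searchPath : ∀ {u v} {P : Walk G u v → Set} → Decidable P → Dec (∃ λ w → IsPath w × P w)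
    searchPath P? =
      map′ (λ (w , _ , p) → w , p)
           (λ (w , p , q) → w , path-length w p , p , q)
           (searchWalk (order G) λ w → isPath? w ×-dec P? w)

    searchPaths : ∀ k {u v} {P : List (Walk G u v) → Set} → Decidable P →
                  Dec (∃ λ ps → length ps ≡ k × All IsPath ps × P ps)
    searchPaths zero P? =
      map′ (λ p → [] , refl , [] , p) (λ { ([] , _ , _ , p) → p ; (_ ∷ _ , () , _) }) (P? [])
    searchPaths (suc k) P? =
      map′ (λ { (w , p , ps , refl , a , q) → w ∷ ps , refl , p ∷ a , q })
           (λ { ([] , () , _) ; (w ∷ ps , refl , p ∷ a , q) → w , p , ps , refl , a , q })
           (searchPath λ w → searchPaths k (P? ∘ (w ∷_)))

    firstEdge : ∀ {u v} → u ≢ v → (w : Walk G u v) → ∃ λ e → e ∈ edges w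
    firstEdge u≢v []           = ⊥-elim (u≢v refl)
    firstEdge u≢v (step e _ _) = e , here refl

  disjointPaths? : ∀ u v → Decidable (DisjointPaths G u v)
  disjointPaths? u v k = searchPaths k (allPairs? internallyDisjoint?)

  disjointPaths≤size : ∀ {u v k} → u ≢ v → DisjointPaths G u v k → k ≤ size G
  disjointPaths≤size {u} {v} u≢v (ps , refl , _ , d) =
    ≤-trans (≤-reflexive (sym (length-map f ps)))
            (unique⇒length≤ (AllPairsP.map⁺ (AllPairs.map (λ {p} {q} → differ p q) d)))
    where
    f : Walk G u v → E G
    f = proj₁ ∘ firstEdge u≢v
    differ : ∀ p q → InternallyDisjoint p q → f p ≢ f q
    differ p q (disj , _) eq =
      All.lookup disj (proj₂ (firstEdge u≢v p)) (subst (_∈ edges q) (sym eq) (proj₂ (firstEdge u≢v q)))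

greatest : ∀ {P : ℕ → Set} → Decidable P → ℕ → ℕ
greatest P? zero    = 0
greatest P? (suc b) = if does (P? (suc b)) then suc b else greatest P? b

greatest-isMaximum : ∀ {P : ℕ → Set} (P? : Decidable P) b → P 0 → (∀ k → P k → k ≤ b) →
                     IsMaximum P (greatest P? b)
greatest-isMaximum P? zero    p₀ bound = p₀ , bound
greatest-isMaximum {P} P? (suc b) p₀ bound with P? (suc b)
... | yes p = p , bound
... | no ¬p = greatest-isMaximum P? b p₀ λ k pk →
  [ ≤-pred , (λ { refl → ⊥-elim (¬p pk) }) ] (m≤n⇒m<n∨m≡n (bound k pk))

-- The maximum number of internally disjoint u–v paths, for u ≢ v; the value at
-- u ≡ v is meaningless.  Disjoint paths use different edges, so the search can
-- stop at the size of the graph.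
κ : (G : Graph) → V G → V G → ℕ
κ G u v = greatest (disjointPaths? {G} u v) (size G)

κ-isMaximum : ∀ G {u v} → u ≢ v → IsMaximum (DisjointPaths G u v) (κ G u v)
κ-isMaximum G {u} {v} u≢v =
  greatest-isMaximum (disjointPaths? {G} u v) (size G) ([] , refl , [] , [])
                     (λ _ → disjointPaths≤size u≢v)

IdeallyConnected : Graph → Set
IdeallyConnected G = ∀ u v → u ≢ v → κ G u v ≡ degree G u ⊓ degree G v

-- Each unordered pair {u , v} with u ≢ v, listed once.
pairs : ∀ n → List (Fin n × Fin n)
pairs n = filter (uncurry _<?_) (cartesianProduct (allFin n) (allFin n))

totalConnectivity : Graph → ℕ
totalConnectivity G = sum (map (uncurry (κ G)) (pairs (order G)))

nC2≢0 : ∀ n → .{{NonTrivial n}} → NonZero (n C 2)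
nC2≢0 (suc (suc n)) = subst NonZero
  (trans (cong (_+ (suc n C 2)) (sym (nC1≡n (suc n)))) (nCk+nC[k+1]≡[n+1]C[k+1] (suc n) 1)) _

averageConnectivity : (G : Graph) .{{_ : NonTrivial (order G)}} → ℚ
averageConnectivity G = (+ totalConnectivity G / (order G C 2)) {{nC2≢0 (order G)}}

4n[n∸1]≢0 : ∀ n → .{{NonTrivial n}} → NonZero (4 * n * (n ∸ 1))
4n[n∸1]≢0 (suc (suc n)) = _

4[n∸1]≢0 : ∀ n → .{{NonTrivial n}} → NonZero (4 * (n ∸ 1))
4[n∸1]≢0 (suc (suc n)) = _

module _ (G : Graph) where

  ConnectedAvoiding : Subset (order G) → V G → V G → Set
  ConnectedAvoiding S u v = ∃ λ (w : Walk G u v) → All (_∉ₛ S) (vertices w)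

  -- G − S is disconnected.
  Disconnects : Subset (order G) → Set
  Disconnects S = ∃ λ u → ∃ λ v → u ∉ₛ S × v ∉ₛ S × ¬ ConnectedAvoiding S u v

  -- G − S has exactly one vertex.
  LeavesTrivial : Subset (order G) → Set
  LeavesTrivial S = ∣ ∁ S ∣ ≡ 1

  -- κ(G) = c.  Exactly one such c exists when G has at least one vertex.
  HasConnectivity : ℕ → Set
  HasConnectivity = IsMinimum λ c → ∃ λ S → ∣ S ∣ ≡ c × (Disconnects S ⊎ LeavesTrivial S)

_-ₑ_ : (G : Graph) → E G → Graph
record { order = n ; size = suc m ; ends = f ; loopless = l } -ₑ e =
  record { order = n ; size = m ; ends = f ∘ punchIn e ; loopless = l ∘ punchIn e }

Minimally2Connected : Graph → Set
Minimally2Connected G =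
  HasConnectivity G 2 × (∀ e → ∃ λ c → c < 2 × HasConnectivity (G -ₑ e) c)

minimally2Connected⇒nonTrivial : ∀ G → Minimally2Connected G → NonTrivial (order G)
minimally2Connected⇒nonTrivial G (((S , ∣S∣≡2 , _) , _) , _) =
  n>1⇒nonTrivial (subst (_≤ order G) ∣S∣≡2 (∣p∣≤n S))

-- The old vertices come first, followed by one new vertex for each edge of G.
-- Edge e yields the two edges e ↑ˡ m and m ↑ʳ e joining its ends to its new vertex.
module _ (G : Graph) where

  private
    n = order G
    m = size G

  half : E G ⊎ E G → Fin (n + m) × Fin (n + m)
  half (inj₁ e) = proj₁ (ends G e) ↑ˡ m , n ↑ʳ e
  half (inj₂ e) = proj₂ (ends G e) ↑ˡ m , n ↑ʳ e

  private
    old≢new : ∀ (u : V G) (e : E G) → u ↑ˡ m ≢ n ↑ʳ e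
    old≢new u e eq
      with () ← trans (sym (splitAt-↑ˡ n u m)) (trans (cong (splitAt n) eq) (splitAt-↑ʳ n m e))

    half-loopless : ∀ s → proj₁ (half s) ≢ proj₂ (half s)
    half-loopless (inj₁ e) = old≢new _ e
    half-loopless (inj₂ e) = old≢new _ e

  subdivide : Graph
  subdivide = record
    { order    = n + m
    ; size     = m + m
    ; ends     = half ∘ splitAt m
    ; loopless = half-loopless ∘ splitAt m }

record _≅_ (G H : Graph) : Set where
  field
    onV : V G ↔ V H
    onE : E G ↔ E H
    preserves : ∀ e {u v} → Joins G e u v →
                Joins H (Inverse.to onE e) (Inverse.to onV u) (Inverse.to onV v)

{-# OPTIONS --safe #-}
module Submission where

-- Let F be the set of vertices of degree at least 3 and p = |F|.  As κ(u,v) is at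
-- most the smaller degree, only pairs in F exceed 2.  If F is independent, the
-- degrees in F sum to at most 2(n − p), and the excess Σ (κ − 2) is at most
-- (p − 1)(n − 2p) ≤ (n − 2)²/8.  If uv is an edge inside F, minimality gives a
-- vertex c separating u from v in G − uv; then κ ≤ 2 across this cut, and
-- replacing one side of it by the path u v c yields two smaller graphs of the same
-- kind whose orders sum to n + 3 and whose excesses sum to at least that of G.
-- Both sides have at least three vertices besides c, so by induction and
-- convexity the excess is then strictly below all the bounds.
--
-- For independent F and a given degree sum, Σ min(dᵢ, dⱼ) is largest exactly for
-- nearly regular degrees, and comparing the maxima leaves p = k or p = k + 1.  In
-- the case of equality the complement of F is independent with all degrees 2, so
-- G subdivides a graph on F.  Conversely, by Whitney's theorem κ ≥ 2 for all
-- pairs of vertices of G, which makes all the estimates tight.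

-- The induction does not run over minimally 2-connected graphs but over `Piece`, which asks only
-- for what a split is seen to preserve: every mixed cut costs at least 2, an edge has to be
-- separated at cost 2 only if both its ends have degree at least 3, and `K` is bounded by cuts. The
-- vertex `v` of the added path has degree 2, which exempts the two new edges, and no other degree
-- grows, so no old edge becomes subject to the condition in a side alone.
--
-- That a side has three vertices besides `c` is a matter of constants. With `a` and `b` such
-- vertices, a + b = n - 1, four times the excess is at most a² + b². A side with a = 2 would allow
-- n² - 6n + 13, which is exactly the numerator for ℓ = 1 and more than the one for ℓ = 2 once n is
-- large. From a = 3 on, convexity gives n² - 8n + 25, below the n² - 8n + 60 for ℓ = 2.
--
-- The excess X is taken over ordered pairs, so that the average connectivity is 2 + 4X / 4n(n - 1)
-- and the numerators in the theorem are bounds for 4X. The thresholds for k arise where two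
-- competing estimates of Σ min(dᵢ, dⱼ) both stop being strict.

-- Finite sums over lists.

module Summation where

  open import Data.Empty using (⊥-elim)
  open import Data.Fin.Base using (Fin; zero; suc)
  import Data.Fin.Properties as Fin
  open import Data.List.Base using (List; []; _∷_; _++_; length; map; filter; allFin)
  open import Data.List.Membership.Propositional using (_∈_)
  open import Data.List.Membership.Propositional.Properties using (∈-allFin)
  open import Data.List.Properties using (map-tabulate; map-∘; map-++)
  open import Data.List.Relation.Unary.All as All using (All; []; _∷_)
  open import Data.List.Relation.Unary.AllPairs using (AllPairs; []; _∷_)
  open import Data.List.Relation.Unary.Any using (here; there)
  open import Data.List.Relation.Unary.Unique.Propositional using (Unique)
  open import Data.List.Relation.Unary.Unique.Propositional.Properties using (allFin⁺)
  open import Data.Nat.Base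
  open import Data.Nat.ListAction using (sum)
  open import Data.Nat.ListAction.Properties using (sum-++)
  open import Data.Nat.Properties
  open import Data.Nat.Tactic.RingSolver using (solve-∀)
  open import Data.Product.Base using (∃; _×_; _,_)
  open import Function.Base using (_∘_; id)
  open import Function.Bundles using (_↔_; Inverse)
  open import Relation.Binary.Definitions using (DecidableEquality)
  open import Relation.Binary.PropositionalEquality
  open import Relation.Nullary using (¬_; ¬?; Dec; yes; no)
  open import Relation.Unary using (Decidable)

  private variable
    A B : Set
    P Q : Set

  𝟙 : Dec P → ℕ
  𝟙 (yes _) = 1
  𝟙 (no  _) = 0

  𝟙≤1 : (d : Dec P) → 𝟙 d ≤ 1
  𝟙≤1 (yes _) = ≤-refl
  𝟙≤1 (no  _) = z≤n

  𝟙-yes : (d : Dec P) → P → 𝟙 d ≡ 1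
  𝟙-yes (yes _) _ = refl
  𝟙-yes (no ¬p) p = ⊥-elim (¬p p)

  𝟙-no : (d : Dec P) → ¬ P → 𝟙 d ≡ 0
  𝟙-no (yes p) ¬p = ⊥-elim (¬p p)
  𝟙-no (no _)  _  = refl

  𝟙-pos : (d : Dec P) → 1 ≤ 𝟙 d → P
  𝟙-pos (yes p) _ = p

  𝟙-mono : (P → Q) → (d : Dec P) (e : Dec Q) → 𝟙 d ≤ 𝟙 e
  𝟙-mono f (yes p) e = ≤-reflexive (sym (𝟙-yes e (f p)))
  𝟙-mono f (no _)  e = z≤n

  𝟙-cong : (P → Q) → (Q → P) → (d : Dec P) (e : Dec Q) → 𝟙 d ≡ 𝟙 e
  𝟙-cong f g d e = ≤-antisym (𝟙-mono f d e) (𝟙-mono g e d)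

  ∑ : List A → (A → ℕ) → ℕ
  ∑ xs f = sum (map f xs)

  ∑-cong : ∀ (xs : List A) {f g : A → ℕ} → (∀ {x} → x ∈ xs → f x ≡ g x) → ∑ xs f ≡ ∑ xs g
  ∑-cong []       h = refl
  ∑-cong (x ∷ xs) h = cong₂ _+_ (h (here refl)) (∑-cong xs (h ∘ there))

  ∑-mono : ∀ (xs : List A) {f g : A → ℕ} → (∀ {x} → x ∈ xs → f x ≤ g x) → ∑ xs f ≤ ∑ xs g
  ∑-mono []       h = z≤n
  ∑-mono (x ∷ xs) h = +-mono-≤ (h (here refl)) (∑-mono xs (h ∘ there))

  -- This is how cases of equality are read off: once a chain of summed estimates closes up, none of
  -- its summands has any room left.
  ∑-tight : ∀ (xs : List A) {f g : A → ℕ} → (∀ {x} → x ∈ xs → f x ≤ g x) → ∑ xs g ≤ ∑ xs f →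
            ∀ {x} → x ∈ xs → f x ≡ g x
  ∑-tight (x ∷ xs) {f} {g} h le (here refl) = ≤-antisym (h (here refl)) (+-cancelʳ-≤ (∑ xs f) (g x) (f x)
    (≤-trans (+-monoʳ-≤ (g x) (∑-mono xs (h ∘ there))) le))
  ∑-tight (x ∷ xs) {f} {g} h le (there i) = ∑-tight xs (h ∘ there) (+-cancelˡ-≤ (g x) (∑ xs g) (∑ xs f)
    (≤-trans le (+-monoˡ-≤ (∑ xs f) (h (here refl))))) i

  ∑-+ : ∀ (xs : List A) {f g : A → ℕ} → ∑ xs (λ x → f x + g x) ≡ ∑ xs f + ∑ xs g
  ∑-+ []               = refl
  ∑-+ (x ∷ xs) {f} {g} = trans (cong (f x + g x +_) (∑-+ xs)) (interchange (f x) (g x) (∑ xs f) (∑ xs g))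
    where
    interchange : ∀ a b c d → (a + b) + (c + d) ≡ (a + c) + (b + d)
    interchange = solve-∀

  ∑-*ˡ : ∀ (xs : List A) c {f : A → ℕ} → ∑ xs (λ x → c * f x) ≡ c * ∑ xs f
  ∑-*ˡ []       c     = sym (*-zeroʳ c)
  ∑-*ˡ (x ∷ xs) c {f} = trans (cong (c * f x +_) (∑-*ˡ xs c)) (sym (*-distribˡ-+ c (f x) (∑ xs f)))

  ∑-*ʳ : ∀ (xs : List A) c {f : A → ℕ} → ∑ xs (λ x → f x * c) ≡ ∑ xs f * c
  ∑-*ʳ xs c {f} = trans (∑-cong xs (λ {x} _ → *-comm (f x) c)) (trans (∑-*ˡ xs c) (*-comm c (∑ xs f)))

  ∑-const : ∀ (xs : List A) c → ∑ xs (λ _ → c) ≡ length xs * c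
  ∑-const []       c = refl
  ∑-const (x ∷ xs) c = cong (c +_) (∑-const xs c)

  ∑-zero : ∀ (xs : List A) {f : A → ℕ} → (∀ {x} → x ∈ xs → f x ≡ 0) → ∑ xs f ≡ 0
  ∑-zero xs h = trans (∑-cong xs h) (trans (∑-const xs 0) (*-zeroʳ (length xs)))

  ∑-swap : ∀ (xs : List A) (ys : List B) {f : A → B → ℕ} →
           ∑ xs (λ x → ∑ ys (f x)) ≡ ∑ ys (λ y → ∑ xs (λ x → f x y))
  ∑-swap []       ys     = sym (∑-zero ys (λ _ → refl))
  ∑-swap (x ∷ xs) ys {f} = trans (cong (∑ ys (f x) +_) (∑-swap xs ys)) (sym (∑-+ ys))

  ∑-product : ∀ (xs : List A) (ys : List B) {f : A → ℕ} {g : B → ℕ} →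
              ∑ xs (λ x → ∑ ys (λ y → f x * g y)) ≡ ∑ xs f * ∑ ys g
  ∑-product xs ys {f} {g} = trans (∑-cong xs (λ {x} _ → ∑-*ˡ ys (f x))) (∑-*ʳ xs (∑ ys g))

  ∑-++ : ∀ (xs ys : List A) {f : A → ℕ} → ∑ (xs ++ ys) f ≡ ∑ xs f + ∑ ys f
  ∑-++ xs ys {f} = trans (cong sum (map-++ f xs ys)) (sum-++ (map f xs) (map f ys))

  ∑-map : ∀ (g : A → B) (xs : List A) {f : B → ℕ} → ∑ (map g xs) f ≡ ∑ xs (f ∘ g)
  ∑-map g xs = cong sum (sym (map-∘ xs))

  ∑-filter : ∀ {P : A → Set} (P? : Decidable P) (xs : List A) {f : A → ℕ} →
             ∑ (filter P? xs) f ≡ ∑ xs (λ x → 𝟙 (P? x) * f x)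
  ∑-filter P? []           = refl
  ∑-filter P? (x ∷ xs) {f} with P? x
  ... | yes p = cong₂ _+_ (sym (*-identityˡ (f x))) (∑-filter P? xs)
  ... | no ¬p = ∑-filter P? xs

  ∑-partition : ∀ {P : A → Set} (P? : Decidable P) (xs : List A) {f : A → ℕ} →
                ∑ xs f ≡ ∑ (filter P? xs) f + ∑ (filter (¬? ∘ P?) xs) f
  ∑-partition P? []           = refl
  ∑-partition P? (x ∷ xs) {f} with P? x
  ... | yes p = trans (cong (f x +_) (∑-partition P? xs)) (sym (+-assoc (f x) _ _))
  ... | no ¬p = trans (cong (f x +_) (∑-partition P? xs)) (rotate (f x) (∑ (filter P? xs) f) _)
    where
    rotate : ∀ a b c → a + (b + c) ≡ b + (a + c)
    rotate = solve-∀

  length-∑ : ∀ (xs : List A) → length xs ≡ ∑ xs (λ _ → 1)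
  length-∑ xs = trans (sym (*-identityʳ (length xs))) (sym (∑-const xs 1))

  length-filter-∑ : ∀ {P : A → Set} (P? : Decidable P) (xs : List A) →
                    length (filter P? xs) ≡ ∑ xs (𝟙 ∘ P?)
  length-filter-∑ P? xs = trans (length-∑ (filter P? xs))
    (trans (∑-filter P? xs) (∑-cong xs (λ _ → *-identityʳ _)))

  ∑-∈ : ∀ {xs : List A} {f : A → ℕ} {x} → x ∈ xs → f x ≤ ∑ xs f
  ∑-∈ (here refl)        = m≤m+n _ _
  ∑-∈ {f = f} (there {x = y} i) = ≤-trans (∑-∈ i) (m≤n+m _ (f y))

  ∑-pos : ∀ (xs : List A) {f : A → ℕ} → 1 ≤ ∑ xs f → ∃ λ x → x ∈ xs × 1 ≤ f x
  ∑-pos (x ∷ xs) {f} le with f x in eq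
  ... | suc _ = x , here refl , subst (1 ≤_) (sym eq) (s≤s z≤n)
  ... | zero  with y , i , p ← ∑-pos xs le = y , there i , p

  ∑≤1-unique : ∀ (xs : List A) {f : A → ℕ} → ∑ xs f ≤ 1 →
               ∀ {x y} → x ∈ xs → y ∈ xs → 1 ≤ f x → 1 ≤ f y → x ≡ y
  ∑≤1-unique (z ∷ xs)     le (here refl) (here refl) p q = refl
  ∑≤1-unique (z ∷ xs)     le (here refl) (there j)   p q = ⊥-elim (n≮n 1 (≤-trans (+-mono-≤ p (≤-trans q (∑-∈ j))) le))
  ∑≤1-unique (z ∷ xs)     le (there i)   (here refl) p q = ⊥-elim (n≮n 1 (≤-trans (+-mono-≤ q (≤-trans p (∑-∈ i))) le))
  ∑≤1-unique (z ∷ xs) {f} le (there i)   (there j)   p q =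
    ∑≤1-unique xs (≤-trans (m≤n+m _ (f z)) le) i j p q

  module _ (_≟_ : DecidableEquality A) where

    ∑-δ : ∀ {xs : List A} {f : A → ℕ} {x} → Unique xs → x ∈ xs → ∑ xs (λ y → 𝟙 (y ≟ x) * f y) ≡ f x
    ∑-δ {x ∷ xs} {f} (x≢ ∷ u) (here refl) = trans
      (cong₂ _+_ (trans (cong (_* f x) (𝟙-yes (x ≟ x) refl)) (*-identityˡ (f x)))
        (∑-zero xs (λ {y} i → cong (_* f y) (𝟙-no (y ≟ x) (λ { refl → All.lookup x≢ i refl })))))
      (+-identityʳ (f x))
    ∑-δ {z ∷ xs} {f} {x} (z≢ ∷ u) (there i) = trans
      (cong (_+ ∑ xs (λ y → 𝟙 (y ≟ x) * f y)) (cong (_* f z) (𝟙-no (z ≟ x) (λ { refl → All.lookup z≢ i refl }))))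
      (∑-δ {f = f} u i)

    ∑-δ₁ : ∀ {xs : List A} {x} → Unique xs → x ∈ xs → ∑ xs (λ y → 𝟙 (y ≟ x)) ≡ 1
    ∑-δ₁ {xs} {x} u i = trans (∑-cong xs (λ {y} _ → sym (*-identityʳ (𝟙 (y ≟ x))))) (∑-δ {f = λ _ → 1} u i)

    ∑-diag : ∀ {xs : List A} {f : A → A → ℕ} → Unique xs →
             ∑ xs (λ x → ∑ xs (λ y → 𝟙 (x ≟ y) * f x y)) ≡ ∑ xs (λ x → f x x)
    ∑-diag {xs} {f} u = ∑-cong xs (λ {x} i → trans
      (∑-cong xs (λ {y} _ → cong (_* f x y) (𝟙-cong sym sym (x ≟ y) (y ≟ x)))) (∑-δ {f = f x} u i))

  -- In its use for families of paths, `R` is internal disjointness and `P` says that a path passes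
  -- through a fixed edge or a fixed inner vertex, which only one path of the family can do.
  ∑-disjoint : ∀ {R : A → A → Set} {P : A → Set} (P? : Decidable P) → (∀ {x y} → R x y → P x → P y → Q) → ¬ Q →
               ∀ {xs} → AllPairs R xs → ∑ xs (𝟙 ∘ P?) ≤ 1
  ∑-disjoint P? h ¬q {[]}     []       = z≤n
  ∑-disjoint P? h ¬q {x ∷ xs} (r ∷ rs) with P? x
  ... | no _  = ∑-disjoint P? h ¬q rs
  ... | yes p = s≤s (≤-reflexive (∑-zero xs (λ {y} i → 𝟙-no (P? y) (λ q → ¬q (h (All.lookup r i) p q)))))

  ∑Fin : ∀ n → (Fin n → ℕ) → ℕ
  ∑Fin n = ∑ (allFin n)

  ∑Fin-suc : ∀ n (f : Fin (suc n) → ℕ) → ∑Fin (suc n) f ≡ f zero + ∑Fin n (f ∘ suc)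
  ∑Fin-suc n f = cong (λ xs → f zero + sum xs)
    (trans (map-tabulate suc f) (sym (map-tabulate id (f ∘ suc))))

  ∑Fin-const : ∀ n c → ∑Fin n (λ _ → c) ≡ n * c
  ∑Fin-const zero    c = refl
  ∑Fin-const (suc n) c = trans (∑Fin-suc n (λ _ → c)) (cong (c +_) (∑Fin-const n c))

  ∑Fin-↔ : ∀ {m n} (φ : Fin m ↔ Fin n) (f : Fin n → ℕ) → ∑Fin m (f ∘ Inverse.to φ) ≡ ∑Fin n f
  ∑Fin-↔ {m} {n} φ f = begin
    ∑Fin m (f ∘ to)                                        ≡⟨ ∑-cong (allFin m) (λ {x} _ → sym (∑-δ Fin._≟_ {f = f} (allFin⁺ n) (∈-allFin (to x)))) ⟩
    ∑Fin m (λ x → ∑Fin n (λ y → 𝟙 (y Fin.≟ to x) * f y))   ≡⟨ ∑-swap (allFin m) (allFin n) ⟩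
    ∑Fin n (λ y → ∑Fin m (λ x → 𝟙 (y Fin.≟ to x) * f y))   ≡⟨ ∑-cong (allFin n) (λ {y} _ → trans (∑-*ʳ (allFin m) (f y)) (trans (cong (_* f y) (count y)) (*-identityˡ (f y)))) ⟩
    ∑Fin n f                                               ∎
    where
    open ≡-Reasoning
    open Inverse φ
    count : ∀ y → ∑Fin m (λ x → 𝟙 (y Fin.≟ to x)) ≡ 1
    count y = trans
      (∑-cong (allFin m) (λ {x} _ → 𝟙-cong (λ { refl → sym (strictlyInverseʳ x) }) (λ { refl → sym (strictlyInverseˡ y) })
        (y Fin.≟ to x) (x Fin.≟ from y)))
      (∑-δ₁ Fin._≟_ (allFin⁺ m) (∈-allFin (from y)))

-- Upper bounds for sums of pairwise minima of weights.

module WeightSums where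

  open import Data.Empty using (⊥-elim)
  open import Data.List.Base using (List)
  open import Data.List.Membership.Propositional using (_∈_)
  open import Data.List.Relation.Unary.Unique.Propositional using (Unique)
  open import Data.Nat.Base
  open import Data.Nat.Properties hiding (_≟_)
  open import Data.Nat.Tactic.RingSolver using (solve-∀)
  open import Data.Product.Base using (_×_; _,_)
  open import Data.Sum.Base using (_⊎_; inj₁; inj₂)
  open import Relation.Binary.Definitions using (DecidableEquality)
  open import Relation.Binary.PropositionalEquality
  open import Relation.Nullary using (Dec; yes; no; ¬?)
  open Summation

  2m⊓n≤m+n : ∀ m n → 2 * (m ⊓ n) ≤ m + n
  2m⊓n≤m+n m n = subst (_≤ m + n) (cong (m ⊓ n +_) (sym (+-identityʳ (m ⊓ n)))) (+-mono-≤ (m⊓n≤m m n) (m⊓n≤n m n))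

  m+[n∸m]≡n+[m∸n] : ∀ m n → m + (n ∸ m) ≡ n + (m ∸ n)
  m+[n∸m]≡n+[m∸n] zero    n       = sym (trans (cong (n +_) (0∸n≡0 n)) (+-identityʳ n))
  m+[n∸m]≡n+[m∸n] (suc m) zero    = cong suc (+-identityʳ m)
  m+[n∸m]≡n+[m∸n] (suc m) (suc n) = cong suc (m+[n∸m]≡n+[m∸n] m n)

  n≤n² : ∀ n → n ≤ n * n
  n≤n² zero    = z≤n
  n≤n² (suc n) = m≤m*n (suc n) (suc n)

  4mn≤[m+n]² : ∀ m n → 4 * (m * n) ≤ (m + n) * (m + n)
  4mn≤[m+n]² m n with ≤-total m n
  ... | inj₁ m≤n with d , refl ← m≤n⇒∃[o]m+o≡n m≤n = ≤-trans (m≤m+n _ (d * d)) (≤-reflexive (square m d))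
    where
    square : ∀ m d → 4 * (m * (m + d)) + d * d ≡ (m + (m + d)) * (m + (m + d))
    square = solve-∀
  ... | inj₂ n≤m with d , refl ← m≤n⇒∃[o]m+o≡n n≤m = ≤-trans (m≤m+n _ (d * d)) (≤-reflexive (square n d))
    where
    square : ∀ n d → 4 * ((n + d) * n) + d * d ≡ (n + d + n) * (n + d + n)
    square = solve-∀

  private
    -- `Z` stands for Y + qp and `D` for qp²; `π` counts the weights above q, `P` is their total
    -- surplus and `Q` the total deficit of the positive weights below q. Here π = suc (r + t)
    -- exceeds r, so Q ≥ P - r ≥ π - r = suc t, and this deficit outweighs all that the additional
    -- large weights gain.
    opt-arith-> : ∀ Z D P Q r t → Z + (P + 2 * (suc (r + t) * Q)) ≤ D + suc (r + t) * P → P ≤ r + Q →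
                  suc (r + t) ≤ P → Z + r < D + r * r
    opt-arith-> Z D P Q r t h₁ h₂ h₃ = +-cancelʳ-< (r * t) _ _ (begin-strict
      (Z + r) + r * t                                   <⟨ m<m+n _ {suc (suc (t * t + 3 * t))} z<s ⟩
      ((Z + r) + r * t) + suc (suc (t * t + 3 * t))     ≡⟨ e₁ Z r t ⟩
      Z + (r + t + 2) * suc t                           ≤⟨ +-monoʳ-≤ Z (*-monoʳ-≤ (r + t + 2) 1+t≤Q) ⟩
      Z + (r + t + 2) * Q                               ≤⟨ +-cancelʳ-≤ (P + (r + t) * Q) _ _ step ⟩
      D + (r + t) * r                                   ≡⟨ e₂ D r t ⟩
      (D + r * r) + r * t                               ∎)
      where
      open ≤-Reasoning
      1+t≤Q : suc t ≤ Q
      1+t≤Q = +-cancelˡ-≤ r (suc t) Q (≤-trans (≤-reflexive (+-suc r t)) (≤-trans h₃ h₂))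
      e₁ : ∀ Z r t → ((Z + r) + r * t) + suc (suc (t * t + 3 * t)) ≡ Z + (r + t + 2) * suc t
      e₁ = solve-∀
      e₂ : ∀ D r t → D + (r + t) * r ≡ (D + r * r) + r * t
      e₂ = solve-∀
      e₃ : ∀ Z P m Q → (Z + (m + 2) * Q) + (P + m * Q) ≡ Z + (P + 2 * (suc m * Q))
      e₃ = solve-∀
      e₄ : ∀ D m r P Q → D + (P + m * (r + Q)) ≡ (D + m * r) + (P + m * Q)
      e₄ = solve-∀
      step : (Z + (r + t + 2) * Q) + (P + (r + t) * Q) ≤ (D + (r + t) * r) + (P + (r + t) * Q)
      step = begin
        (Z + (r + t + 2) * Q) + (P + (r + t) * Q) ≡⟨ e₃ Z P (r + t) Q ⟩
        Z + (P + 2 * (suc (r + t) * Q))           ≤⟨ h₁ ⟩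
        D + (P + (r + t) * P)                     ≤⟨ +-monoʳ-≤ D (+-monoʳ-≤ P (*-monoʳ-≤ (r + t) h₂)) ⟩
        D + (P + (r + t) * (r + Q))               ≡⟨ e₄ D (r + t) r P Q ⟩
        (D + (r + t) * r) + (P + (r + t) * Q)     ∎

    -- Here π = suc m and r = π + e. After P has been replaced by r + Q, the leftover
    -- `e * r + (m + 2) * Q` is kept on the left, because equality has to force both of its terms to
    -- vanish.
    opt-arith-≤ : ∀ Z D P Q m e → Z + (P + 2 * (suc m * Q)) ≤ D + suc m * P → P ≤ suc m + e + Q →
                  Z + (suc m + e) + (e * (suc m + e) + (m + 2) * Q) ≤ D + (suc m + e) * (suc m + e)
    opt-arith-≤ Z D P Q m e h₁ h₂ = +-cancelʳ-≤ (P + m * Q) _ _ (begin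
      Z + r + (e * r + (m + 2) * Q) + (P + m * Q) ≡⟨ e₁ Z m e P Q ⟩
      Z + (P + 2 * (suc m * Q)) + (r + e * r)     ≤⟨ +-monoˡ-≤ (r + e * r) h₁ ⟩
      D + (P + m * P) + (r + e * r)               ≤⟨ +-monoˡ-≤ (r + e * r) (+-monoʳ-≤ D (+-monoʳ-≤ P (*-monoʳ-≤ m h₂))) ⟩
      D + (P + m * (r + Q)) + (r + e * r)         ≡⟨ e₂ D m e P Q ⟩
      D + r * r + (P + m * Q)                     ∎)
      where
      open ≤-Reasoning
      r = suc m + e
      e₁ : ∀ Z m e P Q → Z + (suc m + e) + (e * (suc m + e) + (m + 2) * Q) + (P + m * Q) ≡
                         Z + (P + 2 * (suc m * Q)) + ((suc m + e) + e * (suc m + e))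
      e₁ = solve-∀
      e₂ : ∀ D m e P Q → D + (P + m * ((suc m + e) + Q)) + ((suc m + e) + e * (suc m + e)) ≡
                         D + (suc m + e) * (suc m + e) + (P + m * Q)
      e₂ = solve-∀

    opt-arith : ∀ Z D P Q π r → Z + (P + 2 * (π * Q)) ≤ D + π * P → P ≤ r + Q → π ≤ P → Z + r ≤ D + r * r
    opt-arith Z D P Q zero r h₁ h₂ h₃ =
      +-mono-≤ (≤-trans (m≤m+n Z (P + 0)) (≤-trans h₁ (≤-reflexive (+-identityʳ D)))) (n≤n² r)
    opt-arith Z D P Q (suc m) r h₁ h₂ h₃ with suc m ≤? r
    ... | yes le with e , refl ← m≤n⇒∃[o]m+o≡n le = ≤-trans (m≤m+n (Z + r) _) (opt-arith-≤ Z D P Q m e h₁ h₂)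
    ... | no gt with t , refl ← m≤n⇒∃[o]m+o≡n (s≤s⁻¹ (≰⇒> gt)) = <⇒≤ (opt-arith-> Z D P Q r t h₁ h₂ h₃)

    -- The condition `2 ≤ r` is for π = 0: there `Z + r` is at most `D + r`, which is smaller than
    -- `D + r * r` only if r is neither 0 nor 1.
    opt-tight : ∀ Z D P Q π r → 2 ≤ r → Z + (P + 2 * (π * Q)) ≤ D + π * P → P ≤ r + Q → π ≤ P →
                D + r * r ≤ Z + r → π ≡ r × Q ≡ 0 × P ≡ r
    opt-tight Z D P Q zero (suc zero) (s≤s ())
    opt-tight Z D P Q zero (suc (suc r)) 2≤r h₁ h₂ h₃ h₄ = ⊥-elim (n≮n _ (begin-strict
      Z + suc (suc r)                       ≤⟨ +-monoˡ-≤ (suc (suc r)) (≤-trans (m≤m+n Z (P + 0)) (≤-trans h₁ (≤-reflexive (+-identityʳ D)))) ⟩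
      D + suc (suc r)                       <⟨ +-monoʳ-< D (m<m*n (suc (suc r)) (suc (suc r)) (s≤s (s≤s z≤n))) ⟩
      D + suc (suc r) * suc (suc r)         ≤⟨ h₄ ⟩
      Z + suc (suc r)                       ∎))
      where open ≤-Reasoning
    opt-tight Z D P Q (suc m) (suc r) 2≤r h₁ h₂ h₃ h₄ with suc m ≤? suc r
    ... | no gt with t , refl ← m≤n⇒∃[o]m+o≡n (s≤s⁻¹ (≰⇒> gt)) = ⊥-elim (<⇒≱ (opt-arith-> Z D P Q (suc r) t h₁ h₂ h₃) h₄)
    ... | yes le with e , refl ← m≤n⇒∃[o]m+o≡n le = conclude e h₂ (+-cancelˡ-≤ (Z + suc (m + e)) _ 0
            (≤-trans (opt-arith-≤ Z D P Q m e h₁ h₂) (≤-trans h₄ (≤-reflexive (sym (+-identityʳ (Z + suc (m + e))))))))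
      where
      conclude : ∀ e → P ≤ suc m + e + Q → e * suc (m + e) + (m + 2) * Q ≤ 0 → suc m ≡ suc m + e × Q ≡ 0 × P ≡ suc m + e
      conclude (suc e) _  ()
      conclude zero    h₂ tight = sym (+-identityʳ (suc m)) , Q≡0 , ≤-antisym
        (≤-trans h₂ (≤-reflexive (trans (cong (suc m + 0 +_) Q≡0) (+-identityʳ (suc m + 0)))))
        (≤-trans (≤-reflexive (+-identityʳ (suc m))) h₃)
        where
        Q≡0 : Q ≡ 0
        Q≡0 with m*n≡0⇒m≡0∨n≡0 (m + 2) (n≤0⇒n≡0 tight)
        ... | inj₂ q = q
        ... | inj₁ m+2≡0 with () ← trans (sym (+-comm m 2)) m+2≡0

  module Weights {A : Set} (_≟_ : DecidableEquality A) (xs : List A) (unique : Unique xs) (w : A → ℕ) where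

    pos : A → ℕ
    pos x = 𝟙 (1 ≤? w x)

    p W Y : ℕ
    p = ∑ xs pos
    W = ∑ xs w
    Y = ∑ xs λ x → ∑ xs λ y → 𝟙 (¬? (x ≟ y)) * (w x ⊓ w y)

    -- `Y` leaves out the diagonal, whose entries are the weights themselves. The estimates are made
    -- with the diagonal included, where double sums of products factor.
    Y+W : ∑ xs (λ x → ∑ xs λ y → w x ⊓ w y) ≡ Y + W
    Y+W = begin
      ∑ xs (λ x → ∑ xs λ y → w x ⊓ w y)
        ≡⟨ ∑-cong xs (λ {x} _ → trans (∑-cong xs (λ {y} _ → split (x ≟ y) (w x ⊓ w y))) (∑-+ xs)) ⟩
      ∑ xs (λ x → ∑ xs (λ y → 𝟙 (¬? (x ≟ y)) * (w x ⊓ w y)) + ∑ xs (λ y → 𝟙 (x ≟ y) * (w x ⊓ w y)))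
        ≡⟨ ∑-+ xs ⟩
      Y + ∑ xs (λ x → ∑ xs (λ y → 𝟙 (x ≟ y) * (w x ⊓ w y)))
        ≡⟨ cong (Y +_) (trans (∑-diag _≟_ unique) (∑-cong xs (λ {x} _ → ⊓-idem (w x)))) ⟩
      Y + W ∎
      where
      open ≡-Reasoning
      split : ∀ {P : Set} (d : Dec P) m → m ≡ 𝟙 (¬? d) * m + 𝟙 d * m
      split (yes _) m = sym (*-identityˡ m)
      split (no _)  m = sym (trans (+-identityʳ (1 * m)) (*-identityˡ m))

    -- A minimum is at most the mean, and it vanishes unless both weights are positive. The
    -- indicators keep the zero weights from contributing, so that the factor is `p` and not the
    -- number of all vertices.
    average-bound : Y + W ≤ p * W
    average-bound = *-cancelˡ-≤ 2 (begin
      2 * (Y + W)                                                 ≡⟨ cong (2 *_) (sym Y+W) ⟩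
      2 * ∑ xs (λ x → ∑ xs λ y → w x ⊓ w y)                       ≡⟨ sym (trans (∑-cong xs (λ _ → ∑-*ˡ xs 2)) (∑-*ˡ xs 2)) ⟩
      ∑ xs (λ x → ∑ xs λ y → 2 * (w x ⊓ w y))                     ≤⟨ ∑-mono xs (λ {x} _ → ∑-mono xs (λ {y} _ → pointwise (w x) (w y))) ⟩
      ∑ xs (λ x → ∑ xs λ y → pos x * w y + w x * pos y)           ≡⟨ trans (∑-cong xs (λ _ → ∑-+ xs)) (∑-+ xs) ⟩
      ∑ xs (λ x → ∑ xs λ y → pos x * w y) + ∑ xs (λ x → ∑ xs λ y → w x * pos y)
                                                                  ≡⟨ cong₂ _+_ (∑-product xs xs) (∑-product xs xs) ⟩
      p * W + W * p                                               ≡⟨ double p W ⟩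
      2 * (p * W)                                                 ∎)
      where
      open ≤-Reasoning
      double : ∀ p W → p * W + W * p ≡ 2 * (p * W)
      double = solve-∀
      pointwise : ∀ a b → 2 * (a ⊓ b) ≤ 𝟙 (1 ≤? a) * b + a * 𝟙 (1 ≤? b)
      pointwise zero    b       = z≤n
      pointwise (suc a) zero    = z≤n
      pointwise (suc a) (suc b) = ≤-trans (2m⊓n≤m+n (suc a) (suc b))
        (≤-reflexive (trans (+-comm (suc a) (suc b)) (sym (cong₂ _+_ (*-identityˡ (suc b)) (*-identityʳ (suc a))))))

    module _ (q : ℕ) where

      private
        big a b : A → ℕ
        big x = 𝟙 (suc q ≤? w x)
        a x   = w x ∸ q
        -- Weights that are zero have no deficit: the comparison is with `q` at the `p` positive
        -- weights only.
        b x   = pos x * (q ∸ w x)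

        π P Q : ℕ
        π = ∑ xs big
        P = ∑ xs a
        Q = ∑ xs b

        W+Q : W + Q ≡ q * p + P
        W+Q = trans (sym (∑-+ xs)) (trans (∑-cong xs (λ {x} _ → pointwise (w x))) (trans (∑-+ xs) (cong (_+ P) (∑-*ˡ xs q))))
          where
          pointwise : ∀ m → m + 𝟙 (1 ≤? m) * (q ∸ m) ≡ q * 𝟙 (1 ≤? m) + (m ∸ q)
          pointwise zero    = sym (cong₂ _+_ (*-zeroʳ q) (0∸n≡0 q))
          pointwise (suc m) = begin
            suc m + 1 * (q ∸ suc m) ≡⟨ cong (suc m +_) (*-identityˡ (q ∸ suc m)) ⟩
            suc m + (q ∸ suc m)     ≡⟨ m+[n∸m]≡n+[m∸n] (suc m) q ⟩
            q + (suc m ∸ q)         ≡⟨ cong (_+ (suc m ∸ q)) (sym (*-identityʳ q)) ⟩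
            q * 1 + (suc m ∸ q)     ∎
            where open ≡-Reasoning

        big≤a : ∀ x → big x ≤ a x
        big≤a x = pointwise (w x)
          where
          pointwise : ∀ m → 𝟙 (suc q ≤? m) ≤ m ∸ q
          pointwise m with suc q ≤? m
          ... | yes q<m = m<n⇒0<n∸m q<m
          ... | no _    = z≤n

        π≤P : π ≤ P
        π≤P = ∑-mono xs (λ {x} _ → big≤a x)

        -- The minimum of two weights is at most their mean if both exceed q, the
        -- smaller one if only one does, and q if none does; the last term makes
        -- this exact on the diagonal.
        pair≤ : ∀ x y → 2 * (w x ⊓ w y) + (2 * (big x * b y) + 2 * (b x * big y)) + 𝟙 (x ≟ y) * (2 * b x) ≤
                        2 * q * (pos x * pos y) + (a x * big y + big x * a y)
        pair≤ x y = go (x ≟ y) (w x) (w y) (cong w)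
          where
          B : ℕ → ℕ
          B m = 𝟙 (1 ≤? m) * (q ∸ m)
          go : ∀ {P : Set} (d : Dec P) m n → (P → m ≡ n) →
               2 * (m ⊓ n) + (2 * (𝟙 (suc q ≤? m) * B n) + 2 * (B m * 𝟙 (suc q ≤? n))) + 𝟙 d * (2 * B m) ≤
               2 * q * (𝟙 (1 ≤? m) * 𝟙 (1 ≤? n)) + ((m ∸ q) * 𝟙 (suc q ≤? n) + 𝟙 (suc q ≤? m) * (n ∸ q))
          go d zero n _ = ≤-trans (≤-reflexive (vanish (𝟙 d))) z≤n
            where
            vanish : ∀ k → 2 * 0 + (2 * (0 * B n) + 2 * (0 * 𝟙 (suc q ≤? n))) + k * (2 * 0) ≡ 0
            vanish k = *-zeroʳ k
          go (yes e) (suc m) zero h with () ← h e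
          go (no _) (suc m) zero _ = ≤-trans (≤-reflexive (vanish (𝟙 (suc q ≤? suc m)) (B (suc m)))) z≤n
            where
            vanish : ∀ k l → 2 * 0 + (2 * (k * 0) + 2 * (l * 0)) + 0 ≡ 0
            vanish = solve-∀
          go d (suc m) (suc n) h with suc q ≤? suc m | suc q ≤? suc n
          go (yes e) (suc m) (suc n) h | yes i | yes j with refl ← h e = ≤-reflexive (begin
            2 * (suc m ⊓ suc m) + (2 * (1 * (1 * (q ∸ suc m))) + 2 * ((1 * (q ∸ suc m)) * 1)) + 1 * (2 * (1 * (q ∸ suc m)))
              ≡⟨ cong₂ (λ s t → 2 * s + (2 * (1 * (1 * t)) + 2 * ((1 * t) * 1)) + 1 * (2 * (1 * t)))
                   (⊓-idem (suc m)) (m≤n⇒m∸n≡0 (<⇒≤ i)) ⟩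
            2 * suc m + 0 + 0                               ≡⟨ cong (λ s → 2 * s + 0 + 0) (sym (m+[n∸m]≡n (<⇒≤ i))) ⟩
            2 * (q + (suc m ∸ q)) + 0 + 0                   ≡⟨ expand q (suc m ∸ q) ⟩
            2 * q * 1 + ((suc m ∸ q) * 1 + 1 * (suc m ∸ q)) ∎)
            where
            open ≡-Reasoning
            expand : ∀ q k → 2 * (q + k) + 0 + 0 ≡ 2 * q * 1 + (k * 1 + 1 * k)
            expand = solve-∀
          go (no _) (suc m) (suc n) h | yes i | yes j = begin
            2 * (suc m ⊓ suc n) + (2 * (1 * (1 * (q ∸ suc n))) + 2 * ((1 * (q ∸ suc m)) * 1)) + 0
              ≡⟨ cong₂ (λ s t → 2 * (suc m ⊓ suc n) + (2 * (1 * (1 * s)) + 2 * ((1 * t) * 1)) + 0)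
                   (m≤n⇒m∸n≡0 (<⇒≤ j)) (m≤n⇒m∸n≡0 (<⇒≤ i)) ⟩
            2 * (suc m ⊓ suc n) + 0 + 0            ≡⟨ trans (+-identityʳ _) (+-identityʳ _) ⟩
            2 * (suc m ⊓ suc n)                    ≤⟨ 2m⊓n≤m+n (suc m) (suc n) ⟩
            suc m + suc n                          ≡⟨ cong₂ _+_ (sym (m+[n∸m]≡n (<⇒≤ i))) (sym (m+[n∸m]≡n (<⇒≤ j))) ⟩
            (q + (suc m ∸ q)) + (q + (suc n ∸ q))  ≡⟨ expand q (suc m ∸ q) (suc n ∸ q) ⟩
            2 * q * 1 + ((suc m ∸ q) * 1 + 1 * (suc n ∸ q)) ∎
            where
            open ≤-Reasoning
            expand : ∀ q k l → (q + k) + (q + l) ≡ 2 * q * 1 + (k * 1 + 1 * l)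
            expand = solve-∀
          go (yes e) (suc m) (suc n) h | yes i | no j with refl ← h e = ⊥-elim (j i)
          go (no _) (suc m) (suc n) h | yes i | no j = begin
            2 * (suc m ⊓ suc n) + (2 * (1 * (1 * (q ∸ suc n))) + 2 * ((1 * (q ∸ suc m)) * 0)) + 0
              ≤⟨ +-monoˡ-≤ 0 (+-monoˡ-≤ _ (*-monoʳ-≤ 2 (m⊓n≤n (suc m) (suc n)))) ⟩
            2 * suc n + (2 * (1 * (1 * (q ∸ suc n))) + 2 * ((1 * (q ∸ suc m)) * 0)) + 0
              ≡⟨ collect (suc n) (q ∸ suc n) (q ∸ suc m) ⟩
            2 * (suc n + (q ∸ suc n)) * 1       ≡⟨ cong (λ s → 2 * s * 1) (m+[n∸m]≡n (s≤s⁻¹ (≰⇒> j))) ⟩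
            2 * q * 1                           ≤⟨ m≤m+n _ _ ⟩
            2 * q * 1 + ((suc m ∸ q) * 0 + 1 * (suc n ∸ q)) ∎
            where
            open ≤-Reasoning
            collect : ∀ n k l → 2 * n + (2 * (1 * (1 * k)) + 2 * ((1 * l) * 0)) + 0 ≡ 2 * (n + k) * 1
            collect = solve-∀
          go (yes e) (suc m) (suc n) h | no i | yes j with refl ← h e = ⊥-elim (i j)
          go (no _) (suc m) (suc n) h | no i | yes j = begin
            2 * (suc m ⊓ suc n) + (2 * (0 * (1 * (q ∸ suc n))) + 2 * ((1 * (q ∸ suc m)) * 1)) + 0
              ≤⟨ +-monoˡ-≤ 0 (+-monoˡ-≤ _ (*-monoʳ-≤ 2 (m⊓n≤m (suc m) (suc n)))) ⟩
            2 * suc m + (2 * (0 * (1 * (q ∸ suc n))) + 2 * ((1 * (q ∸ suc m)) * 1)) + 0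
              ≡⟨ collect (suc m) (q ∸ suc n) (q ∸ suc m) ⟩
            2 * (suc m + (q ∸ suc m)) * 1       ≡⟨ cong (λ s → 2 * s * 1) (m+[n∸m]≡n (s≤s⁻¹ (≰⇒> i))) ⟩
            2 * q * 1                           ≤⟨ m≤m+n _ _ ⟩
            2 * q * 1 + ((suc m ∸ q) * 1 + 0 * (suc n ∸ q)) ∎
            where
            open ≤-Reasoning
            collect : ∀ n k l → 2 * n + (2 * (0 * (1 * k)) + 2 * ((1 * l) * 1)) + 0 ≡ 2 * (n + l) * 1
            collect = solve-∀
          go (yes e) (suc m) (suc n) h | no i | no j with refl ← h e = begin
            2 * (suc m ⊓ suc m) + (2 * (0 * (1 * (q ∸ suc m))) + 2 * ((1 * (q ∸ suc m)) * 0)) + 1 * (2 * (1 * (q ∸ suc m)))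
              ≡⟨ cong (λ s → 2 * s + (2 * (0 * (1 * (q ∸ suc m))) + 2 * ((1 * (q ∸ suc m)) * 0)) + 1 * (2 * (1 * (q ∸ suc m)))) (⊓-idem (suc m)) ⟩
            2 * suc m + (2 * (0 * (1 * (q ∸ suc m))) + 2 * ((1 * (q ∸ suc m)) * 0)) + 1 * (2 * (1 * (q ∸ suc m)))
              ≡⟨ collect (suc m) (q ∸ suc m) ⟩
            2 * (suc m + (q ∸ suc m)) * 1       ≡⟨ cong (λ s → 2 * s * 1) (m+[n∸m]≡n (s≤s⁻¹ (≰⇒> i))) ⟩
            2 * q * 1                           ≤⟨ m≤m+n _ _ ⟩
            2 * q * 1 + ((suc m ∸ q) * 0 + 0 * (suc m ∸ q)) ∎
            where
            open ≤-Reasoning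
            collect : ∀ n k → 2 * n + (2 * (0 * (1 * k)) + 2 * ((1 * k) * 0)) + 1 * (2 * (1 * k)) ≡ 2 * (n + k) * 1
            collect = solve-∀
          go (no _) (suc m) (suc n) h | no i | no j = begin
            2 * (suc m ⊓ suc n) + (2 * (0 * (1 * (q ∸ suc n))) + 2 * ((1 * (q ∸ suc m)) * 0)) + 0
              ≡⟨ collect (suc m ⊓ suc n) (q ∸ suc n) (q ∸ suc m) ⟩
            2 * (suc m ⊓ suc n) * 1             ≤⟨ *-monoˡ-≤ 1 (*-monoʳ-≤ 2 (≤-trans (m⊓n≤m (suc m) (suc n)) (s≤s⁻¹ (≰⇒> i)))) ⟩
            2 * q * 1                           ≤⟨ m≤m+n _ _ ⟩
            2 * q * 1 + ((suc m ∸ q) * 0 + 0 * (suc n ∸ q)) ∎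
            where
            open ≤-Reasoning
            collect : ∀ n k l → 2 * n + (2 * (0 * (1 * k)) + 2 * ((1 * l) * 0)) + 0 ≡ 2 * n * 1
            collect = solve-∀

        -- This is `pair≤` summed over all ordered pairs. Off the diagonal term and the minima, each
        -- summand is a function of x times a function of y, so its double sum is a product of two
        -- of p, π, P and Q. The diagonal term of `pair≤` supplies the `Q` that turns W into qp + P.
        summed : (Y + q * p) + (P + 2 * (π * Q)) ≤ q * (p * p) + π * P
        summed = *-cancelˡ-≤ 2 (begin
          2 * ((Y + q * p) + (P + 2 * (π * Q)))         ≡⟨ e₁ Y q p P π Q ⟩
          2 * (Y + (q * p + P)) + (2 * (π * Q) + 2 * (Q * π))
            ≡⟨ cong (λ s → 2 * (Y + s) + (2 * (π * Q) + 2 * (Q * π))) (sym W+Q) ⟩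
          2 * (Y + (W + Q)) + (2 * (π * Q) + 2 * (Q * π)) ≡⟨ e₂ Y W π Q ⟩
          2 * (Y + W) + (2 * (π * Q) + 2 * (Q * π)) + 2 * Q
            ≡⟨ cong₂ _+_ (cong₂ _+_ (trans (cong (2 *_) (sym Y+W)) (sym (double 2))) (cong₂ _+_ (sym (double×)) (sym double×))) (sym diagonal) ⟩
          (∑ xs (λ x → ∑ xs λ y → 2 * (w x ⊓ w y)) +
            (∑ xs (λ x → ∑ xs λ y → 2 * (big x * b y)) + ∑ xs (λ x → ∑ xs λ y → 2 * (b x * big y)))) +
            ∑ xs (λ x → ∑ xs λ y → 𝟙 (x ≟ y) * (2 * b x))
            ≡⟨ sym (trans (∑∑-+ sum₃ diag₁) (cong (_+ ∑ xs (λ x → ∑ xs (diag₁ x))) (trans (∑∑-+ min₂ sum₂)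
                (cong (∑ xs (λ x → ∑ xs (min₂ x)) +_) (∑∑-+ (λ x y → 2 * (big x * b y)) (λ x y → 2 * (b x * big y))))))) ⟩
          ∑ xs (λ x → ∑ xs λ y → 2 * (w x ⊓ w y) + (2 * (big x * b y) + 2 * (b x * big y)) + 𝟙 (x ≟ y) * (2 * b x))
            ≤⟨ ∑-mono xs (λ {x} _ → ∑-mono xs (λ {y} _ → pair≤ x y)) ⟩
          ∑ xs (λ x → ∑ xs λ y → 2 * q * (pos x * pos y) + (a x * big y + big x * a y))
            ≡⟨ trans (∑∑-+ (λ x y → 2 * q * (pos x * pos y)) (λ x y → a x * big y + big x * a y))
                (cong₂ _+_ (double (2 * q)) (∑∑-+ (λ x y → a x * big y) (λ x y → big x * a y))) ⟩
          2 * q * ∑ xs (λ x → ∑ xs λ y → pos x * pos y) +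
            (∑ xs (λ x → ∑ xs λ y → a x * big y) + ∑ xs (λ x → ∑ xs λ y → big x * a y))
            ≡⟨ cong₂ _+_ (cong (2 * q *_) (∑-product xs xs)) (cong₂ _+_ (∑-product xs xs) (∑-product xs xs)) ⟩
          2 * q * (p * p) + (P * π + π * P)             ≡⟨ e₃ q p P π ⟩
          2 * (q * (p * p) + π * P)                     ∎)
          where
          open ≤-Reasoning
          e₁ : ∀ Y q p P π Q → 2 * ((Y + q * p) + (P + 2 * (π * Q))) ≡ 2 * (Y + (q * p + P)) + (2 * (π * Q) + 2 * (Q * π))
          e₁ = solve-∀
          e₂ : ∀ Y W π Q → 2 * (Y + (W + Q)) + (2 * (π * Q) + 2 * (Q * π)) ≡ 2 * (Y + W) + (2 * (π * Q) + 2 * (Q * π)) + 2 * Q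
          e₂ = solve-∀
          e₃ : ∀ q p P π → 2 * q * (p * p) + (P * π + π * P) ≡ 2 * (q * (p * p) + π * P)
          e₃ = solve-∀
          min₂ sum₂ sum₃ diag₁ : A → A → ℕ
          min₂ x y  = 2 * (w x ⊓ w y)
          sum₂ x y  = 2 * (big x * b y) + 2 * (b x * big y)
          sum₃ x y  = min₂ x y + sum₂ x y
          diag₁ x y = 𝟙 (x ≟ y) * (2 * b x)
          ∑∑-+ : ∀ (f g : A → A → ℕ) → ∑ xs (λ x → ∑ xs λ y → f x y + g x y) ≡ ∑ xs (λ x → ∑ xs (f x)) + ∑ xs (λ x → ∑ xs (g x))
          ∑∑-+ f g = trans (∑-cong xs (λ _ → ∑-+ xs)) (∑-+ xs)
          double : ∀ c {f : A → A → ℕ} → ∑ xs (λ x → ∑ xs λ y → c * f x y) ≡ c * ∑ xs (λ x → ∑ xs (f x))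
          double c = trans (∑-cong xs (λ _ → ∑-*ˡ xs c)) (∑-*ˡ xs c)
          double× : ∀ {f g : A → ℕ} → ∑ xs (λ x → ∑ xs λ y → 2 * (f x * g y)) ≡ 2 * (∑ xs f * ∑ xs g)
          double× = trans (double 2) (cong (2 *_) (∑-product xs xs))
          diagonal : ∑ xs (λ x → ∑ xs λ y → 𝟙 (x ≟ y) * (2 * b x)) ≡ 2 * Q
          diagonal = trans (∑-diag _≟_ unique) (∑-*ˡ xs 2)

        P≤ : ∀ {r} → W ≤ q * p + r → P ≤ r + Q
        P≤ {r} h = +-cancelˡ-≤ (q * p) P (r + Q) (≤-trans (≤-reflexive (sym W+Q))
          (≤-trans (+-monoˡ-≤ Q h) (≤-reflexive (+-assoc (q * p) r Q))))

      regular-bound : ∀ r → W ≤ q * p + r → Y + q * p + r ≤ q * (p * p) + r * r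
      regular-bound r h = opt-arith (Y + q * p) (q * (p * p)) P Q π r summed (P≤ h) π≤P

      -- Equality makes the total deficit zero, so no positive weight is below `q`, and makes the
      -- surplus equal to the number of weights above `q`, so none of them exceeds `suc q`.
      regular-tight : ∀ r → 2 ≤ r → W ≤ q * p + r → q * (p * p) + r * r ≤ Y + q * p + r →
                      W ≡ q * p + r × (∀ {x} → x ∈ xs → 1 ≤ w x → w x ≡ q ⊎ w x ≡ suc q)
      regular-tight r 2≤r h tight = conclude (opt-tight (Y + q * p) (q * (p * p)) P Q π r 2≤r summed (P≤ h) π≤P tight)
        where
        conclude : π ≡ r × Q ≡ 0 × P ≡ r → W ≡ q * p + r × (∀ {x} → x ∈ xs → 1 ≤ w x → w x ≡ q ⊎ w x ≡ suc q)
        conclude (π≡r , Q≡0 , P≡r) =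
          trans (sym (+-identityʳ W)) (trans (cong (W +_) (sym Q≡0)) (trans W+Q (cong (q * p +_) P≡r))) ,
          λ {x} i 1≤w → value i 1≤w (suc q ≤? w x)
          where
          b≡0 : ∀ {x} → x ∈ xs → b x ≡ 0
          b≡0 i = n≤0⇒n≡0 (≤-trans (∑-∈ i) (≤-reflexive Q≡0))
          big≡a : ∀ {x} → x ∈ xs → big x ≡ a x
          big≡a = ∑-tight xs (λ {x} _ → big≤a x) (≤-reflexive (trans P≡r (sym π≡r)))
          value : ∀ {x} → x ∈ xs → 1 ≤ w x → Dec (suc q ≤ w x) → w x ≡ q ⊎ w x ≡ suc q
          value {x} i 1≤w (yes q<w) = inj₂ (trans (sym (m+[n∸m]≡n (<⇒≤ q<w)))
            (trans (cong (q +_) (trans (sym (big≡a i)) (𝟙-yes (suc q ≤? w x) q<w))) (+-comm q 1)))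
          value {x} i 1≤w (no q≮w) = inj₁ (≤-antisym (s≤s⁻¹ (≰⇒> q≮w)) (m∸n≡0⇒m≤n
            (trans (sym (trans (cong (_* (q ∸ w x)) (𝟙-yes (1 ≤? w x) 1≤w)) (*-identityˡ _))) (b≡0 i))))

-- Mixed cuts of a multigraph and the excess bound.

module EdgeCuts where

  open import Data.Empty using (⊥; ⊥-elim)
  open import Data.List.Base using (List; _∷_; length; filter)
  open import Data.List.Membership.Propositional using (_∈_; find; lose)
  open import Data.List.Membership.Propositional.Properties using (∈-filter⁺; ∈-filter⁻)
  open import Data.List.Relation.Unary.All as All using (All; _∷_)
  open import Data.List.Relation.Unary.AllPairs using (_∷_)
  import Data.List.Relation.Unary.Any as Any
  open import Data.List.Relation.Unary.Any using (here; there)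
  open import Data.List.Relation.Unary.Unique.Propositional using (Unique)
  import Data.List.Relation.Unary.Unique.Propositional.Properties as Unique
  open import Data.Nat.Base
  open import Data.Nat.Properties renaming (_≟_ to _≟ℕ_)
  open import Data.Nat.Tactic.RingSolver using (solve-∀)
  open import Data.Product.Base using (∃; _×_; _,_; proj₁; proj₂)
  open import Data.Sum.Base using (_⊎_; inj₁; inj₂; swap)
  open import Data.Unit.Base using (tt)
  open import Function.Base using (_∘_)
  open import Relation.Binary.Definitions using (DecidableEquality)
  open import Relation.Binary.PropositionalEquality
  open import Relation.Nullary using (¬_; Dec; yes; no; _×-dec_; ¬?)
  open import Relation.Nullary.Decidable using (toWitness; map′)
  open import Relation.Unary using (Decidable)
  open Summation
  open WeightSums

  ∑-exceed : ∀ {A : Set} (xs : List A) {f g : A → ℕ} → ∑ xs g < ∑ xs f → ∃ λ x → x ∈ xs × g x < f x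
  ∑-exceed (x ∷ xs) {f} {g} lt with suc (g x) ≤? f x
  ... | yes p = x , here refl , p
  ... | no ¬p with y , i , q ← ∑-exceed xs {f} {g} (+-cancelˡ-< (g x) (∑ xs g) (∑ xs f)
                    (<-≤-trans lt (+-monoˡ-≤ (∑ xs f) (≮⇒≥ ¬p)))) = y , there i , q

  ∑-mono-< : ∀ {A : Set} (xs : List A) {f g : A → ℕ} → (∀ {x} → x ∈ xs → f x ≤ g x) →
             ∀ {x} → x ∈ xs → f x < g x → ∑ xs f < ∑ xs g
  ∑-mono-< xs h i lt = ≰⇒> λ ge → <⇒≢ lt (∑-tight xs h ge i)

  data Label : Set where
    left middle right : Label

  flip : Label → Label
  flip left   = right
  flip middle = middle
  flip right  = left

  isMiddle : Label → ℕ
  isMiddle middle = 1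
  isMiddle _      = 0

  cross : Label → Label → ℕ
  cross left  right = 1
  cross right left  = 1
  cross _     _     = 0

  _≟ₗ_ : DecidableEquality Label
  left   ≟ₗ left   = yes refl
  left   ≟ₗ middle = no λ ()
  left   ≟ₗ right  = no λ ()
  middle ≟ₗ left   = no λ ()
  middle ≟ₗ middle = yes refl
  middle ≟ₗ right  = no λ ()
  right  ≟ₗ left   = no λ ()
  right  ≟ₗ middle = no λ ()
  right  ≟ₗ right  = yes refl

  -- A label that is never `middle` and never crosses `a`. If `a` leaves the choice open, it follows
  -- `b`.
  pick : Label → Label → Label
  pick middle middle = left
  pick middle b      = b
  pick a      _      = a

  -- There are only three labels, so the identities and inequalities between `cross`, `pick` and
  -- `isMiddle` are settled by evaluating a decision procedure.
  ∀ₗ? : {P : Label → Set} → Decidable P → Dec (∀ ℓ → P ℓ)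
  ∀ₗ? P? = map′ (λ { (l , m , r) left → l ; (l , m , r) middle → m ; (l , m , r) right → r })
                (λ f → f left , f middle , f right) (P? left ×-dec P? middle ×-dec P? right)

  isMiddle-flip : ∀ a → isMiddle (flip a) ≡ isMiddle a
  isMiddle-flip = toWitness {a? = ∀ₗ? λ a → isMiddle (flip a) ≟ℕ isMiddle a} tt

  isMiddle-pick : ∀ a b → isMiddle (pick a b) ≡ 0
  isMiddle-pick = toWitness {a? = ∀ₗ? λ a → ∀ₗ? λ b → isMiddle (pick a b) ≟ℕ 0} tt

  cross-self : ∀ a → cross a a ≡ 0
  cross-self = toWitness {a? = ∀ₗ? λ a → cross a a ≟ℕ 0} tt

  cross-sym : ∀ a b → cross a b ≡ cross b a
  cross-sym = toWitness {a? = ∀ₗ? λ a → ∀ₗ? λ b → cross a b ≟ℕ cross b a} tt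

  cross≤1 : ∀ a b → cross a b ≤ 1
  cross≤1 = toWitness {a? = ∀ₗ? λ a → ∀ₗ? λ b → cross a b ≤? 1} tt

  cross-flip : ∀ a b → cross (flip a) (flip b) ≡ cross a b
  cross-flip = toWitness {a? = ∀ₗ? λ a → ∀ₗ? λ b → cross (flip a) (flip b) ≟ℕ cross a b} tt

  cross-pickˡ : ∀ a b → cross (pick a b) a ≡ 0
  cross-pickˡ = toWitness {a? = ∀ₗ? λ a → ∀ₗ? λ b → cross (pick a b) a ≟ℕ 0} tt

  cross-pickʳ : ∀ a b → cross a (pick a b) ≡ 0
  cross-pickʳ = toWitness {a? = ∀ₗ? λ a → ∀ₗ? λ b → cross a (pick a b) ≟ℕ 0} tt

  cross-pick-≤ : ∀ a b → cross a (pick b a) ≤ cross a b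
  cross-pick-≤ = toWitness {a? = ∀ₗ? λ a → ∀ₗ? λ b → cross a (pick b a) ≤? cross a b} tt

  -- To be read with a, b, c as the labels of the vertices u, v, c of a cut: if the whole far side
  -- receives the label `pick c b`, then what the edge uv costs is already paid by the path u v c.
  cross-triangle : ∀ a b c → cross a (pick c b) ≤ isMiddle b + (cross a b + cross b c)
  cross-triangle = toWitness {a? = ∀ₗ? λ a → ∀ₗ? λ b → ∀ₗ? λ c → cross a (pick c b) ≤? isMiddle b + (cross a b + cross b c)} tt

  cross≡0 : ∀ {a b} → isMiddle a ≡ 0 → isMiddle b ≡ 0 → cross a b ≡ 0 → a ≡ b
  cross≡0 {left}  {left}  _ _ _ = refl
  cross≡0 {right} {right} _ _ _ = refl
  cross≡0 {left}  {right} _ _ ()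
  cross≡0 {right} {left}  _ _ ()
  cross≡0 {left}  {middle} _ ()
  cross≡0 {right} {middle} _ ()
  cross≡0 {middle} ()

  cross-pos : ∀ {a b} → 1 ≤ cross a b → isMiddle a ≡ 0 × isMiddle b ≡ 0 × a ≢ b
  cross-pos {left}  {right} _ = refl , refl , λ ()
  cross-pos {right} {left}  _ = refl , refl , λ ()
  cross-pos {left}  {left}  ()
  cross-pos {left}  {middle} ()
  cross-pos {middle} ()
  cross-pos {right} {middle} ()
  cross-pos {right} {right} ()

  cross-other : ∀ {a b} ℓ → isMiddle ℓ ≡ 0 → a ≢ ℓ → a ≢ middle → b ≡ ℓ → 1 ≤ cross b a
  cross-other {left}   left  _ a≢ℓ _ _    = ⊥-elim (a≢ℓ refl)
  cross-other {right}  left  _ _ _ refl   = s≤s z≤n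
  cross-other {middle} left  _ _ a≢m _    = ⊥-elim (a≢m refl)
  cross-other {left}   right _ _ _ refl   = s≤s z≤n
  cross-other {right}  right _ a≢ℓ _ _    = ⊥-elim (a≢ℓ refl)
  cross-other {middle} right _ _ a≢m _    = ⊥-elim (a≢m refl)

  isMiddle⇒ : ∀ {a} → 1 ≤ isMiddle a → a ≡ middle
  isMiddle⇒ {middle} _ = refl

  onRight : Label → Label → Label → Label
  onRight right _ b = b
  onRight _     a _ = a

  notRight? : Decidable (_≢ right)
  notRight? ℓ = ¬? (ℓ ≟ₗ right)

  -- Labellings, their costs, and pieces.

  module Cuts {V : Set} (_≟_ : DecidableEquality V) where

    -- A labelling is a mixed cut: its middle vertices and left–right edges separate
    -- left from right.  In these terms 2-connectedness, minimality and the easy half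
    -- of Menger's theorem are statements about costs.
    cut : (V → Label) → V × V → ℕ
    cut σ (x , y) = cross (σ x) (σ y)

    cost : (V → Label) → List V → List (V × V) → ℕ
    cost σ Ws Es = ∑ Ws (isMiddle ∘ σ) + ∑ Es (cut σ)

    inc : V → V × V → ℕ
    inc x (a , b) = 𝟙 (x ≟ a) + 𝟙 (x ≟ b)

    deg : List (V × V) → V → ℕ
    deg Es x = ∑ Es (inc x)

    Adj : List (V × V) → V → V → Set
    Adj Es x y = (x , y) ∈ Es ⊎ (y , x) ∈ Es

    _[_↦_] : (V → Label) → V → Label → V → Label
    (σ [ x ↦ ℓ ]) y with y ≟ x
    ... | yes _ = ℓ
    ... | no  _ = σ y

    update-≡ : ∀ σ x ℓ → (σ [ x ↦ ℓ ]) x ≡ ℓ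
    update-≡ σ x ℓ with x ≟ x
    ... | yes _  = refl
    ... | no x≢x = ⊥-elim (x≢x refl)

    update-≢ : ∀ σ {x} ℓ {y} → y ≢ x → (σ [ x ↦ ℓ ]) y ≡ σ y
    update-≢ σ {x} ℓ {y} y≢x with y ≟ x
    ... | yes y≡x = ⊥-elim (y≢x y≡x)
    ... | no _    = refl

    cut-update≤ : ∀ σ x e → cut (σ [ x ↦ middle ]) e ≤ cut σ e
    cut-update≤ σ x (a , b) with a ≟ x | b ≟ x
    ... | yes _ | _     = z≤n
    ... | no _  | no _  = ≤-refl
    ... | no _  | yes _ with σ a
    ...   | left   = z≤n
    ...   | middle = z≤n
    ...   | right  = z≤n

    cut-updateˡ : ∀ σ {a b} → cut (σ [ a ↦ middle ]) (a , b) ≡ 0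
    cut-updateˡ σ {a} {b} = cong (λ ℓ → cross ℓ ((σ [ a ↦ middle ]) b)) (update-≡ σ a middle)

    cut-updateʳ : ∀ σ {a b} → cut (σ [ b ↦ middle ]) (a , b) ≡ 0
    cut-updateʳ σ {a} {b} = trans (cong (cross ((σ [ b ↦ middle ]) a)) (update-≡ σ b middle))
      (cross-sym ((σ [ b ↦ middle ]) a) middle)

    cost-flip : ∀ σ Ws Es → cost (flip ∘ σ) Ws Es ≡ cost σ Ws Es
    cost-flip σ Ws Es = cong₂ _+_
      (∑-cong Ws (λ {x} _ → isMiddle-flip (σ x)))
      (∑-cong Es (λ { {x , y} _ → cross-flip (σ x) (σ y) }))

    -- The cut around one vertex. Its cost is the degree of that vertex, so that statements about
    -- degrees become instances of statements about cuts.
    single : V → V → Label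
    single x = (λ _ → right) [ x ↦ left ]

    single-other : ∀ {x y} → y ≢ x → single x y ≡ right
    single-other = update-≢ (λ _ → right) left

    isMiddle-single : ∀ x y → isMiddle (single x y) ≡ 0
    isMiddle-single x y with y ≟ x
    ... | yes _ = refl
    ... | no  _ = refl

    cut-single : ∀ x {a b} → a ≢ b → cut (single x) (a , b) ≡ inc x (a , b)
    cut-single x {a} {b} a≢b with a ≟ x | b ≟ x | x ≟ a | x ≟ b
    ... | yes p | yes q | _     | _     = ⊥-elim (a≢b (trans p (sym q)))
    ... | yes p | no q  | yes _ | yes s = ⊥-elim (q (sym s))
    ... | yes p | no q  | yes _ | no _  = refl
    ... | yes p | no q  | no r  | _     = ⊥-elim (r (sym p))
    ... | no p  | yes q | yes r | _     = ⊥-elim (p (sym r))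
    ... | no p  | yes q | no _  | yes _ = refl
    ... | no p  | yes q | no _  | no s  = ⊥-elim (s (sym q))
    ... | no p  | no q  | yes r | _     = ⊥-elim (p (sym r))
    ... | no p  | no q  | no _  | yes s = ⊥-elim (q (sym s))
    ... | no p  | no q  | no _  | no _  = refl

    inc≤1 : ∀ x {a b} → a ≢ b → inc x (a , b) ≤ 1
    inc≤1 x {a} {b} a≢b = subst (_≤ 1) (cut-single x a≢b) (cross≤1 (single x a) (single x b))

    -- K stands for κ; it is arbitrary because the sides of a split keep the values
    -- of K on the whole graph instead of having a connectivity of their own.
    record Piece (Ws : List V) (Es : List (V × V)) (K : V → V → ℕ) : Set where
      field
        unique : Unique Ws
        wf     : ∀ {x y} → (x , y) ∈ Es → x ∈ Ws × y ∈ Ws × x ≢ y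
        two    : ∀ σ {x y} → x ∈ Ws → y ∈ Ws → σ x ≡ left → σ y ≡ right → 2 ≤ cost σ Ws Es
        sep    : ∀ {x y} → (x , y) ∈ Es → 3 ≤ deg Es x → 3 ≤ deg Es y →
                 ∃ λ σ → cost σ Ws Es ≤ 2 × σ x ≡ left × σ y ≡ right
        bound  : ∀ σ {x y} → x ∈ Ws → y ∈ Ws → σ x ≡ left → σ y ≡ right → K x y ≤ cost σ Ws Es
        diag   : ∀ x → K x x ≡ 0

      wfʳ : ∀ {x y} → Adj Es x y → x ∈ Ws × y ∈ Ws × x ≢ y
      wfʳ (inj₁ i) = wf i
      wfʳ (inj₂ i) with a , b , c ← wf i = b , a , c ∘ sym

      sepʳ : ∀ {x y} → Adj Es x y → 3 ≤ deg Es x → 3 ≤ deg Es y →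
             ∃ λ σ → cost σ Ws Es ≤ 2 × σ x ≡ left × σ y ≡ right
      sepʳ (inj₁ i) p q = sep i p q
      sepʳ (inj₂ i) p q with σ , c , a , b ← sep i q p =
        flip ∘ σ , subst (_≤ 2) (sym (cost-flip σ Ws Es)) c , cong flip b , cong flip a

      cost-single : ∀ x → cost (single x) Ws Es ≡ deg Es x
      cost-single x = cong₂ _+_
        (∑-zero Ws (λ {y} _ → isMiddle-single x y))
        (∑-cong Es (λ { {a , b} i → cut-single x (proj₂ (proj₂ (wf i))) }))

      bound-degˡ : ∀ {x y} → x ∈ Ws → y ∈ Ws → x ≢ y → K x y ≤ deg Es x
      bound-degˡ {x} i j x≢y = subst (_ ≤_) (cost-single x)
        (bound (single x) i j (update-≡ (λ _ → right) x left) (single-other (x≢y ∘ sym)))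

      bound-degʳ : ∀ {x y} → x ∈ Ws → y ∈ Ws → x ≢ y → K x y ≤ deg Es y
      bound-degʳ {x} {y} i j x≢y = subst (_ ≤_) (trans (cost-flip (single y) Ws Es) (cost-single y))
        (bound (flip ∘ single y) i j (cong flip (single-other x≢y)) (cong flip (update-≡ (λ _ → right) y left)))

    Adj⇒1≤cut : ∀ σ {Es u v} → Adj Es u v → σ u ≡ left → σ v ≡ right → 1 ≤ ∑ Es (cut σ)
    Adj⇒1≤cut σ (inj₁ i) p q = ≤-trans (≤-reflexive (sym (cong₂ cross p q))) (∑-∈ i)
    Adj⇒1≤cut σ (inj₂ i) p q = ≤-trans (≤-reflexive (sym (cong₂ cross q p))) (∑-∈ i)

    -- The shape of cut along which a piece is split: `c` is the only middle vertex of `Ws`, and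
    -- since `u` and `v` are adjacent across it, the bound `cut≤1` makes `uv` the only crossing
    -- edge, parallel edges included.
    record NormalCut (Ws : List V) (Es : List (V × V)) (u v : V) : Set where
      field
        σ      : V → Label
        c      : V
        σu     : σ u ≡ left
        σv     : σ v ≡ right
        c∈     : c ∈ Ws
        σc     : σ c ≡ middle
        only-c : ∀ {x} → x ∈ Ws → σ x ≡ middle → x ≡ c
        adj    : Adj Es u v
        cut≤1  : ∑ Es (cut σ) ≤ 1

      only-uv : ∀ {x y} → (x , y) ∈ Es → σ x ≡ left → σ y ≡ right → (x , y) ≡ (u , v)
      only-uv i p q with adj
      ... | inj₁ j = ∑≤1-unique Es cut≤1 i j (≤-reflexive (sym (cong₂ cross p q)))
                       (≤-reflexive (sym (cong₂ cross σu σv)))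
      ... | inj₂ j with refl ← ∑≤1-unique Es cut≤1 i j (≤-reflexive (sym (cong₂ cross p q)))
                       (≤-reflexive (sym (cong₂ cross σv σu))) with () ← trans (sym p) σv

      only-vu : ∀ {x y} → (x , y) ∈ Es → σ x ≡ right → σ y ≡ left → (x , y) ≡ (v , u)
      only-vu i p q with adj
      ... | inj₂ j = ∑≤1-unique Es cut≤1 i j (≤-reflexive (sym (cong₂ cross p q)))
                       (≤-reflexive (sym (cong₂ cross σv σu)))
      ... | inj₁ j with refl ← ∑≤1-unique Es cut≤1 i j (≤-reflexive (sym (cong₂ cross p q)))
                       (≤-reflexive (sym (cong₂ cross σu σv))) with () ← trans (sym p) σu

    -- Everything about the side of `u` becomes available for the side of `v` in this way.
    flipCut : ∀ {Ws Es u v} → NormalCut Ws Es u v → NormalCut Ws Es v u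
    flipCut {Ws} {Es} N = record
      { σ      = flip ∘ σ
      ; c      = c
      ; σu     = cong flip σv
      ; σv     = cong flip σu
      ; c∈     = c∈
      ; σc     = cong flip σc
      ; only-c = λ {x} i p → only-c i (unflip x p)
      ; adj    = swap adj
      ; cut≤1  = subst (_≤ 1) (sym (∑-cong Es (λ { {x , y} _ → cross-flip (σ x) (σ y) }))) cut≤1
      }
      where
      open NormalCut N
      unflip : ∀ x → flip (σ x) ≡ middle → σ x ≡ middle
      unflip x p with σ x
      ... | middle = refl

    module _ {Ws Es K} (P : Piece Ws Es K) where
      open Piece P

      private
        ∑-middle-update : ∀ {σ x} → ∑ Ws (isMiddle ∘ σ) ≤ 0 → x ∈ Ws →
                          ∑ Ws (isMiddle ∘ (σ [ x ↦ middle ])) ≡ 1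
        ∑-middle-update {σ} {x} none x∈ = trans (∑-cong Ws pointwise) (∑-δ₁ _≟_ unique x∈)
          where
          pointwise : ∀ {y} → y ∈ Ws → isMiddle ((σ [ x ↦ middle ]) y) ≡ 𝟙 (y ≟ x)
          pointwise {y} i with y ≟ x
          ... | yes _ = refl
          ... | no _  = n≤0⇒n≡0 (≤-trans (∑-∈ i) none)

      -- A cut of two crossing edges is turned into one with a middle vertex by
      -- moving an end of the edge other than uv to the middle.
      normalise : ∀ {u v} → Adj Es u v → 3 ≤ deg Es u → 3 ≤ deg Es v → NormalCut Ws Es u v
      normalise {u} {v} uv du dv with sepʳ uv du dv
      ... | σ , σ≤2 , σu , σv = go (∑ Ws (isMiddle ∘ σ)) refl
        where
        1≤cut : 1 ≤ ∑ Es (cut σ)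
        1≤cut = Adj⇒1≤cut σ uv σu σv

        go : ∀ m → ∑ Ws (isMiddle ∘ σ) ≡ m → NormalCut Ws Es u v
        go (suc m) eq with c , c∈ , σc ← ∑-pos Ws {isMiddle ∘ σ} (subst (1 ≤_) (sym eq) (s≤s z≤n)) = record
          { σ = σ ; c = c ; σu = σu ; σv = σv ; c∈ = c∈ ; σc = isMiddle⇒ σc
          ; only-c = λ i p → ∑≤1-unique Ws
              (+-cancelʳ-≤ 1 _ 1 (≤-trans (+-monoʳ-≤ _ 1≤cut) σ≤2)) i c∈ (≤-reflexive (sym (cong isMiddle p))) σc
          ; adj = uv
          ; cut≤1 = +-cancelˡ-≤ 1 _ 1 (≤-trans (+-monoˡ-≤ _ (subst (1 ≤_) (sym eq) (s≤s z≤n))) σ≤2) }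
        go zero eq = result crossing
          where
          none : ∑ Ws (isMiddle ∘ σ) ≤ 0
          none = ≤-reflexive eq

          nonMiddle : ∀ {x} → x ∈ Ws → isMiddle (σ x) ≡ 0
          nonMiddle i = n≤0⇒n≡0 (≤-trans (∑-∈ i) none)

          cut≤2 : ∑ Es (cut σ) ≤ 2
          cut≤2 = subst (λ m → m + ∑ Es (cut σ) ≤ 2) eq σ≤2

          -- Not all edges at u cross, so u is not the only left vertex.
          otherLeft : ∃ λ x → x ∈ Ws × x ≢ u × σ x ≡ left
          otherLeft with ∑-exceed Es {inc u} {cut σ} (≤-trans (s≤s cut≤2) du)
          ... | (a , b) , i , lt with u ≟ a | u ≟ b | wf i
          ... | yes refl | yes refl | _ , _ , a≢b = ⊥-elim (a≢b refl)
          ... | yes refl | no u≢b | a∈ , b∈ , _ =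
            b , b∈ , u≢b ∘ sym , trans (sym (cross≡0 (nonMiddle a∈) (nonMiddle b∈) (n<1⇒n≡0 lt))) σu
          ... | no u≢a | yes refl | a∈ , b∈ , _ =
            a , a∈ , u≢a ∘ sym , trans (cross≡0 (nonMiddle a∈) (nonMiddle b∈) (n<1⇒n≡0 lt)) σu
          ... | no _ | no _ | _ with () ← lt

          σ₁ : V → Label
          σ₁ = σ [ u ↦ middle ]

          left≢right : ∀ {x y} → σ x ≡ left → σ y ≡ right → x ≢ y
          left≢right p q refl with () ← trans (sym p) q

          -- With `u` in the middle, both a left and a right vertex remain, and the one middle
          -- vertex does not reach the cost 2 demanded by `two`. Hence some crossing edge avoids
          -- `u`; its left end will serve as `c`.
          crossing : ∃ λ e → e ∈ Es × 1 ≤ cut σ₁ e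
          crossing with x , x∈ , x≢u , σx ← otherLeft = ∑-pos Es
            (+-cancelˡ-≤ 1 1 _ (subst (λ m → 2 ≤ m + ∑ Es (cut σ₁)) (∑-middle-update none (proj₁ (wfʳ uv)))
              (two σ₁ x∈ (proj₁ (proj₂ (wfʳ uv)))
                (trans (update-≢ σ middle x≢u) σx)
                (trans (update-≢ σ middle (left≢right σu σv ∘ sym)) σv))))

          build : ∀ {x} → x ∈ Ws → x ≢ u → σ x ≡ left → ∃ (λ e → e ∈ Es × cut (σ [ x ↦ middle ]) e < cut σ e) →
                  NormalCut Ws Es u v
          build {x} x∈ x≢u σx (e , i , lt) = record
            { σ = σ [ x ↦ middle ] ; c = x
            ; σu = trans (update-≢ σ middle (x≢u ∘ sym)) σu
            ; σv = trans (update-≢ σ middle (left≢right σx σv ∘ sym)) σv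
            ; c∈ = x∈ ; σc = update-≡ σ x middle
            ; only-c = λ j p → ∑≤1-unique Ws (≤-reflexive (∑-middle-update none x∈)) j x∈
                (≤-reflexive (sym (cong isMiddle p))) (≤-reflexive (sym (cong isMiddle (update-≡ σ x middle))))
            ; adj = uv
            ; cut≤1 = s≤s⁻¹ (≤-trans (∑-mono-< Es (λ {e} _ → cut-update≤ σ x e) i lt) cut≤2) }

          result : (∃ λ e → e ∈ Es × 1 ≤ cut σ₁ e) → NormalCut Ws Es u v
          result ((a , b) , i , 1≤) with a ≟ u | b ≟ u
          ... | no a≢u | yes _ with σ a | 1≤
          ...   | left | ()
          ...   | middle | ()
          ...   | right | ()
          result ((a , b) , i , 1≤) | no a≢u | no b≢u with σ a in σa | σ b in σb
          ...   | left  | right = build (proj₁ (wf i)) a≢u σa ((a , b) , i ,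
                    subst₂ _<_ (sym (cut-updateˡ σ)) (sym (cong₂ cross σa σb)) (s≤s z≤n))
          ...   | right | left  = build (proj₁ (proj₂ (wf i))) b≢u σb ((a , b) , i ,
                    subst₂ _<_ (sym (cut-updateʳ σ)) (sym (cong₂ cross σa σb)) (s≤s z≤n))

  -- Replacing one side of a cut by a path.

  module Split {V : Set} (_≟_ : DecidableEquality V) where

    open Cuts _≟_

    module Side {Ws Es K} (P : Piece Ws Es K) {u v} (N : NormalCut Ws Es u v) where
      open Piece P
      open NormalCut N

      L? : Decidable (λ x → σ x ≢ right)
      L? x = notRight? (σ x)

      E? : Decidable (λ (e : V × V) → σ (proj₁ e) ≢ right × σ (proj₂ e) ≢ right)
      E? (x , y) = L? x ×-dec L? y

      As : List V
      As = filter L? Ws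

      EA : List (V × V)
      EA = filter E? Es

      -- The side of u together with c, in which the other side is replaced by the
      -- path u v c.
      sideV : List V
      sideV = v ∷ As

      sideE : List (V × V)
      sideE = (u , v) ∷ (v , c) ∷ EA

      sideK : V → V → ℕ
      sideK x y with x ≟ v | y ≟ v
      ... | no _ | no _ = K x y
      ... | _    | _    = 0

      u∈ : u ∈ Ws
      u∈ = proj₁ (wfʳ adj)

      v∈ : v ∈ Ws
      v∈ = proj₁ (proj₂ (wfʳ adj))

      labels≢ : ∀ {x y a b} → σ x ≡ a → σ y ≡ b → a ≢ b → x ≢ y
      labels≢ p q a≢b refl = a≢b (trans (sym p) q)

      u≢v : u ≢ v
      u≢v = labels≢ σu σv λ ()

      c≢v : c ≢ v
      c≢v = labels≢ σc σv λ ()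

      u≢c : u ≢ c
      u≢c = labels≢ σu σc λ ()

      As⇒ : ∀ {x} → x ∈ As → x ∈ Ws × σ x ≢ right
      As⇒ = ∈-filter⁻ L? {xs = Ws}

      As⇒≢v : ∀ {x} → x ∈ As → x ≢ v
      As⇒≢v i refl = proj₂ (As⇒ i) σv

      u∈As : u ∈ As
      u∈As = ∈-filter⁺ L? u∈ (λ p → left≢ (trans (sym σu) p))
        where
        left≢ : left ≢ right
        left≢ ()

      c∈As : c ∈ As
      c∈As = ∈-filter⁺ L? c∈ (λ p → middle≢ (trans (sym σc) p))
        where
        middle≢ : middle ≢ right
        middle≢ ()

      EA⇒ : ∀ {x y} → (x , y) ∈ EA → (x , y) ∈ Es × x ∈ As × y ∈ As
      EA⇒ i with j , p , q ← ∈-filter⁻ E? {xs = Es} i =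
        j , ∈-filter⁺ L? (proj₁ (wf j)) p , ∈-filter⁺ L? (proj₁ (proj₂ (wf j))) q

      module _ (τ : V → Label) where

        private
          lab : Label
          lab = pick (τ c) (τ v)

          t : ℕ
          t = isMiddle (τ v) + (cross (τ u) (τ v) + cross (τ v) (τ c))

        -- The far side receives a single label which is not `middle` and does not cross the label
        -- of `c`. Hence no far vertex, no edge inside the far side and no edge from there to `c`
        -- costs anything, and only `uv` is left to be paid for.
        extend : V → Label
        extend x = onRight (σ x) (τ x) lab

        extend-A : ∀ {x} → σ x ≢ right → extend x ≡ τ x
        extend-A {x} p with σ x
        ... | left   = refl
        ... | middle = refl
        ... | right  = ⊥-elim (p refl)

        extend-B : ∀ {x} → σ x ≡ right → extend x ≡ lab
        extend-B {x} p = cong (λ s → onRight s (τ x) lab) p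

        private
          vertex≤ : ∀ x s → isMiddle (onRight s (τ x) lab) ≤ 𝟙 (notRight? s) * isMiddle (τ x)
          vertex≤ x left   = ≤-reflexive (sym (*-identityˡ _))
          vertex≤ x middle = ≤-reflexive (sym (*-identityˡ _))
          vertex≤ x right  = ≤-reflexive (isMiddle-pick (τ c) (τ v))

          same : ∀ a b → a ≤ 1 * a + 0 * b
          same a b = ≤-reflexive (sym (trans (+-identityʳ (1 * a)) (*-identityˡ a)))

          edge≤ : ∀ {x y} → (x , y) ∈ Es → ∀ s s′ → σ x ≡ s → σ y ≡ s′ →
                  cross (onRight s (τ x) lab) (onRight s′ (τ y) lab) ≤
                  𝟙 (notRight? s ×-dec notRight? s′) * cross (τ x) (τ y) + cross s s′ * t
          edge≤ {x} {y} i left   left   p q = same (cross (τ x) (τ y)) t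
          edge≤ {x} {y} i left   middle p q = same (cross (τ x) (τ y)) t
          edge≤ {x} {y} i middle left   p q = same (cross (τ x) (τ y)) t
          edge≤ {x} {y} i middle middle p q = same (cross (τ x) (τ y)) t
          edge≤ {x} {y} i right  right  p q = ≤-reflexive (cross-self lab)
          edge≤ {x} {y} i right  middle p q with refl ← only-c (proj₁ (proj₂ (wf i))) q = ≤-reflexive (cross-pickˡ (τ c) (τ v))
          edge≤ {x} {y} i middle right  p q with refl ← only-c (proj₁ (wf i)) p = ≤-reflexive (cross-pickʳ (τ c) (τ v))
          edge≤ {x} {y} i left   right  p q with refl ← only-uv i p q =
            subst (cross (τ u) lab ≤_) (sym (*-identityˡ t)) (cross-triangle (τ u) (τ v) (τ c))
          edge≤ {x} {y} i right  left   p q with refl ← only-vu i p q =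
            subst₂ _≤_ (cross-sym (τ u) lab) (sym (*-identityˡ t)) (cross-triangle (τ u) (τ v) (τ c))

        -- The path u v c is charged once for every edge that crosses `σ`. There is at most one such
        -- edge, so one copy of the path covers it.
        extend-cost : cost extend Ws Es ≤ cost τ sideV sideE
        extend-cost = begin
          ∑ Ws (isMiddle ∘ extend) + ∑ Es (cut extend)
            ≤⟨ +-mono-≤ (∑-mono Ws (λ {x} _ → vertex≤ x (σ x)))
                        (∑-mono Es (λ { {x , y} i → edge≤ i (σ x) (σ y) refl refl })) ⟩
          ∑ Ws (λ x → 𝟙 (L? x) * isMiddle (τ x)) + ∑ Es (λ e → 𝟙 (E? e) * cut τ e + cut σ e * t)
            ≡⟨ cong₂ _+_ (sym (∑-filter L? Ws)) (trans (∑-+ Es) (cong₂ _+_ (sym (∑-filter E? Es)) (∑-*ʳ Es t))) ⟩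
          ∑ As (isMiddle ∘ τ) + (∑ EA (cut τ) + ∑ Es (cut σ) * t)
            ≤⟨ +-monoʳ-≤ (∑ As (isMiddle ∘ τ)) (+-monoʳ-≤ (∑ EA (cut τ)) (*-monoˡ-≤ t cut≤1)) ⟩
          ∑ As (isMiddle ∘ τ) + (∑ EA (cut τ) + 1 * t)
            ≡⟨ rearrange (∑ As (isMiddle ∘ τ)) (∑ EA (cut τ)) (isMiddle (τ v)) (cross (τ u) (τ v)) (cross (τ v) (τ c)) ⟩
          cost τ sideV sideE ∎
          where
          open ≤-Reasoning
          rearrange : ∀ a b m p q → a + (b + 1 * (m + (p + q))) ≡ (m + a) + (p + (q + b))
          rearrange = solve-∀

        private
          two-edges : 1 ≤ cross (τ u) (τ v) → 1 ≤ cross (τ v) (τ c) → 2 ≤ cost τ sideV sideE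
          two-edges p q = ≤-trans (+-mono-≤ p (≤-trans q (m≤m+n _ (∑ EA (cut τ)))))
            (m≤n+m _ (isMiddle (τ v) + ∑ As (isMiddle ∘ τ)))

          middle-edge : 1 ≤ isMiddle (τ u) → 1 ≤ cross (τ v) (τ c) → 2 ≤ cost τ sideV sideE
          middle-edge p q = +-mono-≤ (≤-trans p (≤-trans (∑-∈ {f = isMiddle ∘ τ} u∈As) (m≤n+m _ (isMiddle (τ v)))))
            (≤-trans q (≤-trans (m≤m+n _ (∑ EA (cut τ))) (m≤n+m _ (cross (τ u) (τ v)))))

          Lifted : Label → Set
          Lifted ℓ = ∃ λ x → x ∈ Ws × extend x ≡ ℓ

          -- The label of `v` itself may be lost, since `extend` lets the far side follow `c`. If
          -- `c` or `u` has the label, it takes the place of `v`; if `c` is in the middle, the far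
          -- side does follow `v`. Otherwise `vc` crosses, and `u` is in the middle or `uv` crosses
          -- too, which already costs 2.
          atV : ∀ ℓ → isMiddle ℓ ≡ 0 → τ v ≡ ℓ → Lifted ℓ ⊎ 2 ≤ cost τ sideV sideE
          atV ℓ ℓ≢m p with τ c ≟ₗ ℓ | τ c ≟ₗ middle | τ u ≟ₗ ℓ
          ... | yes q | _ | _ = inj₁ (c , c∈ , trans (extend-A (proj₂ (As⇒ c∈As))) q)
          ... | no _ | yes q | _ = inj₁ (v , v∈ , trans (extend-B σv) (picked ℓ ℓ≢m q p))
            where
            picked : ∀ {a b} ℓ → isMiddle ℓ ≡ 0 → a ≡ middle → b ≡ ℓ → pick a b ≡ ℓ
            picked left  _ refl refl = refl
            picked right _ refl refl = refl
          ... | no _ | no _ | yes r = inj₁ (u , u∈ , trans (extend-A (proj₂ (As⇒ u∈As))) r)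
          ... | no c≢ℓ | no c≢m | no u≢ℓ with τ u ≟ₗ middle
          ...   | yes u≡m = inj₂ (middle-edge (≤-reflexive (sym (cong isMiddle u≡m))) (cross-other ℓ ℓ≢m c≢ℓ c≢m p))
          ...   | no u≢m = inj₂ (two-edges
                    (subst (1 ≤_) (cross-sym (τ v) (τ u)) (cross-other ℓ ℓ≢m u≢ℓ u≢m p)) (cross-other ℓ ℓ≢m c≢ℓ c≢m p))

          lift : ∀ {x} ℓ → isMiddle ℓ ≡ 0 → x ∈ sideV → τ x ≡ ℓ → Lifted ℓ ⊎ 2 ≤ cost τ sideV sideE
          lift     ℓ ℓ≢m (here refl) p = atV ℓ ℓ≢m p
          lift {x} ℓ ℓ≢m (there i)   p with j , q ← As⇒ i = inj₁ (x , j , trans (extend-A q) p)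

        side-two : ∀ {x y} → x ∈ sideV → y ∈ sideV → τ x ≡ left → τ y ≡ right → 2 ≤ cost τ sideV sideE
        side-two i j p q with lift left refl i p | lift right refl j q
        ... | inj₂ r            | _                 = r
        ... | inj₁ _            | inj₂ r            = r
        ... | inj₁ (_ , i , p)  | inj₁ (_ , j , q)  = ≤-trans (two extend i j p q) extend-cost

        side-bound : ∀ {x y} → x ∈ sideV → y ∈ sideV → τ x ≡ left → τ y ≡ right → sideK x y ≤ cost τ sideV sideE
        side-bound {x} {y} i j p q with x ≟ v | y ≟ v
        ... | yes _ | _     = z≤n
        ... | no _  | yes _ = z≤n
        ... | no x≢v | no y≢v = ≤-trans
          (bound extend (proj₁ (As⇒ (old x≢v i))) (proj₁ (As⇒ (old y≢v j)))
            (trans (extend-A (proj₂ (As⇒ (old x≢v i)))) p) (trans (extend-A (proj₂ (As⇒ (old y≢v j)))) q))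
          extend-cost
          where
          old : ∀ {z} → z ≢ v → z ∈ sideV → z ∈ As
          old z≢v (here eq) = ⊥-elim (z≢v eq)
          old z≢v (there k) = k

        -- The cost if the far side were replaced by an edge from `u` to `c`. It mediates between
        -- the whole piece and the side: it is at most the cost in the former, and `restrict`
        -- attains at most this cost in the latter.
        edgeCost : ℕ
        edgeCost = ∑ As (isMiddle ∘ τ) + (∑ EA (cut τ) + cross (τ u) (τ c))

        -- `v` follows `c`, or `u` if `c` is in the middle. Then `vc` is never crossed, and `uv` at
        -- most if `u` and `c` are on different sides.
        restrict : V → Label
        restrict = τ [ v ↦ pick (τ c) (τ u) ]

        restrict-A : ∀ {x} → x ∈ As → restrict x ≡ τ x
        restrict-A i = update-≢ τ _ (As⇒≢v i)

        restrict-cost : cost restrict sideV sideE ≤ edgeCost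
        restrict-cost = begin
          (isMiddle (restrict v) + ∑ As (isMiddle ∘ restrict)) +
            (cross (restrict u) (restrict v) + (cross (restrict v) (restrict c) + ∑ EA (cut restrict)))
            ≡⟨ cong₂ _+_ (cong₂ _+_ (trans (cong isMiddle at-v) (isMiddle-pick (τ c) (τ u)))
                                    (∑-cong As (λ i → cong isMiddle (restrict-A i))))
                         (cong₂ _+_ (cong₂ cross (restrict-A u∈As) at-v)
                           (cong₂ _+_ (trans (cong₂ cross at-v (restrict-A c∈As)) (cross-pickˡ (τ c) (τ u)))
                             (∑-cong EA (λ { {x , y} i → cong₂ cross (restrict-A (proj₁ (proj₂ (EA⇒ i)))) (restrict-A (proj₂ (proj₂ (EA⇒ i)))) })))) ⟩
          ∑ As (isMiddle ∘ τ) + (cross (τ u) (pick (τ c) (τ u)) + ∑ EA (cut τ))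
            ≡⟨ cong (∑ As (isMiddle ∘ τ) +_) (+-comm (cross (τ u) (pick (τ c) (τ u))) (∑ EA (cut τ))) ⟩
          ∑ As (isMiddle ∘ τ) + (∑ EA (cut τ) + cross (τ u) (pick (τ c) (τ u)))
            ≤⟨ +-monoʳ-≤ (∑ As (isMiddle ∘ τ)) (+-monoʳ-≤ (∑ EA (cut τ)) (cross-pick-≤ (τ u) (τ c))) ⟩
          edgeCost ∎
          where
          open ≤-Reasoning
          at-v : restrict v ≡ pick (τ c) (τ u)
          at-v = update-≡ τ v _

        -- Everything that `τ` pays outside the near side. The edge `uv` belongs to this part, as
        -- one of its ends is right.
        farCost : ℕ
        farCost = ∑ (filter (¬? ∘ L?) Ws) (isMiddle ∘ τ) + ∑ (filter (¬? ∘ E?) Es) (cut τ)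

        near+far : (∑ As (isMiddle ∘ τ) + ∑ EA (cut τ)) + farCost ≡ cost τ Ws Es
        near+far = trans (interchange (∑ As (isMiddle ∘ τ)) (∑ EA (cut τ)) _ _)
          (sym (cong₂ _+_ (∑-partition L? Ws) (∑-partition E? Es)))
          where
          interchange : ∀ a b c d → (a + b) + (c + d) ≡ (a + c) + (b + d)
          interchange = solve-∀

        module _ (far≡0 : farCost ≡ 0) (u×c : 1 ≤ cross (τ u) (τ c)) where

          private
            farV : ∀ {x} → x ∈ Ws → σ x ≡ right → isMiddle (τ x) ≡ 0
            farV i p = n≤0⇒n≡0 (≤-trans (∑-∈ {f = isMiddle ∘ τ} (∈-filter⁺ (¬? ∘ L?) i (λ q → q p)))
              (≤-trans (m≤m+n _ _) (≤-reflexive far≡0)))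

            farE : ∀ {x y} → (x , y) ∈ Es → ¬ (σ x ≢ right × σ y ≢ right) → cross (τ x) (τ y) ≡ 0
            farE i p = n≤0⇒n≡0 (≤-trans (∑-∈ {f = cut τ} (∈-filter⁺ (¬? ∘ E?) i p))
              (≤-trans (m≤n+m _ _) (≤-reflexive far≡0)))

            τu≢m : isMiddle (τ u) ≡ 0
            τu≢m = proj₁ (cross-pos u×c)

            τc≢m : isMiddle (τ c) ≡ 0
            τc≢m = proj₁ (proj₂ (cross-pos u×c))

            τu≢τc : τ u ≢ τ c
            τu≢τc = proj₂ (proj₂ (cross-pos u×c))

            side : V → Label
            side x = onRight (σ x) left right

            side-middle : ∀ s → isMiddle (onRight s left right) ≡ 0
            side-middle left   = refl
            side-middle middle = refl
            side-middle right  = refl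

            -- By `two`, at least two edges join the right vertices to the others, and only one of
            -- them crosses `σ`; another one therefore starts at `c`. Its far end has the label of
            -- `c` because the far part of `τ` costs nothing.
            neighbour : ∃ λ y → y ∈ Ws × σ y ≡ right × τ y ≡ τ c
            neighbour with ∑-exceed Es {cut side} {cut σ} (≤-<-trans cut≤1 (subst (λ m → 2 ≤ m + ∑ Es (cut side))
                (∑-zero Ws (λ {x} _ → side-middle (σ x)))
                (two side u∈ v∈ (cong (λ s → onRight s left right) σu) (cong (λ s → onRight s left right) σv))))
            ... | (x , y) , i , lt with σ x in p | σ y in q
            ... | left   | left   with () ← lt
            neighbour | (x , y) , i , lt | left   | middle with () ← lt
            neighbour | (x , y) , i , lt | left   | right  with () ← n≮n 1 lt
            neighbour | (x , y) , i , lt | middle | left   with () ← lt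
            neighbour | (x , y) , i , lt | middle | middle with () ← lt
            neighbour | (x , y) , i , lt | right  | left   with () ← n≮n 1 lt
            neighbour | (x , y) , i , lt | right  | right  with () ← lt
            neighbour | (x , y) , i , lt | middle | right  with refl ← only-c (proj₁ (wf i)) p =
              y , proj₁ (proj₂ (wf i)) , q , sym (cross≡0 τc≢m (farV (proj₁ (proj₂ (wf i))) q) (farE i (λ r → proj₂ r q)))
            neighbour | (x , y) , i , lt | right  | middle with refl ← only-c (proj₁ (proj₂ (wf i))) q =
              x , proj₁ (wf i) , p , cross≡0 (farV (proj₁ (wf i)) p) τc≢m (farE i (λ r → proj₁ r p))

            likeC : Label → Label
            likeC t with t ≟ₗ τ c
            ... | yes _ = right
            ... | no _  = left

            likeC-≢middle : ∀ t → isMiddle (likeC t) ≡ 0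
            likeC-≢middle t with t ≟ₗ τ c
            ... | yes _ = refl
            ... | no _  = refl

            ρ′ : Label → Label → Label
            ρ′ left   _ = left
            ρ′ middle _ = middle
            ρ′ right  t = likeC t

            -- If the far part costs nothing while `u` and `c` cross, the far vertices labelled like
            -- `c` are joined to all others through `c` alone. Putting `c` in the middle then
            -- separates them from `u` at cost 1, which contradicts `two`.
            ρ : V → Label
            ρ x = ρ′ (σ x) (τ x)

            τv≢τc : τ v ≢ τ c
            τv≢τc eq = τu≢τc (trans (cross≡0 τu≢m (farV v∈ σv) uv) eq)
              where
              uv : cross (τ u) (τ v) ≡ 0
              uv with adj
              ... | inj₁ i = farE i (λ r → proj₂ r σv)
              ... | inj₂ i = trans (cross-sym (τ u) (τ v)) (farE i (λ r → proj₁ r σv))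

            likeC-v : likeC (τ v) ≡ left
            likeC-v with τ v ≟ₗ τ c
            ... | yes eq = ⊥-elim (τv≢τc eq)
            ... | no _   = refl

            likeC-c : ∀ {t} → t ≡ τ c → likeC t ≡ right
            likeC-c {t} eq with t ≟ₗ τ c
            ... | yes _ = refl
            ... | no ¬p = ⊥-elim (¬p eq)

            ρ-middle : ∀ {x} → x ∈ Ws → ∀ s → σ x ≡ s → isMiddle (ρ′ s (τ x)) ≤ 𝟙 (x ≟ c)
            ρ-middle i left   p = z≤n
            ρ-middle {x} i middle p = ≤-reflexive (sym (𝟙-yes (x ≟ c) (only-c i p)))
            ρ-middle {x} i right  p = subst (_≤ 𝟙 (x ≟ c)) (sym (likeC-≢middle (τ x))) z≤n

            ρ-cut : ∀ {x y} → (x , y) ∈ Es → ∀ s s′ → σ x ≡ s → σ y ≡ s′ → cross (ρ′ s (τ x)) (ρ′ s′ (τ y)) ≡ 0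
            ρ-cut i left   left   p q = refl
            ρ-cut i left   middle p q = refl
            ρ-cut i middle left   p q = refl
            ρ-cut i middle middle p q = refl
            ρ-cut i middle right  p q = refl
            ρ-cut {x} i right middle p q = cross-sym (likeC (τ x)) middle
            ρ-cut i left   right  p q with refl ← only-uv i p q = cong (cross left) likeC-v
            ρ-cut i right  left   p q with refl ← only-vu i p q = cong (λ s → cross s left) likeC-v
            ρ-cut {x} {y} i right right p q =
              trans (cong (λ t → cross (likeC (τ x)) (likeC t))
                      (sym (cross≡0 (farV (proj₁ (wf i)) p) (farV (proj₁ (proj₂ (wf i))) q) (farE i (λ r → proj₁ r p)))))
                    (cross-self (likeC (τ x)))

          far-≢0 : ⊥
          far-≢0 with y , y∈ , σy , τy ← neighbour = n≮n 1 (≤-trans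
            (two ρ u∈ y∈ (cong (λ s → ρ′ s (τ u)) σu) (trans (cong (λ s → ρ′ s (τ y)) σy) (likeC-c τy)))
            (+-mono-≤
              (≤-trans (∑-mono Ws (λ {x} i → ρ-middle i (σ x) refl)) (≤-reflexive (∑-δ₁ _≟_ unique c∈)))
              (≤-reflexive (∑-zero Es (λ { {x , y} i → ρ-cut i (σ x) (σ y) refl refl })))))

        -- By 2-connectedness there is a way from `u` over `v` through the far side to `c`, on which
        -- a labelling that puts `u` and `c` on different sides has to pay.
        far-pos : 1 ≤ cross (τ u) (τ c) → 1 ≤ farCost
        far-pos h = n≢0⇒n>0 (λ eq → far-≢0 eq h)

        edgeCost≤cost : edgeCost ≤ cost τ Ws Es
        edgeCost≤cost = begin
          ∑ As (isMiddle ∘ τ) + (∑ EA (cut τ) + cross (τ u) (τ c))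
            ≡⟨ sym (+-assoc (∑ As (isMiddle ∘ τ)) _ _) ⟩
          (∑ As (isMiddle ∘ τ) + ∑ EA (cut τ)) + cross (τ u) (τ c)
            ≤⟨ +-monoʳ-≤ (∑ As (isMiddle ∘ τ) + ∑ EA (cut τ)) (cross≤far (cross (τ u) (τ c)) (cross≤1 (τ u) (τ c)) far-pos) ⟩
          (∑ As (isMiddle ∘ τ) + ∑ EA (cut τ)) + farCost ≡⟨ near+far ⟩
          cost τ Ws Es ∎
          where
          open ≤-Reasoning
          cross≤far : ∀ m → m ≤ 1 → (1 ≤ m → 1 ≤ farCost) → m ≤ farCost
          cross≤far zero _ _ = z≤n
          cross≤far (suc zero) _ h = h ≤-refl
          cross≤far (suc (suc m)) (s≤s ()) h

      -- This is `edgeCost≤cost` for the cut around `x`. At `u` and `c`, the edge of the new path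
      -- takes the place of an edge to the far side.
      side-deg : ∀ {x} → x ∈ As → deg sideE x ≤ deg Es x
      side-deg {x} i = begin
        inc x (u , v) + (inc x (v , c) + ∑ EA (inc x))
          ≡⟨ cong (λ m → (𝟙 (x ≟ u) + m) + ((m + 𝟙 (x ≟ c)) + ∑ EA (inc x))) (𝟙-no (x ≟ v) (As⇒≢v i)) ⟩
        (𝟙 (x ≟ u) + 0) + (𝟙 (x ≟ c) + ∑ EA (inc x))
          ≡⟨ rearrange (𝟙 (x ≟ u)) (𝟙 (x ≟ c)) (∑ EA (inc x)) ⟩
        ∑ EA (inc x) + inc x (u , c)
          ≡⟨ cong₂ _+_ (∑-cong EA (λ { {a , b} j → sym (cut-single x (proj₂ (proj₂ (wf (proj₁ (EA⇒ j)))))) }))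
                       (sym (cut-single x u≢c)) ⟩
        ∑ EA (cut (single x)) + cross (single x u) (single x c)
          ≤⟨ m≤n+m _ (∑ As (isMiddle ∘ single x)) ⟩
        edgeCost (single x)   ≤⟨ edgeCost≤cost (single x) ⟩
        cost (single x) Ws Es ≡⟨ cost-single x ⟩
        deg Es x              ∎
        where
        open ≤-Reasoning
        rearrange : ∀ a b d → (a + 0) + (b + d) ≡ d + (a + b)
        rearrange = solve-∀

      side-deg-v : deg sideE v ≡ 2
      side-deg-v = trans
        (cong₂ _+_ (cong₂ _+_ (𝟙-no (v ≟ u) (u≢v ∘ sym)) (𝟙-yes (v ≟ v) refl))
          (cong₂ _+_ (cong₂ _+_ (𝟙-yes (v ≟ v) refl) (𝟙-no (v ≟ c) (c≢v ∘ sym)))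
            (∑-zero EA (λ { {a , b} j → cong₂ _+_ (𝟙-no (v ≟ a) (As⇒≢v (proj₁ (proj₂ (EA⇒ j))) ∘ sym))
                                                  (𝟙-no (v ≟ b) (As⇒≢v (proj₂ (proj₂ (EA⇒ j))) ∘ sym)) }))))
        refl

      -- Separation is inherited because an old edge with two ends of degree at least 3 in the side
      -- has such ends in the whole piece, where its separating cut can be restricted. The two new
      -- edges end at `v`, whose degree is 2.
      sidePiece : Piece sideV sideE sideK
      sidePiece = record
        { unique = All.tabulate (λ i v≡ → As⇒≢v i (sym v≡)) ∷ Unique.filter⁺ L? unique
        ; wf     = wf₁
        ; two    = side-two
        ; sep    = sep₁
        ; bound  = side-bound
        ; diag   = diag₁
        }
        where
        wf₁ : ∀ {x y} → (x , y) ∈ sideE → x ∈ sideV × y ∈ sideV × x ≢ y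
        wf₁ (here refl)         = there u∈As , here refl , u≢v
        wf₁ (there (here refl)) = here refl , there c∈As , c≢v ∘ sym
        wf₁ (there (there i)) with j , a , b ← EA⇒ i = there a , there b , proj₂ (proj₂ (wf j))
        sep₁ : ∀ {x y} → (x , y) ∈ sideE → 3 ≤ deg sideE x → 3 ≤ deg sideE y →
               ∃ λ τ → cost τ sideV sideE ≤ 2 × τ x ≡ left × τ y ≡ right
        sep₁ (here refl)         p q = ⊥-elim (n≮n 2 (≤-trans q (≤-reflexive side-deg-v)))
        sep₁ (there (here refl)) p q = ⊥-elim (n≮n 2 (≤-trans p (≤-reflexive side-deg-v)))
        sep₁ (there (there i))   p q with j , a , b ← EA⇒ i
          with τ , τ≤2 , τx , τy ← sep j (≤-trans p (side-deg a)) (≤-trans q (side-deg b)) =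
          restrict τ , ≤-trans (restrict-cost τ) (≤-trans (edgeCost≤cost τ) τ≤2) ,
          trans (restrict-A τ a) τx , trans (restrict-A τ b) τy
        diag₁ : ∀ x → sideK x x ≡ 0
        diag₁ x with x ≟ v
        ... | yes _ = refl
        ... | no _  = diag x

  halve : Label → Label
  halve left = left
  halve _    = right

  halve-middle : ∀ s → isMiddle (halve s) ≡ 0
  halve-middle = toWitness {a? = ∀ₗ? λ s → isMiddle (halve s) ≟ℕ 0} tt

  both : Label → Label → Label
  both left left = left
  both _    _    = right

  both-middle : ∀ s t → isMiddle (both s t) ≡ 0
  both-middle = toWitness {a? = ∀ₗ? λ s → ∀ₗ? λ t → isMiddle (both s t) ≟ℕ 0} tt

  both-left : ∀ {s t} → both s t ≡ left → s ≡ left × t ≡ left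
  both-left {left} {left} _ = refl , refl

  both-right : ∀ {s t} → both s t ≡ right → s ≢ left ⊎ t ≢ left
  both-right {left}   {middle} _ = inj₂ λ ()
  both-right {left}   {right}  _ = inj₂ λ ()
  both-right {middle}          _ = inj₁ λ ()
  both-right {right}           _ = inj₁ λ ()

  orient : ∀ a b → 1 ≤ cross a b → a ≡ left × b ≡ right ⊎ a ≡ right × b ≡ left
  orient left right _ = inj₁ (refl , refl)
  orient right left _ = inj₂ (refl , refl)
  orient left left ()
  orient left middle ()
  orient middle _ ()
  orient right middle ()
  orient right right ()

  -- Each side of a cut has at least three vertices besides c.

  module PieceBounds {V : Set} (_≟_ : DecidableEquality V) where

    open Cuts _≟_
    open Split _≟_

    inc⇒ : ∀ {u x y} → 1 ≤ inc u (x , y) → u ≡ x ⊎ u ≡ y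
    inc⇒ {u} {x} {y} h with u ≟ x | u ≟ y
    ... | yes p | _     = inj₁ p
    ... | no _  | yes q = inj₂ q
    ... | no _  | no _ with () ← h

    inc-fst : ∀ {u y} → 1 ≤ inc u (u , y)
    inc-fst {u} {y} = ≤-trans (≤-reflexive (sym (𝟙-yes (u ≟ u) refl))) (m≤m+n _ (𝟙 (u ≟ y)))

    inc-snd : ∀ {u x} → 1 ≤ inc u (x , u)
    inc-snd {u} {x} = ≤-trans (≤-reflexive (sym (𝟙-yes (u ≟ u) refl))) (m≤n+m _ (𝟙 (u ≟ x)))

    inc≡0 : ∀ {u x y} → u ≢ x → u ≢ y → inc u (x , y) ≡ 0
    inc≡0 {u} {x} {y} p q = cong₂ _+_ (𝟙-no (u ≟ x) p) (𝟙-no (u ≟ y) q)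

    cover₁ : ∀ {xs : List V} {a x} → Unique xs → length xs ≤ 1 → a ∈ xs → x ∈ xs → x ≡ a
    cover₁ {xs} u le i j = ∑≤1-unique xs {λ _ → 1} (≤-trans (≤-reflexive (sym (length-∑ xs))) le) j i ≤-refl ≤-refl

    cover₂ : ∀ {xs : List V} {a b x} → Unique xs → length xs ≤ 2 → a ∈ xs → b ∈ xs → a ≢ b → x ∈ xs → x ≡ a ⊎ x ≡ b
    cover₂ {xs} {a} {b} {x} u le i j a≢b k = inc⇒ (≤-reflexive (sym tight))
      where
      at-most : ∀ y → inc y (a , b) ≤ 1
      at-most y = inc≤1 y a≢b
      total : ∑ xs (λ y → inc y (a , b)) ≡ 2
      total = trans (∑-+ xs) (cong₂ _+_ (∑-δ₁ _≟_ u i) (∑-δ₁ _≟_ u j))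
      tight : inc x (a , b) ≡ 1
      tight = ∑-tight xs {g = λ _ → 1} (λ {y} _ → at-most y)
        (≤-trans (≤-reflexive (sym (length-∑ xs))) (≤-trans le (≤-reflexive (sym total)))) k

    Adj-cross : ∀ σ {Es e} → e ∈ Es → 1 ≤ cut σ e → ∃ λ x → ∃ λ y → Adj Es x y × σ x ≡ left × σ y ≡ right
    Adj-cross σ {e = a , b} i h with orient (σ a) (σ b) h
    ... | inj₁ (p , q) = a , b , inj₁ i , p , q
    ... | inj₂ (p , q) = b , a , inj₂ i , q , p

    -- A total of at most 1 has room for one edge, so two adjacencies that both count are the same
    -- edge up to its orientation.
    Adj-∑ : ∀ {Es x y} (f : V × V → ℕ) → (∀ a b → f (a , b) ≡ f (b , a)) → ∑ Es f ≤ 1 →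
            Adj Es x y → 1 ≤ f (x , y) → ∀ {x′ y′} → Adj Es x′ y′ → 1 ≤ f (x′ , y′) → x ≡ x′ ⊎ x ≡ y′
    Adj-∑ {Es} f f-sym h (inj₁ i) p (inj₁ j) q with refl ← ∑≤1-unique Es h i j p q = inj₁ refl
    Adj-∑ {Es} f f-sym h (inj₁ i) p (inj₂ j) q with refl ← ∑≤1-unique Es h i j p (subst (1 ≤_) (f-sym _ _) q) = inj₂ refl
    Adj-∑ {Es} f f-sym h (inj₂ i) p (inj₁ j) q with refl ← ∑≤1-unique Es h i j (subst (1 ≤_) (f-sym _ _) p) q = inj₂ refl
    Adj-∑ {Es} f f-sym h (inj₂ i) p (inj₂ j) q
      with refl ← ∑≤1-unique Es h i j (subst (1 ≤_) (f-sym _ _) p) (subst (1 ≤_) (f-sym _ _) q) = inj₁ refl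

    update-middle : ∀ {σ x y ℓ} → (σ [ x ↦ middle ]) y ≡ ℓ → ℓ ≢ middle → y ≢ x × σ y ≡ ℓ
    update-middle {σ} {x} {y} eq ℓ≢m with y ≟ x
    ... | yes _  = ⊥-elim (ℓ≢m (sym eq))
    ... | no y≢x = y≢x , eq

    module _ {Ws Es K} (P : Piece Ws Es K) {u v} (N : NormalCut Ws Es u v) (du : 3 ≤ deg Es u) where
      open Piece P
      open NormalCut N
      open Side P N

      left? : Decidable (λ x → σ x ≡ left)
      left? x = σ x ≟ₗ left

      strictSide : List V
      strictSide = filter left? Ws

      strict⁺ : ∀ {x} → x ∈ Ws → σ x ≡ left → x ∈ strictSide
      strict⁺ = ∈-filter⁺ left?

      As-split : ∀ {x} → x ∈ As → x ∈ strictSide ⊎ x ≡ c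
      As-split {x} i with j , p ← As⇒ i with σ x in σx
      ... | left   = inj₁ (strict⁺ j σx)
      ... | middle = inj₂ (only-c j σx)
      ... | right  = ⊥-elim (p refl)

      length-As : length As ≡ suc (length strictSide)
      length-As = begin
        length As                                        ≡⟨ length-filter-∑ L? Ws ⟩
        ∑ Ws (λ x → 𝟙 (L? x))                            ≡⟨ ∑-cong Ws (λ {x} i → pointwise i (σ x) refl) ⟩
        ∑ Ws (λ x → 𝟙 (x ≟ c) + 𝟙 (left? x))             ≡⟨ ∑-+ Ws ⟩
        ∑ Ws (λ x → 𝟙 (x ≟ c)) + ∑ Ws (λ x → 𝟙 (left? x)) ≡⟨ cong₂ _+_ (∑-δ₁ _≟_ unique c∈) (sym (length-filter-∑ left? Ws)) ⟩
        suc (length strictSide)                          ∎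
        where
        open ≡-Reasoning
        pointwise : ∀ {x} → x ∈ Ws → ∀ s → σ x ≡ s → 𝟙 (notRight? s) ≡ 𝟙 (x ≟ c) + 𝟙 (s ≟ₗ left)
        pointwise {x} i left   p = sym (cong (_+ 1) (𝟙-no (x ≟ c) (labels≢ p σc λ ())))
        pointwise {x} i middle p = sym (cong (_+ 0) (𝟙-yes (x ≟ c) (only-c i p)))
        pointwise {x} i right  p = sym (cong (_+ 0) (𝟙-no (x ≟ c) (labels≢ p σc λ ())))

      EA-Adj : ∀ {x y} → Adj EA x y → Adj Es x y × x ∈ As × y ∈ As
      EA-Adj (inj₁ i) with j , a , b ← EA⇒ i = inj₁ j , a , b
      EA-Adj (inj₂ i) with j , a , b ← EA⇒ i = inj₂ j , b , a

      Adj-EA : ∀ {x y} → Adj Es x y → σ x ≢ right → σ y ≢ right → Adj EA x y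
      Adj-EA (inj₁ i) p q = inj₁ (∈-filter⁺ E? i (p , q))
      Adj-EA (inj₂ i) p q = inj₂ (∈-filter⁺ E? i (q , p))

      only-uvʳ : ∀ {x y} → Adj Es x y → σ x ≡ left → σ y ≡ right → x ≡ u
      only-uvʳ (inj₁ i) p q with refl ← only-uv i p q = refl
      only-uvʳ (inj₂ i) p q with refl ← only-vu i q p = refl

      -- Among the edges at `u`, of which there are at least three, only the crossing edge leaves
      -- the near side.
      2≤inc-u : 2 ≤ ∑ EA (inc u)
      2≤inc-u = +-cancelʳ-≤ 1 2 _ (begin
        3                                                ≤⟨ du ⟩
        ∑ Es (inc u)                                     ≤⟨ ∑-mono Es (λ { {x , y} i → pointwise i (σ x) (σ y) refl refl }) ⟩
        ∑ Es (λ e → 𝟙 (E? e) * inc u e + cut σ e)        ≡⟨ trans (∑-+ Es) (cong (_+ ∑ Es (cut σ)) (sym (∑-filter E? Es))) ⟩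
        ∑ EA (inc u) + ∑ Es (cut σ)                      ≤⟨ +-monoʳ-≤ (∑ EA (inc u)) cut≤1 ⟩
        ∑ EA (inc u) + 1                                 ∎)
        where
        open ≤-Reasoning
        near : ∀ m → m ≤ 1 * m + 0
        near m = ≤-reflexive (sym (trans (+-identityʳ (1 * m)) (*-identityˡ m)))
        away : ∀ {x y} → σ x ≢ left → σ y ≢ left → inc u (x , y) ≤ 0
        away p q = ≤-reflexive (inc≡0 (λ { refl → p σu }) (λ { refl → q σu }))
        is : ∀ {x a b} → σ x ≡ a → a ≢ b → σ x ≢ b
        is refl h = h
        pointwise : ∀ {x y} → (x , y) ∈ Es → ∀ s s′ → σ x ≡ s → σ y ≡ s′ →
                    inc u (x , y) ≤ 𝟙 (notRight? s ×-dec notRight? s′) * inc u (x , y) + cross s s′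
        pointwise {x} {y} i left   left   p q = near (inc u (x , y))
        pointwise {x} {y} i left   middle p q = near (inc u (x , y))
        pointwise {x} {y} i middle left   p q = near (inc u (x , y))
        pointwise {x} {y} i middle middle p q = near (inc u (x , y))
        pointwise i right  right  p q = away (is p λ ()) (is q λ ())
        pointwise i right  middle p q = away (is p λ ()) (is q λ ())
        pointwise i middle right  p q = away (is p λ ()) (is q λ ())
        pointwise i left   right  p q = inc≤1 u (proj₂ (proj₂ (wf i)))
        pointwise i right  left   p q = inc≤1 u (proj₂ (proj₂ (wf i)))

      -- `u` is not a cut vertex: placing it in the middle costs 1, so an edge avoiding `u` must
      -- cross to make up the cost 2.
      middle-at-u : ∀ (h : V → Label) → (∀ x → isMiddle (h x) ≡ 0) → ∀ {x} → x ∈ Ws → x ≢ u → h x ≡ left → h v ≡ right →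
                    ∃ λ x → ∃ λ y → Adj Es x y × x ≢ u × h x ≡ left × h y ≡ right
      middle-at-u h noMiddle {x₀} x∈ x≢u hx hv = result crossing
        where
        pointwise : ∀ y → isMiddle ((h [ u ↦ middle ]) y) ≤ 𝟙 (y ≟ u)
        pointwise y with y ≟ u
        ... | yes _ = ≤-refl
        ... | no _  = ≤-reflexive (noMiddle y)
        crossing : ∃ λ e → e ∈ Es × 1 ≤ cut (h [ u ↦ middle ]) e
        crossing = ∑-pos Es (+-cancelˡ-≤ 1 1 _ (≤-trans
          (two (h [ u ↦ middle ]) x∈ v∈ (trans (update-≢ h middle x≢u) hx) (trans (update-≢ h middle (u≢v ∘ sym)) hv))
          (+-monoˡ-≤ _ (≤-trans (∑-mono Ws (λ {y} _ → pointwise y)) (≤-reflexive (∑-δ₁ _≟_ unique u∈))))))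
        result : (∃ λ e → e ∈ Es × 1 ≤ cut (h [ u ↦ middle ]) e) →
                 ∃ λ x → ∃ λ y → Adj Es x y × x ≢ u × h x ≡ left × h y ≡ right
        result (e , e∈ , 1≤e) with x , y , xy , p , q ← Adj-cross (h [ u ↦ middle ]) e∈ 1≤e =
          x , y , xy , proj₁ (update-middle {h} p λ ()) , proj₂ (update-middle {h} p λ ()) , proj₂ (update-middle {h} q λ ())

      inc-sym : ∀ z a b → inc z (a , b) ≡ inc z (b , a)
      inc-sym z a b = +-comm (𝟙 (z ≟ a)) (𝟙 (z ≟ b))

      labelled : ∀ {x a b} → σ x ≡ a → a ≢ b → σ x ≢ b
      labelled refl h = h

      EA≤Es : ∀ x → ∑ EA (inc x) ≤ deg Es x
      EA≤Es x = ≤-trans (m≤m+n _ _) (≤-reflexive (sym (∑-partition E? Es)))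

      module _ (uc : Adj EA u c) where

        private
          uc′ : Adj Es u c
          uc′ = proj₁ (EA-Adj uc)

          -- In this case the strict side is `u` alone, and as there are no loops, all edges of `EA`
          -- at `u` lead to `c`.
          inc-c-one : length strictSide ≤ 1 → 2 ≤ ∑ EA (inc c)
          inc-c-one le = ≤-trans 2≤inc-u (∑-mono EA (λ { {x , y} i →
              pointwise i (As-split (proj₁ (proj₂ (EA⇒ i)))) (As-split (proj₂ (proj₂ (EA⇒ i)))) }))
            where
            isU : ∀ {x} → x ∈ strictSide → x ≡ u
            isU = cover₁ (Unique.filter⁺ left? unique) le (strict⁺ u∈ σu)
            pointwise : ∀ {x y} → (x , y) ∈ EA → x ∈ strictSide ⊎ x ≡ c → y ∈ strictSide ⊎ y ≡ c → inc u (x , y) ≤ inc c (x , y)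
            pointwise i _ (inj₂ refl) = ≤-trans (inc≤1 u (proj₂ (proj₂ (wf (proj₁ (EA⇒ i)))))) inc-snd
            pointwise i (inj₂ refl) _ = ≤-trans (inc≤1 u (proj₂ (proj₂ (wf (proj₁ (EA⇒ i)))))) inc-fst
            pointwise i (inj₁ a) (inj₁ b) = ⊥-elim (proj₂ (proj₂ (wf (proj₁ (EA⇒ i)))) (trans (isU a) (sym (isU b))))

          -- Some vertex of the side other than u reaches the rest avoiding u,
          -- hence is joined to c.
          inc-c-many : 2 ≤ length strictSide → 2 ≤ ∑ EA (inc c)
          inc-c-many 2≤ = result (∑-exceed strictSide {λ _ → 1} {λ x → 𝟙 (x ≟ u)}
            (subst₂ _<_ (sym (∑-δ₁ _≟_ (Unique.filter⁺ left? unique) (strict⁺ u∈ σu))) (length-∑ strictSide) 2≤))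
            where
            absurd : ∀ {x y} → Adj Es x y → x ≢ u → halve (σ x) ≡ left → halve (σ y) ≡ right → ∑ EA (inc c) ≤ 1 →
                     ∀ s s′ → σ x ≡ s → σ y ≡ s′ → ⊥
            absurd xy x≢u hx hy le middle _ p q with () ← trans (sym (cong halve p)) hx
            absurd xy x≢u hx hy le right  _ p q with () ← trans (sym (cong halve p)) hx
            absurd xy x≢u hx hy le left left p q with () ← trans (sym (cong halve q)) hy
            absurd xy x≢u hx hy le left right p q = x≢u (only-uvʳ xy p q)
            absurd xy x≢u hx hy le left middle p q with refl ← only-c (proj₁ (proj₂ (wfʳ xy))) q
              with Adj-∑ (inc c) (inc-sym c) le (Adj-EA xy (labelled p λ ()) (labelled q λ ())) inc-snd uc inc-snd
            ... | inj₁ x≡u = x≢u x≡u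
            ... | inj₂ x≡c = labels≢ p q (λ ()) x≡c
            result : (∃ λ z → z ∈ strictSide × 𝟙 (z ≟ u) < 1) → 2 ≤ ∑ EA (inc c)
            result (z , z∈ , lt) with z∈Ws , σz ← ∈-filter⁻ left? {xs = Ws} z∈
              with x , y , xy , x≢u , hx , hy ← middle-at-u (halve ∘ σ) (λ x → halve-middle (σ x)) z∈Ws
                     (λ eq → n≮n 1 (subst (_< 1) (𝟙-yes (z ≟ u) eq) lt)) (cong halve σz) (cong halve σv) =
              ≰⇒> λ le → absurd xy x≢u hx hy le (σ x) (σ y) refl refl

          2≤inc-c : 2 ≤ ∑ EA (inc c)
          2≤inc-c with length strictSide ≤? 1
          ... | yes le = inc-c-one le
          ... | no gt  = inc-c-many (≰⇒> gt)

          -- The path edge `vc` is the third edge at `c` in the side, and `side-deg` carries the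
          -- count back to the whole piece.
          3≤deg-c : 3 ≤ deg Es c
          3≤deg-c = ≤-trans (≤-trans (s≤s 2≤inc-c) (≤-trans (+-monoˡ-≤ _ inc-snd) (m≤n+m _ (inc c (u , v))))) (side-deg c∈As)

          -- The far side and the edge `uc` use up the cost 2, so no near vertex is middle and no
          -- near edge but this one crosses `τ`. Hence another edge at `u` leads to a vertex that is
          -- left for both `σ` and `τ`. By `middle-at-u` an edge leaves the set of such vertices at
          -- an end other than `u`; but an edge crossing `σ` starts at `u`, and so does the only
          -- near edge crossing `τ`. So an edge `uc` cannot exist.
          absurd : (∃ λ τ → cost τ Ws Es ≤ 2 × τ u ≡ left × τ c ≡ right) → ⊥
          absurd (τ , τ≤2 , τu , τc) = result (∑-exceed EA (≤-trans (s≤s near-cut≤1) 2≤inc-u))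
            where
            near≤1 : ∑ As (isMiddle ∘ τ) + ∑ EA (cut τ) ≤ 1
            near≤1 = +-cancelʳ-≤ 1 _ 1 (≤-trans
              (+-monoʳ-≤ _ (far-pos τ (≤-reflexive (sym (cong₂ cross τu τc)))))
              (≤-trans (≤-reflexive (near+far τ)) τ≤2))
            near-cut≤1 : ∑ EA (cut τ) ≤ 1
            near-cut≤1 = ≤-trans (m≤n+m _ (∑ As (isMiddle ∘ τ))) near≤1
            noMiddle : ∀ {x} → x ∈ As → isMiddle (τ x) ≡ 0
            noMiddle i = n≤0⇒n≡0 (≤-trans (∑-∈ i) (+-cancelʳ-≤ 1 _ 0 (≤-trans
              (+-monoʳ-≤ _ (Adj⇒1≤cut τ uc τu τc)) near≤1)))
            nonLeft : ∀ {x} → x ∈ As → τ x ≢ left → τ x ≡ right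
            nonLeft {x} i h with τ x | noMiddle i
            ... | left  | _ = ⊥-elim (h refl)
            ... | right | _ = refl
            uncrossed : ∀ {x y} → Adj Es x y → x ≢ u → σ x ≡ left → τ x ≡ left → σ y ≢ right → τ y ≡ right → ⊥
            uncrossed xy x≢u σx τx σy τy
              with Adj-∑ (cut τ) (λ a b → cross-sym (τ a) (τ b)) near-cut≤1 (Adj-EA xy (labelled σx λ ()) σy)
                     (≤-reflexive (sym (cong₂ cross τx τy))) uc (≤-reflexive (sym (cong₂ cross τu τc)))
            ... | inj₁ x≡u = x≢u x≡u
            ... | inj₂ x≡c = labels≢ σx σc (λ ()) x≡c
            third : ∀ {z} → z ∈ As → z ≢ u → τ z ≡ left → ⊥
            third {z} z∈ z≢u τz with As-split z∈
            ... | inj₂ refl with () ← trans (sym τz) τc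
            ... | inj₁ z∈s
              with x , y , xy , x≢u , hx , hy ← middle-at-u (λ x → both (σ x) (τ x)) (λ x → both-middle (σ x) (τ x))
                     (proj₁ (As⇒ z∈)) z≢u (cong₂ both (proj₂ (∈-filter⁻ left? {xs = Ws} z∈s)) τz) (cong (λ s → both s (τ v)) σv)
              with σx , τx ← both-left {σ x} hx
              = finish (σ y) refl (both-right {σ y} hy)
              where
              finish : ∀ s → σ y ≡ s → σ y ≢ left ⊎ τ y ≢ left → ⊥
              finish left   p (inj₁ h) = h p
              finish left   p (inj₂ h) = uncrossed xy x≢u σx τx (labelled p λ ())
                (nonLeft (∈-filter⁺ L? (proj₁ (proj₂ (wfʳ xy))) (labelled p λ ())) h)
              finish middle p _ with refl ← only-c (proj₁ (proj₂ (wfʳ xy))) p = uncrossed xy x≢u σx τx (labelled p λ ()) τc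
              finish right  p _ = x≢u (only-uvʳ xy σx p)
            result : (∃ λ e → e ∈ EA × cut τ e < inc u e) → ⊥
            result ((x , y) , i , lt) with j , x∈ , y∈ ← EA⇒ i with x≢y ← proj₂ (proj₂ (wf j))
              with τx≡τy ← cross≡0 (noMiddle x∈) (noMiddle y∈) (n<1⇒n≡0 (≤-trans lt (inc≤1 u x≢y)))
              with inc⇒ {u} {x} {y} (≤-trans (s≤s z≤n) lt)
            ... | inj₁ refl = third y∈ (x≢y ∘ sym) (trans (sym τx≡τy) τu)
            ... | inj₂ refl = third x∈ x≢y (trans τx≡τy τu)

        c-not-adjacent : ⊥
        c-not-adjacent = absurd (sepʳ uc′ du 3≤deg-c)

      private
        module _ (small : length strictSide ≤ 2) where

          otherEnd : ∀ {y} → Adj EA u y → y ∈ strictSide × u ≢ y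
          otherEnd uy with e , _ , y∈ ← EA-Adj uy with As-split y∈
          ... | inj₁ s    = s , proj₂ (proj₂ (wfʳ e))
          ... | inj₂ refl = ⊥-elim (c-not-adjacent uy)

          -- With `c` excluded as a neighbour, at least two parallel edges join `u` to the only
          -- other strict vertex `z`. Besides `uv` the strict side needs a second exit, and this can
          -- only be an edge `zc`. Then `z` has degree at least 3, so a cut of cost 2 should
          -- separate `u` from `z`; the parallel edges alone consume it.
          absurd : (∃ λ e → e ∈ EA × 1 ≤ inc u e) → ⊥
          absurd ((a , b) , i , h) = go (neighbour (inc⇒ {u} {a} {b} h))
            where
            neighbour : u ≡ a ⊎ u ≡ b → ∃ λ z → Adj EA u z
            neighbour (inj₁ refl) = b , inj₁ i
            neighbour (inj₂ refl) = a , inj₂ i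
            go : (∃ λ z → Adj EA u z) → ⊥
            go (z , uz) = contradictory (∑-exceed Es {cut (halve ∘ σ)} {cut σ} (≤-<-trans cut≤1
                (≤-trans (two (halve ∘ σ) u∈ v∈ (cong halve σu) (cong halve σv))
                         (≤-reflexive (cong (_+ ∑ Es (cut (halve ∘ σ))) (∑-zero Ws (λ {x} _ → halve-middle (σ x))))))))
              where
              z∈ : z ∈ strictSide
              z∈ = proj₁ (otherEnd uz)
              σz : σ z ≡ left
              σz = proj₂ (∈-filter⁻ left? {xs = Ws} z∈)
              u≢z : u ≢ z
              u≢z = proj₂ (otherEnd uz)
              isZ : ∀ {y} → Adj EA u y → y ≡ z
              isZ uy with cover₂ (Unique.filter⁺ left? unique) small (strict⁺ u∈ σu) z∈ u≢z (proj₁ (otherEnd uy))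
              ... | inj₁ eq = ⊥-elim (proj₂ (otherEnd uy) (sym eq))
              ... | inj₂ eq = eq

              inc-u≤ : ∀ (f : V × V → ℕ) → 1 ≤ f (u , z) → 1 ≤ f (z , u) → ∀ {e} → e ∈ EA → inc u e ≤ f e
              inc-u≤ f p q {x , y} j with inc u (x , y) in eq
              ... | zero = z≤n
              ... | suc m with inc⇒ {u} {x} {y} (subst (1 ≤_) (sym eq) (s≤s z≤n))
              ...   | inj₁ refl with refl ← isZ (inj₁ j) = ≤-trans (subst (_≤ 1) eq (inc≤1 u u≢z)) p
              ...   | inj₂ refl with refl ← isZ (inj₂ j) = ≤-trans (subst (_≤ 1) eq (inc≤1 u (u≢z ∘ sym))) q

              inc-u< : ∀ (f : V × V → ℕ) → 1 ≤ f (u , z) → 1 ≤ f (z , u) → 1 ≤ f (z , c) → 1 ≤ f (c , z) → Adj EA z c → 3 ≤ ∑ EA f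
              inc-u< f p q r s (inj₁ j) = ≤-trans (s≤s 2≤inc-u) (∑-mono-< EA (inc-u≤ f p q) j
                (≤-trans (s≤s (≤-reflexive (inc≡0 u≢z u≢c))) r))
              inc-u< f p q r s (inj₂ j) = ≤-trans (s≤s 2≤inc-u) (∑-mono-< EA (inc-u≤ f p q) j
                (≤-trans (s≤s (≤-reflexive (inc≡0 u≢c u≢z))) s))

              separated : Adj EA z c → (∃ λ τ → cost τ Ws Es ≤ 2 × τ u ≡ left × τ z ≡ right) → ⊥
              separated zc (τ , τ≤2 , τu , τz) = n≮n 2 (≤-trans (by-c (τ c) refl) (≤-trans (≤-reflexive (near+far τ)) τ≤2))
                where
                uz-cross : 1 ≤ cut τ (u , z)
                uz-cross = ≤-reflexive (sym (cong₂ cross τu τz))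
                zu-cross : 1 ≤ cut τ (z , u)
                zu-cross = ≤-reflexive (sym (cong₂ cross τz τu))
                2≤near : 2 ≤ ∑ EA (cut τ)
                2≤near = ≤-trans 2≤inc-u (∑-mono EA (inc-u≤ (cut τ) uz-cross zu-cross))
                -- Whatever the label of `c`, it adds to the cost of the parallel edges: `left`
                -- makes `zc` cross, `middle` costs 1 itself, and `right` forces a cost on the far
                -- side.
                by-c : ∀ ℓ → τ c ≡ ℓ → 3 ≤ ∑ As (isMiddle ∘ τ) + ∑ EA (cut τ) + farCost τ
                by-c left p = ≤-trans (inc-u< (cut τ) uz-cross zu-cross
                    (≤-reflexive (sym (cong₂ cross τz p))) (≤-reflexive (sym (cong₂ cross p τz))) zc)
                  (≤-trans (m≤n+m _ (∑ As (isMiddle ∘ τ))) (m≤m+n _ (farCost τ)))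
                by-c middle p = ≤-trans (+-mono-≤ (≤-trans (≤-reflexive (sym (cong isMiddle p))) (∑-∈ {f = isMiddle ∘ τ} c∈As)) 2≤near)
                  (m≤m+n _ (farCost τ))
                by-c right p = +-mono-≤ (≤-trans 2≤near (m≤n+m _ (∑ As (isMiddle ∘ τ))))
                  (far-pos τ (≤-reflexive (sym (cong₂ cross τu p))))

              withC : Adj EA z c → ⊥
              withC zc = separated zc (sepʳ (proj₁ (EA-Adj uz)) du (≤-trans
                (inc-u< (inc z) inc-snd inc-fst inc-fst inc-snd zc) (EA≤Es z)))

              leftIsZ : ∀ {x} → x ∈ Ws → σ x ≡ left → Adj EA x c → x ≡ z
              leftIsZ x∈ σx xc with cover₂ (Unique.filter⁺ left? unique) small (strict⁺ u∈ σu) z∈ u≢z (strict⁺ x∈ σx)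
              ... | inj₁ refl = ⊥-elim (c-not-adjacent xc)
              ... | inj₂ eq   = eq

              contradictory : (∃ λ e → e ∈ Es × cut σ e < cut (halve ∘ σ) e) → ⊥
              contradictory ((x , y) , j , lt) = by-labels (σ x) (σ y) refl refl lt
                where
                by-labels : ∀ s s′ → σ x ≡ s → σ y ≡ s′ → cross s s′ < cross (halve s) (halve s′) → ⊥
                by-labels left   left   p q ()
                by-labels left   right  p q (s≤s ())
                by-labels right  left   p q (s≤s ())
                by-labels right  right  p q ()
                by-labels right  middle p q ()
                by-labels middle right  p q ()
                by-labels middle middle p q ()
                by-labels left   middle p q lt with refl ← only-c (proj₁ (proj₂ (wf j))) q
                  with xc ← Adj-EA (inj₁ j) (labelled p λ ()) (labelled q λ ())
                  with refl ← leftIsZ (proj₁ (wf j)) p xc = withC xc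
                by-labels middle left   p q lt with refl ← only-c (proj₁ (wf j)) p
                  with yc ← Adj-EA (inj₂ j) (labelled q λ ()) (labelled p λ ())
                  with refl ← leftIsZ (proj₁ (proj₂ (wf j))) q yc = withC yc

      3≤strictSide : 3 ≤ length strictSide
      3≤strictSide = ≰⇒> λ small → absurd small (∑-pos EA (≤-trans (s≤s z≤n) 2≤inc-u))

  -- Induction on the number of vertices.

  module PieceInduction {V : Set} (_≟_ : DecidableEquality V) where

    open Cuts _≟_
    open Split _≟_
    open PieceBounds _≟_

    -- Over ordered pairs, hence twice the sum over unordered ones.
    excess : List V → (V → V → ℕ) → ℕ
    excess Ws K = ∑ Ws λ x → ∑ Ws λ y → K x y ∸ 2

    module _ {Ws Es K} (P : Piece Ws Es K) where
      open Piece P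

      weight : V → ℕ
      weight x = deg Es x ∸ 2

      open Weights _≟_ Ws unique weight

      excess≤Y : excess Ws K ≤ Y
      excess≤Y = ∑-mono Ws (λ {x} i → ∑-mono Ws (λ {y} j → pointwise i j))
        where
        pointwise : ∀ {x y} → x ∈ Ws → y ∈ Ws → K x y ∸ 2 ≤ 𝟙 (¬? (x ≟ y)) * (weight x ⊓ weight y)
        pointwise {x} {y} i j with x ≟ y
        ... | yes refl = subst (λ k → k ∸ 2 ≤ 0) (sym (diag x)) z≤n
        ... | no x≢y   = ≤-trans (⊓-glb (∸-monoˡ-≤ 2 (bound-degˡ i j x≢y)) (∸-monoˡ-≤ 2 (bound-degʳ i j x≢y)))
                           (≤-reflexive (sym (*-identityˡ (weight x ⊓ weight y))))

      -- Double counting of incidences with a factor `g` at each vertex. It is applied to the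
      -- indicators of large and of small degree, to compare how many edge ends fall into each
      -- class.
      handshake : ∀ (g : V → ℕ) → ∑ Ws (λ x → g x * deg Es x) ≡ ∑ Es (λ (a , b) → g a + g b)
      handshake g = begin
        ∑ Ws (λ x → g x * deg Es x)                      ≡⟨ ∑-cong Ws (λ {x} _ → sym (∑-*ˡ Es (g x))) ⟩
        ∑ Ws (λ x → ∑ Es (λ e → g x * inc x e))          ≡⟨ ∑-swap Ws Es ⟩
        ∑ Es (λ e → ∑ Ws (λ x → g x * inc x e))          ≡⟨ ∑-cong Es (λ { {a , b} i → trans (∑-cong Ws (λ {x} _ → distribute (g x) (𝟙 (x ≟ a)) (𝟙 (x ≟ b))))
                                                            (trans (∑-+ Ws) (cong₂ _+_ (∑-δ _≟_ {f = g} unique (proj₁ (wf i))) (∑-δ _≟_ {f = g} unique (proj₁ (proj₂ (wf i)))))) }) ⟩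
        ∑ Es (λ (a , b) → g a + g b)                     ∎
        where
        open ≡-Reasoning
        distribute : ∀ g s t → g * (s + t) ≡ s * g + t * g
        distribute = solve-∀

      large⇒ : ∀ {x} → 1 ≤ weight x → 3 ≤ deg Es x
      large⇒ {x} h = ≰⇒> λ le → n≮n 0 (subst (1 ≤_) (m≤n⇒m∸n≡0 le) h)

      module _ (independent : ∀ {x y} → (x , y) ∈ Es → 1 ≤ weight x → 1 ≤ weight y → ⊥) where

        private
          small : V → ℕ
          small x = 𝟙 (¬? (1 ≤? weight x))

          pos*deg : ∀ x → pos x * deg Es x ≡ weight x + 2 * pos x
          pos*deg x with 1 ≤? weight x
          ... | yes h = trans (*-identityˡ (deg Es x)) (sym (m∸n+n≡m (<⇒≤ (large⇒ h))))
          ... | no ¬h = sym (trans (+-identityʳ (weight x)) (n<1⇒n≡0 (≰⇒> ¬h)))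

          small*deg : ∀ x → small x * deg Es x ≤ 2 * small x
          small*deg x with 1 ≤? weight x
          ... | yes h = z≤n
          ... | no ¬h = ≤-trans (≤-reflexive (*-identityˡ (deg Es x))) (m∸n≡0⇒m≤n (n<1⇒n≡0 (≰⇒> ¬h)))

          pos+small : ∀ x → pos x + small x ≡ 1
          pos+small x with 1 ≤? weight x
          ... | yes _ = refl
          ... | no _  = refl

          edge≤ : ∀ {a b} → (a , b) ∈ Es → pos a + pos b ≤ small a + small b
          edge≤ {a} {b} i with 1 ≤? weight a | 1 ≤? weight b
          ... | yes p | yes q = ⊥-elim (independent i p q)
          ... | yes _ | no _  = ≤-refl
          ... | no _  | yes _ = ≤-refl
          ... | no _  | no _  = z≤n

          lhs : W + 2 * p ≡ ∑ Es (λ (a , b) → pos a + pos b)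
          lhs = trans (sym (trans (∑-+ Ws) (cong (W +_) (∑-*ˡ Ws 2))))
                  (trans (∑-cong Ws (λ {x} _ → sym (pos*deg x))) (handshake pos))

          edges≤ : ∑ Es (λ (a , b) → pos a + pos b) ≤ ∑ Es (λ (a , b) → small a + small b)
          edges≤ = ∑-mono Es (λ { {a , b} i → edge≤ i })

          vertices≤ : ∑ Ws (λ x → small x * deg Es x) ≤ ∑ Ws (λ x → 2 * small x)
          vertices≤ = ∑-mono Ws (λ {x} _ → small*deg x)

          rhs : ∑ Ws (λ x → 2 * small x) + 2 * p ≡ 2 * length Ws
          rhs = begin
            ∑ Ws (λ x → 2 * small x) + 2 * p ≡⟨ cong (_+ 2 * p) (∑-*ˡ Ws 2) ⟩
            2 * ∑ Ws small + 2 * p           ≡⟨ sym (*-distribˡ-+ 2 (∑ Ws small) p) ⟩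
            2 * (∑ Ws small + p)             ≡⟨ cong (2 *_) (trans (+-comm (∑ Ws small) p) (trans (sym (∑-+ Ws))
                                                  (trans (∑-cong Ws (λ {x} _ → pos+small x)) (sym (length-∑ Ws))))) ⟩
            2 * length Ws                    ∎
            where open ≡-Reasoning

          split4 : ∀ W p → W + 4 * p ≡ (W + 2 * p) + 2 * p
          split4 = solve-∀

        -- An edge has at most one end of large degree, so the large degrees, with total W + 2p, sum
        -- to no more than the small ones, of which there are N - p and none exceeds 2.
        W+4p≤2N : W + 4 * p ≤ 2 * length Ws
        W+4p≤2N = begin
          W + 4 * p                                            ≡⟨ split4 W p ⟩
          (W + 2 * p) + 2 * p                                  ≡⟨ cong (_+ 2 * p) lhs ⟩
          ∑ Es (λ (a , b) → pos a + pos b) + 2 * p             ≤⟨ +-monoˡ-≤ (2 * p) edges≤ ⟩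
          ∑ Es (λ (a , b) → small a + small b) + 2 * p         ≡⟨ cong (_+ 2 * p) (sym (handshake small)) ⟩
          ∑ Ws (λ x → small x * deg Es x) + 2 * p              ≤⟨ +-monoˡ-≤ (2 * p) vertices≤ ⟩
          ∑ Ws (λ x → 2 * small x) + 2 * p                     ≡⟨ rhs ⟩
          2 * length Ws                                        ∎
          where open ≤-Reasoning

        module _ (tight : 2 * length Ws ≤ W + 4 * p) where

          private
            -- Tightness closes the chain behind `W+4p≤2N` into a circle. All its summands are then
            -- equalities, so the small degrees are exactly 2 and no edge has two small ends.
            middle≤ : ∑ Ws (λ x → 2 * small x) ≤ ∑ Es (λ (a , b) → pos a + pos b)
            middle≤ = +-cancelʳ-≤ (2 * p) _ _ (begin
              ∑ Ws (λ x → 2 * small x) + 2 * p                 ≡⟨ rhs ⟩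
              2 * length Ws                                    ≤⟨ tight ⟩
              W + 4 * p                                        ≡⟨ split4 W p ⟩
              (W + 2 * p) + 2 * p                              ≡⟨ cong (_+ 2 * p) lhs ⟩
              ∑ Es (λ (a , b) → pos a + pos b) + 2 * p         ∎)
              where open ≤-Reasoning

          small⇒deg≡2 : ∀ {x} → x ∈ Ws → ¬ (1 ≤ weight x) → deg Es x ≡ 2
          small⇒deg≡2 {x} i h = trans (sym (*-identityˡ (deg Es x))) (trans (cong (_* deg Es x) (sym one)) (trans
            (∑-tight Ws (λ {x} _ → small*deg x) (≤-trans middle≤ (≤-trans edges≤ (≤-reflexive (sym (handshake small))))) i)
            (cong (2 *_) one)))
            where
            one : small x ≡ 1
            one = 𝟙-yes (¬? (1 ≤? weight x)) h

          small-end : ∀ {a b} → (a , b) ∈ Es → ¬ (1 ≤ weight a) → ¬ (1 ≤ weight b) → ⊥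
          small-end {a} {b} i p q = 0≢2 (trans (sym (cong₂ _+_ (𝟙-no (1 ≤? weight a) p) (𝟙-no (1 ≤? weight b) q)))
            (trans (∑-tight Es (λ { {a , b} i → edge≤ i }) (≤-trans (≤-reflexive (sym (handshake small))) (≤-trans vertices≤ middle≤)) i)
              (cong₂ _+_ (𝟙-yes (¬? (1 ≤? weight a)) p) (𝟙-yes (¬? (1 ≤? weight b)) q))))
            where
            0≢2 : 0 ≢ 2
            0≢2 ()

        -- With r = p - 1, the mean bound gives Y ≤ rW and the count gives W + 4r ≤ 2(N - 2). The
        -- inequality of arithmetic and geometric means for W and 4r does the rest.
        leaf-bound : 4 * excess Ws K ≤ (length Ws ∸ 2) * (length Ws ∸ 2)
        leaf-bound = ≤-trans (*-monoʳ-≤ 4 excess≤Y) (arith Y W (length Ws) p average-bound W+4p≤2N)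
          where
          arith : ∀ Y W N p → Y + W ≤ p * W → W + 4 * p ≤ 2 * N → 4 * Y ≤ (N ∸ 2) * (N ∸ 2)
          arith Y W N zero h₁ h₂ = ≤-trans (≤-reflexive (cong (4 *_) (n≤0⇒n≡0 (≤-trans (m≤m+n Y _) h₁)))) z≤n
          arith Y W N (suc r) h₁ h₂ = *-cancelˡ-≤ 4 (begin
            4 * (4 * Y)                       ≤⟨ *-monoʳ-≤ 4 (*-monoʳ-≤ 4 Y≤) ⟩
            4 * (4 * (r * W))                 ≡⟨ e₁ r W ⟩
            4 * (W * (4 * r))                 ≤⟨ 4mn≤[m+n]² W (4 * r) ⟩
            (W + 4 * r) * (W + 4 * r)         ≤⟨ *-mono-≤ W+4r≤ W+4r≤ ⟩
            (2 * (N ∸ 2)) * (2 * (N ∸ 2))     ≡⟨ e₂ (N ∸ 2) ⟩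
            4 * ((N ∸ 2) * (N ∸ 2))           ∎)
            where
            open ≤-Reasoning
            Y≤ : Y ≤ r * W
            Y≤ = +-cancelʳ-≤ W Y (r * W) (≤-trans h₁ (≤-reflexive (+-comm W (r * W))))
            2≤N : 2 ≤ N
            2≤N = *-cancelˡ-≤ 2 (≤-trans (*-monoʳ-≤ 4 (s≤s (z≤n {r}))) (≤-trans (m≤n+m (4 * suc r) W) h₂))
            W+4r≤ : W + 4 * r ≤ 2 * (N ∸ 2)
            W+4r≤ = +-cancelʳ-≤ 4 _ _ (begin
              W + 4 * r + 4         ≡⟨ e₃ W r ⟩
              W + 4 * suc r         ≤⟨ h₂ ⟩
              2 * N                 ≡⟨ cong (2 *_) (sym (m∸n+n≡m 2≤N)) ⟩
              2 * (N ∸ 2 + 2)       ≡⟨ *-distribˡ-+ 2 (N ∸ 2) 2 ⟩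
              2 * (N ∸ 2) + 4       ∎)
              where
              e₃ : ∀ W r → W + 4 * r + 4 ≡ W + 4 * suc r
              e₃ = solve-∀
            e₁ : ∀ r W → 4 * (4 * (r * W)) ≡ 4 * (W * (4 * r))
            e₁ = solve-∀
            e₂ : ∀ m → (2 * m) * (2 * m) ≡ 4 * (m * m)
            e₂ = solve-∀

    module _ {Ws Es K} (P : Piece Ws Es K) {u v} (N : NormalCut Ws Es u v) where
      open Piece P
      open NormalCut N
      open Side P N
      private
        module Far = Side P (flipCut N)

      cost-σ≤2 : cost σ Ws Es ≤ 2
      cost-σ≤2 = +-mono-≤ (≤-trans (∑-mono Ws (λ {x} i → pointwise i (σ x) refl)) (≤-reflexive (∑-δ₁ _≟_ unique c∈))) cut≤1
        where
        pointwise : ∀ {x} → x ∈ Ws → ∀ s → σ x ≡ s → isMiddle s ≤ 𝟙 (x ≟ c)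
        pointwise i left   p = z≤n
        pointwise i right  p = z≤n
        pointwise {x} i middle p = ≤-reflexive (sym (𝟙-yes (x ≟ c) (only-c i p)))

      excess-restrict : ∑ As (λ x → ∑ As λ y → K x y ∸ 2) ≤ excess sideV sideK
      excess-restrict = ≤-trans
        (∑-mono As (λ {x} i → ≤-trans (∑-mono As (λ {y} j → ≤-reflexive (cong (_∸ 2) (sym (sideK-old i j))))) (m≤n+m _ (sideK x v ∸ 2))))
        (m≤n+m _ (∑ sideV (λ y → sideK v y ∸ 2)))
        where
        sideK-old : ∀ {x y} → x ∈ As → y ∈ As → sideK x y ≡ K x y
        sideK-old {x} {y} i j with x ≟ v | y ≟ v
        ... | no _  | no _  = refl
        ... | yes p | _     = ⊥-elim (As⇒≢v i p)
        ... | no _  | yes q = ⊥-elim (As⇒≢v j q)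

      excess-near : ∑ Ws (λ x → ∑ Ws λ y → 𝟙 (L? x) * (𝟙 (L? y) * (K x y ∸ 2))) ≡ ∑ As (λ x → ∑ As λ y → K x y ∸ 2)
      excess-near = trans (∑-cong Ws (λ {x} _ → trans (∑-*ˡ Ws (𝟙 (L? x))) (cong (𝟙 (L? x) *_) (sym (∑-filter L? Ws))))) (sym (∑-filter L? Ws))

    module _ {Ws Es K} (P : Piece Ws Es K) {u v} (N : NormalCut Ws Es u v) where
      open Piece P
      open NormalCut N
      private
        module Near = Side P N
        module Far  = Side P (flipCut N)

      -- A pair not separated by `σ` lies in one of the sides, `c` being in both. A separated pair
      -- contributes nothing, since `σ` has cost at most 2 and bounds `K`.
      excess-split : excess Ws K ≤ excess Near.sideV Near.sideK + excess Far.sideV Far.sideK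
      excess-split = begin
        ∑ Ws (λ x → ∑ Ws λ y → K x y ∸ 2)
          ≤⟨ ∑-mono Ws (λ {x} i → ∑-mono Ws (λ {y} j → pointwise i j (σ x) (σ y) refl refl)) ⟩
        ∑ Ws (λ x → ∑ Ws λ y → 𝟙 (Near.L? x) * (𝟙 (Near.L? y) * (K x y ∸ 2)) + 𝟙 (Far.L? x) * (𝟙 (Far.L? y) * (K x y ∸ 2)))
          ≡⟨ trans (∑-cong Ws (λ _ → ∑-+ Ws)) (∑-+ Ws) ⟩
        ∑ Ws (λ x → ∑ Ws λ y → 𝟙 (Near.L? x) * (𝟙 (Near.L? y) * (K x y ∸ 2))) +
        ∑ Ws (λ x → ∑ Ws λ y → 𝟙 (Far.L? x) * (𝟙 (Far.L? y) * (K x y ∸ 2)))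
          ≡⟨ cong₂ _+_ (excess-near P N) (excess-near P (flipCut N)) ⟩
        ∑ Near.As (λ x → ∑ Near.As λ y → K x y ∸ 2) + ∑ Far.As (λ x → ∑ Far.As λ y → K x y ∸ 2)
          ≤⟨ +-mono-≤ (excess-restrict P N) (excess-restrict P (flipCut N)) ⟩
        excess Near.sideV Near.sideK + excess Far.sideV Far.sideK ∎
        where
        open ≤-Reasoning
        nearʳ : ∀ m n → m ≤ 1 * (1 * m) + n
        nearʳ m n = ≤-trans (≤-reflexive (sym (trans (*-identityˡ (1 * m)) (*-identityˡ m)))) (m≤m+n _ n)
        farʳ : ∀ m n → m ≤ n + 1 * (1 * m)
        farʳ m n = ≤-trans (≤-reflexive (sym (trans (*-identityˡ (1 * m)) (*-identityˡ m)))) (m≤n+m _ n)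
        pointwise : ∀ {x y} → x ∈ Ws → y ∈ Ws → ∀ s t → σ x ≡ s → σ y ≡ t →
                    K x y ∸ 2 ≤ 𝟙 (notRight? s) * (𝟙 (notRight? t) * (K x y ∸ 2)) +
                                𝟙 (notRight? (flip s)) * (𝟙 (notRight? (flip t)) * (K x y ∸ 2))
        pointwise {x} {y} i j left   left   p q = nearʳ (K x y ∸ 2) _
        pointwise {x} {y} i j left   middle p q = nearʳ (K x y ∸ 2) _
        pointwise {x} {y} i j middle left   p q = nearʳ (K x y ∸ 2) _
        pointwise {x} {y} i j middle middle p q = nearʳ (K x y ∸ 2) _
        pointwise {x} {y} i j right  right  p q = farʳ (K x y ∸ 2) 0
        pointwise {x} {y} i j right  middle p q = farʳ (K x y ∸ 2) 0
        pointwise {x} {y} i j middle right  p q = farʳ (K x y ∸ 2) (1 * 0)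
        pointwise {x} {y} i j left   right  p q = ≤-trans (≤-reflexive (m≤n⇒m∸n≡0 (≤-trans (bound σ i j p q) (cost-σ≤2 P N)))) z≤n
        pointwise {x} {y} i j right  left   p q = ≤-trans (≤-reflexive (m≤n⇒m∸n≡0
          (≤-trans (bound (flip ∘ σ) i j (cong flip p) (cong flip q)) (cost-σ≤2 P (flipCut N))))) z≤n

      length-split : length Near.As + length Far.As ≡ suc (length Ws)
      length-split = begin
        length Near.As + length Far.As              ≡⟨ cong₂ _+_ (length-filter-∑ Near.L? Ws) (length-filter-∑ Far.L? Ws) ⟩
        ∑ Ws (λ x → 𝟙 (Near.L? x)) + ∑ Ws (λ x → 𝟙 (Far.L? x)) ≡⟨ sym (∑-+ Ws) ⟩
        ∑ Ws (λ x → 𝟙 (Near.L? x) + 𝟙 (Far.L? x))   ≡⟨ ∑-cong Ws (λ {x} i → pointwise i (σ x) refl) ⟩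
        ∑ Ws (λ x → 𝟙 (x ≟ c) + 1)                  ≡⟨ trans (∑-+ Ws) (cong₂ _+_ (∑-δ₁ _≟_ unique c∈) (sym (length-∑ Ws))) ⟩
        suc (length Ws)                             ∎
        where
        open ≡-Reasoning
        pointwise : ∀ {x} → x ∈ Ws → ∀ s → σ x ≡ s → 𝟙 (notRight? s) + 𝟙 (notRight? (flip s)) ≡ 𝟙 (x ≟ c) + 1
        pointwise {x} i left   p = sym (cong (_+ 1) (𝟙-no (x ≟ c) (Near.labels≢ p σc λ ())))
        pointwise {x} i right  p = sym (cong (_+ 1) (𝟙-no (x ≟ c) (Near.labels≢ p σc λ ())))
        pointwise {x} i middle p = sym (cong (_+ 1) (𝟙-yes (x ≟ c) (only-c i p)))

    Bounded : ℕ → Set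
    Bounded m = ∀ {Ws Es K} → Piece Ws Es K → length Ws ≤ m → 4 * excess Ws K ≤ (length Ws ∸ 2) * (length Ws ∸ 2)

    -- `a` and `b` count the strictly left and strictly right vertices. A side has two vertices
    -- more, `c` and the end of the added path, which cancels the subtraction of 2 in the bound for
    -- it.
    CutBound : List V → (V → V → ℕ) → Set
    CutBound Ws K = ∃ λ a → ∃ λ b → 3 ≤ a × 3 ≤ b × suc (a + b) ≡ length Ws × 4 * excess Ws K ≤ a * a + b * b

    bounded⇒cutBound : ∀ {m} → Bounded m → ∀ {Ws Es K u v} (P : Piece Ws Es K) → length Ws ≤ suc m →
                       (u , v) ∈ Es → 3 ≤ deg Es u → 3 ≤ deg Es v → CutBound Ws K
    bounded⇒cutBound {m} IH {Ws} {Es} {K} {u} {v} P Ws≤ uv du dv =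
      length A , length B , 3≤A , 3≤B , total , (begin
        4 * excess Ws K                                  ≤⟨ *-monoʳ-≤ 4 (excess-split P N) ⟩
        4 * (excess Near.sideV Near.sideK + excess Far.sideV Far.sideK)
                                                         ≡⟨ *-distribˡ-+ 4 (excess Near.sideV Near.sideK) _ ⟩
        4 * excess Near.sideV Near.sideK + 4 * excess Far.sideV Far.sideK
                                                         ≤⟨ +-mono-≤ near far ⟩
        length A * length A + length B * length B        ∎)
      where
      open ≤-Reasoning
      N : NormalCut Ws Es u v
      N = normalise P (inj₁ uv) du dv
      module Near = Side P N
      module Far  = Side P (flipCut N)
      A B : List V
      A = strictSide P N du
      B = strictSide P (flipCut N) dv
      3≤A : 3 ≤ length A
      3≤A = 3≤strictSide P N du
      3≤B : 3 ≤ length B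
      3≤B = 3≤strictSide P (flipCut N) dv
      total : suc (length A + length B) ≡ length Ws
      total = suc-injective (trans (cong suc (sym (+-suc (length A) (length B))))
        (trans (sym (cong₂ _+_ (length-As P N du) (length-As P (flipCut N) dv))) (length-split P N)))
      -- A side has `2 + a` vertices; it is smaller than the piece because the `b` vertices it loses
      -- are more than the one vertex put in their place.
      fits : ∀ a b → 3 ≤ b → suc (a + b) ≡ length Ws → 2 + a ≤ m
      fits a b 3≤b eq = s≤s⁻¹ (≤-trans (≤-trans (s≤s (≤-trans (≤-reflexive (+-comm 2 a)) (+-monoʳ-≤ a (<⇒≤ 3≤b)))) (≤-reflexive eq)) Ws≤)
      near : 4 * excess Near.sideV Near.sideK ≤ length A * length A
      near = subst (λ k → 4 * excess Near.sideV Near.sideK ≤ (k ∸ 1) * (k ∸ 1)) (length-As P N du)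
        (IH Near.sidePiece (≤-trans (≤-reflexive (cong suc (length-As P N du))) (fits (length A) (length B) 3≤B total)))
      far : 4 * excess Far.sideV Far.sideK ≤ length B * length B
      far = subst (λ k → 4 * excess Far.sideV Far.sideK ≤ (k ∸ 1) * (k ∸ 1)) (length-As P (flipCut N) dv)
        (IH Far.sidePiece (≤-trans (≤-reflexive (cong suc (length-As P (flipCut N) dv)))
          (fits (length B) (length A) 3≤A (trans (cong suc (+-comm (length B) (length A))) total))))

    Independent : ∀ {Ws Es K} → Piece Ws Es K → Set
    Independent {Es = Es} P = ∀ {x y} → (x , y) ∈ Es → 1 ≤ weight P x → 1 ≤ weight P y → ⊥

    heavyEdge? : ∀ {Ws Es K} (P : Piece Ws Es K) →
                 (∃ λ u → ∃ λ v → (u , v) ∈ Es × 3 ≤ deg Es u × 3 ≤ deg Es v) ⊎ Independent P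
    heavyEdge? {Es = Es} P with Any.any? (λ (u , v) → (1 ≤? weight P u) ×-dec (1 ≤? weight P v)) Es
    ... | yes some with (u , v) , i , p , q ← find some = inj₁ (u , v , i , large⇒ P p , large⇒ P q)
    ... | no none = inj₂ λ i p q → none (lose i (p , q))

    length-pos : ∀ {x} {xs : List V} → x ∈ xs → 1 ≤ length xs
    length-pos (here _)  = s≤s z≤n
    length-pos (there _) = s≤s z≤n

    cutBound⇒ : ∀ {Ws K} → CutBound Ws K → 4 * excess Ws K ≤ (length Ws ∸ 2) * (length Ws ∸ 2)
    cutBound⇒ {Ws} {K} (a , b , 3≤a , 3≤b , total , le) = ≤-trans le (subst (λ n → a * a + b * b ≤ (n ∸ 2) * (n ∸ 2)) total (arith 3≤a 3≤b))
      where
      arith : ∀ {a b} → 3 ≤ a → 3 ≤ b → a * a + b * b ≤ (suc (a + b) ∸ 2) * (suc (a + b) ∸ 2)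
      arith {suc (suc (suc a))} {suc (suc (suc b))} (s≤s (s≤s (s≤s z≤n))) (s≤s (s≤s (s≤s z≤n))) =
        ≤-trans (m≤m+n _ (2 * (a * b) + 4 * a + 4 * b + 7)) (≤-reflexive (e a b))
        where
        e : ∀ a b → (3 + a) * (3 + a) + (3 + b) * (3 + b) + (2 * (a * b) + 4 * a + 4 * b + 7) ≡ (2 + a + (3 + b)) * (2 + a + (3 + b))
        e = solve-∀

    bounded : ∀ m → Bounded m
    bounded m {Ws} {Es} {K} P Ws≤ = byEdge m Ws≤ (heavyEdge? P)
      where
      byEdge : ∀ m → length Ws ≤ m → (∃ λ u → ∃ λ v → (u , v) ∈ Es × 3 ≤ deg Es u × 3 ≤ deg Es v) ⊎ Independent P →
               4 * excess Ws K ≤ (length Ws ∸ 2) * (length Ws ∸ 2)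
      byEdge m       Ws≤ (inj₂ independent) = leaf-bound P independent
      byEdge zero    Ws≤ (inj₁ (u , v , uv , _)) = ⊥-elim (n≮n 0 (≤-trans (length-pos (proj₁ (Piece.wf P uv))) Ws≤))
      byEdge (suc m) Ws≤ (inj₁ (u , v , uv , du , dv)) = cutBound⇒ {Ws} {K} (bounded⇒cutBound (bounded m) P Ws≤ uv du dv)

    excess-bound : ∀ {Ws Es K} → Piece Ws Es K → 4 * excess Ws K ≤ (length Ws ∸ 2) * (length Ws ∸ 2)
    excess-bound {Ws} P = bounded (length Ws) P ≤-refl

    cut-bound : ∀ {Ws Es K u v} → Piece Ws Es K → (u , v) ∈ Es → 3 ≤ deg Es u → 3 ≤ deg Es v → CutBound Ws K
    cut-bound {Ws} P = bounded⇒cutBound (bounded (length Ws)) P (n≤1+n _)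

-- Maximising over the number of vertices of degree at least 3.

module Optimisation where

  open import Data.Bool.Base using (T)
  open import Data.Empty using (⊥-elim)
  open import Data.Fin.Base using (zero; suc)
  open import Data.Nat.Base
  open import Data.Nat.Properties
  open import Data.Nat.Tactic.RingSolver using (solve-∀)
  open import Data.Product.Base using (∃; _×_; _,_; proj₂)
  open import Data.Sum.Base using (_⊎_; inj₁; inj₂)
  open import Defs
  open import Function.Base using (_∘_)
  open import Relation.Binary.PropositionalEquality
  open import Relation.Nullary using (Dec; yes; no)
  open Summation
  open WeightSums
  open EdgeCuts

  module Optimum (p W Y : ℕ) (average : Y + W ≤ p * W)
                 (regular : ∀ q r → W ≤ q * p + r → Y + q * p + r ≤ q * (p * p) + r * r)
                 (k ℓ τ : ℕ) (count : W + 4 * p ≤ 2 * (4 * k + ℓ)) where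

    -- For n = 4k + ℓ the numerator of the bound is four times 4k² - 4k + τ, with τ equal to 0, 2,
    -- 12 and 4k + 2 for ℓ = 0, 1, 2, 3. The subtraction is moved to the other side.
    Strict : Set
    Strict = Y + 4 * k < 4 * (k * k) + τ

    private
      Y≤pred : ∀ {p′} → p ≡ suc p′ → Y ≤ p′ * W
      Y≤pred {p′} refl = +-cancelʳ-≤ W Y (p′ * W) (≤-trans average (≤-reflexive (+-comm W (p′ * W))))

    below-W : ∀ {j} → k ≡ p + j → W ≤ 4 * p + (8 * j + 2 * ℓ)
    below-W {j} refl = +-cancelʳ-≤ (4 * p) _ _ (≤-trans count (≤-reflexive (e p j ℓ)))
      where
      e : ∀ p j ℓ → 2 * (4 * (p + j) + ℓ) ≡ 4 * p + (8 * j + 2 * ℓ) + 4 * p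
      e = solve-∀

    -- The near-regular bound with q = 4 and r = 8j + 2ℓ. Its loss is quadratic in j while its gain
    -- is 8pj, so it serves for j small against p.
    below-regular : ∀ {j} → k ≡ p + j → 60 * (j * j) + 32 * (j * ℓ) + 4 * (ℓ * ℓ) < 8 * (p * j) + 4 * j + τ + 2 * ℓ → Strict
    below-regular {j} eq@refl h = +-cancelʳ-< (8 * j + 2 * ℓ) _ _ (begin-strict
      Y + 4 * (p + j) + (8 * j + 2 * ℓ)              ≡⟨ e₁ Y p j ℓ ⟩
      (Y + 4 * p + r) + 4 * j                        ≤⟨ +-monoˡ-≤ (4 * j) (regular 4 r (below-W eq)) ⟩
      (4 * (p * p) + r * r) + 4 * j                  ≡⟨ e₂ p j ℓ ⟩
      (4 * (p * p) + 4 * (j * j) + 4 * j) + (60 * (j * j) + 32 * (j * ℓ) + 4 * (ℓ * ℓ))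
                                                     <⟨ +-monoʳ-< (4 * (p * p) + 4 * (j * j) + 4 * j) h ⟩
      (4 * (p * p) + 4 * (j * j) + 4 * j) + (8 * (p * j) + 4 * j + τ + 2 * ℓ) ≡⟨ e₃ p j τ ℓ ⟩
      4 * ((p + j) * (p + j)) + τ + (8 * j + 2 * ℓ)  ∎)
      where
      open ≤-Reasoning
      r = 8 * j + 2 * ℓ
      e₁ : ∀ Y p j ℓ → Y + 4 * (p + j) + (8 * j + 2 * ℓ) ≡ (Y + 4 * p + (8 * j + 2 * ℓ)) + 4 * j
      e₁ = solve-∀
      e₂ : ∀ p j ℓ → (4 * (p * p) + (8 * j + 2 * ℓ) * (8 * j + 2 * ℓ)) + 4 * j ≡
                     (4 * (p * p) + 4 * (j * j) + 4 * j) + (60 * (j * j) + 32 * (j * ℓ) + 4 * (ℓ * ℓ))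
      e₂ = solve-∀
      e₃ : ∀ p j τ ℓ → (4 * (p * p) + 4 * (j * j) + 4 * j) + (8 * (p * j) + 4 * j + τ + 2 * ℓ) ≡
                       4 * ((p + j) * (p + j)) + τ + (8 * j + 2 * ℓ)
      e₃ = solve-∀

    -- The mean bound ignores rounding of the weights, which costs 2ℓ(p - 1), but gains 4j² + 4j
    -- with the distance from k, so it serves for large j.
    below-average : ∀ {p′ j} → p ≡ suc p′ → k ≡ p + j → 2 * (ℓ * p′) < 4 * (j * j) + 4 * j + τ → Strict
    below-average {p′} {j} eq@refl eq′@refl h = begin-strict
      Y + 4 * (suc p′ + j)                                     ≤⟨ +-monoˡ-≤ (4 * (suc p′ + j)) (≤-trans (Y≤pred eq) (*-monoʳ-≤ p′ (below-W eq′))) ⟩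
      p′ * (4 * suc p′ + (8 * j + 2 * ℓ)) + 4 * (suc p′ + j)   ≡⟨ e₁ p′ j ℓ ⟩
      (4 * (p′ * p′) + 8 * p′ + 8 * (p′ * j) + 4 + 4 * j) + 2 * (ℓ * p′) <⟨ +-monoʳ-< (4 * (p′ * p′) + 8 * p′ + 8 * (p′ * j) + 4 + 4 * j) h ⟩
      (4 * (p′ * p′) + 8 * p′ + 8 * (p′ * j) + 4 + 4 * j) + (4 * (j * j) + 4 * j + τ) ≡⟨ e₂ p′ j τ ⟩
      4 * ((suc p′ + j) * (suc p′ + j)) + τ                    ∎
      where
      open ≤-Reasoning
      e₁ : ∀ p j ℓ → p * (4 * suc p + (8 * j + 2 * ℓ)) + 4 * (suc p + j) ≡ (4 * (p * p) + 8 * p + 8 * (p * j) + 4 + 4 * j) + 2 * (ℓ * p)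
      e₁ = solve-∀
      e₂ : ∀ p j τ → (4 * (p * p) + 8 * p + 8 * (p * j) + 4 + 4 * j) + (4 * (j * j) + 4 * j + τ) ≡ 4 * ((suc p + j) * (suc p + j)) + τ
      e₂ = solve-∀

    zero-strict : p ≡ 0 → 2 ≤ k → Strict
    zero-strict refl 2≤k = begin-strict
      Y + 4 * k            ≡⟨ cong (_+ 4 * k) (n≤0⇒n≡0 (≤-trans (m≤m+n Y W) average)) ⟩
      4 * k                <⟨ *-monoʳ-< 4 (m<m*n k k {{>-nonZero (<⇒≤ 2≤k)}} 2≤k) ⟩
      4 * (k * k)          ≤⟨ m≤m+n _ τ ⟩
      4 * (k * k) + τ      ∎
      where open ≤-Reasoning

    -- The counterpart for p = k + 1 + i of the mean bound; the gain 4i² + 4i outweighs the rounding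
    -- for large i.
    above-average : ∀ {i} → p ≡ k + suc i → 2 * (ℓ * (k + i)) < 4 * i + 4 * (i * i) + τ → Strict
    above-average {i} eq@refl h = +-cancelʳ-< (4 * (k * i) + 4 * i + 4 * (i * i)) _ _ (begin-strict
      Y + 4 * k + (4 * (k * i) + 4 * i + 4 * (i * i)) ≡⟨ e₁ Y k i ⟩
      Y + (k + i) * (4 * suc i)                       ≤⟨ +-monoˡ-≤ _ (Y≤pred (+-suc k i)) ⟩
      (k + i) * W + (k + i) * (4 * suc i)             ≡⟨ sym (*-distribˡ-+ (k + i) W (4 * suc i)) ⟩
      (k + i) * (W + 4 * suc i)                       ≤⟨ *-monoʳ-≤ (k + i) W≤ ⟩
      (k + i) * (4 * k + 2 * ℓ)                       ≡⟨ e₂ k i ℓ ⟩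
      4 * (k * k) + 4 * (k * i) + 2 * (ℓ * (k + i))   <⟨ +-monoʳ-< (4 * (k * k) + 4 * (k * i)) h ⟩
      4 * (k * k) + 4 * (k * i) + (4 * i + 4 * (i * i) + τ) ≡⟨ e₃ k i τ ⟩
      4 * (k * k) + τ + (4 * (k * i) + 4 * i + 4 * (i * i)) ∎)
      where
      open ≤-Reasoning
      e₀ : ∀ k W i → W + 4 * suc i + 4 * k ≡ W + 4 * (k + suc i)
      e₀ = solve-∀
      e₀′ : ∀ k ℓ → 2 * (4 * k + ℓ) ≡ 4 * k + 2 * ℓ + 4 * k
      e₀′ = solve-∀
      W≤ : W + 4 * suc i ≤ 4 * k + 2 * ℓ
      W≤ = +-cancelʳ-≤ (4 * k) _ _ (≤-trans (≤-reflexive (e₀ k W i)) (≤-trans count (≤-reflexive (e₀′ k ℓ))))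
      e₁ : ∀ Y k i → Y + 4 * k + (4 * (k * i) + 4 * i + 4 * (i * i)) ≡ Y + (k + i) * (4 * suc i)
      e₁ = solve-∀
      e₂ : ∀ k i ℓ → (k + i) * (4 * k + 2 * ℓ) ≡ 4 * (k * k) + 4 * (k * i) + 2 * (ℓ * (k + i))
      e₂ = solve-∀
      e₃ : ∀ k i τ → 4 * (k * k) + 4 * (k * i) + (4 * i + 4 * (i * i) + τ) ≡ 4 * (k * k) + τ + (4 * (k * i) + 4 * i + 4 * (i * i))
      e₃ = solve-∀

    above-W : ∀ {i r s} → p ≡ k + suc i → k ≡ s + r → s + 2 * ℓ ≡ 7 + 7 * i → W ≤ 3 * p + r
    above-W {i} {r} {s} refl refl hs = +-cancelʳ-≤ (4 * p) _ _ (begin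
      W + 4 * p                                           ≤⟨ count ⟩
      2 * (4 * (s + r) + ℓ)                               ≡⟨ e₁ s r ℓ ⟩
      8 * r + 7 * s + (s + 2 * ℓ)                         ≡⟨ cong (8 * r + 7 * s +_) hs ⟩
      8 * r + 7 * s + (7 + 7 * i)                         ≡⟨ e₂ s r i ⟩
      3 * (s + r + suc i) + r + 4 * (s + r + suc i)       ∎)
      where
      open ≤-Reasoning
      e₁ : ∀ s r ℓ → 2 * (4 * (s + r) + ℓ) ≡ 8 * r + 7 * s + (s + 2 * ℓ)
      e₁ = solve-∀
      e₂ : ∀ s r i → 8 * r + 7 * s + (7 + 7 * i) ≡ 3 * (s + r + suc i) + r + 4 * (s + r + suc i)
      e₂ = solve-∀

    -- Beyond k the mean weight falls below 4, hence q = 3. The count then leaves W - 3p at most r =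
    -- k - s, where s = 7 + 7i - 2ℓ; the equation for s is written without subtraction.
    above-regular : ∀ {i r s} → p ≡ k + suc i → k ≡ s + r → s + 2 * ℓ ≡ 7 + 7 * i →
                    3 * (suc i * i) + s * s + s + 6 * (k * suc i) < 2 * (k * s) + τ → Strict
    above-regular {i} {r} {s} eq@refl eq′@refl hs h = +-cancelʳ-< (3 * p + r + 2 * (k * s)) _ _ (begin-strict
      Y + 4 * k + (3 * p + r + 2 * (k * s))                 ≡⟨ e₁ Y k p r s ⟩
      (Y + 3 * p + r) + (4 * k + 2 * (k * s))               ≤⟨ +-monoˡ-≤ (4 * k + 2 * (k * s)) (regular 3 r (above-W {i} eq eq′ hs)) ⟩
      (3 * (p * p) + r * r) + (4 * k + 2 * (k * s))         ≡⟨ e₂ s r i ⟩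
      (4 * (k * k) + 3 * p + r) + (3 * (suc i * i) + s * s + s + 6 * (k * suc i)) <⟨ +-monoʳ-< (4 * (k * k) + 3 * p + r) h ⟩
      (4 * (k * k) + 3 * p + r) + (2 * (k * s) + τ)         ≡⟨ e₃ (4 * (k * k)) (3 * p) r (2 * (k * s)) τ ⟩
      4 * (k * k) + τ + (3 * p + r + 2 * (k * s))           ∎)
      where
      open ≤-Reasoning
      e₁ : ∀ Y k p r s → Y + 4 * k + (3 * p + r + 2 * (k * s)) ≡ (Y + 3 * p + r) + (4 * k + 2 * (k * s))
      e₁ = solve-∀
      e₂ : ∀ s r i → (3 * ((s + r + suc i) * (s + r + suc i)) + r * r) + (4 * (s + r) + 2 * ((s + r) * s)) ≡
                     (4 * ((s + r) * (s + r)) + 3 * (s + r + suc i) + r) + (3 * (suc i * i) + s * s + s + 6 * ((s + r) * suc i))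
      e₂ = solve-∀
      e₃ : ∀ a b c d e → (a + b + c) + (d + e) ≡ a + e + (b + c + d)
      e₃ = solve-∀

  data Position (p k : ℕ) : Set where
    empty  : p ≡ 0 → Position p k
    below : ∀ p′ j → p ≡ suc p′ → k ≡ p + j → Position p k
    above : ∀ i → p ≡ k + suc i → Position p k

  position : ∀ p k → Position p k
  position zero    k = empty refl
  position (suc p) k with suc p ≤? k
  ... | yes le with j , eq ← m≤n⇒∃[o]m+o≡n le = below p j refl (sym eq)
  ... | no gt  with i , eq ← m≤n⇒∃[o]m+o≡n (≰⇒> gt) = above i (trans (sym eq) (sym (+-suc k i)))

  private
    slack : ∀ {m n} d → m + d ≡ n → m ≤ n
    slack {m} d refl = m≤m+n m d

    literal : ∀ {m n} → {T (m ≤ᵇ n)} → m ≤ n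
    literal {m} {n} {t} = ≤ᵇ⇒≤ m n t

    -- Beyond the limit, writing i = suc b + d turns the polynomial inequality needed into one whose
    -- difference has nonnegative coefficients in d, which is then supplied to `slack`.
    byLimit : ∀ {Q : Set} i b → (i ≤ b → Q) → (∀ d → suc b + d ≡ i → Q) → Q
    byLimit i b f g with i ≤? b
    ... | yes le = f le
    ... | no gt  = g _ (proj₂ (m≤n⇒∃[o]m+o≡n (≰⇒> gt)))

    -- As a + j is bounded below by c, replacing a by c - j leaves a condition monotone in j, whose
    -- worst case is j = b.
    linear : ∀ x y a b c j → j ≤ b → (x + 2) * b + y < 2 * c → c ≤ a + j → x * j + y < 2 * a
    linear x y a b c j j≤b h c≤ = +-cancelʳ-< (2 * j) _ _ (begin-strict
      x * j + y + 2 * j   ≡⟨ e x y j ⟩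
      (x + 2) * j + y     ≤⟨ +-monoˡ-≤ y (*-monoʳ-≤ (x + 2) j≤b) ⟩
      (x + 2) * b + y     <⟨ h ⟩
      2 * c               ≤⟨ *-monoʳ-≤ 2 c≤ ⟩
      2 * (a + j)         ≡⟨ *-distribˡ-+ 2 a j ⟩
      2 * a + 2 * j       ∎)
      where
      open ≤-Reasoning
      e : ∀ x y j → x * j + y + 2 * j ≡ (x + 2) * j + y
      e = solve-∀

  module _ (p W Y : ℕ) (average : Y + W ≤ p * W)
           (regular : ∀ q r → W ≤ q * p + r → Y + q * p + r ≤ q * (p * p) + r * r) (k : ℕ) where

    module _ (count : W + 4 * p ≤ 2 * (4 * k + 0)) where

      open Optimum p W Y average regular k 0 0 count

      optimum₀ : 8 ≤ k → Strict ⊎ p ≡ k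
      optimum₀ 8≤k with position p k
      ... | empty p≡0 = inj₁ (zero-strict p≡0 (≤-trans (s≤s (s≤s z≤n)) 8≤k))
      ... | below p′ zero    e e′ = inj₂ (sym (trans e′ (+-identityʳ p)))
      ... | below p′ (suc j) e e′ = inj₁ (below-average e e′ (s≤s z≤n))
      ... | above (suc i) e = inj₁ (above-average e (s≤s z≤n))
      -- At p = k + 1 the mean bound only reaches the target. The near-regular bound, with s = 7, is
      -- strict as soon as 8k > 56, and this is the use of `8 ≤ k`.
      ... | above zero e with r , eq ← m≤n⇒∃[o]m+o≡n (<⇒≤ 8≤k) = inj₁ (above-regular {0} {r} {7} e (sym eq) refl (begin-strict
          3 * (1 * 0) + 7 * 7 + 7 + 6 * (k * 1)  ≡⟨ e₁ k ⟩
          56 + 6 * k                             <⟨ +-monoˡ-< (6 * k) (≤-trans {57} {8 * 8} {8 * k} (literal {57} {64}) (*-monoʳ-≤ 8 8≤k)) ⟩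
          8 * k + 6 * k                          ≡⟨ e₂ k ⟩
          2 * (k * 7) + 0                        ∎))
        where
        open ≤-Reasoning
        e₁ : ∀ k → 3 * (1 * 0) + 7 * 7 + 7 + 6 * (k * 1) ≡ 56 + 6 * k
        e₁ = solve-∀
        e₂ : ∀ k → 8 * k + 6 * k ≡ 2 * (k * 7) + 0
        e₂ = solve-∀

    module _ (count : W + 4 * p ≤ 2 * (4 * k + 1)) where

      open Optimum p W Y average regular k 1 2 count

      private
        -- This is the condition for `below-regular`, under the assumption that the mean bound
        -- fails. For k = 29, j = 3, p = 26 both estimates merely equal the target, which is why k
        -- starts at 30.
        below-key : ∀ p′ j → 30 ≤ suc p′ + j → 4 * (j * j) + 4 * j + 2 ≤ 2 * (1 * p′) → 15 * j + 5 < 2 * p′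
        below-key p′ j 30≤ h = byLimit j 3 (λ j≤3 → linear 15 5 p′ 3 29 j j≤3 literal (s≤s⁻¹ 30≤)) (λ d eq → large j d eq h)
          where
          large : ∀ j d → 4 + d ≡ j → 4 * (j * j) + 4 * j + 2 ≤ 2 * (1 * p′) → 15 * j + 5 < 2 * p′
          large _ d refl h = ≤-trans (slack (16 + 21 * d + 4 * (d * d)) (e d)) (≤-trans h (≤-reflexive (cong (2 *_) (*-identityˡ p′))))
            where
            e : ∀ d → suc (15 * (4 + d) + 5) + (16 + 21 * d + 4 * (d * d)) ≡ 4 * ((4 + d) * (4 + d)) + 4 * (4 + d) + 2
            e = solve-∀

        -- Failure of the mean bound, solved for `k`: it makes k quadratic in i, which is what the
        -- near-regular bound needs for large i.
        above-bound : ∀ i → 4 * i + 4 * (i * i) + 2 ≤ 2 * (1 * (k + i)) → 2 * (i * i) + i + 1 ≤ k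
        above-bound i h = +-cancelʳ-≤ i _ _ (*-cancelˡ-≤ 2 (≤-trans (≤-reflexive (e i)) (≤-trans h (≤-reflexive (cong (2 *_) (*-identityˡ (k + i)))))))
          where
          e : ∀ i → 2 * (2 * (i * i) + i + 1 + i) ≡ 4 * i + 4 * (i * i) + 2
          e = solve-∀

        -- Needed for the remainder r = k - (5 + 7i) to exist.
        above-s : ∀ i → 30 ≤ k → 2 * (i * i) + i + 1 ≤ k → 5 + 7 * i ≤ k
        above-s i 30≤k h = byLimit i 3 (λ i≤3 → ≤-trans (+-monoʳ-≤ 5 (*-monoʳ-≤ 7 i≤3)) (≤-trans literal 30≤k)) (λ d eq → large i d eq h)
          where
          large : ∀ i d → 4 + d ≡ i → 2 * (i * i) + i + 1 ≤ k → 5 + 7 * i ≤ k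
          large _ d refl h = ≤-trans (slack (4 + 10 * d + 2 * (d * d)) (e d)) h
            where
            e : ∀ d → 5 + 7 * (4 + d) + (4 + 10 * d + 2 * (d * d)) ≡ 2 * ((4 + d) * (4 + d)) + (4 + d) + 1
            e = solve-∀

        above-key : ∀ i → 30 ≤ k → 2 * (i * i) + i + 1 ≤ k → 52 * (i * i) + 80 * i + 28 < (4 + 8 * i) * k
        above-key 0 30≤k h = ≤-trans literal (*-monoʳ-≤ 4 30≤k)
        above-key 1 30≤k h = ≤-trans literal (*-monoʳ-≤ 12 30≤k)
        above-key 2 30≤k h = ≤-trans literal (*-monoʳ-≤ 20 30≤k)
        above-key 3 30≤k h = ≤-trans literal (*-monoʳ-≤ 28 30≤k)
        above-key i@(suc (suc (suc (suc j)))) 30≤k h = large i j refl h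
          where
          large : ∀ i d → 4 + d ≡ i → 2 * (i * i) + i + 1 ≤ k → 52 * (i * i) + 80 * i + 28 < (4 + 8 * i) * k
          large _ d refl h = ≤-trans (slack (151 + 412 * d + 156 * (d * d) + 16 * (d * d * d)) (e d)) (*-monoʳ-≤ (4 + 8 * (4 + d)) h)
            where
            e : ∀ d → suc (52 * ((4 + d) * (4 + d)) + 80 * (4 + d) + 28) + (151 + 412 * d + 156 * (d * d) + 16 * (d * d * d)) ≡
                      (4 + 8 * (4 + d)) * (2 * ((4 + d) * (4 + d)) + (4 + d) + 1)
            e = solve-∀

        belowₛ : ∀ p′ j .{{_ : NonZero j}} → 30 ≤ k → p ≡ suc p′ → k ≡ p + j → Strict
        belowₛ p′ j 30≤k refl refl with 2 * (1 * p′) <? 4 * (j * j) + 4 * j + 2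
        ... | yes h = below-average {p′} {j} refl refl h
        ... | no h  = below-regular {j} refl (begin-strict
            60 * (j * j) + 32 * (j * 1) + 4 * (1 * 1) ≡⟨ e₁ j ⟩
            4 * j * (15 * j + 5) + (12 * j + 4)       <⟨ +-monoˡ-< (12 * j + 4) (*-monoʳ-< (4 * j) {{m*n≢0 4 j}} (below-key p′ j 30≤k (≮⇒≥ h))) ⟩
            4 * j * (2 * p′) + (12 * j + 4)           ≡⟨ e₂ j p′ ⟩
            8 * (suc p′ * j) + 4 * j + 2 + 2 * 1      ∎)
          where
          open ≤-Reasoning
          e₁ : ∀ j → 60 * (j * j) + 32 * (j * 1) + 4 * (1 * 1) ≡ 4 * j * (15 * j + 5) + (12 * j + 4)
          e₁ = solve-∀
          e₂ : ∀ j p′ → 4 * j * (2 * p′) + (12 * j + 4) ≡ 8 * (suc p′ * j) + 4 * j + 2 + 2 * 1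
          e₂ = solve-∀

        aboveₛ : ∀ i → 30 ≤ k → p ≡ k + suc i → Strict
        aboveₛ i 30≤k e = decide (2 * (1 * (k + i)) <? 4 * i + 4 * (i * i) + 2)
          where
          regularₛ : 2 * (i * i) + i + 1 ≤ k → (∃ λ r → 5 + 7 * i + r ≡ k) → Strict
          decide : Dec (2 * (1 * (k + i)) < 4 * i + 4 * (i * i) + 2) → Strict
          decide (yes h) = above-average e h
          decide (no h)  = regularₛ (above-bound i (≮⇒≥ h)) (m≤n⇒∃[o]m+o≡n (above-s i 30≤k (above-bound i (≮⇒≥ h))))
          regularₛ bound (r , eq) =
              above-regular {i} {r} {5 + 7 * i} e (sym eq) (e₀ i) (begin-strict
                3 * (suc i * i) + (5 + 7 * i) * (5 + 7 * i) + (5 + 7 * i) + 6 * (k * suc i) ≡⟨ e₁ i k ⟩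
                52 * (i * i) + 80 * i + 28 + (2 + 6 * k + 6 * (k * i))      <⟨ +-monoˡ-< (2 + 6 * k + 6 * (k * i)) (above-key i 30≤k bound) ⟩
                (4 + 8 * i) * k + (2 + 6 * k + 6 * (k * i))                 ≡⟨ e₂ i k ⟩
                2 * (k * (5 + 7 * i)) + 2                                   ∎)
            where
            open ≤-Reasoning
            e₀ : ∀ i → 5 + 7 * i + 2 * 1 ≡ 7 + 7 * i
            e₀ = solve-∀
            e₁ : ∀ i k → 3 * (suc i * i) + (5 + 7 * i) * (5 + 7 * i) + (5 + 7 * i) + 6 * (k * suc i) ≡ 52 * (i * i) + 80 * i + 28 + (2 + 6 * k + 6 * (k * i))
            e₁ = solve-∀
            e₂ : ∀ i k → (4 + 8 * i) * k + (2 + 6 * k + 6 * (k * i)) ≡ 2 * (k * (5 + 7 * i)) + 2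
            e₂ = solve-∀

      optimum₁ : 30 ≤ k → Strict ⊎ p ≡ k
      optimum₁ 30≤k with position p k
      ... | empty p≡0             = inj₁ (zero-strict p≡0 (≤-trans literal 30≤k))
      ... | below p′ zero e e′    = inj₂ (sym (trans e′ (+-identityʳ p)))
      ... | below p′ (suc j) e e′ = inj₁ (belowₛ p′ (suc j) 30≤k e e′)
      ... | above i e             = inj₁ (aboveₛ i 30≤k e)

    module _ (count : W + 4 * p ≤ 2 * (4 * k + 2)) where

      open Optimum p W Y average regular k 2 12 count

      private
        -- For k = 67, j = 7, p = 60 both the mean bound and the near-regular bound merely equal the
        -- target; hence the threshold 68.
        below-key : ∀ p′ j → 68 ≤ suc p′ + j → 4 * (j * j) + 4 * j + 12 ≤ 2 * (2 * p′) → 15 * j + 13 < 2 * p′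
        below-key p′ j 68≤ h = byLimit j 7 (λ j≤7 → linear 15 13 p′ 7 67 j j≤7 literal (s≤s⁻¹ 68≤)) (λ d eq → large j d eq h)
          where
          large : ∀ j d → 8 + d ≡ j → 4 * (j * j) + 4 * j + 12 ≤ 2 * (2 * p′) → 15 * j + 13 < 2 * p′
          large _ d refl h = *-cancelˡ-≤ 2 (≤-trans (slack (32 + 38 * d + 4 * (d * d)) (e d)) h)
            where
            e : ∀ d → 2 * suc (15 * (8 + d) + 13) + (32 + 38 * d + 4 * (d * d)) ≡ 4 * ((8 + d) * (8 + d)) + 4 * (8 + d) + 12
            e = solve-∀

        above-bound : ∀ i → 4 * i + 4 * (i * i) + 12 ≤ 2 * (2 * (k + i)) → i * i + 3 ≤ k
        above-bound i h = +-cancelʳ-≤ i _ _ (*-cancelˡ-≤ 4 (≤-trans (≤-reflexive (e i)) (≤-trans h (≤-reflexive (sym (*-assoc 2 2 (k + i)))))))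
          where
          e : ∀ i → 4 * (i * i + 3 + i) ≡ 4 * i + 4 * (i * i) + 12
          e = solve-∀

        above-s : ∀ i → 68 ≤ k → i * i + 3 ≤ k → 3 + 7 * i ≤ k
        above-s i 68≤k h = byLimit i 8 (λ i≤8 → ≤-trans (+-monoʳ-≤ 3 (*-monoʳ-≤ 7 i≤8)) (≤-trans literal 68≤k)) (λ d eq → large i d eq h)
          where
          large : ∀ i d → 9 + d ≡ i → i * i + 3 ≤ k → 3 + 7 * i ≤ k
          large _ d refl h = ≤-trans (slack (18 + 11 * d + d * d) (e d)) h
            where
            e : ∀ d → 3 + 7 * (9 + d) + (18 + 11 * d + d * d) ≡ (9 + d) * (9 + d) + 3
            e = solve-∀

        above-key : ∀ i → 68 ≤ k → i * i + 3 ≤ k → 13 * i + 13 < 2 * k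
        above-key i 68≤k h = byLimit i 8 (λ i≤8 → ≤-trans (s≤s (+-monoˡ-≤ 13 (*-monoʳ-≤ 13 i≤8))) (≤-trans literal (*-monoʳ-≤ 2 68≤k))) (λ d eq → large i d eq h)
          where
          large : ∀ i d → 9 + d ≡ i → i * i + 3 ≤ k → 13 * i + 13 < 2 * k
          large _ d refl h = ≤-trans (slack (37 + 23 * d + 2 * (d * d)) (e d)) (*-monoʳ-≤ 2 h)
            where
            e : ∀ d → suc (13 * (9 + d) + 13) + (37 + 23 * d + 2 * (d * d)) ≡ 2 * ((9 + d) * (9 + d) + 3)
            e = solve-∀

        belowₛ : ∀ p′ j .{{_ : NonZero j}} → 68 ≤ k → p ≡ suc p′ → k ≡ p + j → Strict
        belowₛ p′ j 68≤k refl refl with 2 * (2 * p′) <? 4 * (j * j) + 4 * j + 12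
        ... | yes h = below-average {p′} {j} refl refl h
        ... | no h  = below-regular {j} refl (begin-strict
            60 * (j * j) + 32 * (j * 2) + 4 * (2 * 2) ≡⟨ e₁ j ⟩
            4 * j * (15 * j + 13) + (12 * j + 16)     <⟨ +-monoˡ-< (12 * j + 16) (*-monoʳ-< (4 * j) {{m*n≢0 4 j}} (below-key p′ j 68≤k (≮⇒≥ h))) ⟩
            4 * j * (2 * p′) + (12 * j + 16)          ≡⟨ e₂ j p′ ⟩
            8 * (suc p′ * j) + 4 * j + 12 + 2 * 2     ∎)
          where
          open ≤-Reasoning
          e₁ : ∀ j → 60 * (j * j) + 32 * (j * 2) + 4 * (2 * 2) ≡ 4 * j * (15 * j + 13) + (12 * j + 16)
          e₁ = solve-∀
          e₂ : ∀ j p′ → 4 * j * (2 * p′) + (12 * j + 16) ≡ 8 * (suc p′ * j) + 4 * j + 12 + 2 * 2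
          e₂ = solve-∀

        aboveₛ : ∀ i .{{_ : NonZero i}} → 68 ≤ k → p ≡ k + suc i → Strict
        aboveₛ i 68≤k e = decide (2 * (2 * (k + i)) <? 4 * i + 4 * (i * i) + 12)
          where
          regularₛ : i * i + 3 ≤ k → (∃ λ r → 3 + 7 * i + r ≡ k) → Strict
          decide : Dec (2 * (2 * (k + i)) < 4 * i + 4 * (i * i) + 12) → Strict
          decide (yes h) = above-average e h
          decide (no h)  = regularₛ (above-bound i (≮⇒≥ h)) (m≤n⇒∃[o]m+o≡n (above-s i 68≤k (above-bound i (≮⇒≥ h))))
          regularₛ bound (r , eq) =
              above-regular {i} {r} {3 + 7 * i} e (sym eq) (e₀ i) (begin-strict
                3 * (suc i * i) + (3 + 7 * i) * (3 + 7 * i) + (3 + 7 * i) + 6 * (k * suc i) ≡⟨ e₁ i k ⟩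
                4 * i * (13 * i + 13) + (12 + 6 * k + 6 * (k * i))          <⟨ +-monoˡ-< (12 + 6 * k + 6 * (k * i)) (*-monoʳ-< (4 * i) {{m*n≢0 4 i}} (above-key i 68≤k bound)) ⟩
                4 * i * (2 * k) + (12 + 6 * k + 6 * (k * i))                ≡⟨ e₂ i k ⟩
                2 * (k * (3 + 7 * i)) + 12                                  ∎)
            where
            open ≤-Reasoning
            e₀ : ∀ i → 3 + 7 * i + 2 * 2 ≡ 7 + 7 * i
            e₀ = solve-∀
            e₁ : ∀ i k → 3 * (suc i * i) + (3 + 7 * i) * (3 + 7 * i) + (3 + 7 * i) + 6 * (k * suc i) ≡ 4 * i * (13 * i + 13) + (12 + 6 * k + 6 * (k * i))
            e₁ = solve-∀
            e₂ : ∀ i k → 4 * i * (2 * k) + (12 + 6 * k + 6 * (k * i)) ≡ 2 * (k * (3 + 7 * i)) + 12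
            e₂ = solve-∀

      -- Neither p = k nor p = k + 1 can be discarded, as the near-regular values at these two
      -- positions coincide.
      optimum₂ : 68 ≤ k → Strict ⊎ (p ≡ k ⊎ p ≡ k + 1)
      optimum₂ 68≤k with position p k
      ... | empty p≡0             = inj₁ (zero-strict p≡0 (≤-trans literal 68≤k))
      ... | below p′ zero e e′    = inj₂ (inj₁ (sym (trans e′ (+-identityʳ p))))
      ... | below p′ (suc j) e e′ = inj₁ (belowₛ p′ (suc j) 68≤k e e′)
      ... | above zero e          = inj₂ (inj₂ e)
      ... | above (suc i) e       = inj₁ (aboveₛ (suc i) 68≤k e)

    module _ (count : W + 4 * p ≤ 2 * (4 * k + 3)) where

      open Optimum p W Y average regular k 3 (4 * k + 2) count

      private
        below-bound : ∀ p′ j → 4 * (j * j) + 4 * j + (4 * (suc p′ + j) + 2) ≤ 2 * (3 * p′) → 2 * (j * j) + 4 * j + 3 ≤ p′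
        below-bound p′ j h = *-cancelˡ-≤ 2 (+-cancelʳ-≤ (4 * p′) _ _ (≤-trans (≤-reflexive (e p′ j)) (≤-trans h (≤-reflexive (e′ p′)))))
          where
          e : ∀ p′ j → 2 * (2 * (j * j) + 4 * j + 3) + 4 * p′ ≡ 4 * (j * j) + 4 * j + (4 * (suc p′ + j) + 2)
          e = solve-∀
          e′ : ∀ p′ → 2 * (3 * p′) ≡ 2 * p′ + 4 * p′
          e′ = solve-∀

        below-key : ∀ p′ j → 30 ≤ suc p′ + j → 2 * (j * j) + 4 * j + 3 ≤ p′ → 60 * (j * j) + 80 * j + 24 < (8 * j + 4) * p′
        below-key p′ 0 30≤ h = ≤-trans literal (*-monoʳ-≤ 4 (+-cancelʳ-≤ 1 29 p′ (≤-trans 30≤ (≤-reflexive (e p′)))))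
          where
          e : ∀ p′ → suc p′ + 0 ≡ p′ + 1
          e = solve-∀
        below-key p′ 1 30≤ h = ≤-trans literal (*-monoʳ-≤ 12 (+-cancelʳ-≤ 2 28 p′ (≤-trans 30≤ (≤-reflexive (e p′)))))
          where
          e : ∀ p′ → suc p′ + 1 ≡ p′ + 2
          e = solve-∀
        below-key p′ 2 30≤ h = ≤-trans literal (*-monoʳ-≤ 20 (+-cancelʳ-≤ 3 27 p′ (≤-trans 30≤ (≤-reflexive (e p′)))))
          where
          e : ∀ p′ → suc p′ + 2 ≡ p′ + 3
          e = solve-∀
        below-key p′ j@(suc (suc (suc d′))) 30≤ h = large j d′ refl h
          where
          large : ∀ j d → 3 + d ≡ j → 2 * (j * j) + 4 * j + 3 ≤ p′ → 60 * (j * j) + 80 * j + 24 < (8 * j + 4) * p′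
          large _ d refl h = ≤-trans (slack (119 + 272 * d + 124 * (d * d) + 16 * (d * d * d)) (e d)) (*-monoʳ-≤ (8 * (3 + d) + 4) h)
            where
            e : ∀ d → suc (60 * ((3 + d) * (3 + d)) + 80 * (3 + d) + 24) + (119 + 272 * d + 124 * (d * d) + 16 * (d * d * d)) ≡
                      (8 * (3 + d) + 4) * (2 * ((3 + d) * (3 + d)) + 4 * (3 + d) + 3)
            e = solve-∀

        above-bound : ∀ i → 4 * i + 4 * (i * i) + (4 * k + 2) ≤ 2 * (3 * (k + i)) → 2 * (i * i) + 1 ≤ k + i
        above-bound i h = *-cancelˡ-≤ 2 (+-cancelʳ-≤ (4 * i + 4 * k) _ _ (≤-trans (≤-reflexive (e i k)) (≤-trans h (≤-reflexive (e′ i k)))))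
          where
          e : ∀ i k → 2 * (2 * (i * i) + 1) + (4 * i + 4 * k) ≡ 4 * i + 4 * (i * i) + (4 * k + 2)
          e = solve-∀
          e′ : ∀ i k → 2 * (3 * (k + i)) ≡ 2 * (k + i) + (4 * i + 4 * k)
          e′ = solve-∀

        above-s : ∀ i → 30 ≤ k → 2 * (i * i) + 1 ≤ k + i → 1 + 7 * i ≤ k
        above-s i 30≤k h = byLimit i 4 (λ i≤4 → ≤-trans (+-monoʳ-≤ 1 (*-monoʳ-≤ 7 i≤4)) (≤-trans literal 30≤k)) (λ d eq → large i d eq h)
          where
          large : ∀ i d → 5 + d ≡ i → 2 * (i * i) + 1 ≤ k + i → 1 + 7 * i ≤ k
          large _ d refl h = +-cancelʳ-≤ (5 + d) _ _ (≤-trans (slack (10 + 12 * d + 2 * (d * d)) (e d)) h)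
            where
            e : ∀ d → 1 + 7 * (5 + d) + (5 + d) + (10 + 12 * d + 2 * (d * d)) ≡ 2 * ((5 + d) * (5 + d)) + 1
            e = solve-∀

        -- Here the threshold comes from above: for k = 29, i = 4, p = 34 both estimates merely
        -- equal the target.
        above-key : ∀ i → 30 ≤ k → 2 * (i * i) + 1 ≤ k + i → 13 * i + 6 < 2 * k
        above-key i 30≤k h = byLimit i 4 (λ i≤4 → ≤-trans (s≤s (+-monoˡ-≤ 6 (*-monoʳ-≤ 13 i≤4))) (≤-trans literal (*-monoʳ-≤ 2 30≤k))) (λ d eq → large i d eq h)
          where
          large : ∀ i d → 5 + d ≡ i → 2 * (i * i) + 1 ≤ k + i → 13 * i + 6 < 2 * k
          large _ d refl h = +-cancelʳ-≤ (2 * (5 + d)) _ _ (≤-trans (slack (20 + 25 * d + 4 * (d * d)) (e d)) (≤-trans (*-monoʳ-≤ 2 h) (≤-reflexive (*-distribˡ-+ 2 k (5 + d)))))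
            where
            e : ∀ d → suc (13 * (5 + d) + 6) + 2 * (5 + d) + (20 + 25 * d + 4 * (d * d)) ≡ 2 * (2 * ((5 + d) * (5 + d)) + 1)
            e = solve-∀

        belowₛ : ∀ p′ j → 30 ≤ k → p ≡ suc p′ → k ≡ p + j → Strict
        belowₛ p′ j 30≤k refl refl with 2 * (3 * p′) <? 4 * (j * j) + 4 * j + (4 * (suc p′ + j) + 2)
        ... | yes h = below-average {p′} {j} refl refl h
        ... | no h  = below-regular {j} refl (begin-strict
            60 * (j * j) + 32 * (j * 3) + 4 * (3 * 3)             ≡⟨ e₁ j ⟩
            60 * (j * j) + 80 * j + 24 + (16 * j + 12)            <⟨ +-monoˡ-< (16 * j + 12) (below-key p′ j 30≤k (below-bound p′ j (≮⇒≥ h))) ⟩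
            (8 * j + 4) * p′ + (16 * j + 12)                      ≡⟨ e₂ j p′ ⟩
            8 * (suc p′ * j) + 4 * j + (4 * (suc p′ + j) + 2) + 2 * 3 ∎)
          where
          open ≤-Reasoning
          e₁ : ∀ j → 60 * (j * j) + 32 * (j * 3) + 4 * (3 * 3) ≡ 60 * (j * j) + 80 * j + 24 + (16 * j + 12)
          e₁ = solve-∀
          e₂ : ∀ j p′ → (8 * j + 4) * p′ + (16 * j + 12) ≡ 8 * (suc p′ * j) + 4 * j + (4 * (suc p′ + j) + 2) + 2 * 3
          e₂ = solve-∀

        aboveₛ : ∀ i .{{_ : NonZero i}} → 30 ≤ k → p ≡ k + suc i → Strict
        aboveₛ i 30≤k e = decide (2 * (3 * (k + i)) <? 4 * i + 4 * (i * i) + (4 * k + 2))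
          where
          regularₛ : 2 * (i * i) + 1 ≤ k + i → (∃ λ r → 1 + 7 * i + r ≡ k) → Strict
          decide : Dec (2 * (3 * (k + i)) < 4 * i + 4 * (i * i) + (4 * k + 2)) → Strict
          decide (yes h) = above-average e h
          decide (no h)  = regularₛ (above-bound i (≮⇒≥ h)) (m≤n⇒∃[o]m+o≡n (above-s i 30≤k (above-bound i (≮⇒≥ h))))
          regularₛ bound (r , eq) =
              above-regular {i} {r} {1 + 7 * i} e (sym eq) (e₀ i) (begin-strict
                3 * (suc i * i) + (1 + 7 * i) * (1 + 7 * i) + (1 + 7 * i) + 6 * (k * suc i) ≡⟨ e₁ i k ⟩
                4 * i * (13 * i + 6) + (2 + 6 * k + 6 * (k * i))            <⟨ +-monoˡ-< (2 + 6 * k + 6 * (k * i)) (*-monoʳ-< (4 * i) {{m*n≢0 4 i}} (above-key i 30≤k bound)) ⟩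
                4 * i * (2 * k) + (2 + 6 * k + 6 * (k * i))                 ≡⟨ e₂ i k ⟩
                2 * (k * (1 + 7 * i)) + (4 * k + 2)                         ∎)
            where
            open ≤-Reasoning
            e₀ : ∀ i → 1 + 7 * i + 2 * 3 ≡ 7 + 7 * i
            e₀ = solve-∀
            e₁ : ∀ i k → 3 * (suc i * i) + (1 + 7 * i) * (1 + 7 * i) + (1 + 7 * i) + 6 * (k * suc i) ≡ 4 * i * (13 * i + 6) + (2 + 6 * k + 6 * (k * i))
            e₁ = solve-∀
            e₂ : ∀ i k → 4 * i * (2 * k) + (2 + 6 * k + 6 * (k * i)) ≡ 2 * (k * (1 + 7 * i)) + (4 * k + 2)
            e₂ = solve-∀

      -- For ℓ = 3 the larger value of `τ` lets `belowₛ` include j = 0, so p = k is already strictly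
      -- worse than p = k + 1.
      optimum₃ : 30 ≤ k → Strict ⊎ p ≡ k + 1
      optimum₃ 30≤k with position p k
      ... | empty p≡0        = inj₁ (zero-strict p≡0 (≤-trans literal 30≤k))
      ... | below p′ j e e′  = inj₁ (belowₛ p′ j 30≤k e e′)
      ... | above zero e     = inj₂ e
      ... | above (suc i) e  = inj₁ (aboveₛ (suc i) 30≤k e)

  -- By convexity the sum of squares is largest at 3 and m - 4, where it is 9 + (m - 4)² = m² - 8m +
  -- 25.
  cut-arith : ∀ {a b m} → 3 ≤ a → 3 ≤ b → suc (a + b) ≡ m → a * a + b * b + 8 * m ≤ m * m + 25
  cut-arith {suc (suc (suc a))} {suc (suc (suc b))} (s≤s (s≤s (s≤s z≤n))) (s≤s (s≤s (s≤s z≤n))) refl =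
    ≤-trans (m≤m+n _ (2 * (a * b))) (≤-reflexive (e a b))
    where
    e : ∀ a b → (3 + a) * (3 + a) + (3 + b) * (3 + b) + 8 * suc (3 + a + (3 + b)) + 2 * (a * b) ≡ suc (3 + a + (3 + b)) * suc (3 + a + (3 + b)) + 25
    e = solve-∀

  -- X is the excess of the graph, p the number of its vertices of degree at least 3,
  -- W the sum of their weights deg − 2, and Y that of the pairwise minima.
  module Outcomes (n X p W Y : ℕ) (Ind : Set) (Values : ℕ → Set)
    (X≤Y : X ≤ Y) (average : Y + W ≤ p * W)
    (regular : ∀ q r → W ≤ q * p + r → Y + q * p + r ≤ q * (p * p) + r * r)
    (tight : ∀ q r → 2 ≤ r → W ≤ q * p + r → q * (p * p) + r * r ≤ Y + q * p + r → W ≡ q * p + r × Values q)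
    (count : Ind → W + 4 * p ≤ 2 * n) (dichotomy : 4 * X + 8 * n ≤ n * n + 25 ⊎ Ind)
    where

    record Structure (q p₀ : ℕ) : Set where
      field
        independent : Ind
        full        : 2 * n ≤ W + 4 * p
        p≡          : p ≡ p₀
        values      : Values q
        Y≤X         : Y ≤ X

    record Outcome (k τ : ℕ) (S : Set) : Set where
      constructor outcome
      field
        upper    : X + 4 * k ≤ 4 * (k * k) + τ
        extreme  : 4 * (k * k) + τ ≤ X + 4 * k → S

    private
      strict : ∀ {k τ S} → X + 4 * k < 4 * (k * k) + τ → Outcome k τ S
      strict lt = outcome (<⇒≤ lt) λ ge → ⊥-elim (<⇒≱ lt ge)

      -- `size` says that the count leaves exactly `q * p₀ + r` for W, and `value` that the
      -- near-regular bound for these parameters is the target. Reaching the target thus requires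
      -- equality in the count, in the near-regular bound and in X ≤ Y at once.
      extremal : ∀ {k τ} q {p₀} r → Ind → p ≡ p₀ → 2 ≤ r → (q + 4) * p₀ + r ≡ 2 * n →
                 q * (p₀ * p₀) + r * r + 4 * k ≡ 4 * (k * k) + τ + (q * p₀ + r) → Outcome k τ (Structure q p₀)
      extremal {k} {τ} q r independent refl 2≤r size value =
        outcome (+-cancelʳ-≤ (q * p + r) _ _ (begin
          X + 4 * k + (q * p + r)              ≤⟨ +-monoˡ-≤ (q * p + r) (+-monoˡ-≤ (4 * k) X≤Y) ⟩
          Y + 4 * k + (q * p + r)              ≡⟨ e₁ Y k q p r ⟩
          Y + q * p + r + 4 * k                ≤⟨ +-monoˡ-≤ (4 * k) bound ⟩
          q * (p * p) + r * r + 4 * k          ≡⟨ value ⟩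
          4 * (k * k) + τ + (q * p + r)        ∎))
        λ ge → structure (+-cancelʳ-≤ (4 * k) _ _ (begin
          q * (p * p) + r * r + 4 * k          ≡⟨ value ⟩
          4 * (k * k) + τ + (q * p + r)        ≤⟨ +-monoˡ-≤ (q * p + r) ge ⟩
          X + 4 * k + (q * p + r)              ≡⟨ e₁ X k q p r ⟩
          X + q * p + r + 4 * k                ∎))
        where
        open ≤-Reasoning
        e₁ : ∀ Y k q p r → Y + 4 * k + (q * p + r) ≡ Y + q * p + r + 4 * k
        e₁ = solve-∀
        e₂ : ∀ q p r → (q + 4) * p + r ≡ q * p + r + 4 * p
        e₂ = solve-∀
        W≤ : W ≤ q * p + r
        W≤ = +-cancelʳ-≤ (4 * p) _ _ (≤-trans (count independent) (≤-reflexive (trans (sym size) (e₂ q p r))))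
        bound : Y + q * p + r ≤ q * (p * p) + r * r
        bound = regular q r W≤
        structure : q * (p * p) + r * r ≤ X + q * p + r → Structure q p
        structure attained with W≡ , values ← tight q r 2≤r W≤ (≤-trans attained (+-monoˡ-≤ r (+-monoˡ-≤ (q * p) X≤Y))) = record
          { independent = independent
          ; full        = ≤-reflexive (trans (sym size) (trans (e₂ q p r) (cong (_+ 4 * p) (sym W≡))))
          ; p≡          = refl
          ; values      = values
          ; Y≤X         = +-cancelʳ-≤ (q * p) _ _ (+-cancelʳ-≤ r _ _ (≤-trans bound attained))
          }

      byCases : ∀ {k τ S} → (4 * X + 8 * n ≤ n * n + 25 → X + 4 * k < 4 * (k * k) + τ) →
                (Ind → Outcome k τ S) → Outcome k τ S
      byCases {k} {τ} {S} f g = either dichotomy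
        where
        either : 4 * X + 8 * n ≤ n * n + 25 ⊎ Ind → Outcome k τ S
        either (inj₁ h)   = strict (f h)
        either (inj₂ ind) = g ind

      fromY : ∀ {k τ S} → Y + 4 * k < 4 * (k * k) + τ → Outcome k τ S
      fromY {k} lt = strict (≤-<-trans (+-monoˡ-≤ (4 * k) X≤Y) lt)

    module _ (k : ℕ) where

      private
        countₖ : ∀ ℓ → n ≡ 4 * k + ℓ → Ind → W + 4 * p ≤ 2 * (4 * k + ℓ)
        countₖ ℓ n≡ independent = subst (λ n → W + 4 * p ≤ 2 * n) n≡ (count independent)

        heavyₖ : ∀ ℓ {τ} → n ≡ 4 * k + ℓ → (4 * k + ℓ) * (4 * k + ℓ) + 25 < 4 * (4 * (k * k) + τ) + (16 * k + 8 * ℓ) →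
                 4 * X + 8 * n ≤ n * n + 25 → X + 4 * k < 4 * (k * k) + τ
        heavyₖ ℓ {τ} n≡ lt h = *-cancelˡ-< 4 _ _ (+-cancelʳ-< (16 * k + 8 * ℓ) _ _ (begin-strict
          4 * (X + 4 * k) + (16 * k + 8 * ℓ)        ≡⟨ e X k ℓ ⟩
          4 * X + 8 * (4 * k + ℓ)                   ≤⟨ subst (λ n → 4 * X + 8 * n ≤ n * n + 25) n≡ h ⟩
          (4 * k + ℓ) * (4 * k + ℓ) + 25            <⟨ lt ⟩
          4 * (4 * (k * k) + τ) + (16 * k + 8 * ℓ)  ∎))
          where
          open ≤-Reasoning
          e : ∀ X k ℓ → 4 * (X + 4 * k) + (16 * k + 8 * ℓ) ≡ 4 * X + 8 * (4 * k + ℓ)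
          e = solve-∀

      outcome₀ : n ≡ 4 * k + 0 → 8 ≤ k → Outcome k 0 (Structure 3 k)
      outcome₀ n≡ 8≤k = byCases (heavyₖ 0 n≡ (exceeds k 8≤k)) byPosition
        where
        exceeds : ∀ k → 8 ≤ k → (4 * k + 0) * (4 * k + 0) + 25 < 4 * (4 * (k * k) + 0) + (16 * k + 8 * 0)
        exceeds k 8≤k with j , refl ← m≤n⇒∃[o]m+o≡n (≤-trans (m≤m+n 2 6) 8≤k) = ≤-trans (m≤m+n _ (6 + 16 * j)) (≤-reflexive (e j))
          where
          e : ∀ j → suc ((4 * (2 + j) + 0) * (4 * (2 + j) + 0) + 25) + (6 + 16 * j) ≡ 4 * (4 * ((2 + j) * (2 + j)) + 0) + (16 * (2 + j) + 8 * 0)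
          e = solve-∀
        fits : ∀ k → (3 + 4) * k + k ≡ 2 * (4 * k + 0)
        fits = solve-∀
        value : ∀ k → 3 * (k * k) + k * k + 4 * k ≡ 4 * (k * k) + 0 + (3 * k + k)
        value = solve-∀
        byPosition : Ind → Outcome k 0 (Structure 3 k)
        byPosition ind with optimum₀ p W Y average regular k (countₖ 0 n≡ ind) 8≤k
        ... | inj₁ lt = fromY lt
        -- All weights equal to 4 are presented as q = 3 with r = k rather than q = 4 with r = 0,
        -- because the case of equality needs r ≥ 2. The degrees are then confined to 5 and 6 only,
        -- and the size makes them 6.
        ... | inj₂ p≡k = extremal {k} {0} 3 k ind p≡k (≤-trans (m≤m+n 2 6) 8≤k) (trans (fits k) (cong (2 *_) (sym n≡))) (value k)

      outcome₁ : n ≡ 4 * k + 1 → 30 ≤ k → Outcome k 2 (Structure 4 k)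
      outcome₁ n≡ 30≤k = byCases (heavyₖ 1 n≡ (exceeds k 30≤k)) byPosition
        where
        exceeds : ∀ k → 30 ≤ k → (4 * k + 1) * (4 * k + 1) + 25 < 4 * (4 * (k * k) + 2) + (16 * k + 8 * 1)
        exceeds k 30≤k with j , refl ← m≤n⇒∃[o]m+o≡n (≤-trans (m≤m+n 2 28) 30≤k) = ≤-trans (m≤m+n _ (5 + 8 * j)) (≤-reflexive (e j))
          where
          e : ∀ j → suc ((4 * (2 + j) + 1) * (4 * (2 + j) + 1) + 25) + (5 + 8 * j) ≡ 4 * (4 * ((2 + j) * (2 + j)) + 2) + (16 * (2 + j) + 8 * 1)
          e = solve-∀
        fits : ∀ k → (4 + 4) * k + 2 ≡ 2 * (4 * k + 1)
        fits = solve-∀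
        value : ∀ k → 4 * (k * k) + 2 * 2 + 4 * k ≡ 4 * (k * k) + 2 + (4 * k + 2)
        value = solve-∀
        byPosition : Ind → Outcome k 2 (Structure 4 k)
        byPosition ind with optimum₁ p W Y average regular k (countₖ 1 n≡ ind) 30≤k
        ... | inj₁ lt = fromY lt
        ... | inj₂ p≡k = extremal {k} {2} 4 2 ind p≡k ≤-refl (trans (fits k) (cong (2 *_) (sym n≡))) (value k)

      -- The two optima are k weights, four of them 5 and the others 4, and k + 1 weights, k - 3 of
      -- them 4 and the others 3. Both have the value 4k² - 4k + 12.
      outcome₂ : n ≡ 4 * k + 2 → 68 ≤ k → Outcome k 12 (Structure 4 k ⊎ Structure 3 (k + 1))
      outcome₂ n≡ 68≤k = byCases (heavyₖ 2 n≡ (exceeds k)) byPosition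
        where
        -- This compares n² - 8n + 25 with n² - 8n + 60, so it holds for every k.
        exceeds : ∀ k → (4 * k + 2) * (4 * k + 2) + 25 < 4 * (4 * (k * k) + 12) + (16 * k + 8 * 2)
        exceeds k = ≤-trans (m≤m+n _ 34) (≤-reflexive (e k))
          where
          e : ∀ k → suc ((4 * k + 2) * (4 * k + 2) + 25) + 34 ≡ 4 * (4 * (k * k) + 12) + (16 * k + 8 * 2)
          e = solve-∀
        fits : ∀ k → (4 + 4) * k + 4 ≡ 2 * (4 * k + 2)
        fits = solve-∀
        value : ∀ k → 4 * (k * k) + 4 * 4 + 4 * k ≡ 4 * (k * k) + 12 + (4 * k + 4)
        value = solve-∀
        fits′ : ∀ r → (3 + 4) * (3 + r + 1) + r ≡ 2 * (4 * (3 + r) + 2)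
        fits′ = solve-∀
        value′ : ∀ r → 3 * ((3 + r + 1) * (3 + r + 1)) + r * r + 4 * (3 + r) ≡ 4 * ((3 + r) * (3 + r)) + 12 + (3 * (3 + r + 1) + r)
        value′ = solve-∀
        2≤r : ∀ r → 3 + r ≡ k → 2 ≤ r
        2≤r r refl = +-cancelˡ-≤ 3 2 r (≤-trans (m≤m+n 5 63) 68≤k)
        at-k : Ind → p ≡ k → Outcome k 12 (Structure 4 k)
        at-k ind p≡k = extremal {k} {12} 4 4 ind p≡k (s≤s (s≤s z≤n)) (trans (fits k) (cong (2 *_) (sym n≡))) (value k)
        at-k+1 : Ind → p ≡ k + 1 → ∀ r → 3 + r ≡ k → Outcome k 12 (Structure 3 (k + 1))
        at-k+1 ind p≡k+1 r 3+r≡k = extremal {k} {12} 3 r ind p≡k+1 (2≤r r 3+r≡k)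
          (trans (subst (λ k → 7 * (k + 1) + r ≡ 2 * (4 * k + 2)) 3+r≡k (fits′ r)) (cong (2 *_) (sym n≡)))
          (subst (λ k → 3 * ((k + 1) * (k + 1)) + r * r + 4 * k ≡ 4 * (k * k) + 12 + (3 * (k + 1) + r)) 3+r≡k (value′ r))
        mapOutcome : ∀ {τ S T} → (S → T) → Outcome k τ S → Outcome k τ T
        mapOutcome f (outcome le eq) = outcome le (f ∘ eq)
        byPosition : Ind → Outcome k 12 (Structure 4 k ⊎ Structure 3 (k + 1))
        byPosition ind with optimum₂ p W Y average regular k (countₖ 2 n≡ ind) 68≤k
        ... | inj₁ lt = fromY lt
        ... | inj₂ (inj₁ p≡k) = mapOutcome inj₁ (at-k ind p≡k)
        ... | inj₂ (inj₂ p≡k+1) with r , 3+r≡k ← m≤n⇒∃[o]m+o≡n (≤-trans (m≤m+n 3 65) 68≤k) = mapOutcome inj₂ (at-k+1 ind p≡k+1 r 3+r≡k)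

      outcome₃ : n ≡ 4 * k + 3 → 30 ≤ k → Outcome k (4 * k + 2) (Structure 3 (k + 1))
      outcome₃ n≡ 30≤k = byCases (heavyₖ 3 n≡ (exceeds k 30≤k)) byPosition
        where
        exceeds : ∀ k → 30 ≤ k → (4 * k + 3) * (4 * k + 3) + 25 < 4 * (4 * (k * k) + (4 * k + 2)) + (16 * k + 8 * 3)
        exceeds k 30≤k with j , refl ← m≤n⇒∃[o]m+o≡n (≤-trans (m≤m+n 2 28) 30≤k) = ≤-trans (m≤m+n _ (13 + 8 * j)) (≤-reflexive (e j))
          where
          e : ∀ j → suc ((4 * (2 + j) + 3) * (4 * (2 + j) + 3) + 25) + (13 + 8 * j) ≡
                    4 * (4 * ((2 + j) * (2 + j)) + (4 * (2 + j) + 2)) + (16 * (2 + j) + 8 * 3)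
          e = solve-∀
        fits : ∀ r → (3 + 4) * (1 + r + 1) + r ≡ 2 * (4 * (1 + r) + 3)
        fits = solve-∀
        value : ∀ r → 3 * ((1 + r + 1) * (1 + r + 1)) + r * r + 4 * (1 + r) ≡ 4 * ((1 + r) * (1 + r)) + (4 * (1 + r) + 2) + (3 * (1 + r + 1) + r)
        value = solve-∀
        2≤r : ∀ r → 1 + r ≡ k → 2 ≤ r
        2≤r r refl = s≤s⁻¹ (≤-trans (m≤m+n 3 27) 30≤k)
        at-k+1 : Ind → p ≡ k + 1 → ∀ r → 1 + r ≡ k → Outcome k (4 * k + 2) (Structure 3 (k + 1))
        at-k+1 ind p≡k+1 r 1+r≡k = extremal {k} {4 * k + 2} 3 r ind p≡k+1 (2≤r r 1+r≡k)
          (trans (subst (λ k → 7 * (k + 1) + r ≡ 2 * (4 * k + 3)) 1+r≡k (fits r)) (cong (2 *_) (sym n≡)))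
          (subst (λ k → 3 * ((k + 1) * (k + 1)) + r * r + 4 * k ≡ 4 * (k * k) + (4 * k + 2) + (3 * (k + 1) + r)) 1+r≡k (value r))
        byPosition : Ind → Outcome k (4 * k + 2) (Structure 3 (k + 1))
        byPosition ind with optimum₃ p W Y average regular k (countₖ 3 n≡ ind) 30≤k
        ... | inj₁ lt = fromY lt
        ... | inj₂ p≡k+1 with r , 1+r≡k ← m≤n⇒∃[o]m+o≡n (≤-trans (m≤m+n 1 29) 30≤k) = at-k+1 ind p≡k+1 r 1+r≡k

-- From mixed cuts to graphs, paths and subdivisions.

module Multigraphs where

  open import Data.Bool.Base using (true; false)
  open import Data.Empty using (⊥; ⊥-elim)
  open import Data.Fin.Base using (Fin; zero; suc; punchOut; splitAt; _↑ˡ_; _↑ʳ_; join)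
  open import Data.Fin.Properties using (_≟_; any?; punchIn-punchOut; splitAt-↑ˡ; splitAt-↑ʳ; ↑ˡ-injective; ↑ʳ-injective; splitAt⁻¹-↑ˡ; splitAt⁻¹-↑ʳ; +↔⊎)
  open import Data.Fin.Subset using (Subset; ∣_∣; ∁; inside; outside) renaming (_∈_ to _∈ₛ_; _∉_ to _∉ₛ_)
  open import Data.Fin.Subset.Properties using (∣p∣≤n; ∣∁p∣≡n∸∣p∣) renaming (_∈?_ to _∈ₛ?_)
  open import Data.List.Base using (List; []; _∷_; length; map; filter; allFin; _++_)
  open import Data.List.Extrema.Nat using (max≤v⁺; v≤min⁺; min≤xs; xs≤max)
  import Data.List.Membership.DecPropositional as DecMembership
  open import Data.List.Membership.Propositional using (_∈_; _∉_)
  open import Data.List.Membership.Propositional.Properties using (∈-allFin; ∈-map⁺; ∈-map⁻; ∈-++⁻; ∈-filter⁺; ∈-filter⁻)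
  open import Data.List.Properties using (length-map; length-tabulate)
  open import Data.List.Relation.Unary.All as All using (All; []; _∷_)
  import Data.List.Relation.Unary.All.Properties as All
  import Data.List.Relation.Unary.AllPairs as AllPairs
  open import Data.List.Relation.Unary.AllPairs using (AllPairs; []; _∷_)
  import Data.List.Relation.Unary.AllPairs.Properties as AllPairs
  open import Data.List.Relation.Unary.Any using (here; there)
  open import Data.List.Relation.Unary.Unique.Propositional using (Unique)
  import Data.List.Relation.Unary.Unique.Propositional.Properties as Unique
  open import Data.List.Relation.Unary.Unique.Propositional.Properties using (allFin⁺)
  open import Data.Nat.Base
  open import Data.Nat.Properties renaming (_≟_ to _≟ℕ_)
  open import Data.Nat.Tactic.RingSolver using (solve-∀)
  open import Data.Product.Base using (∃; _×_; _,_; proj₁; proj₂)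
  open import Data.Product.Properties using (,-injective)
  open import Data.Sum.Base using (_⊎_; inj₁; inj₂)
  open import Data.Sum.Properties using (inj₂-injective)
  open import Data.Vec.Base as Vec using (Vec; []; _∷_; here; there)
  open import Data.Vec.Properties using (lookup∘tabulate; []=⇒lookup; lookup⇒[]=)
  open import Defs
  open import Function.Base using (_∘_; id)
  open import Function.Bundles using (_↔_; Inverse; mk↔ₛ′)
  open import Function.Construct.Composition using (_↔-∘_)
  open import Function.Construct.Symmetry using (↔-sym)
  open import Relation.Binary.Definitions using (tri<; tri≈; tri>)
  open import Relation.Binary.PropositionalEquality
  open import Relation.Nullary using (¬_; Dec; yes; no; does; ¬?; _×-dec_; _⊎-dec_)
  open import Relation.Unary using (Decidable)
  open Summation
  open WeightSums
  open EdgeCuts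
  open Optimisation

  -- A minimally 2-connected graph is a piece.

  module GraphPiece where

    open module FinCuts {n} = Cuts (_≟_ {n}) public
    open module FinBounds {n} = PieceBounds (_≟_ {n}) public

    module _ {G : Graph} where

      infixr 5 _++ʷ_

      _++ʷ_ : ∀ {u v x} → Walk G u v → Walk G v x → Walk G u x
      []         ++ʷ q = q
      step e j p ++ʷ q = step e j (p ++ʷ q)

      edges-++ : ∀ {u v x} (p : Walk G u v) (q : Walk G v x) → edges (p ++ʷ q) ≡ edges p ++ edges q
      edges-++ []           q = refl
      edges-++ (step e _ p) q = cong (e ∷_) (edges-++ p q)

    cut-Joins : ∀ (G : Graph) (σ : V G → Label) {e u v} → Joins G e u v → cut σ (ends G e) ≡ cross (σ u) (σ v)
    cut-Joins G σ {u = u} {v} (inj₁ eq) = cong (cut σ) eq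
    cut-Joins G σ {u = u} {v} (inj₂ eq) = trans (cong (cut σ) eq) (cross-sym (σ v) (σ u))

    module _ (G : Graph) {Ok : E G → Set} (Ok? : Decidable Ok) (s : V G) where

      private
        n = order G

        Reached : V G → Set
        Reached x = ∃ λ (w : Walk G s x) → All Ok (edges w)

        extend : ∀ {x y e} → Reached x → Joins G e x y → Ok e → Reached y
        extend (w , ok) j ok-e = w ++ʷ step _ j [] ,
          subst (All Ok) (sym (edges-++ w _)) (All.++⁺ ok (ok-e ∷ []))

        rights : (V G → Label) → ℕ
        rights h = ∑Fin n (λ x → 𝟙 (h x ≟ₗ right))

      -- The vertices reachable from `s` along permitted edges, presented as a labelling. A right
      -- vertex yields a cut crossed by no permitted edge, a left one a walk; this is the
      -- alternative behind every existence proof for walks below.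
      record Closure : Set where
        field
          h       : V G → Label
          total   : ∀ x → h x ≡ left ⊎ h x ≡ right
          start   : h s ≡ left
          reached : ∀ {x} → h x ≡ left → Reached x
          closed  : ∀ {e} → Ok e → cut h (ends G e) ≡ 0

      private
        -- Each round turns the right end of a permitted crossing edge left. The fuel bounds the
        -- number of right vertices, which drops every time.
        grow : ∀ fuel (h : V G → Label) → rights h ≤ fuel → (∀ x → h x ≡ left ⊎ h x ≡ right) → h s ≡ left →
               (∀ {x} → h x ≡ left → Reached x) → Closure
        grow fuel h r total start reached with any? (λ e → Ok? e ×-dec (1 ≤? cut h (ends G e)))
        ... | no none = record { h = h ; total = total ; start = start ; reached = reached
                               ; closed = λ {e} ok → n<1⇒n≡0 (≰⇒> (λ crossing → none (e , ok , crossing))) }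
        ... | yes (e , ok , crossing) = go fuel r (cases (orient (h (proj₁ (ends G e))) (h (proj₂ (ends G e))) crossing))
          where
          cases : _ → ∃ λ x → ∃ λ y → Joins G e x y × h x ≡ left × h y ≡ right
          cases (inj₁ (p , q)) = _ , _ , inj₁ refl , p , q
          cases (inj₂ (p , q)) = _ , _ , inj₂ refl , q , p
          go : ∀ fuel → rights h ≤ fuel → (∃ λ x → ∃ λ y → Joins G e x y × h x ≡ left × h y ≡ right) → Closure
          go fuel r (x , y , j , hx , hy) = next fuel (≤-trans fewer r)
            where
            h′ = h [ y ↦ left ]
            label≤ : ∀ z → 𝟙 (h′ z ≟ₗ right) ≤ 𝟙 (h z ≟ₗ right)
            label≤ z with z ≟ y
            ... | yes _ = z≤n
            ... | no _  = ≤-refl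
            fewer : rights h′ < rights h
            fewer = ∑-mono-< (allFin n) (λ {z} _ → label≤ z) (∈-allFin y)
              (subst₂ _<_ (cong (λ ℓ → 𝟙 (ℓ ≟ₗ right)) (sym (update-≡ h y left))) (cong (λ ℓ → 𝟙 (ℓ ≟ₗ right)) (sym hy)) (s≤s z≤n))
            total′ : ∀ z → h′ z ≡ left ⊎ h′ z ≡ right
            total′ z with z ≟ y
            ... | yes _ = inj₁ refl
            ... | no _  = total z
            start′ : h′ s ≡ left
            start′ with s ≟ y
            ... | yes _ = refl
            ... | no _  = start
            reached′ : ∀ {z} → h′ z ≡ left → Reached z
            reached′ {z} p with z ≟ y
            ... | yes refl = extend (reached hx) j ok
            ... | no _     = reached p
            next : ∀ fuel → rights h′ < fuel → Closure
            next (suc fuel) (s≤s r) = grow fuel h′ r total′ start′ reached′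

      closure : Closure
      closure = grow n (single s)
        (≤-trans (∑-mono (allFin n) (λ {x} _ → 𝟙≤1 (single s x ≟ₗ right))) (≤-reflexive (trans (∑Fin-const n 1) (*-identityʳ n))))
        single-total (update-≡ (λ _ → right) s left) single-reached
        where
        single-total : ∀ x → single s x ≡ left ⊎ single s x ≡ right
        single-total x with x ≟ s
        ... | yes _ = inj₁ refl
        ... | no _  = inj₂ refl
        single-reached : ∀ {x} → single s x ≡ left → Reached x
        single-reached {x} p with x ≟ s
        ... | yes refl = [] , []
        ... | no _ with () ← p

    module _ {G : Graph} (σ : V G → Label) where

      blocked : ∀ {u v} (w : Walk G u v) → σ u ≡ left → σ v ≡ right →
                (∃ λ x → x ∈ vertices w × σ x ≡ middle) ⊎ (∃ λ e → e ∈ edges w × 1 ≤ cut σ (ends G e))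
      blocked []           p q with () ← trans (sym p) q
      blocked (step {w = x} e j w) p q with σ x in σx
      ... | middle = inj₁ (x , there (first w) , σx)
        where
        first : ∀ {u v} (w : Walk G u v) → u ∈ vertices w
        first []           = here refl
        first (step _ _ _) = here refl
      ... | right  = inj₂ (e , here refl , ≤-reflexive (sym (trans (cut-Joins G σ j) (cong₂ cross p σx))))
      ... | left with blocked w σx q
      ...   | inj₁ (y , i , σy) = inj₁ (y , there i , σy)
      ...   | inj₂ (f , i , ×f) = inj₂ (f , there i , ×f)

    edgeList : (G : Graph) → List (V G × V G)
    edgeList G = map (ends G) (allFin (size G))

    graphCost : (G : Graph) → (V G → Label) → ℕ
    graphCost G σ = cost σ (allFin (order G)) (edgeList G)

    ∑-edgeList : ∀ G (f : V G × V G → ℕ) → ∑ (edgeList G) f ≡ ∑Fin (size G) (f ∘ ends G)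
    ∑-edgeList G f = ∑-map (ends G) (allFin (size G))

    -- Every path of a family has a middle vertex or a crossing edge of its own.
    disjointPaths≤cost : ∀ G (σ : V G → Label) {u v k} → σ u ≡ left → σ v ≡ right → DisjointPaths G u v k → k ≤ graphCost G σ
    disjointPaths≤cost G σ {u} {v} σu σv (ps , refl , _ , disjoint) = begin
      length ps                                                    ≡⟨ length-∑ ps ⟩
      ∑ ps (λ _ → 1)                                               ≤⟨ ∑-mono ps (λ {p} _ → hit p (blocked σ p σu σv)) ⟩
      ∑ ps (λ p → ∑Fin n (λ x → isMiddle (σ x) * 𝟙 (x ∈V? vertices p)) + ∑Fin m (λ e → cut σ (ends G e) * 𝟙 (e ∈E? edges p)))
                                                                   ≡⟨ trans (∑-+ ps) (cong₂ _+_ (∑-swap ps (allFin n)) (∑-swap ps (allFin m))) ⟩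
      ∑Fin n (λ x → ∑ ps (λ p → isMiddle (σ x) * 𝟙 (x ∈V? vertices p))) + ∑Fin m (λ e → ∑ ps (λ p → cut σ (ends G e) * 𝟙 (e ∈E? edges p)))
                                                                   ≤⟨ +-mono-≤ (∑-mono (allFin n) (λ {x} _ → vertex≤ x)) (∑-mono (allFin m) (λ {e} _ → edge≤ e)) ⟩
      ∑Fin n (isMiddle ∘ σ) + ∑Fin m (cut σ ∘ ends G)              ≡⟨ cong (∑Fin n (isMiddle ∘ σ) +_) (sym (∑-edgeList G (cut σ))) ⟩
      graphCost G σ                                                ∎
      where
      open ≤-Reasoning
      open DecMembership (_≟_ {order G}) using () renaming (_∈?_ to _∈V?_)
      open DecMembership (_≟_ {size G}) using () renaming (_∈?_ to _∈E?_)
      n = order G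
      m = size G
      hit : ∀ p → _ ⊎ _ → 1 ≤ ∑Fin n (λ x → isMiddle (σ x) * 𝟙 (x ∈V? vertices p)) + ∑Fin m (λ e → cut σ (ends G e) * 𝟙 (e ∈E? edges p))
      hit p (inj₁ (x , i , σx)) = ≤-trans
        (≤-trans (≤-reflexive (sym (cong₂ _*_ (cong isMiddle σx) (𝟙-yes (x ∈V? vertices p) i))))
          (∑-∈ {f = λ x → isMiddle (σ x) * 𝟙 (x ∈V? vertices p)} (∈-allFin x))) (m≤m+n _ _)
      hit p (inj₂ (e , i , ×e)) = ≤-trans
        (≤-trans (*-mono-≤ ×e (≤-reflexive (sym (𝟙-yes (e ∈E? edges p) i))))
          (∑-∈ {f = λ e → cut σ (ends G e) * 𝟙 (e ∈E? edges p)} (∈-allFin e))) (m≤n+m _ _)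
      vertex≤ : ∀ x → ∑ ps (λ p → isMiddle (σ x) * 𝟙 (x ∈V? vertices p)) ≤ isMiddle (σ x)
      vertex≤ x with σ x in σx
      ... | left   = ≤-reflexive (∑-zero ps (λ _ → refl))
      ... | right  = ≤-reflexive (∑-zero ps (λ _ → refl))
      ... | middle = ≤-trans (≤-reflexive (∑-cong ps (λ _ → *-identityˡ _)))
        (∑-disjoint {P = λ p → x ∈ vertices p} (λ p → x ∈V? vertices p)
          (λ (_ , d) i j → inner (All.lookup d i j)) id disjoint)
        where
        inner : x ≡ u ⊎ x ≡ v → ⊥
        inner (inj₁ refl) with () ← trans (sym σx) σu
        inner (inj₂ refl) with () ← trans (sym σx) σv
      edge≤ : ∀ e → ∑ ps (λ p → cut σ (ends G e) * 𝟙 (e ∈E? edges p)) ≤ cut σ (ends G e)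
      edge≤ e = ≤-trans (≤-reflexive (∑-*ˡ ps (cut σ (ends G e))))
        (≤-trans (*-monoʳ-≤ (cut σ (ends G e))
          (∑-disjoint {P = λ p → e ∈ edges p} (λ p → e ∈E? edges p) (λ (d , _) i j → All.lookup d i j) id disjoint))
          (≤-reflexive (*-identityʳ _)))

    card-∑ : ∀ {n} (S : Subset n) → ∣ S ∣ ≡ ∑Fin n (λ x → 𝟙 (x ∈ₛ? S))
    card-∑ []            = refl
    card-∑ {suc n} (s ∷ S) = trans (card s) (sym (trans (∑Fin-suc n _) (cong (𝟙 (zero ∈ₛ? (s ∷ S)) +_)
        (∑-cong (allFin n) (λ {x} _ → 𝟙-cong drop there (suc x ∈ₛ? (s ∷ S)) (x ∈ₛ? S))))))
      where
      drop : ∀ {x} → suc x ∈ₛ (s ∷ S) → x ∈ₛ S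
      drop (there i) = i
      card : ∀ s → ∣ s ∷ S ∣ ≡ 𝟙 (zero ∈ₛ? (s ∷ S)) + ∑Fin n (λ x → 𝟙 (x ∈ₛ? S))
      card true  = cong suc (card-∑ S)
      card false = card-∑ S

    module _ {n} (σ : Fin n → Label) where

      middles : Subset n
      middles = Vec.tabulate (λ x → does (σ x ≟ₗ middle))

      middles⁺ : ∀ {x} → σ x ≡ middle → x ∈ₛ middles
      middles⁺ {x} p = lookup⇒[]= x middles (trans (lookup∘tabulate (λ x → does (σ x ≟ₗ middle)) x) (cong (λ ℓ → does (ℓ ≟ₗ middle)) p))

      middles⁻ : ∀ {x} → x ∈ₛ middles → σ x ≡ middle
      middles⁻ {x} i with σ x ≟ₗ middle | trans (sym (lookup∘tabulate (λ x → does (σ x ≟ₗ middle)) x)) ([]=⇒lookup i)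
      ... | yes p | _ = p

      card-middles : ∣ middles ∣ ≡ ∑Fin n (isMiddle ∘ σ)
      card-middles = trans (card-∑ middles) (∑-cong (allFin n) (λ {x} _ → pointwise x))
        where
        isMiddle-𝟙 : ∀ ℓ → isMiddle ℓ ≡ 𝟙 (ℓ ≟ₗ middle)
        isMiddle-𝟙 left   = refl
        isMiddle-𝟙 middle = refl
        isMiddle-𝟙 right  = refl
        pointwise : ∀ x → 𝟙 (x ∈ₛ? middles) ≡ isMiddle (σ x)
        pointwise x = trans (𝟙-cong middles⁻ middles⁺ (x ∈ₛ? middles) (σ x ≟ₗ middle)) (sym (isMiddle-𝟙 (σ x)))

    third-vertex : ∀ {n} → 3 ≤ n → (a b : Fin n) → ∃ λ z → z ≢ a × z ≢ b
    third-vertex {n} 3≤n a b with z , _ , lt ← ∑-exceed (allFin n) {λ _ → 1} {λ z → inc z (a , b)}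
        (subst₂ _<_ (sym (trans (∑-+ (allFin n)) (cong₂ _+_ (∑-δ₁ _≟_ (allFin⁺ n) (∈-allFin a)) (∑-δ₁ _≟_ (allFin⁺ n) (∈-allFin b)))))
                    (sym (trans (∑Fin-const n 1) (*-identityʳ n))) 3≤n) =
      z , (λ { refl → <⇒≱ lt (inc-fst {u = z} {y = b}) }) , (λ { refl → <⇒≱ lt (inc-snd {u = z} {x = a}) })

    module _ (G : Graph) (conn : HasConnectivity G 2) where

      private
        n = order G

        least : ∀ S → Disconnects G S ⊎ LeavesTrivial G S → 2 ≤ ∣ S ∣
        least S h = proj₂ conn ∣ S ∣ (S , refl , h)

      3≤order : 3 ≤ n
      3≤order = three n (subst (_≤ n) (proj₁ (proj₂ (proj₁ conn))) (∣p∣≤n (proj₁ (proj₁ conn)))) (λ S → least S ∘ inj₂)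
        where
        three : ∀ n → 2 ≤ n → ((S : Subset n) → ∣ ∁ S ∣ ≡ 1 → 2 ≤ ∣ S ∣) → 3 ≤ n
        three (suc zero)                (s≤s ()) _
        three (suc (suc zero))          _ trivial with s≤s () ← trivial (inside ∷ outside ∷ []) refl
        three (suc (suc (suc _)))       _ _ = s≤s (s≤s (s≤s z≤n))

      private
        uncrossed : ∀ σ {x y} → σ x ≡ left → σ y ≡ right → ∑ (edgeList G) (cut σ) ≡ 0 → 2 ≤ ∑Fin n (isMiddle ∘ σ)
        uncrossed σ {x} {y} σx σy none = subst (2 ≤_) (card-middles σ) (least (middles σ) (inj₁ (x , y , avoids σx (λ ()) , avoids σy (λ ()) , apart)))
          where
          avoids : ∀ {x ℓ} → σ x ≡ ℓ → ℓ ≢ middle → x ∉ₛ middles σ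
          avoids p ℓ≢m i = ℓ≢m (trans (sym p) (middles⁻ σ i))
          apart : ¬ ConnectedAvoiding G (middles σ) x y
          apart (w , avoid) with blocked σ w σx σy
          ... | inj₁ (z , i , σz) = All.lookup avoid i (middles⁺ σ σz)
          ... | inj₂ (e , _ , ×e) = n≮n 0 (≤-trans ×e (≤-trans (∑-∈ {f = cut σ} (∈-map⁺ (ends G) (∈-allFin e))) (≤-reflexive none)))

      -- Connectivity speaks of vertex sets only. A mixed cut of cost at most 1 that has a crossing
      -- edge has no middle vertex, and an end of that edge can be moved to the middle without
      -- raising the cost. A third vertex decides which end may be moved so that neither side
      -- becomes empty.
      2≤cost : ∀ σ {x y} → σ x ≡ left → σ y ≡ right → 2 ≤ graphCost G σ
      2≤cost σ {x} {y} σx σy = ≰⇒> λ le → small le (∑ (edgeList G) (cut σ)) refl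
        where
        small : graphCost G σ ≤ 1 → ∀ k → ∑ (edgeList G) (cut σ) ≡ k → ⊥
        small le zero eq = n≮n 1 (≤-trans (uncrossed σ σx σy eq) (≤-trans (m≤m+n _ _) le))
        small le (suc k) eq with (a , b) , e∈ , ×e ← ∑-pos (edgeList G) {cut σ} (subst (1 ≤_) (sym eq) (s≤s z≤n)) = moved e∈ (orient (σ a) (σ b) ×e)
          where
          noMiddle : ∀ z → isMiddle (σ z) ≡ 0
          noMiddle z = n≤0⇒n≡0 (≤-trans (∑-∈ {f = isMiddle ∘ σ} (∈-allFin z)) (+-cancelʳ-≤ 1 _ 0
            (≤-trans (+-monoʳ-≤ _ (subst (1 ≤_) (sym eq) (s≤s z≤n))) le)))
          cut≤1 : ∑ (edgeList G) (cut σ) ≤ 1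
          cut≤1 = ≤-trans (m≤n+m _ _) le
          -- Moving an end of the only crossing edge to the middle.
          move : ∀ a {e x y} → e ∈ edgeList G → cut (σ [ a ↦ middle ]) e ≡ 0 → 1 ≤ cut σ e →
                 x ≢ a → σ x ≡ left → y ≢ a → σ y ≡ right → ⊥
          move a {e} {x} {y} e∈ zero′ pos′ x≢a σx y≢a σy = n≮n 1 (≤-trans
            (uncrossed (σ [ a ↦ middle ]) {x} {y} (trans (update-≢ σ middle x≢a) σx) (trans (update-≢ σ middle y≢a) σy)
              (n<1⇒n≡0 (≤-trans (∑-mono-< (edgeList G) (λ {e} _ → cut-update≤ σ a e) e∈ (subst (_< cut σ e) (sym zero′) pos′)) cut≤1)))
            (≤-trans (∑-mono (allFin n) (λ {z} _ → one z)) (≤-reflexive (∑-δ₁ _≟_ (allFin⁺ n) (∈-allFin a)))))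
            where
            one : ∀ z → isMiddle ((σ [ a ↦ middle ]) z) ≤ 𝟙 (z ≟ a)
            one z with z ≟ a
            ... | yes _ = ≤-refl
            ... | no _  = ≤-reflexive (noMiddle z)
          differ : ∀ {x y} → σ x ≡ left → σ y ≡ right → x ≢ y
          differ p q refl with () ← trans (sym p) q
          moved : ∀ {a b} → (a , b) ∈ edgeList G → σ a ≡ left × σ b ≡ right ⊎ σ a ≡ right × σ b ≡ left → ⊥
          moved {a} {b} e∈ h with z , z≢a , z≢b ← third-vertex 3≤order a b with σ z in σz | noMiddle z | h
          ... | left  | _ | inj₁ (p , q) = move a e∈ (cut-updateˡ σ {a} {b}) (≤-reflexive (sym (cong₂ cross p q))) z≢a σz (differ p q ∘ sym) q
          ... | left  | _ | inj₂ (p , q) = move b e∈ (cut-updateʳ σ {a} {b}) (≤-reflexive (sym (cong₂ cross p q))) z≢b σz (differ q p ∘ sym) p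
          ... | right | _ | inj₁ (p , q) = move b e∈ (cut-updateʳ σ {a} {b}) (≤-reflexive (sym (cong₂ cross p q))) (differ p q) p z≢b σz
          ... | right | _ | inj₂ (p , q) = move a e∈ (cut-updateˡ σ {a} {b}) (≤-reflexive (sym (cong₂ cross p q))) (differ q p) q z≢a σz

    withMiddle : ∀ {n} (S : Subset n) → (Fin n → Label) → Fin n → Label
    withMiddle S h x with x ∈ₛ? S
    ... | yes _ = middle
    ... | no _  = h x

    -- A disconnecting set of G − e together with e is a cut of G.
    separateEdge : ∀ G → HasConnectivity G 2 → (∀ e → ∃ λ c → c < 2 × HasConnectivity (G -ₑ e) c) → ∀ e →
                   ∃ λ σ → graphCost G σ ≤ 2 × σ (proj₁ (ends G e)) ≡ left × σ (proj₂ (ends G e)) ≡ right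
    separateEdge G@(record { order = n ; size = suc m ; ends = f ; loopless = l }) conn minimal e
      with c , c<2 , (S , ∣S∣≡c , disconnects) , _ ← minimal e = go disconnects
      where
      G′ = G -ₑ e
      Avoids : Fin m → Set
      Avoids i = proj₁ (ends G′ i) ∉ₛ S × proj₂ (ends G′ i) ∉ₛ S
      Avoids? : Decidable Avoids
      Avoids? i = ¬? (proj₁ (ends G′ i) ∈ₛ? S) ×-dec ¬? (proj₂ (ends G′ i) ∈ₛ? S)
      ∣S∣≤1 : ∣ S ∣ ≤ 1
      ∣S∣≤1 = ≤-trans (≤-reflexive ∣S∣≡c) (s≤s⁻¹ c<2)
      avoiding : ∀ {x y} (w : Walk G′ x y) → x ∉ₛ S → All Avoids (edges w) → All (_∉ₛ S) (vertices w)
      avoiding []           x∉ []       = x∉ ∷ []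
      avoiding (step i j w) x∉ (a ∷ as) = x∉ ∷ avoiding w (next j a) as
        where
        next : ∀ {x y i} → Joins G′ i x y → Avoids i → y ∉ₛ S
        next (inj₁ eq) (_ , q) = subst (_∉ₛ S) (cong proj₂ eq) q
        next (inj₂ eq) (p , _) = subst (_∉ₛ S) (cong proj₁ eq) p
      go : Disconnects G′ S ⊎ LeavesTrivial G′ S →
           ∃ λ σ → graphCost G σ ≤ 2 × σ (proj₁ (f e)) ≡ left × σ (proj₂ (f e)) ≡ right
      go (inj₂ trivial) = ⊥-elim (<⇒≱ (3≤order G conn) (begin
        n             ≤⟨ m≤n+m∸n n ∣ S ∣ ⟩
        ∣ S ∣ + (n ∸ ∣ S ∣) ≡⟨ cong (∣ S ∣ +_) (trans (sym (∣∁p∣≡n∸∣p∣ S)) trivial) ⟩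
        ∣ S ∣ + 1     ≤⟨ +-monoˡ-≤ 1 ∣S∣≤1 ⟩
        2             ∎))
        where open ≤-Reasoning
      go (inj₁ (x , y , x∉ , y∉ , apart)) with total y
        where open Closure (closure G′ Avoids? x)
      ... | inj₁ hy = ⊥-elim (apart (proj₁ (reached hy) , avoiding (proj₁ (reached hy)) x∉ (proj₂ (reached hy))))
        where open Closure (closure G′ Avoids? x)
      ... | inj₂ hy = orientation (orient (σ (proj₁ (f e))) (σ (proj₂ (f e))) crossing)
        where
        open Closure (closure G′ Avoids? x)
        σ : Fin n → Label
        σ = withMiddle S h
        σ-∉ : ∀ {z} → z ∉ₛ S → σ z ≡ h z
        σ-∉ {z} z∉ with z ∈ₛ? S
        ... | yes z∈ = ⊥-elim (z∉ z∈)
        ... | no _   = refl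
        middle≤ : ∀ z → isMiddle (σ z) ≤ 𝟙 (z ∈ₛ? S)
        middle≤ z with z ∈ₛ? S
        ... | yes _ = ≤-refl
        ... | no _ with h z | total z
        ...   | left  | _ = z≤n
        ...   | right | _ = z≤n
        ...   | middle | inj₁ ()
        ...   | middle | inj₂ ()
        uncut : ∀ i → cut σ (ends G′ i) ≡ 0
        uncut i with ends G′ i | closed {i}
        ... | a , b | closed′ with a ∈ₛ? S | b ∈ₛ? S
        ...   | yes _ | _     = refl
        ...   | no _  | yes _ = cross-sym (h a) middle
        ...   | no p  | no q  = closed′ (p , q)
        cut≤ : ∀ i → cut σ (f i) ≤ 𝟙 (i ≟ e)
        cut≤ i with i ≟ e
        ... | yes _  = cross≤1 _ _
        ... | no i≢e = ≤-reflexive (trans (cong (cut σ ∘ f) (sym (punchIn-punchOut (i≢e ∘ sym)))) (uncut (punchOut (i≢e ∘ sym))))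
        vertexCost≤1 : ∑Fin n (isMiddle ∘ σ) ≤ 1
        vertexCost≤1 = ≤-trans (∑-mono (allFin n) (λ {z} _ → middle≤ z)) (≤-trans (≤-reflexive (sym (card-∑ S))) ∣S∣≤1)
        edgeCost≡ : ∑ (edgeList G) (cut σ) ≡ ∑Fin (suc m) (cut σ ∘ f)
        edgeCost≡ = ∑-edgeList G (cut σ)
        σ≤2 : graphCost G σ ≤ 2
        σ≤2 = +-mono-≤ vertexCost≤1 (≤-trans (≤-reflexive edgeCost≡)
          (≤-trans (∑-mono (allFin (suc m)) (λ {i} _ → cut≤ i)) (≤-reflexive (∑-δ₁ _≟_ (allFin⁺ (suc m)) (∈-allFin e)))))
        -- Without `e` the labelling would cost at most the size of `S`, hence at most 1, although
        -- its two sides are not empty.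
        crossing : 1 ≤ cut σ (f e)
        crossing with i , _ , ×i ← ∑-pos (allFin (suc m)) {cut σ ∘ f} (subst (1 ≤_) edgeCost≡ (+-cancelˡ-≤ 1 1 _
            (≤-trans (2≤cost G conn σ {x} {y} (trans (σ-∉ x∉) start) (trans (σ-∉ y∉) hy)) (+-monoˡ-≤ _ vertexCost≤1))))
          with refl ← 𝟙-pos (i ≟ e) (≤-trans ×i (cut≤ i)) = ×i
        orientation : _ → ∃ λ σ → graphCost G σ ≤ 2 × σ (proj₁ (f e)) ≡ left × σ (proj₂ (f e)) ≡ right
        orientation (inj₁ (p , q)) = σ , σ≤2 , p , q
        orientation (inj₂ (p , q)) = flip ∘ σ , subst (_≤ 2) (sym (cost-flip σ (allFin n) (edgeList G))) σ≤2 , cong flip p , cong flip q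

    -- The value of `κ` on the diagonal is meaningless; zero there lets the excess run over all
    -- ordered pairs.
    κ₀ : ∀ G → V G → V G → ℕ
    κ₀ G x y with x ≟ y
    ... | yes _ = 0
    ... | no _  = κ G x y

    κ₀-≢ : ∀ G {x y} → x ≢ y → κ₀ G x y ≡ κ G x y
    κ₀-≢ G {x} {y} x≢y with x ≟ y
    ... | yes x≡y = ⊥-elim (x≢y x≡y)
    ... | no _    = refl

    -- In a minimally 2-connected graph every edge can be separated at cost 2; the restriction to
    -- ends of large degree matters only for the sides produced later.
    graphPiece : ∀ G → Minimally2Connected G → Piece (allFin (order G)) (edgeList G) (κ₀ G)
    graphPiece G (conn , minimal) = record
      { unique = allFin⁺ (order G)
      ; wf     = λ i → ∈-allFin _ , ∈-allFin _ , wf′ (∈-map⁻ (ends G) i)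
      ; two    = λ σ {x} {y} _ _ p q → 2≤cost G conn σ {x} {y} p q
      ; sep    = λ i _ _ → sep′ (∈-map⁻ (ends G) i)
      ; bound  = λ σ {x} {y} _ _ → bound′ σ {x} {y}
      ; diag   = diag′
      }
      where
      wf′ : ∀ {x y} → (∃ λ e → e ∈ allFin (size G) × (x , y) ≡ ends G e) → x ≢ y
      wf′ (e , _ , eq) x≡y = loopless G e (trans (sym (cong proj₁ eq)) (trans x≡y (cong proj₂ eq)))
      sep′ : ∀ {x y} → (∃ λ e → e ∈ allFin (size G) × (x , y) ≡ ends G e) → ∃ λ σ → graphCost G σ ≤ 2 × σ x ≡ left × σ y ≡ right
      sep′ (e , _ , refl) = separateEdge G conn minimal e
      bound′ : ∀ σ {x y} → σ x ≡ left → σ y ≡ right → κ₀ G x y ≤ graphCost G σ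
      bound′ σ {x} {y} p q with x ≟ y
      ... | yes _  = z≤n
      ... | no x≢y = disjointPaths≤cost G σ p q (proj₁ (κ-isMaximum G x≢y))
      diag′ : ∀ x → κ₀ G x x ≡ 0
      diag′ x with x ≟ x
      ... | yes _  = refl
      ... | no x≢x = ⊥-elim (x≢x refl)

    degree≡deg : ∀ G x → degree G x ≡ deg (edgeList G) x
    degree≡deg G x = trans (length-filter-∑ (incident? G x) (allFin (size G)))
      (trans (∑-cong (allFin (size G)) (λ {e} _ → pointwise (x ≟ proj₁ (ends G e)) (x ≟ proj₂ (ends G e)) (loopless G e)))
        (sym (∑-edgeList G (inc x))))
      where
      pointwise : ∀ {a b : V G} (p : Dec (x ≡ a)) (q : Dec (x ≡ b)) → a ≢ b → 𝟙 (p ⊎-dec q) ≡ 𝟙 p + 𝟙 q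
      pointwise (yes p) (yes q) a≢b = ⊥-elim (a≢b (trans (sym p) q))
      pointwise (yes p) (no q)  _   = refl
      pointwise (no p)  (yes q) _   = refl
      pointwise (no p)  (no q)  _   = refl

  -- Whitney's theorem and transport of disjoint paths.

  module Paths where

    open GraphPiece

    module _ {G : Graph} where

      open DecMembership (_≟_ {order G}) using () renaming (_∈?_ to _∈V?_)

      first∈ : ∀ {u v} (w : Walk G u v) → u ∈ vertices w
      first∈ []           = here refl
      first∈ (step _ _ _) = here refl

      last∈ : ∀ {u v} (w : Walk G u v) → v ∈ vertices w
      last∈ []           = here refl
      last∈ (step _ _ w) = there (last∈ w)

      ∈-++ʷ : ∀ {u v x} (p : Walk G u v) (q : Walk G v x) {y} → y ∈ vertices (p ++ʷ q) → y ∈ vertices p ⊎ y ∈ vertices q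
      ∈-++ʷ []           q i           = inj₂ i
      ∈-++ʷ (step _ _ p) q (here refl) = inj₁ (here refl)
      ∈-++ʷ (step _ _ p) q (there i) with ∈-++ʷ p q i
      ... | inj₁ j = inj₁ (there j)
      ... | inj₂ j = inj₂ j

      edge⇒ends : ∀ {u v} (w : Walk G u v) {e} → e ∈ edges w → proj₁ (ends G e) ∈ vertices w × proj₂ (ends G e) ∈ vertices w
      edge⇒ends (step e (inj₁ eq) w) (here refl) rewrite eq = here refl , there (first∈ w)
      edge⇒ends (step e (inj₂ eq) w) (here refl) rewrite eq = there (first∈ w) , here refl
      edge⇒ends (step e j w) (there i) with a , b ← edge⇒ends w i = there a , there b

      incident⇒∈ : ∀ {u v} (w : Walk G u v) {x e} → Incident G x e → e ∈ edges w → x ∈ vertices w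
      incident⇒∈ w (inj₁ refl) i = proj₁ (edge⇒ends w i)
      incident⇒∈ w (inj₂ refl) i = proj₂ (edge⇒ends w i)

      Joins⇒incidentʳ : ∀ {e u v} → Joins G e u v → Incident G v e
      Joins⇒incidentʳ (inj₁ eq) = inj₂ (sym (cong proj₂ eq))
      Joins⇒incidentʳ (inj₂ eq) = inj₁ (sym (cong proj₁ eq))

      Joins⇒≢ : ∀ {e u v} → Joins G e u v → u ≢ v
      Joins⇒≢ {e} (inj₁ eq) u≡v = loopless G e (trans (cong proj₁ eq) (trans u≡v (sym (cong proj₂ eq))))
      Joins⇒≢ {e} (inj₂ eq) u≡v = loopless G e (trans (cong proj₁ eq) (trans (sym u≡v) (sym (cong proj₂ eq))))

      -- The last component records that a proper suffix avoids the first vertex of the path. In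
      -- rerouting, this is what frees that vertex for the other of the two paths.
      suffix : ∀ {u v x} (p : Walk G u v) → IsPath p → x ∈ vertices p →
               ∃ λ (q : Walk G x v) → IsPath q × (∀ {y} → y ∈ vertices q → y ∈ vertices p) ×
               (∀ {e} → e ∈ edges q → e ∈ edges p) × (u ≢ x → u ∉ vertices q)
      suffix []           unique (here refl) = [] , unique , id , id , λ u≢u _ → u≢u refl
      suffix (step e j p) unique (here refl) = step e j p , unique , id , id , λ u≢u _ → u≢u refl
      suffix (step e j p) (u∉ ∷ unique) (there i) with q , path , ⊆V , ⊆E , _ ← suffix p unique i =
        q , path , there ∘ ⊆V , there ∘ ⊆E , λ _ k → All.lookup u∉ (⊆V k) refl

      toPath : ∀ {u v} (w : Walk G u v) → ∃ λ (p : Walk G u v) → IsPath p ×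
               (∀ {y} → y ∈ vertices p → y ∈ vertices w) × (∀ {e} → e ∈ edges p → e ∈ edges w)
      toPath [] = [] , [] ∷ [] , id , id
      toPath {u} (step e j w) with p , path , ⊆V , ⊆E ← toPath w with u ∈V? vertices p
      ... | yes u∈ with q , path′ , ⊆V′ , ⊆E′ , _ ← suffix p path u∈ =
        q , path′ , there ∘ ⊆V ∘ ⊆V′ , there ∘ ⊆E ∘ ⊆E′
      ... | no u∉ = step e j p , All.tabulate (λ { i refl → u∉ i }) ∷ path ,
        (λ { (here eq) → here eq ; (there i) → there (⊆V i) }) , (λ { (here eq) → here eq ; (there i) → there (⊆E i) })

      disjoint-⊆ : ∀ {u v} {p q p′ q′ : Walk G u v} → InternallyDisjoint p q →
                   (∀ {y} → y ∈ vertices p′ → y ∈ vertices p) → (∀ {e} → e ∈ edges p′ → e ∈ edges p) →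
                   (∀ {y} → y ∈ vertices q′ → y ∈ vertices q) → (∀ {e} → e ∈ edges q′ → e ∈ edges q) →
                   InternallyDisjoint p′ q′
      disjoint-⊆ (dE , dV) pV pE qV qE =
        All.tabulate (λ i j → All.lookup dE (pE i) (qE j)) , All.tabulate (λ i j → All.lookup dV (pV i) (qV j))

      disjoint-sym : ∀ {u v} {p q : Walk G u v} → InternallyDisjoint p q → InternallyDisjoint q p
      disjoint-sym (dE , dV) = All.tabulate (λ i j → All.lookup dE j i) , All.tabulate (λ i j → All.lookup dV j i)

      record TwoPaths (u v : V G) : Set where
        constructor twoPaths
        field
          P Q      : Walk G u v
          pathP    : IsPath P
          pathQ    : IsPath Q
          disjoint : InternallyDisjoint P Q

      twoPaths⇒ : ∀ {u v} → TwoPaths u v → DisjointPaths G u v 2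
      twoPaths⇒ (twoPaths P Q p q d) = P ∷ Q ∷ [] , refl , p ∷ q ∷ [] , (d ∷ []) ∷ [] ∷ []

      fromWalks : ∀ {u v} (p q : Walk G u v) → InternallyDisjoint p q → TwoPaths u v
      fromWalks p q d with p′ , path , pV , pE ← toPath p | q′ , path′ , qV , qE ← toPath q =
        twoPaths p′ q′ path path′ (disjoint-⊆ d pV pE qV qE)

      firstHit : ∀ {S : V G → Set} → Decidable S → ∀ {u v} (w : Walk G u v) → S v →
                 ∃ λ z → ∃ λ (p : Walk G u z) → S z × (∀ {y} → y ∈ vertices p → S y → y ≡ z) × (∀ {e} → e ∈ edges p → e ∈ edges w)
      firstHit S? [] s = _ , [] , s , (λ { (here eq) _ → eq }) , id
      firstHit S? {u} (step e j w) s with S? u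
      ... | yes su = u , [] , su , (λ { (here eq) _ → eq }) , λ ()
      ... | no ¬su with z , p , sz , only , ⊆E ← firstHit S? w s =
        z , step e j p , sz , (λ { (here refl) sy → ⊥-elim (¬su sy) ; (there i) sy → only i sy }) ,
        λ { (here eq) → here eq ; (there i) → there (⊆E i) }

    module _ (G : Graph) (conn : HasConnectivity G 2) where

      open DecMembership (_≟_ {order G}) using () renaming (_∈?_ to _∈V?_)

      -- Otherwise `v` is outside the closure of `u` under edges not at `y`, and this closure with
      -- `y` in the middle is a cut of cost 1.
      avoidVertex : ∀ {u v} y → u ≢ y → v ≢ y → ∃ λ (w : Walk G u v) → All (λ e → ¬ Incident G y e) (edges w)
      avoidVertex {u} {v} y u≢y v≢y = go (total v)
        where
        open Closure (closure G (λ e → ¬? (incident? G y e)) u)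
        σ = h [ y ↦ middle ]
        uncut : ∀ e → cut σ (ends G e) ≡ 0
        uncut e with incident? G y e
        ... | no ¬inc = n≤0⇒n≡0 (≤-trans (cut-update≤ h y (ends G e)) (≤-reflexive (closed ¬inc)))
        ... | yes (inj₁ refl) = cut-updateˡ h {proj₁ (ends G e)} {proj₂ (ends G e)}
        ... | yes (inj₂ refl) = cut-updateʳ h {proj₁ (ends G e)} {proj₂ (ends G e)}
        noMiddle : ∀ x → isMiddle (h x) ≡ 0
        noMiddle x with h x | total x
        ... | left   | _ = refl
        ... | right  | _ = refl
        ... | middle | inj₁ ()
        ... | middle | inj₂ ()
        one : ∀ x → isMiddle (σ x) ≤ 𝟙 (x ≟ y)
        one x with x ≟ y
        ... | yes _ = ≤-refl
        ... | no _  = ≤-reflexive (noMiddle x)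
        go : h v ≡ left ⊎ h v ≡ right → _
        go (inj₁ p) = reached p
        go (inj₂ p) = ⊥-elim (n≮n 1 (≤-trans
          (2≤cost G conn σ {u} {v} (trans (update-≢ h middle u≢y) start) (trans (update-≢ h middle v≢y) p))
          (+-mono-≤ (≤-trans (∑-mono (allFin (order G)) (λ {x} _ → one x)) (≤-reflexive (∑-δ₁ _≟_ (allFin⁺ (order G)) (∈-allFin y))))
            (≤-reflexive (trans (∑-edgeList G (cut σ)) (∑-zero (allFin (size G)) (λ {e} _ → uncut e)))))))

      avoidEdge : ∀ {u v} e → ∃ λ (w : Walk G u v) → All (_≢ e) (edges w)
      avoidEdge {u} {v} e = go (total v)
        where
        open Closure (closure G (λ f → ¬? (f ≟ e)) u)
        noMiddle : ∀ x → isMiddle (h x) ≡ 0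
        noMiddle x with h x | total x
        ... | left   | _ = refl
        ... | right  | _ = refl
        ... | middle | inj₁ ()
        ... | middle | inj₂ ()
        one : ∀ f → cut h (ends G f) ≤ 𝟙 (f ≟ e)
        one f with f ≟ e
        ... | yes _  = cross≤1 (h (proj₁ (ends G f))) (h (proj₂ (ends G f)))
        ... | no f≢e = ≤-reflexive (closed f≢e)
        go : h v ≡ left ⊎ h v ≡ right → _
        go (inj₁ p) = reached p
        go (inj₂ p) = ⊥-elim (n≮n 1 (≤-trans (2≤cost G conn h {u} {v} start p)
          (+-mono-≤ (≤-reflexive (∑-zero (allFin (order G)) (λ {x} _ → noMiddle x)))
            (≤-trans (≤-reflexive (∑-edgeList G (cut h)))
              (≤-trans (∑-mono (allFin (size G)) (λ {f} _ → one f)) (≤-reflexive (∑-δ₁ _≟_ (allFin⁺ (size G)) (∈-allFin e))))))))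

      private
        -- The walk z reaches P first; it continues along P, and Q is preceded by e.
        reroute : ∀ {u y v z e} (j : Joins G e u y) (P Q : Walk G y v) → IsPath P → InternallyDisjoint P Q →
                  (Z : Walk G u z) → All (λ f → ¬ Incident G y f) (edges Z) → y ≢ z → z ∈ vertices P →
                  (∀ {x} → x ∈ vertices Z → x ∈ vertices P ⊎ x ∈ vertices Q → x ≡ z) → TwoPaths u v
        reroute {u} {y} {v} {z} {e} j P Q pathP (dE , dV) Z avoids y≢z z∈P only
          with S , _ , S⊆V , S⊆E , y∉ ← suffix P pathP z∈P =
          fromWalks (Z ++ʷ S) (step e j Q) (All.tabulate edgesApart , All.tabulate verticesApart)
          where
          edgesApart : ∀ {f} → f ∈ edges (Z ++ʷ S) → f ∉ e ∷ edges Q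
          edgesApart {f} i k with ∈-++⁻ (edges Z) (subst (f ∈_) (edges-++ Z S) i) | k
          ... | inj₁ f∈Z | here refl = All.lookup avoids f∈Z (Joins⇒incidentʳ {G} j)
          ... | inj₂ f∈S | here refl = y∉ y≢z (incident⇒∈ S (Joins⇒incidentʳ {G} j) f∈S)
          ... | inj₂ f∈S | there f∈Q = All.lookup dE (S⊆E f∈S) f∈Q
          ... | inj₁ f∈Z | there f∈Q = loopless G f
            (trans (only (proj₁ (edge⇒ends Z f∈Z)) (inj₂ (proj₁ (edge⇒ends Q f∈Q))))
              (sym (only (proj₂ (edge⇒ends Z f∈Z)) (inj₂ (proj₂ (edge⇒ends Q f∈Q))))))
          onBoth : ∀ {x} → x ∈ vertices S → x ∈ vertices Q → x ≡ u ⊎ x ≡ v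
          onBoth x∈S x∈Q with All.lookup dV (S⊆V x∈S) x∈Q
          ... | inj₁ refl = ⊥-elim (y∉ y≢z x∈S)
          ... | inj₂ x≡v  = inj₂ x≡v
          verticesApart : ∀ {x} → x ∈ vertices (Z ++ʷ S) → x ∈ u ∷ vertices Q → x ≡ u ⊎ x ≡ v
          verticesApart i (here x≡u) = inj₁ x≡u
          verticesApart i (there x∈Q) with ∈-++ʷ Z S i
          ... | inj₂ x∈S = onBoth x∈S x∈Q
          ... | inj₁ x∈Z with refl ← only x∈Z (inj₂ x∈Q) = onBoth (first∈ S) x∈Q

      -- Induction along a walk, as in Whitney's proof. Given two disjoint paths from the next
      -- vertex `y` to `v`, a walk from `u` avoiding `y` is followed up to its first vertex on
      -- either of them; one new path continues there, the other takes the edge to `y` and the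
      -- remaining path. If `y` is `v`, a walk avoiding the edge `e` is disjoint from it.
      whitney-walk : ∀ {u v} → Walk G u v → u ≢ v → TwoPaths {G} u v
      whitney-walk [] u≢u = ⊥-elim (u≢u refl)
      whitney-walk {u} {v} (step {w = y} e j w) u≢v with y ≟ v
      ... | yes refl with Z , avoids ← avoidEdge {u} {v} e =
        fromWalks Z (step e j []) (All.tabulate (λ { i (here refl) → All.lookup avoids i refl }) ,
          All.tabulate (λ { _ (here eq) → inj₁ eq ; _ (there (here eq)) → inj₂ eq }))
      ... | no y≢v with twoPaths P Q pathP pathQ d ← whitney-walk w y≢v
        with Z , avoids ← avoidVertex {u} {v} y (Joins⇒≢ {G} j) (y≢v ∘ sym)
        with z , p , z∈ , only , ⊆E ← firstHit (λ x → (x ∈V? vertices P) ⊎-dec (x ∈V? vertices Q)) Z (inj₁ (last∈ P)) = choose z∈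
        where
        avoids′ : All (λ f → ¬ Incident G y f) (edges p)
        avoids′ = All.tabulate (All.lookup avoids ∘ ⊆E)
        lastAvoids : ∀ {x z} (p : Walk G x z) → x ≢ y → All (λ f → ¬ Incident G y f) (edges p) → y ≢ z
        lastAvoids []           x≢y _        eq = x≢y (sym eq)
        lastAvoids (step e j p) x≢y (¬i ∷ as) eq = lastAvoids p (λ { refl → ¬i (Joins⇒incidentʳ {G} j) }) as eq
        y≢z : y ≢ z
        y≢z = lastAvoids p (Joins⇒≢ {G} j) avoids′
        choose : z ∈ vertices P ⊎ z ∈ vertices Q → TwoPaths u v
        choose (inj₁ z∈P) = reroute j P Q pathP d p avoids′ y≢z z∈P only
        choose (inj₂ z∈Q) = reroute j Q P pathQ (disjoint-sym d) p avoids′ y≢z z∈Q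
          (λ i → λ { (inj₁ a) → only i (inj₂ a) ; (inj₂ a) → only i (inj₁ a) })

      2≤κ : ∀ {u v} → u ≢ v → 2 ≤ κ G u v
      2≤κ {u} {v} u≢v with y , y≢u , y≢v ← third-vertex (3≤order G conn) u v =
        proj₂ (κ-isMaximum G u≢v) 2 (twoPaths⇒ (whitney-walk (proj₁ (avoidVertex y (y≢u ∘ sym) (y≢v ∘ sym))) u≢v))

    -- `Φ` may produce walks with repetitions. Shortening them to paths only drops vertices and
    -- edges, so disjointness survives. Reversal, isomorphism, subdivision and its inverse all go
    -- through this.
    mapPaths : ∀ {G H} {u v u′ v′} (Φ : Walk G u v → Walk H u′ v′) →
               (∀ p q → InternallyDisjoint p q → InternallyDisjoint (Φ p) (Φ q)) → ∀ {k} → DisjointPaths G u v k → DisjointPaths H u′ v′ k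
    mapPaths {G} {H} {u} {v} {u′} {v′} Φ keeps (ps , refl , _ , d) = map Ψ ps , length-map Ψ ps ,
      All.map⁺ (All.tabulate (λ {p} _ → proj₁ (proj₂ (toPath (Φ p))))) ,
      AllPairs.map⁺ (AllPairs.map (λ {p} {q} dpq → disjoint-⊆ (keeps p q dpq)
        (proj₁ (proj₂ (proj₂ (toPath (Φ p))))) (proj₂ (proj₂ (proj₂ (toPath (Φ p)))))
        (proj₁ (proj₂ (proj₂ (toPath (Φ q))))) (proj₂ (proj₂ (proj₂ (toPath (Φ q)))))) d)
      where
      Ψ : Walk G u v → Walk H u′ v′
      Ψ p = proj₁ (toPath (Φ p))

    κ-mono : ∀ G H {u v u′ v′} → u ≢ v → u′ ≢ v′ → (∀ {k} → DisjointPaths G u v k → DisjointPaths H u′ v′ k) → κ G u v ≤ κ H u′ v′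
    κ-mono G H u≢v u′≢v′ f = proj₂ (κ-isMaximum H u′≢v′) _ (f (proj₁ (κ-isMaximum G u≢v)))

    module _ {G : Graph} where

      swapJoins : ∀ {e u v} → Joins G e u v → Joins G e v u
      swapJoins (inj₁ eq) = inj₂ eq
      swapJoins (inj₂ eq) = inj₁ eq

      reverse : ∀ {u v} → Walk G u v → Walk G v u
      reverse []           = []
      reverse (step e j w) = reverse w ++ʷ step e (swapJoins j) []

      ∈-reverseV : ∀ {u v} (w : Walk G u v) {x} → x ∈ vertices (reverse w) → x ∈ vertices w
      ∈-reverseV []           i = i
      ∈-reverseV (step e j w) i with ∈-++ʷ (reverse w) (step e (swapJoins j) []) i
      ... | inj₁ k                   = there (∈-reverseV w k)
      ... | inj₂ (here refl)         = there (first∈ w)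
      ... | inj₂ (there (here refl)) = here refl

      ∈-reverseE : ∀ {u v} (w : Walk G u v) {f} → f ∈ edges (reverse w) → f ∈ edges w
      ∈-reverseE (step e j w) {f} i with ∈-++⁻ (edges (reverse w)) (subst (f ∈_) (edges-++ (reverse w) (step e (swapJoins j) [])) i)
      ... | inj₁ k           = there (∈-reverseE w k)
      ... | inj₂ (here refl) = here refl

    κ-sym≤ : ∀ G {u v} → u ≢ v → κ G u v ≤ κ G v u
    κ-sym≤ G u≢v = κ-mono G G u≢v (u≢v ∘ sym) (mapPaths reverse (λ p q (dE , dV) →
      All.tabulate (λ i j → All.lookup dE (∈-reverseE p i) (∈-reverseE q j)) ,
      All.tabulate (λ i j → swap′ (All.lookup dV (∈-reverseV p i) (∈-reverseV q j)))))
      where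
      swap′ : ∀ {A B : Set} → A ⊎ B → B ⊎ A
      swap′ (inj₁ a) = inj₂ a
      swap′ (inj₂ b) = inj₁ b

    κ-sym : ∀ G {u v} → u ≢ v → κ G u v ≡ κ G v u
    κ-sym G u≢v = ≤-antisym (κ-sym≤ G u≢v) (κ-sym≤ G (u≢v ∘ sym))

  -- Degrees and connectivity under isomorphism and subdivision.

  module Transfer where

    open GraphPiece
    open Paths

    ∑Fin-+ : ∀ m n (f : Fin (m + n) → ℕ) → ∑Fin (m + n) f ≡ ∑Fin m (f ∘ (_↑ˡ n)) + ∑Fin n (f ∘ (m ↑ʳ_))
    ∑Fin-+ zero    n f = refl
    ∑Fin-+ (suc m) n f = trans (∑Fin-suc (m + n) f) (trans (cong (f zero +_) (∑Fin-+ m n (f ∘ suc)))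
      (trans (sym (+-assoc (f zero) _ _)) (cong (_+ ∑Fin n (f ∘ (suc m ↑ʳ_))) (sym (∑Fin-suc m (f ∘ (_↑ˡ n)))))))

    graphDeg : ∀ G → V G → ℕ
    graphDeg G x = ∑Fin (size G) (inc x ∘ ends G)

    degree≡graphDeg : ∀ G x → degree G x ≡ graphDeg G x
    degree≡graphDeg G x = trans (degree≡deg G x) (∑-edgeList G (inc x))

    κ≤degrees : ∀ G {u v} → u ≢ v → κ G u v ≤ degree G u ⊓ degree G v
    κ≤degrees G {u} {v} u≢v = ⊓-glb
      (≤-trans (disjointPaths≤cost G (single u) (update-≡ (λ _ → right) u left) (single-other (u≢v ∘ sym)) paths) (≤-reflexive (trans (single-cost u) (sym (degree≡deg G u)))))
      (≤-trans (disjointPaths≤cost G (flip ∘ single v) (cong flip (single-other u≢v)) (cong flip (update-≡ (λ _ → right) v left)) paths)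
        (≤-reflexive (trans (cost-flip (single v) (allFin (order G)) (edgeList G)) (trans (single-cost v) (sym (degree≡deg G v))))))
      where
      paths = proj₁ (κ-isMaximum G u≢v)
      single-cost : ∀ x → graphCost G (single x) ≡ deg (edgeList G) x
      single-cost x = cong₂ _+_ (∑-zero (allFin (order G)) (λ {y} _ → isMiddle-single x y))
        (trans (∑-edgeList G (cut (single x))) (trans (∑-cong (allFin (size G)) (λ {e} _ → cut-single x (loopless G e))) (sym (∑-edgeList G (inc x)))))

    module _ {G H : Graph} (φ : G ≅ H) where

      open _≅_ φ
      private
        toV   = Inverse.to onV
        fromV = Inverse.from onV
        toE   = Inverse.to onE
        fromE = Inverse.from onE

      toV-injective : ∀ {x y} → toV x ≡ toV y → x ≡ y
      toV-injective {x} {y} eq = trans (sym (Inverse.strictlyInverseʳ onV x)) (trans (cong fromV eq) (Inverse.strictlyInverseʳ onV y))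

      toE-injective : ∀ {x y} → toE x ≡ toE y → x ≡ y
      toE-injective {x} {y} eq = trans (sym (Inverse.strictlyInverseʳ onE x)) (trans (cong fromE eq) (Inverse.strictlyInverseʳ onE y))

      ≅-sym : H ≅ G
      ≅-sym = record { onV = ↔-sym onV ; onE = ↔-sym onE ; preserves = λ e j → back e j }
        where
        back : ∀ e {u v} → Joins H e u v → Joins G (fromE e) (fromV u) (fromV v)
        back e {u} {v} j = go (subst (λ f → Joins H f (toV a) (toV b)) (Inverse.strictlyInverseˡ onE e) (preserves (fromE e) (inj₁ refl))) j
          where
          a = proj₁ (ends G (fromE e))
          b = proj₂ (ends G (fromE e))
          home : ∀ {x y} → toV x ≡ y → x ≡ fromV y
          home {x} refl = sym (Inverse.strictlyInverseʳ onV x)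
          same : ∀ {p q r s} → (p , q) ≡ (r , s) → p ≡ r × q ≡ s
          same refl = refl , refl
          go : Joins H e (toV a) (toV b) → Joins H e u v → Joins G (fromE e) (fromV u) (fromV v)
          go (inj₁ p) (inj₁ q) with r , s ← same (trans (sym p) q) = inj₁ (cong₂ _,_ (home r) (home s))
          go (inj₁ p) (inj₂ q) with r , s ← same (trans (sym p) q) = inj₂ (cong₂ _,_ (home r) (home s))
          go (inj₂ p) (inj₁ q) with r , s ← same (trans (sym p) q) = inj₂ (cong₂ _,_ (home s) (home r))
          go (inj₂ p) (inj₂ q) with r , s ← same (trans (sym p) q) = inj₁ (cong₂ _,_ (home s) (home r))

      mapWalk : ∀ {u v} → Walk G u v → Walk H (toV u) (toV v)
      mapWalk []           = []
      mapWalk (step e j w) = step (toE e) (preserves e j) (mapWalk w)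

      vertices-mapWalk : ∀ {u v} (w : Walk G u v) → vertices (mapWalk w) ≡ map toV (vertices w)
      vertices-mapWalk []           = refl
      vertices-mapWalk (step e j w) = cong (_ ∷_) (vertices-mapWalk w)

      edges-mapWalk : ∀ {u v} (w : Walk G u v) → edges (mapWalk w) ≡ map toE (edges w)
      edges-mapWalk []           = refl
      edges-mapWalk (step e j w) = cong (_ ∷_) (edges-mapWalk w)

      ≅-paths : ∀ {u v k} → DisjointPaths G u v k → DisjointPaths H (toV u) (toV v) k
      ≅-paths {u} {v} = mapPaths mapWalk keeps
        where
        keeps : ∀ p q → InternallyDisjoint p q → InternallyDisjoint (mapWalk p) (mapWalk q)
        keeps p q (dE , dV) = All.tabulate edgesApart , All.tabulate verticesApart
          where
          edgesApart : ∀ {e} → e ∈ edges (mapWalk p) → e ∈ edges (mapWalk q) → ⊥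
          edgesApart {e} i j with f , f∈ , refl ← ∈-map⁻ toE (subst (e ∈_) (edges-mapWalk p) i)
            with g , g∈ , eq ← ∈-map⁻ toE (subst (e ∈_) (edges-mapWalk q) j)
            with refl ← toE-injective eq = All.lookup dE f∈ g∈
          verticesApart : ∀ {x} → x ∈ vertices (mapWalk p) → x ∈ vertices (mapWalk q) → x ≡ toV u ⊎ x ≡ toV v
          verticesApart {x} i j with y , y∈ , refl ← ∈-map⁻ toV (subst (x ∈_) (vertices-mapWalk p) i)
            with z , z∈ , eq ← ∈-map⁻ toV (subst (x ∈_) (vertices-mapWalk q) j)
            with refl ← toV-injective eq with All.lookup dV y∈ z∈
          ... | inj₁ refl = inj₁ refl
          ... | inj₂ refl = inj₂ refl

      ≅-κ≤ : ∀ {u v} → u ≢ v → κ G u v ≤ κ H (toV u) (toV v)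
      ≅-κ≤ u≢v = κ-mono G H u≢v (u≢v ∘ toV-injective) ≅-paths

      ≅-deg : ∀ x → graphDeg G x ≡ graphDeg H (toV x)
      ≅-deg x = trans (∑-cong (allFin (size G)) (λ {e} _ → pointwise e (preserves e (inj₁ refl)))) (∑Fin-↔ onE (inc (toV x) ∘ ends H))
        where
        𝟙-toV : ∀ a → 𝟙 (x ≟ a) ≡ 𝟙 (toV x ≟ toV a)
        𝟙-toV a = 𝟙-cong (cong toV) toV-injective (x ≟ a) (toV x ≟ toV a)
        pointwise : ∀ e → Joins H (toE e) (toV (proj₁ (ends G e))) (toV (proj₂ (ends G e))) → inc x (ends G e) ≡ inc (toV x) (ends H (toE e))
        pointwise e (inj₁ eq) = trans (cong₂ _+_ (𝟙-toV _) (𝟙-toV _)) (cong (inc (toV x)) (sym eq))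
        pointwise e (inj₂ eq) = trans (cong₂ _+_ (𝟙-toV _) (𝟙-toV _)) (trans (+-comm (𝟙 (toV x ≟ toV (proj₁ (ends G e)))) _) (cong (inc (toV x)) (sym eq)))

    module _ (H : Graph) where

      private
        n = order H
        m = size H
        S = subdivide H

      old : V H → V S
      old x = x ↑ˡ m

      new : E H → V S
      new e = n ↑ʳ e

      old≢new : ∀ x e → old x ≢ new e
      old≢new x e eq with () ← trans (sym (splitAt-↑ˡ n x m)) (trans (cong (splitAt n) eq) (splitAt-↑ʳ n m e))

      old-injective : ∀ {x y} → old x ≡ old y → x ≡ y
      old-injective {x} {y} = ↑ˡ-injective m x y

      new-injective : ∀ {x y} → new x ≡ new y → x ≡ y
      new-injective {x} {y} = ↑ʳ-injective n x y

      data VertexView : V S → Set where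
        old′ : ∀ x → VertexView (old x)
        new′ : ∀ e → VertexView (new e)

      vertexView : ∀ x → VertexView x
      vertexView x with splitAt n x in eq
      ... | inj₁ y = subst VertexView (splitAt⁻¹-↑ˡ eq) (old′ y)
      ... | inj₂ e = subst VertexView (splitAt⁻¹-↑ʳ eq) (new′ e)

      data EdgeView : E S → Set where
        first′  : ∀ e → EdgeView (e ↑ˡ m)
        second′ : ∀ e → EdgeView (m ↑ʳ e)

      edgeView : ∀ f → EdgeView f
      edgeView f with splitAt m f in eq
      ... | inj₁ e = subst EdgeView (splitAt⁻¹-↑ˡ eq) (first′ e)
      ... | inj₂ e = subst EdgeView (splitAt⁻¹-↑ʳ eq) (second′ e)

      ends-first : ∀ e → ends S (e ↑ˡ m) ≡ (old (proj₁ (ends H e)) , new e)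
      ends-first e = cong (half H) (splitAt-↑ˡ m e m)

      ends-second : ∀ e → ends S (m ↑ʳ e) ≡ (old (proj₂ (ends H e)) , new e)
      ends-second e = cong (half H) (splitAt-↑ʳ m m e)

      subdivide-deg-old : ∀ x → graphDeg S (old x) ≡ graphDeg H x
      subdivide-deg-old x = trans (∑Fin-+ m m (inc (old x) ∘ ends S)) (trans (sym (∑-+ (allFin m))) (∑-cong (allFin m) (λ {e} _ → cong₂ _+_ (first e) (second e))))
        where
        at : ∀ a e → inc (old x) (old a , new e) ≡ 𝟙 (x ≟ a)
        at a e = trans (cong₂ _+_ (𝟙-cong old-injective (cong old) (old x ≟ old a) (x ≟ a)) (𝟙-no (old x ≟ new e) (old≢new x e))) (+-identityʳ _)
        first : ∀ e → inc (old x) (ends S (e ↑ˡ m)) ≡ 𝟙 (x ≟ proj₁ (ends H e))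
        first e = trans (cong (inc (old x)) (ends-first e)) (at _ e)
        second : ∀ e → inc (old x) (ends S (m ↑ʳ e)) ≡ 𝟙 (x ≟ proj₂ (ends H e))
        second e = trans (cong (inc (old x)) (ends-second e)) (at _ e)

      subdivide-deg-new : ∀ e → graphDeg S (new e) ≡ 2
      subdivide-deg-new e = trans (∑Fin-+ m m (inc (new e) ∘ ends S)) (cong₂ _+_
          (trans (∑-cong (allFin m) (λ {f} _ → trans (cong (inc (new e)) (ends-first f)) (at _ f))) (∑-δ₁ _≟_ (allFin⁺ m) (∈-allFin e)))
          (trans (∑-cong (allFin m) (λ {f} _ → trans (cong (inc (new e)) (ends-second f)) (at _ f))) (∑-δ₁ _≟_ (allFin⁺ m) (∈-allFin e))))
        where
        at : ∀ a f → inc (new e) (old a , new f) ≡ 𝟙 (f ≟ e)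
        at a f = cong₂ _+_ (𝟙-no (new e ≟ old a) (old≢new a e ∘ sym)) (𝟙-cong (sym ∘ new-injective) (sym ∘ cong new) (new e ≟ new f) (f ≟ e))

      private
        twoSteps : ∀ {e u w v} → Joins H e u w → Walk S (old w) (old v) → Walk S (old u) (old v)
        twoSteps {e} (inj₁ eq) w = step (e ↑ˡ m) (inj₁ (trans (ends-first e) (cong (λ p → old (proj₁ p) , new e) eq)))
          (step (m ↑ʳ e) (inj₂ (trans (ends-second e) (cong (λ p → old (proj₂ p) , new e) eq))) w)
        twoSteps {e} (inj₂ eq) w = step (m ↑ʳ e) (inj₁ (trans (ends-second e) (cong (λ p → old (proj₂ p) , new e) eq)))
          (step (e ↑ˡ m) (inj₂ (trans (ends-first e) (cong (λ p → old (proj₁ p) , new e) eq))) w)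

      expand : ∀ {u v} → Walk H u v → Walk S (old u) (old v)
      expand []           = []
      expand (step e j w) = twoSteps j (expand w)

      data FromVertex (vs : List (V H)) (es : List (E H)) : V S → Set where
        old″ : ∀ {x} → x ∈ vs → FromVertex vs es (old x)
        new″ : ∀ {e} → e ∈ es → FromVertex vs es (new e)

      data FromEdge (es : List (E H)) : E S → Set where
        first″  : ∀ {e} → e ∈ es → FromEdge es (e ↑ˡ m)
        second″ : ∀ {e} → e ∈ es → FromEdge es (m ↑ʳ e)

      private
        weakenV : ∀ {vs es u e x} → FromVertex vs es x → FromVertex (u ∷ vs) (e ∷ es) x
        weakenV (old″ i) = old″ (there i)
        weakenV (new″ i) = new″ (there i)

        weakenE : ∀ {es e x} → FromEdge es x → FromEdge (e ∷ es) x
        weakenE (first″ i)  = first″ (there i)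
        weakenE (second″ i) = second″ (there i)

      ∈-expandV : ∀ {u v} (w : Walk H u v) {x} → x ∈ vertices (expand w) → FromVertex (vertices w) (edges w) x
      ∈-expandV []                  (here refl)         = old″ (here refl)
      ∈-expandV (step e (inj₁ _) w) (here refl)         = old″ (here refl)
      ∈-expandV (step e (inj₁ _) w) (there (here refl)) = new″ (here refl)
      ∈-expandV (step e (inj₁ _) w) (there (there i))   = weakenV (∈-expandV w i)
      ∈-expandV (step e (inj₂ _) w) (here refl)         = old″ (here refl)
      ∈-expandV (step e (inj₂ _) w) (there (here refl)) = new″ (here refl)
      ∈-expandV (step e (inj₂ _) w) (there (there i))   = weakenV (∈-expandV w i)

      ∈-expandE : ∀ {u v} (w : Walk H u v) {x} → x ∈ edges (expand w) → FromEdge (edges w) x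
      ∈-expandE (step e (inj₁ _) w) (here refl)         = first″ (here refl)
      ∈-expandE (step e (inj₁ _) w) (there (here refl)) = second″ (here refl)
      ∈-expandE (step e (inj₁ _) w) (there (there i))   = weakenE (∈-expandE w i)
      ∈-expandE (step e (inj₂ _) w) (here refl)         = second″ (here refl)
      ∈-expandE (step e (inj₂ _) w) (there (here refl)) = first″ (here refl)
      ∈-expandE (step e (inj₂ _) w) (there (there i))   = weakenE (∈-expandE w i)

      old∈ : ∀ {vs es x y} → FromVertex vs es y → y ≡ old x → x ∈ vs
      old∈ (old″ i) eq with refl ← old-injective eq = i
      old∈ (new″ i) eq = ⊥-elim (old≢new _ _ (sym eq))

      new∈ : ∀ {vs es e y} → FromVertex vs es y → y ≡ new e → e ∈ es
      new∈ (old″ i) eq = ⊥-elim (old≢new _ _ eq)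
      new∈ (new″ i) eq with refl ← new-injective eq = i

      edge∈ : ∀ {es es′ f} → FromEdge es f → FromEdge es′ f → ∃ λ e → e ∈ es × e ∈ es′
      edge∈ {es} {es′} a b = go a b refl
        where
        first≢second : ∀ (e e′ : E H) → e ↑ˡ m ≢ m ↑ʳ e′
        first≢second e e′ eq with () ← trans (sym (splitAt-↑ˡ m e m)) (trans (cong (splitAt m) eq) (splitAt-↑ʳ m m e′))
        go : ∀ {f g} → FromEdge es f → FromEdge es′ g → f ≡ g → ∃ λ e → e ∈ es × e ∈ es′
        go (first″ {e} i)  (first″ {e′} j)  eq with refl ← ↑ˡ-injective m e e′ eq = e , i , j
        go (second″ {e} i) (second″ {e′} j) eq with refl ← ↑ʳ-injective m e e′ eq = e , i , j
        go (first″ {e} i)  (second″ {e′} j) eq = ⊥-elim (first≢second e e′ eq)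
        go (second″ {e} i) (first″ {e′} j)  eq = ⊥-elim (first≢second e′ e (sym eq))

      subdivide-κ≥ : ∀ {u v} → u ≢ v → κ H u v ≤ κ S (old u) (old v)
      subdivide-κ≥ {u} {v} u≢v = κ-mono H S u≢v (u≢v ∘ old-injective) (mapPaths expand keeps)
        where
        keeps : ∀ p q → InternallyDisjoint p q → InternallyDisjoint (expand p) (expand q)
        keeps p q (dE , dV) = All.tabulate edgesApart , All.tabulate (λ {x} i → verticesApart (∈-expandV p i))
          where
          edgesApart : ∀ {f} → f ∈ edges (expand p) → f ∈ edges (expand q) → ⊥
          edgesApart i j with e , a , b ← edge∈ (∈-expandE p i) (∈-expandE q j) = All.lookup dE a b
          verticesApart : ∀ {x} → FromVertex (vertices p) (edges p) x → x ∈ vertices (expand q) → x ≡ old u ⊎ x ≡ old v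
          verticesApart (new″ i) j = ⊥-elim (All.lookup dE i (new∈ (∈-expandV q j) refl))
          verticesApart (old″ i) j with All.lookup dV i (old∈ (∈-expandV q j) refl)
          ... | inj₁ refl = inj₁ refl
          ... | inj₂ refl = inj₂ refl

      private
        incident-new : ∀ {f x e} → Joins S f (old x) (new e) → Incident H x e
        incident-new {f} j with edgeView f
        ... | first′ e′ with j
        ...   | inj₁ eq with refl ← new-injective (cong proj₂ (trans (sym (ends-first e′)) eq)) =
                inj₁ (sym (old-injective (cong proj₁ (trans (sym (ends-first e′)) eq))))
        ...   | inj₂ eq = ⊥-elim (old≢new _ _ (cong proj₁ (trans (sym (ends-first e′)) eq)))
        incident-new {f} j | second′ e′ with j
        ...   | inj₁ eq with refl ← new-injective (cong proj₂ (trans (sym (ends-second e′)) eq)) =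
                inj₂ (sym (old-injective (cong proj₁ (trans (sym (ends-second e′)) eq))))
        ...   | inj₂ eq = ⊥-elim (old≢new _ _ (cong proj₁ (trans (sym (ends-second e′)) eq)))

        bipartite : ∀ f → ∃ λ a → ∃ λ e → ends S f ≡ (old a , new e)
        bipartite f with edgeView f
        ... | first′ e  = _ , e , ends-first e
        ... | second′ e = _ , e , ends-second e

        old-old : ∀ {f x y} → Joins S f (old x) (old y) → ⊥
        old-old {f} (inj₁ eq) with a , e , eq′ ← bipartite f = old≢new _ e (cong proj₂ (trans (sym eq) eq′))
        old-old {f} (inj₂ eq) with a , e , eq′ ← bipartite f = old≢new _ e (cong proj₂ (trans (sym eq) eq′))

        new-new : ∀ {f x y} → Joins S f (new x) (new y) → ⊥
        new-new {f} (inj₁ eq) with a , e , eq′ ← bipartite f = old≢new a _ (cong proj₁ (trans (sym eq′) eq))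
        new-new {f} (inj₂ eq) with a , e , eq′ ← bipartite f = old≢new a _ (cong proj₁ (trans (sym eq′) eq))

        incident⇒Joins : ∀ {e x y} → Incident H x e → Incident H y e → x ≢ y → Joins H e x y
        incident⇒Joins (inj₁ refl) (inj₁ refl) x≢y = ⊥-elim (x≢y refl)
        incident⇒Joins (inj₁ refl) (inj₂ refl) x≢y = inj₁ refl
        incident⇒Joins (inj₂ refl) (inj₁ refl) x≢y = inj₂ refl
        incident⇒Joins (inj₂ refl) (inj₂ refl) x≢y = ⊥-elim (x≢y refl)

      -- Edges of `H` are traced by their new vertices instead of their halves. New vertices are
      -- never ends of the walks in question, so vertex-disjointness in the subdivision yields
      -- edge-disjointness in `H`.
      record Contraction {x y} (w : Walk S x y) (u v : V H) : Set where
        field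
          walk : Walk H u v
          ⊆V   : ∀ {z} → z ∈ vertices walk → old z ∈ vertices w
          ⊆E   : ∀ {e} → e ∈ edges walk → new e ∈ vertices w

      -- The subdivision is bipartite, so a walk between old vertices is read two steps at a time.
      -- Two steps that go to a new vertex and back correspond to no edge and are dropped.
      contract : ∀ {x y} (w : Walk S x y) {u v} → x ≡ old u → y ≡ old v → Contraction w u v
      contract [] refl eq with refl ← old-injective eq = record { walk = [] ; ⊆V = λ { (here refl) → here refl } ; ⊆E = λ () }
      contract (step {w = y} f j []) refl refl = ⊥-elim (old-old j)
      contract (step {w = y} f j (step {w = z} f′ j′ w)) {u} refl refl with vertexView y | vertexView z
      ... | old′ _ | _      = ⊥-elim (old-old j)
      ... | new′ _ | new′ _ = ⊥-elim (new-new j′)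
      ... | new′ e | old′ a with contract w {a} refl refl | a ≟ u
      ...   | c | yes refl = record
        { walk = Contraction.walk c ; ⊆V = λ i → there (there (Contraction.⊆V c i)) ; ⊆E = λ i → there (there (Contraction.⊆E c i)) }
      ...   | c | no a≢u = record
        { walk = step e (incident⇒Joins (incident-new j) (incident-new (flipJoins j′)) (a≢u ∘ sym)) (Contraction.walk c)
        ; ⊆V = λ { (here refl) → here refl ; (there i) → there (there (Contraction.⊆V c i)) }
        ; ⊆E = λ { (here refl) → there (here refl) ; (there i) → there (there (Contraction.⊆E c i)) } }
        where
        flipJoins : ∀ {f x y} → Joins S f x y → Joins S f y x
        flipJoins (inj₁ eq) = inj₂ eq
        flipJoins (inj₂ eq) = inj₁ eq

      subdivide-κ≤ : ∀ {u v} → u ≢ v → κ S (old u) (old v) ≤ κ H u v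
      subdivide-κ≤ {u} {v} u≢v = κ-mono S H (u≢v ∘ old-injective) u≢v (mapPaths (λ w → Contraction.walk (contract w {u} {v} refl refl)) keeps)
        where
        keeps : (p q : Walk S (old u) (old v)) → InternallyDisjoint p q → InternallyDisjoint (Contraction.walk (contract p {u} {v} refl refl)) (Contraction.walk (contract q {u} {v} refl refl))
        keeps p q (dE , dV) = All.tabulate edgesApart , All.tabulate verticesApart
          where
          open Contraction (contract p {u} {v} refl refl) renaming (walk to p′; ⊆V to pV; ⊆E to pE)
          open Contraction (contract q {u} {v} refl refl) renaming (walk to q′; ⊆V to qV; ⊆E to qE)
          edgesApart : ∀ {e} → e ∈ edges p′ → e ∈ edges q′ → ⊥
          edgesApart i j with All.lookup dV (pE i) (qE j)
          ... | inj₁ eq = old≢new _ _ (sym eq)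
          ... | inj₂ eq = old≢new _ _ (sym eq)
          verticesApart : ∀ {z} → z ∈ vertices p′ → z ∈ vertices q′ → z ≡ u ⊎ z ≡ v
          verticesApart i j with All.lookup dV (pV i) (qV j)
          ... | inj₁ eq = inj₁ (old-injective eq)
          ... | inj₂ eq = inj₂ (old-injective eq)

  -- Recognising a graph as a subdivision.

  record Partition {n} (P : Fin n → Set) : Set where
    field
      {a b} : ℕ
      bij   : Fin n ↔ (Fin a ⊎ Fin b)
      holds : ∀ i → P (Inverse.from bij (inj₁ i))
      fails : ∀ j → ¬ P (Inverse.from bij (inj₂ j))

  partition : ∀ {n} {P : Fin n → Set} → Decidable P → Partition P
  partition {zero} P? = record
    { a = 0 ; b = 0 ; bij = mk↔ₛ′ (λ ()) (λ { (inj₁ ()) ; (inj₂ ()) }) (λ { (inj₁ ()) ; (inj₂ ()) }) (λ ()) ; holds = λ () ; fails = λ () }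
  partition {suc n} {P} P? with partition (P? ∘ suc) | P? zero
  ... | record { a = a ; b = b ; bij = φ ; holds = holds ; fails = fails } | yes p = record
    { bij = mk↔ₛ′ to′ from′ to∘from from∘to ; holds = λ { zero → p ; (suc i) → holds i } ; fails = fails }
    where
    raise : Fin a ⊎ Fin b → Fin (suc a) ⊎ Fin b
    raise (inj₁ i) = inj₁ (suc i)
    raise (inj₂ j) = inj₂ j
    to′ : Fin (suc n) → Fin (suc a) ⊎ Fin b
    to′ zero    = inj₁ zero
    to′ (suc x) = raise (Inverse.to φ x)
    from′ : Fin (suc a) ⊎ Fin b → Fin (suc n)
    from′ (inj₁ zero)    = zero
    from′ (inj₁ (suc i)) = suc (Inverse.from φ (inj₁ i))
    from′ (inj₂ j)       = suc (Inverse.from φ (inj₂ j))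
    to∘from : ∀ y → to′ (from′ y) ≡ y
    to∘from (inj₁ zero)    = refl
    to∘from (inj₁ (suc i)) = cong raise (Inverse.strictlyInverseˡ φ (inj₁ i))
    to∘from (inj₂ j)       = cong raise (Inverse.strictlyInverseˡ φ (inj₂ j))
    from-raise : ∀ y → from′ (raise y) ≡ suc (Inverse.from φ y)
    from-raise (inj₁ i) = refl
    from-raise (inj₂ j) = refl
    from∘to : ∀ x → from′ (to′ x) ≡ x
    from∘to zero    = refl
    from∘to (suc x) = trans (from-raise (Inverse.to φ x)) (cong suc (Inverse.strictlyInverseʳ φ x))
  ... | record { a = a ; b = b ; bij = φ ; holds = holds ; fails = fails } | no ¬p = record
    { bij = mk↔ₛ′ to′ from′ to∘from from∘to ; holds = holds ; fails = λ { zero → ¬p ; (suc j) → fails j } }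
    where
    raise : Fin a ⊎ Fin b → Fin a ⊎ Fin (suc b)
    raise (inj₁ i) = inj₁ i
    raise (inj₂ j) = inj₂ (suc j)
    to′ : Fin (suc n) → Fin a ⊎ Fin (suc b)
    to′ zero    = inj₂ zero
    to′ (suc x) = raise (Inverse.to φ x)
    from′ : Fin a ⊎ Fin (suc b) → Fin (suc n)
    from′ (inj₁ i)       = suc (Inverse.from φ (inj₁ i))
    from′ (inj₂ zero)    = zero
    from′ (inj₂ (suc j)) = suc (Inverse.from φ (inj₂ j))
    to∘from : ∀ y → to′ (from′ y) ≡ y
    to∘from (inj₁ i)       = cong raise (Inverse.strictlyInverseˡ φ (inj₁ i))
    to∘from (inj₂ zero)    = refl
    to∘from (inj₂ (suc j)) = cong raise (Inverse.strictlyInverseˡ φ (inj₂ j))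
    from-raise : ∀ y → from′ (raise y) ≡ suc (Inverse.from φ y)
    from-raise (inj₁ i) = refl
    from-raise (inj₂ j) = refl
    from∘to : ∀ x → from′ (to′ x) ≡ x
    from∘to zero    = refl
    from∘to (suc x) = trans (from-raise (Inverse.to φ x)) (cong suc (Inverse.strictlyInverseʳ φ x))

  module Unsubdivide
    (G : Graph) (conn : HasConnectivity G 2) {Big : V G → Set} (Big? : Decidable Big)
    (one-big : ∀ e → Big (proj₁ (ends G e)) × ¬ Big (proj₂ (ends G e)) ⊎ ¬ Big (proj₁ (ends G e)) × Big (proj₂ (ends G e)))
    (degree≡2 : ∀ {x} → ¬ Big x → degree G x ≡ 2)
    where

    open GraphPiece
    open Paths
    open Transfer
    open Partition (partition Big?)
    open Inverse bij using (to; from; strictlyInverseˡ; strictlyInverseʳ)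

    private
      n = order G
      m = size G

      big : Fin a → V G
      big = from ∘ inj₁

      small : Fin b → V G
      small = from ∘ inj₂

      from-injective : ∀ {x y} → from x ≡ from y → x ≡ y
      from-injective {x} {y} eq = trans (sym (strictlyInverseˡ x)) (trans (cong to eq) (strictlyInverseˡ y))

      small-injective : ∀ {i j} → small i ≡ small j → i ≡ j
      small-injective = inj₂-injective ∘ from-injective

      big≢small : ∀ {i j} → big i ≢ small j
      big≢small eq with () ← from-injective eq

      bigIndex : ∀ {x} → Big x → ∃ λ i → big i ≡ x
      bigIndex {x} B with to x in eq | strictlyInverseʳ x
      ... | inj₁ i | p = i , p
      ... | inj₂ j | p = ⊥-elim (fails j (subst Big (sym p) B))

      smallIndex : ∀ {x} → ¬ Big x → ∃ λ j → small j ≡ x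
      smallIndex {x} ¬B with to x in eq | strictlyInverseʳ x
      ... | inj₁ i | p = ⊥-elim (¬B (subst Big p (holds i)))
      ... | inj₂ j | p = j , p

      record EndsAt (e : E G) : Set where
        constructor endsAt
        field
          i : Fin a
          j : Fin b
          joins : Joins G e (big i) (small j)

      endsOf : ∀ e → EndsAt e
      endsOf e with one-big e
      ... | inj₁ (B , ¬B) with i , p ← bigIndex B | j , q ← smallIndex ¬B = endsAt i j (inj₁ (sym (cong₂ _,_ p q)))
      ... | inj₂ (¬B , B) with i , p ← bigIndex B | j , q ← smallIndex ¬B = endsAt i j (inj₂ (sym (cong₂ _,_ q p)))

      incident⇒ : ∀ {x u v e} → Joins G e u v → Incident G x e → x ≡ u ⊎ x ≡ v
      incident⇒ (inj₁ eq) (inj₁ p) = inj₁ (trans p (cong proj₁ eq))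
      incident⇒ (inj₁ eq) (inj₂ p) = inj₂ (trans p (cong proj₂ eq))
      incident⇒ (inj₂ eq) (inj₁ p) = inj₂ (trans p (cong proj₁ eq))
      incident⇒ (inj₂ eq) (inj₂ p) = inj₁ (trans p (cong proj₂ eq))

      small-unique : ∀ {e i j k} → Joins G e (big i) (small j) → Incident G (small k) e → k ≡ j
      small-unique jn inc with incident⇒ jn inc
      ... | inj₁ eq = ⊥-elim (big≢small (sym eq))
      ... | inj₂ eq = small-injective eq

      record EdgePair (z : V G) : Set where
        field
          e₁ e₂    : E G
          distinct : e₁ ≢ e₂
          at₁      : Incident G z e₁
          at₂      : Incident G z e₂
          only     : ∀ {e} → Incident G z e → e ≡ e₁ ⊎ e ≡ e₂

      edgePair : ∀ z → degree G z ≡ 2 → EdgePair z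
      edgePair z d = go (filter (incident? G z) (allFin m)) refl d
        where
        go : ∀ es → filter (incident? G z) (allFin m) ≡ es → length es ≡ 2 → EdgePair z
        go (e₁ ∷ e₂ ∷ []) eq refl = record
          { e₁ = e₁ ; e₂ = e₂ ; distinct = distinct (subst Unique eq (Unique.filter⁺ (incident? G z) (allFin⁺ m)))
          ; at₁ = at (here refl) ; at₂ = at (there (here refl)) ; only = λ {e} inc → listed (subst (e ∈_) eq (∈-filter⁺ (incident? G z) (∈-allFin e) inc)) }
          where
          distinct : Unique (e₁ ∷ e₂ ∷ []) → e₁ ≢ e₂
          distinct ((e₁≢e₂ ∷ []) ∷ _) = e₁≢e₂
          at : ∀ {e} → e ∈ e₁ ∷ e₂ ∷ [] → Incident G z e
          at {e} i = proj₂ (∈-filter⁻ (incident? G z) {xs = allFin m} (subst (e ∈_) (sym eq) i))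
          listed : ∀ {e} → e ∈ e₁ ∷ e₂ ∷ [] → e ≡ e₁ ⊎ e ≡ e₂
          listed (here eq)         = inj₁ eq
          listed (there (here eq)) = inj₂ eq

      pair : ∀ j → EdgePair (small j)
      pair j = edgePair (small j) (degree≡2 (fails j))

      first second : Fin b → E G
      first j  = EdgePair.e₁ (pair j)
      second j = EdgePair.e₂ (pair j)

      bigEnd : E G → Fin a
      bigEnd e = EndsAt.i (endsOf e)

      smallEnd : E G → Fin b
      smallEnd e = EndsAt.j (endsOf e)

      smallEnd-≡ : ∀ {e j} → Incident G (small j) e → smallEnd e ≡ j
      smallEnd-≡ {e} inc = sym (small-unique (EndsAt.joins (endsOf e)) inc)

      -- If both edges at a vertex of degree 2 led to the same vertex, that one
      -- would be a cut vertex.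
      differentEnds : ∀ j → bigEnd (first j) ≢ bigEnd (second j)
      differentEnds j eq with w , w≢y , w≢z ← third-vertex (3≤order G conn) (big (bigEnd (first j))) (small j) =
        n≮n 1 (≤-trans (2≤cost G conn σ {small j} {w} σz (trans (update-≢ (single (small j)) middle w≢y) (single-other w≢z)))
          (+-mono-≤ (≤-trans (∑-mono (allFin n) (λ {x} _ → one x)) (≤-reflexive (∑-δ₁ _≟_ (allFin⁺ n) (∈-allFin y))))
            (≤-reflexive (trans (∑-edgeList G (cut σ)) (∑-zero (allFin m) (λ {e} _ → uncut e (incident? G (small j) e)))))))
        where
        y = big (bigEnd (first j))
        σ = single (small j) [ y ↦ middle ]
        σz : σ (small j) ≡ left
        σz = trans (update-≢ (single (small j)) middle (λ eq → big≢small (sym eq))) (update-≡ (λ _ → right) (small j) left)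
        σy : σ y ≡ middle
        σy = update-≡ (single (small j)) y middle
        one : ∀ x → isMiddle (σ x) ≤ 𝟙 (x ≟ y)
        one x with x ≟ y
        ... | yes _ = ≤-refl
        ... | no _  = ≤-reflexive (isMiddle-single (small j) x)
        atPair : ∀ {e} → Joins G e y (small j) → cut σ (ends G e) ≡ 0
        atPair jn = trans (cut-Joins G σ jn) (cong (λ ℓ → cross ℓ (σ (small j))) σy)
        joinsPair : ∀ {e} → Incident G (small j) e → bigEnd e ≡ bigEnd (first j) → Joins G e y (small j)
        joinsPair {e} inc eq = subst₂ (λ i k → Joins G e (big i) (small k)) eq (smallEnd-≡ inc) (EndsAt.joins (endsOf e))
        uncut : ∀ e → Dec (Incident G (small j) e) → cut σ (ends G e) ≡ 0
        uncut e (yes inc) with EdgePair.only (pair j) inc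
        ... | inj₁ refl = atPair (joinsPair inc refl)
        ... | inj₂ refl = atPair (joinsPair inc (sym eq))
        uncut e (no ¬inc) = n≤0⇒n≡0 (≤-trans (cut-update≤ (single (small j)) y (ends G e))
          (≤-reflexive (cong₂ cross (single-other (¬inc ∘ inj₁ ∘ sym)) (single-other (¬inc ∘ inj₂ ∘ sym)))))

    H : Graph
    H = record { order = a ; size = b ; ends = λ j → bigEnd (first j) , bigEnd (second j) ; loopless = differentEnds }

    private
      choose : ∀ e j → Dec (e ≡ first j) → Fin b ⊎ Fin b
      choose e j (yes _) = inj₁ j
      choose e j (no _)  = inj₂ j

      -- A vertex `j` of degree 2 becomes an edge of `H`, and its two edges become the halves of
      -- that edge. Every edge has a unique small end, so it suffices to ask whether it is the first
      -- edge there.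
      toE : E G → Fin b ⊎ Fin b
      toE e = choose e (smallEnd e) (e ≟ first (smallEnd e))

      fromE : Fin b ⊎ Fin b → E G
      fromE (inj₁ j) = first j
      fromE (inj₂ j) = second j

      toE-≡ : ∀ {e j} → Incident G (small j) e → toE e ≡ choose e j (e ≟ first j)
      toE-≡ {e} inc = cong (λ j → choose e j (e ≟ first j)) (smallEnd-≡ inc)

      to∘fromE : ∀ x → toE (fromE x) ≡ x
      to∘fromE (inj₁ j) = trans (toE-≡ (EdgePair.at₁ (pair j))) (pick₁ (first j ≟ first j))
        where
        pick₁ : (d : Dec (first j ≡ first j)) → choose (first j) j d ≡ inj₁ j
        pick₁ (yes _) = refl
        pick₁ (no ¬p) = ⊥-elim (¬p refl)
      to∘fromE (inj₂ j) = trans (toE-≡ (EdgePair.at₂ (pair j))) (pick₂ (second j ≟ first j))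
        where
        pick₂ : (d : Dec (second j ≡ first j)) → choose (second j) j d ≡ inj₂ j
        pick₂ (yes p) = ⊥-elim (EdgePair.distinct (pair j) (sym p))
        pick₂ (no _)  = refl

      atSmallEnd : ∀ e → Incident G (small (smallEnd e)) e
      atSmallEnd e = Joins⇒incidentʳ {G} (EndsAt.joins (endsOf e))

      choose-inv : ∀ e j (d : Dec (e ≡ first j)) → Incident G (small j) e → fromE (choose e j d) ≡ e
      choose-inv e j (yes p) inc = sym p
      choose-inv e j (no ¬p) inc with EdgePair.only (pair j) inc
      ... | inj₁ p = ⊥-elim (¬p p)
      ... | inj₂ p = sym p

      from∘toE : ∀ e → fromE (toE e) ≡ e
      from∘toE e = choose-inv e (smallEnd e) (e ≟ first (smallEnd e)) (atSmallEnd e)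

      onV : Fin n ↔ Fin (a + b)
      onV = ↔-sym (+↔⊎ {a} {b}) ↔-∘ bij

      onE : Fin m ↔ Fin (b + b)
      onE = ↔-sym (+↔⊎ {b} {b}) ↔-∘ mk↔ₛ′ toE fromE to∘fromE from∘toE

      halfEdge : ∀ e j (d : Dec (e ≡ first j)) → Incident G (small j) e →
                 ends (subdivide H) (join b b (choose e j d)) ≡ (old H (bigEnd e) , new H j)
      halfEdge e j (yes refl) inc = ends-first H j
      halfEdge e j (no ¬p) inc with EdgePair.only (pair j) inc
      ... | inj₁ p    = ⊥-elim (¬p p)
      ... | inj₂ refl = ends-second H j

      onV-big : ∀ i → Inverse.to onV (big i) ≡ old H i
      onV-big i = cong (join a b) (strictlyInverseˡ (inj₁ i))

      onV-small : ∀ j → Inverse.to onV (small j) ≡ new H j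
      onV-small j = cong (join a b) (strictlyInverseˡ (inj₂ j))

      preserves : ∀ e {u v} → Joins G e u v → Joins (subdivide H) (Inverse.to onE e) (Inverse.to onV u) (Inverse.to onV v)
      preserves e {u} {v} jn = go jn (EndsAt.joins (endsOf e))
        where
        i = bigEnd e
        j = smallEnd e
        image : ends (subdivide H) (Inverse.to onE e) ≡ (Inverse.to onV (big i) , Inverse.to onV (small j))
        image = trans (halfEdge e j (e ≟ first j) (atSmallEnd e)) (sym (cong₂ _,_ (onV-big i) (onV-small j)))
        φ = Inverse.to onV
        go : Joins G e u v → Joins G e (big i) (small j) → Joins (subdivide H) (Inverse.to onE e) (φ u) (φ v)
        go (inj₁ p) (inj₁ q) with refl , refl ← ,-injective (trans (sym p) q) = inj₁ image
        go (inj₁ p) (inj₂ q) with refl , refl ← ,-injective (trans (sym p) q) = inj₂ image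
        go (inj₂ p) (inj₁ q) with refl , refl ← ,-injective (trans (sym p) q) = inj₂ image
        go (inj₂ p) (inj₂ q) with refl , refl ← ,-injective (trans (sym p) q) = inj₁ image

    iso : G ≅ subdivide H
    iso = record { onV = onV ; onE = onE ; preserves = preserves }

    original : V H → V G
    original = big

    original-≡ : ∀ x → Inverse.from onV (old H x) ≡ original x
    original-≡ x = cong from (splitAt-↑ˡ a x b)

    original-big : ∀ x → Big (original x)
    original-big = holds

    order≡∑ : order H ≡ ∑Fin n (𝟙 ∘ Big?)
    order≡∑ = sym (begin
      ∑Fin n (𝟙 ∘ Big?)                               ≡⟨ ∑-cong (allFin n) (λ {x} _ → cong (𝟙 ∘ Big?) (sym (Inverse.strictlyInverseʳ onV x))) ⟩
      ∑Fin n (𝟙 ∘ Big? ∘ Inverse.from onV ∘ Inverse.to onV) ≡⟨ ∑Fin-↔ onV (𝟙 ∘ Big? ∘ Inverse.from onV) ⟩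
      ∑Fin (a + b) (𝟙 ∘ Big? ∘ Inverse.from onV)      ≡⟨ ∑Fin-+ a b _ ⟩
      ∑Fin a (𝟙 ∘ Big? ∘ Inverse.from onV ∘ (_↑ˡ b)) + ∑Fin b (𝟙 ∘ Big? ∘ Inverse.from onV ∘ (a ↑ʳ_))
        ≡⟨ cong₂ _+_ (trans (∑-cong (allFin a) (λ {i} _ → 𝟙-yes (Big? _) (subst Big (sym (cong from (splitAt-↑ˡ a i b))) (holds i)))) (trans (∑Fin-const a 1) (*-identityʳ a)))
                     (∑-zero (allFin b) (λ {j} _ → 𝟙-no (Big? _) (λ B → fails j (subst Big (cong from (splitAt-↑ʳ a b j)) B)))) ⟩
      a + 0                                           ≡⟨ +-identityʳ a ⟩
      a                                               ∎)
      where open ≡-Reasoning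

  ≅⇒order : ∀ {G H} → G ≅ H → order G ≡ order H
  ≅⇒order {G} {H} φ = trans (sym (*-identityʳ (order G))) (trans (sym (∑Fin-const (order G) 1))
    (trans (∑Fin-↔ (_≅_.onV φ) (λ _ → 1)) (trans (∑Fin-const (order H) 1) (*-identityʳ (order H)))))

  -- The bounds for a graph and its structure in the case of equality.

  module Extremal (G : Graph) (min2conn : Minimally2Connected G) where

    open GraphPiece
    open Paths
    open Transfer
    open PieceInduction {Fin (order G)} _≟_

    n : ℕ
    n = order G

    P : Piece (allFin n) (edgeList G) (κ₀ G)
    P = graphPiece G min2conn

    w : V G → ℕ
    w = weight P

    open Weights _≟_ (allFin n) (allFin⁺ n) w public

    X : ℕ
    X = excess (allFin n) (κ₀ G)

    length-allFin : length (allFin n) ≡ n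
    length-allFin = length-tabulate id

    general-bound : 4 * X ≤ (n ∸ 2) * (n ∸ 2)
    general-bound = subst (λ l → 4 * X ≤ (l ∸ 2) * (l ∸ 2)) length-allFin (excess-bound P)

    heavy : ∀ {u v} → (u , v) ∈ edgeList G → 3 ≤ deg (edgeList G) u → 3 ≤ deg (edgeList G) v → 4 * X + 8 * n ≤ n * n + 25
    heavy i du dv = fromCut (cut-bound P i du dv)
      where
      fromCut : CutBound (allFin n) (κ₀ G) → 4 * X + 8 * n ≤ n * n + 25
      fromCut (a , b , 3≤a , 3≤b , total , le) = ≤-trans (+-monoˡ-≤ (8 * n) le) (cut-arith 3≤a 3≤b (trans total length-allFin))

    dichotomy : 4 * X + 8 * n ≤ n * n + 25 ⊎ Independent P
    dichotomy = fromEdge (heavyEdge? P)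
      where
      fromEdge : _ → 4 * X + 8 * n ≤ n * n + 25 ⊎ Independent P
      fromEdge (inj₁ (u , v , i , du , dv)) = inj₁ (heavy i du dv)
      fromEdge (inj₂ independent)           = inj₂ independent

    open Outcomes n X p W Y (Independent P) (λ q → ∀ x → 1 ≤ w x → w x ≡ q ⊎ w x ≡ suc q)
      (excess≤Y P) average-bound regular-bound
      (λ q r 2≤r W≤ h → proj₁ (regular-tight q r 2≤r W≤ h) , λ x → proj₂ (regular-tight q r 2≤r W≤ h) (∈-allFin x))
      (λ independent → subst (λ l → W + 4 * p ≤ 2 * l) length-allFin (W+4p≤2N P independent)) dichotomy public

    2≤degree : ∀ x → 2 ≤ degree G x
    2≤degree x with y , y≢x , _ ← third-vertex (3≤order G (proj₁ min2conn)) x x =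
      ≤-trans (2≤κ G (proj₁ min2conn) (y≢x ∘ sym)) (≤-trans (κ≤degrees G (y≢x ∘ sym)) (m⊓n≤m _ _))

    w+2 : ∀ x → degree G x ≡ w x + 2
    w+2 x = trans (sym (m∸n+n≡m (2≤degree x))) (cong (λ d → d ∸ 2 + 2) (degree≡deg G x))

    record Subdivided (q p₀ : ℕ) : Set where
      field
        H       : Graph
        ideal   : IdeallyConnected H
        degrees-H : ∀ v → degree H v ≡ q + 2 ⊎ degree H v ≡ suc (q + 2)
        order≡  : order H ≡ p₀
        iso     : G ≅ subdivide H

    structure⇒subdivided : ∀ {q p₀} → Structure q p₀ → Subdivided q p₀
    structure⇒subdivided {q} {p₀} S = record
      { H = H ; ideal = λ u v u≢v → ≤-antisym (κ≤degrees H u≢v) (ideal u≢v) ; degrees-H = degrees-H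
      ; order≡ = trans order≡∑ p≡ ; iso = iso }
      where
      open Structure S

      full′ : 2 * length (allFin n) ≤ W + 4 * p
      full′ = subst (λ l → 2 * l ≤ W + 4 * p) (sym length-allFin) full

      Big : V G → Set
      Big x = 1 ≤ w x

      -- Independence rules out two large ends, and equality in the count rules out two small ones.
      one-big : ∀ e → Big (proj₁ (ends G e)) × ¬ Big (proj₂ (ends G e)) ⊎ ¬ Big (proj₁ (ends G e)) × Big (proj₂ (ends G e))
      one-big e = cases (∈-map⁺ (ends G) (∈-allFin e)) (1 ≤? w (proj₁ (ends G e))) (1 ≤? w (proj₂ (ends G e)))
        where
        cases : ∀ {x y} → (x , y) ∈ edgeList G → Dec (Big x) → Dec (Big y) → Big x × ¬ Big y ⊎ ¬ Big x × Big y
        cases i (yes p) (yes q) = ⊥-elim (independent i p q)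
        cases i (yes p) (no q)  = inj₁ (p , q)
        cases i (no p)  (yes q) = inj₂ (p , q)
        cases i (no p)  (no q)  = ⊥-elim (small-end P independent full′ i p q)

      open Unsubdivide G (proj₁ min2conn) {Big} (λ x → 1 ≤? w x) one-big
        (λ {x} small → trans (degree≡deg G x) (small⇒deg≡2 P independent full′ (∈-allFin x) small))

      toOld : ∀ v → Inverse.to (_≅_.onV iso) (original v) ≡ old H v
      toOld v = trans (cong (Inverse.to (_≅_.onV iso)) (sym (original-≡ v))) (Inverse.strictlyInverseˡ (_≅_.onV iso) (old H v))

      degree-H : ∀ v → degree H v ≡ degree G (original v)
      degree-H v = begin
        degree H v                             ≡⟨ degree≡graphDeg H v ⟩
        graphDeg H v                           ≡⟨ sym (subdivide-deg-old H v) ⟩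
        graphDeg (subdivide H) (old H v)       ≡⟨ cong (graphDeg (subdivide H)) (sym (toOld v)) ⟩
        graphDeg (subdivide H) (Inverse.to (_≅_.onV iso) (original v)) ≡⟨ sym (≅-deg iso (original v)) ⟩
        graphDeg G (original v)                ≡⟨ sym (degree≡graphDeg G (original v)) ⟩
        degree G (original v)                  ∎
        where open ≡-Reasoning

      degrees-H : ∀ v → degree H v ≡ q + 2 ⊎ degree H v ≡ suc (q + 2)
      degrees-H v = byValue (values (original v) (original-big v))
        where
        byValue : w (original v) ≡ q ⊎ w (original v) ≡ suc q → degree H v ≡ q + 2 ⊎ degree H v ≡ suc (q + 2)
        byValue (inj₁ eq) = inj₁ (trans (degree-H v) (trans (w+2 (original v)) (cong (_+ 2) eq)))
        byValue (inj₂ eq) = inj₂ (trans (degree-H v) (trans (w+2 (original v)) (cong (_+ 2) eq)))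

      pair≤ : ∀ x y → κ₀ G x y ∸ 2 ≤ 𝟙 (¬? (x ≟ y)) * (w x ⊓ w y)
      pair≤ x y = byEquality (x ≟ y)
        where
        open ≤-Reasoning
        byEquality : Dec (x ≡ y) → κ₀ G x y ∸ 2 ≤ 𝟙 (¬? (x ≟ y)) * (w x ⊓ w y)
        byEquality (yes refl) = subst (λ k → k ∸ 2 ≤ 𝟙 (¬? (x ≟ x)) * (w x ⊓ w x)) (sym (Piece.diag P x)) z≤n
        byEquality (no x≢y) = begin
          κ₀ G x y ∸ 2                            ≡⟨ cong (_∸ 2) (κ₀-≢ G x≢y) ⟩
          κ G x y ∸ 2                             ≤⟨ ∸-monoˡ-≤ 2 (κ≤degrees G x≢y) ⟩
          degree G x ⊓ degree G y ∸ 2             ≡⟨ ∸-distribʳ-⊓ 2 (degree G x) (degree G y) ⟩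
          (degree G x ∸ 2) ⊓ (degree G y ∸ 2)     ≡⟨ cong₂ (λ a b → (a ∸ 2) ⊓ (b ∸ 2)) (degree≡deg G x) (degree≡deg G y) ⟩
          w x ⊓ w y                               ≡⟨ sym (*-identityˡ (w x ⊓ w y)) ⟩
          1 * (w x ⊓ w y)                         ≡⟨ cong (_* (w x ⊓ w y)) (sym (𝟙-yes (¬? (x ≟ y)) x≢y)) ⟩
          𝟙 (¬? (x ≟ y)) * (w x ⊓ w y)            ∎

      tight : ∀ x y → κ₀ G x y ∸ 2 ≡ 𝟙 (¬? (x ≟ y)) * (w x ⊓ w y)
      tight x y = ∑-tight (allFin n) (λ {y} _ → pair≤ x y) (≤-reflexive (sym rows)) (∈-allFin y)
        where
        rows : ∑Fin n (λ y → κ₀ G x y ∸ 2) ≡ ∑Fin n (λ y → 𝟙 (¬? (x ≟ y)) * (w x ⊓ w y))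
        rows = ∑-tight (allFin n) (λ {x} _ → ∑-mono (allFin n) (λ {y} _ → pair≤ x y)) Y≤X (∈-allFin x)

      -- `Y ≤ X` closes the estimate of κ by the degrees pair by pair. What remains is the truncated
      -- subtraction of 2, which is undone by Whitney's theorem.
      κ-original : ∀ {x y} → x ≢ y → degree G x ⊓ degree G y ≤ κ G x y
      κ-original {x} {y} x≢y = begin
        degree G x ⊓ degree G y      ≡⟨ cong₂ _⊓_ (w+2 x) (w+2 y) ⟩
        (w x + 2) ⊓ (w y + 2)        ≡⟨ sym (+-distribʳ-⊓ 2 (w x) (w y)) ⟩
        (w x ⊓ w y) + 2              ≡⟨ cong (_+ 2) (sym (trans (tight x y) (trans (cong (_* (w x ⊓ w y)) (𝟙-yes (¬? (x ≟ y)) x≢y)) (*-identityˡ (w x ⊓ w y))))) ⟩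
        κ₀ G x y ∸ 2 + 2             ≡⟨ cong (λ k → k ∸ 2 + 2) (κ₀-≢ G x≢y) ⟩
        κ G x y ∸ 2 + 2              ≡⟨ m∸n+n≡m (2≤κ G (proj₁ min2conn) x≢y) ⟩
        κ G x y                      ∎
        where open ≤-Reasoning

      original-injective : ∀ {u v} → original u ≡ original v → u ≡ v
      original-injective {u} {v} eq = old-injective H (trans (sym (toOld u)) (trans (cong (Inverse.to (_≅_.onV iso)) eq) (toOld v)))

      ideal : ∀ {u v} → u ≢ v → degree H u ⊓ degree H v ≤ κ H u v
      ideal {u} {v} u≢v = begin
        degree H u ⊓ degree H v                       ≡⟨ cong₂ _⊓_ (degree-H u) (degree-H v) ⟩
        degree G (original u) ⊓ degree G (original v) ≤⟨ κ-original (u≢v ∘ original-injective) ⟩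
        κ G (original u) (original v)                 ≤⟨ ≅-κ≤ iso (u≢v ∘ original-injective) ⟩
        κ (subdivide H) (Inverse.to (_≅_.onV iso) (original u)) (Inverse.to (_≅_.onV iso) (original v))
                                                      ≡⟨ cong₂ (κ (subdivide H)) (toOld u) (toOld v) ⟩
        κ (subdivide H) (old H u) (old H v)           ≤⟨ subdivide-κ≤ H u≢v ⟩
        κ H u v                                       ∎
        where open ≤-Reasoning

  -- Degree sums and near regularity.

  module Degrees (H : Graph) where

    open GraphPiece
    open Transfer

    degreeSum : ∑Fin (order H) (degree H) ≡ 2 * size H
    degreeSum = begin
      ∑Fin (order H) (degree H)                                   ≡⟨ ∑-cong (allFin (order H)) (λ {v} _ → degree≡graphDeg H v) ⟩
      ∑Fin (order H) (λ v → ∑Fin (size H) (inc v ∘ ends H))       ≡⟨ ∑-swap (allFin (order H)) (allFin (size H)) ⟩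
      ∑Fin (size H) (λ e → ∑Fin (order H) (λ v → inc v (ends H e))) ≡⟨ ∑-cong (allFin (size H)) (λ {e} _ → ends-twice (proj₁ (ends H e)) (proj₂ (ends H e))) ⟩
      ∑Fin (size H) (λ _ → 2)                                     ≡⟨ trans (∑Fin-const (size H) 2) (*-comm (size H) 2) ⟩
      2 * size H                                                  ∎
      where
      open ≡-Reasoning
      vs = allFin (order H)
      ends-twice : ∀ a b → ∑ vs (λ v → inc v (a , b)) ≡ 2
      ends-twice a b = trans (∑-+ vs {λ v → 𝟙 (v ≟ a)} {λ v → 𝟙 (v ≟ b)})
        (cong₂ _+_ (∑-δ₁ _≟_ (allFin⁺ (order H)) (∈-allFin a)) (∑-δ₁ _≟_ (allFin⁺ (order H)) (∈-allFin b)))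

    Within : ℕ → Set
    Within d = ∀ v → degree H v ≡ d ⊎ degree H v ≡ suc d

    private
      bounds : ∀ {m d} → m ≡ d ⊎ m ≡ suc d → d ≤ m × m ≤ suc d
      bounds (inj₁ refl) = ≤-refl , n≤1+n _
      bounds (inj₂ refl) = n≤1+n _ , ≤-refl

      unbounds : ∀ {m d} → d ≤ m → m ≤ suc d → m ≡ d ⊎ m ≡ suc d
      unbounds d≤m m≤ with m≤n⇒m<n∨m≡n m≤
      ... | inj₁ m<  = inj₁ (≤-antisym (s≤s⁻¹ m<) d≤m)
      ... | inj₂ m≡ = inj₂ m≡

      degree∈ : ∀ v → degree H v ∈ degrees H
      degree∈ v = ∈-map⁺ (degree H) (∈-allFin v)

    within⇒nearlyRegular : ∀ {d} → 1 ≤ order H → Within d → NearlyRegular H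
    within⇒nearlyRegular {d} 1≤order within = begin
      maxDegree H ∸ minDegree H ≤⟨ ∸-mono upper lower ⟩
      suc d ∸ d                 ≡⟨ m+n∸n≡m 1 d ⟩
      1                         ∎
      where
      open ≤-Reasoning
      all : ∀ {Q : ℕ → Set} → (∀ v → Q (degree H v)) → All Q (degrees H)
      all h = All.map⁺ (All.tabulate (λ {v} _ → h v))
      upper : maxDegree H ≤ suc d
      upper = max≤v⁺ z≤n (all (λ v → proj₂ (bounds (within v))))
      someVertex : ∀ {n} → 1 ≤ n → Fin n
      someVertex (s≤s _) = zero
      lower : d ≤ minDegree H
      lower = v≤min⁺ (≤-trans (proj₁ (bounds (within v))) (All.lookup (xs≤max 0 (degrees H)) (degree∈ v)))
                     (all (λ v → proj₁ (bounds (within v))))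
        where v = someVertex 1≤order

    nearlyRegular⇒within : NearlyRegular H → Within (minDegree H)
    nearlyRegular⇒within nearly v = unbounds (All.lookup (min≤xs (maxDegree H) (degrees H)) (degree∈ v)) (begin
      degree H v                                 ≤⟨ All.lookup (xs≤max 0 (degrees H)) (degree∈ v) ⟩
      maxDegree H                                ≤⟨ m≤n+m∸n (maxDegree H) (minDegree H) ⟩
      minDegree H + (maxDegree H ∸ minDegree H)  ≤⟨ +-monoʳ-≤ (minDegree H) nearly ⟩
      minDegree H + 1                            ≡⟨ +-comm (minDegree H) 1 ⟩
      suc (minDegree H)                          ∎)
      where open ≤-Reasoning

    -- Near regularity leaves the smaller degree open, but the degree sum lies strictly between D
    -- and D + 1 times the order, and this admits no d other than D.
    within-unique : ∀ {d} D r → Within d → D * order H + r ≡ 2 * size H → 1 ≤ r → r < order H → Within D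
    within-unique {d} D r within eq 1≤r r< with <-cmp d D
    ... | tri≈ _ refl _ = within
    ... | tri< d<D _ _ = ⊥-elim (<⇒≱ (≤-trans (s≤s (*-monoˡ-≤ (order H) d<D)) (≤-trans (≤-reflexive (+-comm 1 _)) (+-monoʳ-≤ (D * order H) 1≤r)))
        (begin
          D * order H + r             ≡⟨ trans eq (sym degreeSum) ⟩
          ∑Fin (order H) (degree H)   ≤⟨ ∑-mono (allFin (order H)) (λ {v} _ → proj₂ (bounds (within v))) ⟩
          ∑Fin (order H) (λ _ → suc d) ≡⟨ trans (∑Fin-const (order H) (suc d)) (*-comm (order H) (suc d)) ⟩
          suc d * order H             ∎))
      where open ≤-Reasoning
    ... | tri> _ _ D<d = ⊥-elim (<⇒≱ (+-monoʳ-< (D * order H) r<) (begin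
          D * order H + order H       ≡⟨ +-comm (D * order H) (order H) ⟩
          suc D * order H             ≤⟨ *-monoˡ-≤ (order H) D<d ⟩
          d * order H                 ≡⟨ sym (trans (∑Fin-const (order H) d) (*-comm (order H) d)) ⟩
          ∑Fin (order H) (λ _ → d)    ≤⟨ ∑-mono (allFin (order H)) (λ {v} _ → proj₁ (bounds (within v))) ⟩
          ∑Fin (order H) (degree H)   ≡⟨ trans degreeSum (sym eq) ⟩
          D * order H + r             ∎))
      where open ≤-Reasoning

    within⇒regular : ∀ {d} → Within d → 2 * size H ≡ order H * suc d → Regular H (suc d)
    within⇒regular {d} within eq v = ∑-tight (allFin (order H)) {g = λ _ → suc d} (λ {v} _ → proj₂ (bounds (within v)))
      (≤-reflexive (trans (∑Fin-const (order H) (suc d)) (trans (sym eq) (sym degreeSum)))) (∈-allFin v)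

  -- Subdivisions of ideally connected graphs attain the bounds.

  module Converse (G : Graph) (min2conn : Minimally2Connected G) (H : Graph) (φ : G ≅ subdivide H) (ideal : IdeallyConnected H)
                  (q : ℕ) (1≤q : 1 ≤ q) (within : Degrees.Within H (q + 2)) where

    open GraphPiece
    open Paths
    open Transfer
    open Extremal G min2conn
    open _≅_ φ
    open Degrees H

    private
      S = subdivide H
      toV = Inverse.to onV

      degree-S : ∀ x → degree G x ≡ graphDeg S (toV x)
      degree-S x = trans (degree≡graphDeg G x) (≅-deg φ x)

      degree-old : ∀ v → graphDeg S (old H v) ≡ degree H v
      degree-old v = trans (subdivide-deg-old H v) (sym (degree≡graphDeg H v))

      w≡ : ∀ x → w x ≡ degree G x ∸ 2
      w≡ x = cong (_∸ 2) (sym (degree≡deg G x))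

      -- All new vertices have degree 2, so they drop out of the sum when `g 2` is zero.
      ∑-degrees : ∀ (g : ℕ → ℕ) → g 2 ≡ 0 → ∑Fin n (g ∘ degree G) ≡ ∑Fin (order H) (g ∘ degree H)
      ∑-degrees g g2 = begin
        ∑Fin n (g ∘ degree G)               ≡⟨ ∑-cong (allFin n) (λ {x} _ → cong g (degree-S x)) ⟩
        ∑Fin n (g ∘ graphDeg S ∘ toV)       ≡⟨ ∑Fin-↔ onV (g ∘ graphDeg S) ⟩
        ∑Fin (order H + size H) (g ∘ graphDeg S) ≡⟨ ∑Fin-+ (order H) (size H) (g ∘ graphDeg S) ⟩
        ∑Fin (order H) (g ∘ graphDeg S ∘ old H) + ∑Fin (size H) (g ∘ graphDeg S ∘ new H)
          ≡⟨ cong₂ _+_ (∑-cong (allFin (order H)) (λ {v} _ → cong g (degree-old v)))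
                       (∑-zero (allFin (size H)) (λ {e} _ → trans (cong g (subdivide-deg-new H e)) g2)) ⟩
        ∑Fin (order H) (g ∘ degree H) + 0   ≡⟨ +-identityʳ _ ⟩
        ∑Fin (order H) (g ∘ degree H)       ∎
        where open ≡-Reasoning

      degree∸2 : ∀ {v} → degree H v ≡ q + 2 ⊎ degree H v ≡ suc (q + 2) → degree H v ∸ 2 ≡ q ⊎ degree H v ∸ 2 ≡ suc q
      degree∸2 (inj₁ eq) = inj₁ (trans (cong (_∸ 2) eq) (m+n∸n≡m q 2))
      degree∸2 (inj₂ eq) = inj₂ (trans (cong (_∸ 2) eq) (m+n∸n≡m (suc q) 2))

      values : ∀ x → w x ≡ 0 ⊎ (w x ≡ q ⊎ w x ≡ suc q)
      values x = byView (toV x) refl (vertexView H (toV x))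
        where
        byView : ∀ y → toV x ≡ y → VertexView H y → w x ≡ 0 ⊎ (w x ≡ q ⊎ w x ≡ suc q)
        byView _ eq (new′ e) = inj₁ (trans (w≡ x) (cong (_∸ 2) (trans (degree-S x) (trans (cong (graphDeg S) eq) (subdivide-deg-new H e)))))
        byView _ eq (old′ v) = inj₂ (subst (λ m → m ≡ q ⊎ m ≡ suc q)
          (sym (trans (w≡ x) (cong (_∸ 2) (trans (degree-S x) (trans (cong (graphDeg S) eq) (degree-old v)))))) (degree∸2 {v} (within v)))

      h : V G → ℕ
      h x = 𝟙 (w x ≟ℕ suc q)

      h∑ : ℕ
      h∑ = ∑Fin n h

    p≡order : p ≡ order H
    p≡order = begin
      ∑Fin n pos                                        ≡⟨ ∑-cong (allFin n) (λ {x} _ → cong (λ m → 𝟙 (1 ≤? m)) (w≡ x)) ⟩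
      ∑Fin n (λ x → 𝟙 (1 ≤? degree G x ∸ 2))            ≡⟨ ∑-degrees (λ d → 𝟙 (1 ≤? d ∸ 2)) refl ⟩
      ∑Fin (order H) (λ v → 𝟙 (1 ≤? degree H v ∸ 2))    ≡⟨ ∑-cong (allFin (order H)) (λ {v} _ → 𝟙-yes (1 ≤? degree H v ∸ 2) (large (degree∸2 {v} (within v)))) ⟩
      ∑Fin (order H) (λ _ → 1)                          ≡⟨ trans (∑Fin-const (order H) 1) (*-identityʳ (order H)) ⟩
      order H                                           ∎
      where
      open ≡-Reasoning
      large : ∀ {m} → m ≡ q ⊎ m ≡ suc q → 1 ≤ m
      large (inj₁ refl) = 1≤q
      large (inj₂ refl) = s≤s z≤n

    private
      W≡∑ : W + 2 * order H ≡ 2 * size H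
      W≡∑ = begin
        W + 2 * order H                                 ≡⟨ cong (_+ 2 * order H) (trans (∑-cong (allFin n) (λ {x} _ → w≡ x)) (∑-degrees (_∸ 2) refl)) ⟩
        ∑Fin (order H) (λ v → degree H v ∸ 2) + 2 * order H ≡⟨ cong (∑Fin (order H) (λ v → degree H v ∸ 2) +_) (sym (trans (∑Fin-const (order H) 2) (*-comm (order H) 2))) ⟩
        ∑Fin (order H) (λ v → degree H v ∸ 2) + ∑Fin (order H) (λ _ → 2) ≡⟨ sym (∑-+ (allFin (order H))) ⟩
        ∑Fin (order H) (λ v → degree H v ∸ 2 + 2)       ≡⟨ ∑-cong (allFin (order H)) (λ {v} _ → m∸n+n≡m (large (within v))) ⟩
        ∑Fin (order H) (degree H)                       ≡⟨ degreeSum ⟩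
        2 * size H                                      ∎
        where
        open ≡-Reasoning
        large : ∀ {m} → m ≡ q + 2 ⊎ m ≡ suc (q + 2) → 2 ≤ m
        large (inj₁ refl) = m≤n+m 2 q
        large (inj₂ refl) = m≤n⇒m≤1+n (m≤n+m 2 q)

      value : ∀ m → m ≡ 0 ⊎ (m ≡ q ⊎ m ≡ suc q) → m ≡ q * 𝟙 (1 ≤? m) + 𝟙 (m ≟ℕ suc q)
      value m (inj₁ refl) = sym (trans (+-identityʳ (q * 0)) (*-zeroʳ q))
      value m (inj₂ (inj₁ refl)) = sym (trans (cong₂ (λ s t → q * s + t) (𝟙-yes (1 ≤? q) 1≤q) (𝟙-no (q ≟ℕ suc q) m≢1+m))
        (trans (+-identityʳ (q * 1)) (*-identityʳ q)))
        where
        m≢1+m : ∀ {m} → m ≢ suc m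
        m≢1+m ()
      value m (inj₂ (inj₂ refl)) = sym (trans (cong₂ (λ s t → q * s + t) (𝟙-yes (1 ≤? suc q) (s≤s z≤n)) (𝟙-yes (suc q ≟ℕ suc q) refl))
        (trans (cong (_+ 1) (*-identityʳ q)) (+-comm q 1)))

      W≡ : W ≡ q * p + h∑
      W≡ = trans (∑-cong (allFin n) (λ {x} _ → value (w x) (values x))) (trans (∑-+ (allFin n)) (cong (_+ h∑) (∑-*ˡ (allFin n) q)))

      -- With weights confined to 0, q and q + 1, a minimum is a combination of two products of
      -- indicators, and the double sum can be evaluated exactly instead of estimated.
      product : ∀ a b → a ≡ 0 ⊎ (a ≡ q ⊎ a ≡ suc q) → b ≡ 0 ⊎ (b ≡ q ⊎ b ≡ suc q) →
                a ⊓ b ≡ q * (𝟙 (1 ≤? a) * 𝟙 (1 ≤? b)) + 𝟙 (a ≟ℕ suc q) * 𝟙 (b ≟ℕ suc q)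
      product a b (inj₁ refl) vb = sym (trans (+-identityʳ (q * 0)) (*-zeroʳ q))
      product a b (inj₂ va) (inj₁ refl) = trans (⊓-zeroʳ a) (sym (trans (cong₂ _+_ (trans (cong (q *_) (*-zeroʳ (𝟙 (1 ≤? a)))) (*-zeroʳ q)) (*-zeroʳ (𝟙 (a ≟ℕ suc q)))) refl))
      product a b (inj₂ va) (inj₂ vb) = trans (case va vb) (cong (λ s → q * s + 𝟙 (a ≟ℕ suc q) * 𝟙 (b ≟ℕ suc q))
          (sym (cong₂ _*_ (𝟙-yes (1 ≤? a) (large va)) (𝟙-yes (1 ≤? b) (large vb)))))
        where
        large : ∀ {m} → m ≡ q ⊎ m ≡ suc q → 1 ≤ m
        large (inj₁ refl) = 1≤q
        large (inj₂ refl) = s≤s z≤n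
        q≢ : 𝟙 (q ≟ℕ suc q) ≡ 0
        q≢ = 𝟙-no (q ≟ℕ suc q) (λ ())
        q+ : 𝟙 (suc q ≟ℕ suc q) ≡ 1
        q+ = 𝟙-yes (suc q ≟ℕ suc q) refl
        case : ∀ {a b} → a ≡ q ⊎ a ≡ suc q → b ≡ q ⊎ b ≡ suc q → a ⊓ b ≡ q * 1 + 𝟙 (a ≟ℕ suc q) * 𝟙 (b ≟ℕ suc q)
        case (inj₁ refl) (inj₁ refl) = trans (⊓-idem q) (sym (trans (cong (λ s → q * 1 + s * s) q≢) (trans (+-identityʳ (q * 1)) (*-identityʳ q))))
        case (inj₁ refl) (inj₂ refl) = trans (m≤n⇒m⊓n≡m (n≤1+n q)) (sym (trans (cong (λ s → q * 1 + s * 𝟙 (suc q ≟ℕ suc q)) q≢) (trans (+-identityʳ (q * 1)) (*-identityʳ q))))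
        case (inj₂ refl) (inj₁ refl) = trans (m≥n⇒m⊓n≡n (n≤1+n q)) (sym (trans (cong₂ (λ s t → q * 1 + s * t) q+ q≢) (trans (+-identityʳ (q * 1)) (*-identityʳ q))))
        case (inj₂ refl) (inj₂ refl) = trans (⊓-idem (suc q)) (sym (trans (cong (λ s → q * 1 + s * s) q+) (trans (cong (_+ 1) (*-identityʳ q)) (+-comm q 1))))

      Y+W≡ : Y + W ≡ q * (p * p) + h∑ * h∑
      Y+W≡ = trans (sym Y+W) (trans (∑-cong (allFin n) (λ {x} _ → ∑-cong (allFin n) (λ {y} _ → product (w x) (w y) (values x) (values y))))
        (trans (trans (∑-cong (allFin n) (λ _ → ∑-+ (allFin n))) (∑-+ (allFin n)))
          (cong₂ _+_ (trans (trans (∑-cong (allFin n) (λ _ → ∑-*ˡ (allFin n) q)) (∑-*ˡ (allFin n) q)) (cong (q *_) (∑-product (allFin n) (allFin n))))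
                     (∑-product (allFin n) (allFin n)))))

    -- The degree sum identifies `r` as the number of weights equal to `suc q`.
    Y-value : ∀ r → (q + 2) * order H + r ≡ 2 * size H → Y + (q * order H + r) ≡ q * (order H * order H) + r * r
    Y-value r eq = subst₂ (λ p r → Y + (q * p + r) ≡ q * (p * p) + r * r) p≡order h≡r (trans (cong (Y +_) (sym W≡)) Y+W≡)
      where
      e₁ : ∀ q p r → (q + 2) * p + r ≡ q * p + r + 2 * p
      e₁ = solve-∀
      h≡r : h∑ ≡ r
      h≡r = +-cancelˡ-≡ (q * order H) _ _ (+-cancelʳ-≡ (2 * order H) _ _ (begin
        q * order H + h∑ + 2 * order H  ≡⟨ cong (λ p → q * p + h∑ + 2 * order H) (sym p≡order) ⟩
        q * p + h∑ + 2 * order H        ≡⟨ cong (_+ 2 * order H) (sym W≡) ⟩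
        W + 2 * order H                 ≡⟨ trans W≡∑ (sym eq) ⟩
        (q + 2) * order H + r           ≡⟨ e₁ q (order H) r ⟩
        q * order H + r + 2 * order H   ∎))
        where open ≡-Reasoning

    -- Only pairs of old vertices have a positive minimum. For these, ideal connectedness of `H` is
    -- carried through the subdivision and back along the isomorphism.
    Y≤X : Y ≤ X
    Y≤X = ∑-mono (allFin n) (λ {x} _ → ∑-mono (allFin n) (λ {y} _ → pointwise x y (toV x) (toV y) refl refl (vertexView H (toV x)) (vertexView H (toV y))))
      where
      w-new : ∀ {x e} → toV x ≡ new H e → w x ≡ 0
      w-new {x} {e} eq = trans (w≡ x) (cong (_∸ 2) (trans (degree-S x) (trans (cong (graphDeg S) eq) (subdivide-deg-new H e))))
      w-old : ∀ {x v} → toV x ≡ old H v → w x ≡ degree H v ∸ 2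
      w-old {x} {v} eq = trans (w≡ x) (cong (_∸ 2) (trans (degree-S x) (trans (cong (graphDeg S) eq) (degree-old v))))
      pointwise : ∀ x y a b → toV x ≡ a → toV y ≡ b → VertexView H a → VertexView H b → 𝟙 (¬? (x ≟ y)) * (w x ⊓ w y) ≤ κ₀ G x y ∸ 2
      pointwise x y _ _ p q (new′ e) vb = ≤-trans (≤-reflexive (trans (cong (λ m → 𝟙 (¬? (x ≟ y)) * (m ⊓ w y)) (w-new p)) (*-zeroʳ (𝟙 (¬? (x ≟ y)))))) z≤n
      pointwise x y _ _ p q (old′ u) (new′ e) = ≤-trans (≤-reflexive (trans (cong (λ m → 𝟙 (¬? (x ≟ y)) * (w x ⊓ m)) (w-new q))
        (trans (cong (𝟙 (¬? (x ≟ y)) *_) (⊓-zeroʳ (w x))) (*-zeroʳ (𝟙 (¬? (x ≟ y))))))) z≤n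
      pointwise x y _ _ p q (old′ u) (old′ v) = byEquality (x ≟ y)
        where
        open ≤-Reasoning
        home : ∀ {z a} → toV z ≡ a → Inverse.from onV a ≡ z
        home {z} refl = Inverse.strictlyInverseʳ onV z
        byEquality : Dec (x ≡ y) → 𝟙 (¬? (x ≟ y)) * (w x ⊓ w y) ≤ κ₀ G x y ∸ 2
        byEquality (yes x≡y) = ≤-trans (≤-reflexive (cong (_* (w x ⊓ w y)) (𝟙-no (¬? (x ≟ y)) (λ x≢y → x≢y x≡y)))) z≤n
        byEquality (no x≢y) = begin
          𝟙 (¬? (x ≟ y)) * (w x ⊓ w y)             ≡⟨ cong (_* (w x ⊓ w y)) (𝟙-yes (¬? (x ≟ y)) x≢y) ⟩
          1 * (w x ⊓ w y)                          ≡⟨ trans (*-identityˡ _) (cong₂ _⊓_ (w-old p) (w-old q)) ⟩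
          (degree H u ∸ 2) ⊓ (degree H v ∸ 2)      ≡⟨ sym (∸-distribʳ-⊓ 2 (degree H u) (degree H v)) ⟩
          degree H u ⊓ degree H v ∸ 2              ≡⟨ cong (_∸ 2) (sym (ideal u v u≢v)) ⟩
          κ H u v ∸ 2                              ≤⟨ ∸-monoˡ-≤ 2 κ≤ ⟩
          κ G x y ∸ 2                              ≡⟨ cong (_∸ 2) (sym (κ₀-≢ G x≢y)) ⟩
          κ₀ G x y ∸ 2                             ∎
          where
          u≢v : u ≢ v
          u≢v eq = x≢y (trans (sym (home p)) (trans (cong (Inverse.from onV ∘ old H) eq) (home q)))
          κ≤ : κ H u v ≤ κ G x y
          κ≤ = begin
            κ H u v                                  ≤⟨ subdivide-κ≥ H u≢v ⟩
            κ S (old H u) (old H v)                  ≤⟨ ≅-κ≤ (≅-sym φ) (u≢v ∘ old-injective H) ⟩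
            κ G (Inverse.from onV (old H u)) (Inverse.from onV (old H v)) ≡⟨ cong₂ (κ G) (home p) (home q) ⟩
            κ G x y                                  ∎

    attained : ∀ {k τ} r → (q + 2) * order H + r ≡ 2 * size H →
               q * (order H * order H) + r * r + 4 * k ≡ 4 * (k * k) + τ + (q * order H + r) → 4 * (k * k) + τ ≤ X + 4 * k
    attained {k} {τ} r eq target = +-cancelʳ-≤ (q * order H + r) _ _ (begin
      4 * (k * k) + τ + (q * order H + r)             ≡⟨ sym target ⟩
      q * (order H * order H) + r * r + 4 * k         ≡⟨ cong (_+ 4 * k) (sym (Y-value r eq)) ⟩
      Y + (q * order H + r) + 4 * k                   ≤⟨ +-monoˡ-≤ (4 * k) (+-monoˡ-≤ (q * order H + r) Y≤X) ⟩
      X + (q * order H + r) + 4 * k                   ≡⟨ e X (q * order H + r) k ⟩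
      X + 4 * k + (q * order H + r)                   ∎)
      where
      open ≤-Reasoning
      e : ∀ X s k → X + s + 4 * k ≡ X + 4 * k + s
      e = solve-∀

-- From the excess to the average connectivity.

module AverageConnectivity where

  open import Data.Fin.Properties using (_≟_; _<?_; <-cmp)
  open import Data.Integer.Base as ℤ using (ℤ; +_)
  import Data.Integer.Properties as ℤ
  import Data.Integer.Tactic.RingSolver as ℤSolver
  open import Data.List.Base using (List; []; _∷_; allFin; cartesianProduct; map)
  open import Data.List.Relation.Unary.Unique.Propositional.Properties using (allFin⁺)
  open import Data.Nat.Base hiding (_/_)
  open import Data.Nat.Combinatorics using (_C_; nC1≡n; nCk+nC[k+1]≡[n+1]C[k+1])
  open import Data.Nat.Properties hiding (_≟_; _<?_; <-cmp)
  open import Data.Nat.Tactic.RingSolver using (solve-∀)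
  open import Data.Product.Base using (_×_; _,_; proj₁; uncurry)
  open import Data.Rational.Base as ℚ using (ℚ; _/_; toℚᵘ)
  import Data.Rational.Properties as ℚ
  open import Data.Rational.Unnormalised.Base as ℚᵘ using (mkℚᵘ; *≡*; *≤*; *<*)
  import Data.Rational.Unnormalised.Properties as ℚᵘ
  open import Defs
  open import Function.Base using (_∘_)
  open import Relation.Binary.Definitions using (tri<; tri≈; tri>)
  open import Relation.Binary.PropositionalEquality
  open import Relation.Nullary using (yes; no)
  open Summation
  open WeightSums
  open EdgeCuts
  open Optimisation
  open Multigraphs

  toℚᵘ-/ : ∀ i d .{{_ : NonZero d}} → toℚᵘ (i / d) ℚᵘ.≃ i ℚᵘ./ d
  toℚᵘ-/ i (suc d) = ℚ.toℚᵘ-fromℚᵘ (mkℚᵘ i d)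

  /-mono-≤ : ∀ {i j} d .{{_ : NonZero d}} → i ℤ.≤ j → i / d ℚ.≤ j / d
  /-mono-≤ {i} {j} d@(suc _) i≤j = ℚ.toℚᵘ-cancel-≤ (ℚᵘ.≤-respˡ-≃ (ℚᵘ.≃-sym (toℚᵘ-/ i d))
    (ℚᵘ.≤-respʳ-≃ (ℚᵘ.≃-sym (toℚᵘ-/ j d)) (*≤* (ℤ.*-monoʳ-≤-nonNeg (+ d) i≤j))))

  /-cross-< : ∀ {i j} c d .{{_ : NonZero c}} .{{_ : NonZero d}} → i ℤ.* + d ℤ.< j ℤ.* + c → i / c ℚ.< j / d
  /-cross-< {i} {j} c@(suc _) d@(suc _) lt = ℚ.toℚᵘ-cancel-< (ℚᵘ.<-respˡ-≃ (ℚᵘ.≃-sym (toℚᵘ-/ i c))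
    (ℚᵘ.<-respʳ-≃ (ℚᵘ.≃-sym (toℚᵘ-/ j d)) (*<* lt)))

  /-mono-< : ∀ {i j} d .{{_ : NonZero d}} → i ℤ.< j → i / d ℚ.< j / d
  /-mono-< {i} {j} d@(suc _) i<j = /-cross-< {i} {j} d d (ℤ.*-monoʳ-<-pos (+ d) i<j)

  /-cross-≡ : ∀ {i j} c d .{{_ : NonZero c}} .{{_ : NonZero d}} → i ℤ.* + d ≡ j ℤ.* + c → i / c ≡ j / d
  /-cross-≡ {i} {j} c@(suc _) d@(suc _) eq = ℚ.toℚᵘ-injective (ℚᵘ.≃-trans (toℚᵘ-/ i c)
    (ℚᵘ.≃-trans (*≡* eq) (ℚᵘ.≃-sym (toℚᵘ-/ j d))))

  2+/ : ∀ i d .{{_ : NonZero d}} → + 2 / 1 ℚ.+ i / d ≡ (+ (2 * d) ℤ.+ i) / d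
  2+/ i d@(suc _) = ℚ.toℚᵘ-injective (ℚᵘ.≃-trans (ℚ.toℚᵘ-homo-+ (+ 2 / 1) (i / d))
    (ℚᵘ.≃-trans (ℚᵘ.+-cong (toℚᵘ-/ (+ 2) 1) (toℚᵘ-/ i d))
      (ℚᵘ.≃-trans (*≡* (trans (e (+ d) i) (cong₂ (λ a b → (a ℤ.+ i) ℤ.* b) (sym (ℤ.pos-* 2 d)) (sym (ℤ.pos-* 1 d))))) (ℚᵘ.≃-sym (toℚᵘ-/ (+ (2 * d) ℤ.+ i) d)))))
    where
    e : ∀ d i → (+ 2 ℤ.* d ℤ.+ i ℤ.* + 1) ℤ.* d ≡ (+ 2 ℤ.* d ℤ.+ i) ℤ.* (+ 1 ℤ.* d)
    e = ℤSolver.solve-∀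

  2nC2+n≡n² : ∀ n → 2 * (n C 2) + n ≡ n * n
  2nC2+n≡n² zero    = refl
  2nC2+n≡n² (suc n) = begin
    2 * (suc n C 2) + suc n          ≡⟨ cong (λ c → 2 * c + suc n) (sym (nCk+nC[k+1]≡[n+1]C[k+1] n 1)) ⟩
    2 * (n C 1 + n C 2) + suc n      ≡⟨ cong (λ c → 2 * (c + n C 2) + suc n) (nC1≡n n) ⟩
    2 * (n + n C 2) + suc n          ≡⟨ e₁ n (n C 2) ⟩
    (2 * (n C 2) + n) + (2 * n + 1)  ≡⟨ cong (_+ (2 * n + 1)) (2nC2+n≡n² n) ⟩
    n * n + (2 * n + 1)              ≡⟨ e₂ n ⟩
    suc n * suc n                    ∎
    where
    open ≡-Reasoning
    e₁ : ∀ n c → 2 * (n + c) + suc n ≡ (2 * c + n) + (2 * n + 1)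
    e₁ = solve-∀
    e₂ : ∀ n → n * n + (2 * n + 1) ≡ suc n * suc n
    e₂ = solve-∀

  ∑-cartesianProduct : ∀ {A B : Set} (xs : List A) (ys : List B) {f : A × B → ℕ} →
                       ∑ (cartesianProduct xs ys) f ≡ ∑ xs (λ x → ∑ ys (λ y → f (x , y)))
  ∑-cartesianProduct []       ys     = refl
  ∑-cartesianProduct (x ∷ xs) ys {f} = trans (∑-++ (map (x ,_) ys) (cartesianProduct xs ys))
    (cong₂ _+_ (∑-map (x ,_) ys) (∑-cartesianProduct xs ys))

  module Average (G : Graph) (min2conn : Minimally2Connected G) where

    open GraphPiece
    open Paths
    open Extremal G min2conn using (n; X)

    private
      T = totalConnectivity G

      T≡ : T ≡ ∑Fin n (λ x → ∑Fin n (λ y → 𝟙 (x <? y) * κ G x y))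
      T≡ = trans (∑-filter (uncurry _<?_) (cartesianProduct (allFin n) (allFin n))) (∑-cartesianProduct (allFin n) (allFin n))

      T≡′ : T ≡ ∑Fin n (λ x → ∑Fin n (λ y → 𝟙 (y <? x) * κ G y x))
      T≡′ = trans T≡ (∑-swap (allFin n) (allFin n))

      -- Off the diagonal, κ is the excess plus 2 because it is at least 2 by Whitney's theorem. On
      -- it, `κ₀` is zero, and the last term on the left balances the 2 on the right.
      pointwise : ∀ x y → 𝟙 (x <? y) * κ G x y + 𝟙 (y <? x) * κ G y x + 2 * 𝟙 (x ≟ y) ≡ (κ₀ G x y ∸ 2) + 2
      pointwise x y = byOrder (<-cmp x y)
        where
        excess+2 : ∀ {x y} → x ≢ y → κ G x y ≡ (κ₀ G x y ∸ 2) + 2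
        excess+2 x≢y = trans (sym (m∸n+n≡m (2≤κ G (proj₁ min2conn) x≢y))) (cong (λ k → k ∸ 2 + 2) (sym (κ₀-≢ G x≢y)))
        byOrder : _ → 𝟙 (x <? y) * κ G x y + 𝟙 (y <? x) * κ G y x + 2 * 𝟙 (x ≟ y) ≡ (κ₀ G x y ∸ 2) + 2
        byOrder (tri< a b c) = trans (cong₂ _+_ (cong₂ _+_ (cong (_* κ G x y) (𝟙-yes (x <? y) a)) (cong (_* κ G y x) (𝟙-no (y <? x) c))) (cong (2 *_) (𝟙-no (x ≟ y) b)))
          (trans (simplify (κ G x y)) (excess+2 b))
          where
          simplify : ∀ k → 1 * k + 0 + 2 * 0 ≡ k
          simplify = solve-∀
        byOrder (tri≈ a b c) = trans (cong₂ _+_ (cong₂ _+_ (cong (_* κ G x y) (𝟙-no (x <? y) a)) (cong (_* κ G y x) (𝟙-no (y <? x) c))) (cong (2 *_) (𝟙-yes (x ≟ y) b)))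
          (cong (λ k → k ∸ 2 + 2) (sym (κ₀-refl b)))
          where
          κ₀-refl : x ≡ y → κ₀ G x y ≡ 0
          κ₀-refl refl with x ≟ x
          ... | yes _  = refl
          ... | no x≢x with () ← x≢x refl
        byOrder (tri> a b c) = trans (cong₂ _+_ (cong₂ _+_ (cong (_* κ G x y) (𝟙-no (x <? y) a)) (cong (_* κ G y x) (𝟙-yes (y <? x) c))) (cong (2 *_) (𝟙-no (x ≟ y) b)))
          (trans (simplify (κ G y x)) (trans (κ-sym G (b ∘ sym)) (excess+2 b)))
          where
          simplify : ∀ k → 0 + 1 * k + 2 * 0 ≡ k
          simplify = solve-∀

    2T : 2 * T + 2 * n ≡ X + 2 * (n * n)
    2T = begin
      2 * T + 2 * n
        ≡⟨ cong (_+ 2 * n) (cong (λ s → T + s) (+-identityʳ T)) ⟩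
      T + T + 2 * n
        ≡⟨ cong₂ _+_ (cong₂ _+_ T≡ T≡′) (sym diagonal) ⟩
      ∑∑ (λ x y → 𝟙 (x <? y) * κ G x y) + ∑∑ (λ x y → 𝟙 (y <? x) * κ G y x) + ∑∑ (λ x y → 2 * 𝟙 (x ≟ y))
        ≡⟨ sym (trans (∑∑-+ (λ x y → 𝟙 (x <? y) * κ G x y + 𝟙 (y <? x) * κ G y x) (λ x y → 2 * 𝟙 (x ≟ y)))
                 (cong (_+ ∑∑ (λ x y → 2 * 𝟙 (x ≟ y))) (∑∑-+ (λ x y → 𝟙 (x <? y) * κ G x y) (λ x y → 𝟙 (y <? x) * κ G y x)))) ⟩
      ∑∑ (λ x y → 𝟙 (x <? y) * κ G x y + 𝟙 (y <? x) * κ G y x + 2 * 𝟙 (x ≟ y))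
        ≡⟨ ∑-cong (allFin n) (λ {x} _ → ∑-cong (allFin n) (λ {y} _ → pointwise x y)) ⟩
      ∑∑ (λ x y → (κ₀ G x y ∸ 2) + 2)
        ≡⟨ ∑∑-+ (λ x y → κ₀ G x y ∸ 2) (λ x y → 2) ⟩
      X + ∑∑ (λ x y → 2)
        ≡⟨ cong (λ s → X + s) (trans (∑-cong (allFin n) (λ _ → ∑Fin-const n 2)) (trans (∑Fin-const n (n * 2)) (e n))) ⟩
      X + 2 * (n * n) ∎
      where
      open ≡-Reasoning
      ∑∑ : (V G → V G → ℕ) → ℕ
      ∑∑ f = ∑Fin n (λ x → ∑Fin n (f x))
      ∑∑-+ : ∀ f g → ∑∑ (λ x y → f x y + g x y) ≡ ∑∑ f + ∑∑ g
      ∑∑-+ f g = trans (∑-cong (allFin n) (λ {x} _ → ∑-+ (allFin n) {f x} {g x})) (∑-+ (allFin n))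
      e : ∀ n → n * (n * 2) ≡ 2 * (n * n)
      e = solve-∀
      diagonal : ∑∑ (λ x y → 2 * 𝟙 (x ≟ y)) ≡ 2 * n
      diagonal = trans (∑-cong (allFin n) (λ {x} _ → ∑-*ˡ (allFin n) 2)) (trans (∑-*ˡ (allFin n) 2)
        (cong (2 *_) (trans (∑-cong (allFin n) (λ {x} _ → ∑-cong (allFin n) (λ {y} _ → sym (*-identityʳ (𝟙 (x ≟ y))))))
          (trans (∑-diag _≟_ {f = λ _ _ → 1} (allFin⁺ n)) (trans (∑Fin-const n 1) (*-identityʳ n))))))

    private
      4n[n∸1]≡8C : 4 * n * (n ∸ 1) ≡ 8 * (n C 2)
      4n[n∸1]≡8C = lemma n (n C 2) (2nC2+n≡n² n)
        where
        lemma : ∀ n c → 2 * c + n ≡ n * n → 4 * n * (n ∸ 1) ≡ 8 * c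
        lemma zero c eq with refl ← m+n≡0⇒m≡0 c (trans (sym (+-identityʳ (2 * c))) eq) = refl
        lemma (suc m) c eq = +-cancelʳ-≡ (4 * suc m) _ _ (trans (e₁ m) (trans (cong (4 *_) (sym eq)) (e₂ c m)))
          where
          e₁ : ∀ m → 4 * suc m * m + 4 * suc m ≡ 4 * (suc m * suc m)
          e₁ = solve-∀
          e₂ : ∀ c m → 4 * (2 * c + suc m) ≡ 8 * c + 4 * suc m
          e₂ = solve-∀

      cross-total : ∀ {T X c N D} → 2 * c + N ≡ N * N → 2 * T + 2 * N ≡ X + 2 * (N * N) → D ≡ 8 * c → T * D ≡ (2 * D + 4 * X) * c
      cross-total {T} {X} {c} {N} hC hT refl = begin
        T * (8 * c)                   ≡⟨ e₁ T c ⟩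
        4 * c * (2 * T)               ≡⟨ cong (4 * c *_) (+-cancelʳ-≡ (2 * N) _ _ (trans hT (trans (cong (λ s → X + 2 * s) (sym hC)) (e₂ X c N)))) ⟩
        4 * c * (X + 4 * c)           ≡⟨ e₃ X c ⟩
        (2 * (8 * c) + 4 * X) * c     ∎
        where
        open ≡-Reasoning
        e₁ : ∀ T c → T * (8 * c) ≡ 4 * c * (2 * T)
        e₁ = solve-∀
        e₂ : ∀ X c N → X + 2 * (2 * c + N) ≡ X + 4 * c + 2 * N
        e₂ = solve-∀
        e₃ : ∀ X c → 4 * c * (X + 4 * c) ≡ (2 * (8 * c) + 4 * X) * c
        e₃ = solve-∀

    -- By `2T` the average exceeds 2 by X / n(n - 1). The fraction is expanded by 4 to share its
    -- denominator with the bounds.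
    averageConnectivity≡ : .{{_ : NonTrivial n}} .{{_ : NonZero (4 * n * (n ∸ 1))}} →
                           averageConnectivity G ≡ + 2 / 1 ℚ.+ + (4 * X) / (4 * n * (n ∸ 1))
    averageConnectivity≡ = trans
      (/-cross-≡ {+ T} {+ (2 * D + 4 * X)} (n C 2) D {{nC2≢0 n}} (trans (sym (ℤ.pos-* T D))
        (trans (cong +_ (cross-total {T} {X} {n C 2} {n} {D} (2nC2+n≡n² n) 2T 4n[n∸1]≡8C)) (ℤ.pos-* (2 * D + 4 * X) (n C 2)))))
      (trans (cong (_/ D) (ℤ.pos-+ (2 * D) (4 * X))) (sym (2+/ (+ (4 * X)) D)))
      where D = 4 * n * (n ∸ 1)

-- Rational bounds and the four residues modulo 4.

module Averages where

  open import Data.Empty using (⊥-elim)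
  open import Data.Integer.Base as ℤ using (ℤ; +_)
  import Data.Integer.Properties as ℤ
  import Data.Integer.Tactic.RingSolver as ℤSolver
  open import Data.Nat.Base hiding (_/_)
  open import Data.Nat.Properties
  open import Data.Nat.Tactic.RingSolver using (solve-∀)
  open import Data.Product.Base using (∃; _×_; _,_; proj₁; proj₂)
  open import Data.Rational.Base as ℚ using (ℚ; _/_)
  import Data.Rational.Properties as ℚ
  open import Data.Sum.Base using (_⊎_; inj₁; inj₂)
  open import Defs
  open import Function.Base using (_∘_)
  open import Function.Bundles using (_⇔_; mk⇔)
  open import Relation.Binary.PropositionalEquality
  open import Relation.Nullary using (Dec; yes; no)
  open Summation
  open WeightSums
  open EdgeCuts
  open Optimisation
  open Multigraphs
  open AverageConnectivity

  pos-difference : ∀ a b → + a ≡ + (a + b) ℤ.- + b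
  pos-difference a b = sym (trans (cong (ℤ._- + b) (ℤ.pos-+ a b)) (e (+ a) (+ b)))
    where
    e : ∀ x y → (x ℤ.+ y) ℤ.- y ≡ x
    e = ℤSolver.solve-∀

  -- The integer numerator becomes a difference of two natural numbers, so that comparisons can be
  -- made in ℕ after m n has been added to both sides.
  numerator≡ : ∀ n m c → (+ n) ℤ.^ 2 ℤ.- + m ℤ.* + n ℤ.+ + c ≡ + (n * n + c) ℤ.- + (m * n)
  numerator≡ n m c = begin
    + n ℤ.* (+ n ℤ.* + 1) ℤ.- + m ℤ.* + n ℤ.+ + c  ≡⟨ e (+ n) (+ m) (+ c) ⟩
    (+ n ℤ.* + n ℤ.+ + c) ℤ.- + m ℤ.* + n          ≡⟨ sym (cong₂ (λ a b → (a ℤ.+ + c) ℤ.- b) (ℤ.pos-* n n) (ℤ.pos-* m n)) ⟩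
    (+ (n * n) ℤ.+ + c) ℤ.- + (m * n)              ≡⟨ cong (ℤ._- + (m * n)) (sym (ℤ.pos-+ (n * n) c)) ⟩
    + (n * n + c) ℤ.- + (m * n)                    ∎
    where
    open ≡-Reasoning
    e : ∀ x m c → x ℤ.* (x ℤ.* + 1) ℤ.- m ℤ.* x ℤ.+ c ≡ (x ℤ.* x ℤ.+ c) ℤ.- m ℤ.* x
    e = ℤSolver.solve-∀

  numerator-≤ : ∀ {x n m c} → x + m * n ≤ n * n + c → + x ℤ.≤ (+ n) ℤ.^ 2 ℤ.- + m ℤ.* + n ℤ.+ + c
  numerator-≤ {x} {n} {m} {c} h = subst₂ ℤ._≤_ (sym (pos-difference x (m * n))) (sym (numerator≡ n m c))
    (ℤ.+-monoˡ-≤ (ℤ.- + (m * n)) (ℤ.+≤+ h))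

  numerator-< : ∀ {x n m c} → x + m * n < n * n + c → + x ℤ.< (+ n) ℤ.^ 2 ℤ.- + m ℤ.* + n ℤ.+ + c
  numerator-< {x} {n} {m} {c} h = subst₂ ℤ._<_ (sym (pos-difference x (m * n))) (sym (numerator≡ n m c))
    (ℤ.+-monoˡ-< (ℤ.- + (m * n)) (ℤ.+<+ h))

  numerator-≡ : ∀ {x n m c} → x + m * n ≡ n * n + c → + x ≡ (+ n) ℤ.^ 2 ℤ.- + m ℤ.* + n ℤ.+ + c
  numerator-≡ {x} {n} {m} {c} h = trans (pos-difference x (m * n)) (trans (cong (λ a → + a ℤ.- + (m * n)) h) (sym (numerator≡ n m c)))

  module Comparison (G : Graph) (min2conn : Minimally2Connected G) where

    open Extremal G min2conn
    open Average G min2conn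

    private
      instance
        n-nonTrivial : NonTrivial n
        n-nonTrivial = minimally2Connected⇒nonTrivial G min2conn
        D-nonZero : NonZero (4 * n * (n ∸ 1))
        D-nonZero = 4n[n∸1]≢0 n
        4[n∸1]-nonZero : NonZero (4 * (n ∸ 1))
        4[n∸1]-nonZero = 4[n∸1]≢0 n

      D = 4 * n * (n ∸ 1)

      2≤n : 2 ≤ n
      2≤n = nonTrivial⇒n>1 n

    κ̄ : ℚ
    κ̄ = averageConnectivity G

    average-≤ : ∀ {z} → + (4 * X) ℤ.≤ z → κ̄ ℚ.≤ + 2 / 1 ℚ.+ z / D
    average-≤ {z} h = subst (ℚ._≤ + 2 / 1 ℚ.+ z / D) (sym averageConnectivity≡) (ℚ.+-monoʳ-≤ (+ 2 / 1) (/-mono-≤ D h))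

    average-< : ∀ {z} → + (4 * X) ℤ.< z → κ̄ ℚ.< + 2 / 1 ℚ.+ z / D
    average-< {z} h = subst (ℚ._< + 2 / 1 ℚ.+ z / D) (sym averageConnectivity≡) (ℚ.+-monoʳ-< (+ 2 / 1) (/-mono-< D h))

    average-≡ : ∀ {z} → + (4 * X) ≡ z → κ̄ ≡ + 2 / 1 ℚ.+ z / D
    average-≡ h = trans averageConnectivity≡ (cong (λ z → + 2 / 1 ℚ.+ z / D) h)

    private
      square≡ : (+ n ℤ.- + 2) ℤ.^ 2 ≡ + ((n ∸ 2) * (n ∸ 2))
      square≡ = trans (cong (ℤ._^ 2) (trans (ℤ.m-n≡m⊖n n 2) (ℤ.⊖-≥ 2≤n)))
        (trans (cong (+ (n ∸ 2) ℤ.*_) (ℤ.*-identityʳ (+ (n ∸ 2)))) (sym (ℤ.pos-* (n ∸ 2) (n ∸ 2))))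

    bound₀ : κ̄ ℚ.≤ + 2 / 1 ℚ.+ (+ n ℤ.- + 2) ℤ.^ 2 / D
    bound₀ = average-≤ (subst (+ (4 * X) ℤ.≤_) (sym square≡) (ℤ.+≤+ general-bound))

    bound₀< : + 2 / 1 ℚ.+ (+ n ℤ.- + 2) ℤ.^ 2 / D ℚ.< + 9 / 4
    bound₀< = ℚ.+-monoʳ-< (+ 2 / 1) {(+ n ℤ.- + 2) ℤ.^ 2 / D} {+ 1 / 4} (/-cross-< {(+ n ℤ.- + 2) ℤ.^ 2} {+ 1} D 4
      (subst₂ ℤ._<_ (trans (ℤ.pos-* ((n ∸ 2) * (n ∸ 2)) 4) (cong (ℤ._* + 4) (sym square≡))) (ℤ.pos-* 1 D) (ℤ.+<+ (small n 2≤n))))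
      where
      small : ∀ n → 2 ≤ n → (n ∸ 2) * (n ∸ 2) * 4 < 1 * (4 * n * (n ∸ 1))
      small (suc (suc m)) _ = ≤-trans (m≤m+n _ (12 * m + 7)) (≤-reflexive (e m))
        where
        e : ∀ m → suc (m * m * 4) + (12 * m + 7) ≡ 1 * (4 * (2 + m) * (1 + m))
        e = solve-∀
      small (suc zero) (s≤s ())

    bound : ℕ → ℕ → ℚ
    bound m c = + 2 / 1 ℚ.+ ((+ n) ℤ.^ 2 ℤ.- + m ℤ.* + n ℤ.+ + c) / D

    bound′ : ℚ
    bound′ = + 2 / 1 ℚ.+ ((+ n) ℤ.^ 2 ℤ.- + 4 ℤ.* + n) / D

    bound-0 : bound 4 0 ≡ bound′
    bound-0 = cong (λ z → + 2 / 1 ℚ.+ z / D) (ℤ.+-identityʳ ((+ n) ℤ.^ 2 ℤ.- + 4 ℤ.* + n))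

    bound₁≡ : + 2 / 1 ℚ.+ ((+ n) ℤ.^ 2 ℤ.- + 4 ℤ.* + n) / D ≡ + 2 / 1 ℚ.+ (+ n ℤ.- + 4) / (4 * (n ∸ 1))
    bound₁≡ = cong (+ 2 / 1 ℚ.+_) (/-cross-≡ {(+ n) ℤ.^ 2 ℤ.- + 4 ℤ.* + n} {+ n ℤ.- + 4} D (4 * (n ∸ 1))
      (trans (e (+ n) (+ (4 * (n ∸ 1)))) (cong ((+ n ℤ.- + 4) ℤ.*_) (trans (sym (ℤ.pos-* n (4 * (n ∸ 1)))) (cong +_ (e′ n (n ∸ 1)))))))
      where
      e : ∀ x y → (x ℤ.* (x ℤ.* + 1) ℤ.- + 4 ℤ.* x) ℤ.* y ≡ (x ℤ.- + 4) ℤ.* (x ℤ.* y)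
      e = ℤSolver.solve-∀
      e′ : ∀ n m → n * (4 * m) ≡ 4 * n * m
      e′ = solve-∀

    -- Four times the two sides of an outcome, shifted by s, are the two sides of
    -- the comparison with the bound whose numerator is n² − mn + c.
    module _ {k τ S} (o : Outcome k τ S) m c s (e₁ : 4 * (X + 4 * k) + s ≡ 4 * X + m * n) (e₂ : 4 * (4 * (k * k) + τ) + s ≡ n * n + c) where

      private
        scale-≤ : ∀ {x y} → x ≤ y → 4 * x + s ≤ 4 * y + s
        scale-≤ h = +-monoˡ-≤ s (*-monoʳ-≤ 4 h)

        scale-< : ∀ {x y} → x < y → 4 * x + s < 4 * y + s
        scale-< h = +-monoˡ-< s (*-monoʳ-< 4 h)

      upperBound : κ̄ ℚ.≤ bound m c
      upperBound = average-≤ (numerator-≤ {4 * X} {n} {m} {c} (subst₂ _≤_ e₁ e₂ (scale-≤ (Outcome.upper o))))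

      equality⇒ : κ̄ ≡ bound m c → S
      equality⇒ eq = decide (X + 4 * k <? 4 * (k * k) + τ)
        where
        decide : Dec (X + 4 * k < 4 * (k * k) + τ) → S
        decide (yes lt) = ⊥-elim (ℚ.<-irrefl eq (average-< (numerator-< {4 * X} {n} {m} {c} (subst₂ _<_ e₁ e₂ (scale-< lt)))))
        decide (no ge)  = Outcome.extreme o (≮⇒≥ ge)

      ⇒equality : 4 * (k * k) + τ ≤ X + 4 * k → κ̄ ≡ bound m c
      ⇒equality ge = average-≡ (numerator-≡ {4 * X} {n} {m} {c}
        (trans (sym e₁) (trans (cong (λ x → 4 * x + s) (≤-antisym (Outcome.upper o) ge)) e₂)))

  module Characterisation (G : Graph) (min2conn : Minimally2Connected G) (k : ℕ) where

    open Extremal G min2conn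
    open Comparison G min2conn
    open Subdivided

    private
      order+size : ∀ {H} → G ≅ subdivide H → n ≡ order H + size H
      order+size = ≅⇒order

    module Case₀ (n≡ : n ≡ 4 * k + 0) (8≤k : 8 ≤ k) where

      Extreme : Set
      Extreme = ∃ λ H → IdeallyConnected H × Regular H 6 × order H ≡ k × G ≅ subdivide H

      private
        size≡ : ∀ {o s} → o ≡ k → 4 * k + 0 ≡ o + s → s ≡ 3 * k
        size≡ {s = s} refl eq = +-cancelˡ-≡ k s (3 * k) (trans (sym eq) (e k))
          where
          e : ∀ k → 4 * k + 0 ≡ k + 3 * k
          e = solve-∀

      extreme : Subdivided 3 k → Extreme
      -- The degrees are known to be 5 or 6, and the degree sum is 6k.
      extreme S = H S , ideal S , Degrees.within⇒regular (H S) {5} (degrees-H S) (twice (order≡ S) (size≡ (order≡ S) (trans (sym n≡) (order+size (iso S))))) , order≡ S , iso S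
        where
        twice : ∀ {o s} → o ≡ k → s ≡ 3 * k → 2 * s ≡ o * 6
        twice refl refl = e k
          where
          e : ∀ k → 2 * (3 * k) ≡ k * 6
          e = solve-∀

      attains : Extreme → 4 * (k * k) + 0 ≤ X + 4 * k
      -- Evaluating `Y` has no condition on `r`, so the 6-regular graph can be described by q = 4
      -- and r = 0 in this direction.
      attains (H , ideal , regular , o≡ , φ) = Converse.attained G min2conn H φ ideal 4 (s≤s z≤n) (λ v → inj₁ (regular v)) {k} {0} 0
        (degrees≡ o≡ (size≡ o≡ (trans (sym n≡) (order+size φ)))) (value o≡)
        where
        degrees≡ : ∀ {o s} → o ≡ k → s ≡ 3 * k → (4 + 2) * o + 0 ≡ 2 * s
        degrees≡ refl refl = e k
          where
          e : ∀ k → (4 + 2) * k + 0 ≡ 2 * (3 * k)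
          e = solve-∀
        value : ∀ {o} → o ≡ k → 4 * (o * o) + 0 * 0 + 4 * k ≡ 4 * (k * k) + 0 + (4 * o + 0)
        value refl = e k
          where
          e : ∀ k → 4 * (k * k) + 0 * 0 + 4 * k ≡ 4 * (k * k) + 0 + (4 * k + 0)
          e = solve-∀

      private
        e₁ : ∀ X k → 4 * (X + 4 * k) + 0 ≡ 4 * X + 4 * (4 * k + 0)
        e₁ = solve-∀
        e₂ : ∀ k → 4 * (4 * (k * k) + 0) + 0 ≡ (4 * k + 0) * (4 * k + 0) + 0
        e₂ = solve-∀
        o = outcome₀ k n≡ 8≤k
        l = trans (e₁ X k) (cong (λ n → 4 * X + 4 * n) (sym n≡))
        r = trans (e₂ k) (cong (λ n → n * n + 0) (sym n≡))

      upper : κ̄ ℚ.≤ bound′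
      upper = subst (κ̄ ℚ.≤_) bound-0 (upperBound o 4 0 0 l r)

      characterisation : κ̄ ≡ bound′ ⇔ Extreme
      characterisation = mk⇔ (λ eq → extreme (structure⇒subdivided (equality⇒ o 4 0 0 l r (trans eq (sym bound-0)))))
                             (λ extremal → trans (⇒equality o 4 0 0 l r (attains extremal)) bound-0)

    module Case₁ (n≡ : n ≡ 4 * k + 1) (30≤k : 30 ≤ k) where

      Extreme : Set
      Extreme = ∃ λ H → IdeallyConnected H × NearlyRegular H × (order H ≡ k × size H ≡ 3 * k + 1) × G ≅ subdivide H

      extreme : Subdivided 4 k → Extreme
      extreme S = H S , ideal S ,
        Degrees.within⇒nearlyRegular (H S) {6} (≤-trans (≤-trans (m≤m+n 1 29) 30≤k) (≤-reflexive (sym (order≡ S)))) (degrees-H S) ,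
        (order≡ S , size≡ (order≡ S) (trans (sym n≡) (order+size (iso S)))) , iso S
        where
        size≡ : ∀ {o s} → o ≡ k → 4 * k + 1 ≡ o + s → s ≡ 3 * k + 1
        size≡ {s = s} refl eq = +-cancelˡ-≡ k s (3 * k + 1) (trans (sym eq) (e k))
          where
          e : ∀ k → 4 * k + 1 ≡ k + (3 * k + 1)
          e = solve-∀

      attains : Extreme → 4 * (k * k) + 2 ≤ X + 4 * k
      attains (H , ideal , nearly , (o≡ , s≡) , φ) = Converse.attained G min2conn H φ ideal 4 (s≤s z≤n)
        -- The degree sum 6k + 2 fixes the degrees as 6 and 7, that is, the weights as 4 and 5.
        (within-unique 6 2 (nearlyRegular⇒within nearly) (degrees≡ o≡ s≡) (s≤s z≤n) (≤-trans (≤-trans (m≤m+n 3 27) 30≤k) (≤-reflexive (sym o≡))))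
        {k} {2} 2 (degrees≡ o≡ s≡) (value o≡)
        where
        open Degrees H
        degrees≡ : ∀ {o s} → o ≡ k → s ≡ 3 * k + 1 → 6 * o + 2 ≡ 2 * s
        degrees≡ refl refl = e k
          where
          e : ∀ k → 6 * k + 2 ≡ 2 * (3 * k + 1)
          e = solve-∀
        value : ∀ {o} → o ≡ k → 4 * (o * o) + 2 * 2 + 4 * k ≡ 4 * (k * k) + 2 + (4 * o + 2)
        value refl = e k
          where
          e : ∀ k → 4 * (k * k) + 2 * 2 + 4 * k ≡ 4 * (k * k) + 2 + (4 * k + 2)
          e = solve-∀

      private
        e₁ : ∀ X k → 4 * (X + 4 * k) + (8 * k + 6) ≡ 4 * X + 6 * (4 * k + 1)
        e₁ = solve-∀
        e₂ : ∀ k → 4 * (4 * (k * k) + 2) + (8 * k + 6) ≡ (4 * k + 1) * (4 * k + 1) + 13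
        e₂ = solve-∀
        o = outcome₁ k n≡ 30≤k
        l = trans (e₁ X k) (cong (λ n → 4 * X + 6 * n) (sym n≡))
        r = trans (e₂ k) (cong (λ n → n * n + 13) (sym n≡))

      upper : κ̄ ℚ.≤ bound 6 13
      upper = upperBound o 6 13 (8 * k + 6) l r

      characterisation : κ̄ ≡ bound 6 13 ⇔ Extreme
      characterisation = mk⇔ (extreme ∘ structure⇒subdivided ∘ equality⇒ o 6 13 (8 * k + 6) l r) (⇒equality o 6 13 (8 * k + 6) l r ∘ attains)

    private
      order-k+1 : ∀ {o s t} → o ≡ k + 1 → 4 * k + suc t ≡ o + s → s ≡ 3 * k + t
      order-k+1 {s = s} {t} refl eq = +-cancelˡ-≡ (k + 1) s (3 * k + t) (trans (sym eq) (e k t))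
        where
        e : ∀ k t → 4 * k + suc t ≡ k + 1 + (3 * k + t)
        e = solve-∀

    module Case₂ (n≡ : n ≡ 4 * k + 2) (68≤k : 68 ≤ k) where

      Extreme : Set
      Extreme = ∃ λ H → IdeallyConnected H × NearlyRegular H ×
                ((order H ≡ k × size H ≡ 3 * k + 2) ⊎ (order H ≡ k + 1 × size H ≡ 3 * k + 1)) × G ≅ subdivide H

      extreme : Subdivided 4 k ⊎ Subdivided 3 (k + 1) → Extreme
      extreme (inj₁ S) = H S , ideal S ,
        Degrees.within⇒nearlyRegular (H S) {6} (≤-trans (≤-trans (m≤m+n 1 67) 68≤k) (≤-reflexive (sym (order≡ S)))) (degrees-H S) ,
        inj₁ (order≡ S , size≡ (order≡ S) (trans (sym n≡) (order+size (iso S)))) , iso S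
        where
        size≡ : ∀ {o s} → o ≡ k → 4 * k + 2 ≡ o + s → s ≡ 3 * k + 2
        size≡ {s = s} refl eq = +-cancelˡ-≡ k s (3 * k + 2) (trans (sym eq) (e k))
          where
          e : ∀ k → 4 * k + 2 ≡ k + (3 * k + 2)
          e = solve-∀
      extreme (inj₂ S) = H S , ideal S ,
        Degrees.within⇒nearlyRegular (H S) {5} (≤-trans (m≤n+m 1 k) (≤-reflexive (sym (order≡ S)))) (degrees-H S) ,
        inj₂ (order≡ S , order-k+1 (order≡ S) (trans (sym n≡) (order+size (iso S)))) , iso S

      attains : Extreme → 4 * (k * k) + 12 ≤ X + 4 * k
      attains (H , ideal , nearly , inj₁ (o≡ , s≡) , φ) = Converse.attained G min2conn H φ ideal 4 (s≤s z≤n)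
        (within-unique 6 4 (nearlyRegular⇒within nearly) (degrees≡ o≡ s≡) (s≤s z≤n) (≤-trans (≤-trans (m≤m+n 5 63) 68≤k) (≤-reflexive (sym o≡))))
        {k} {12} 4 (degrees≡ o≡ s≡) (value o≡)
        where
        open Degrees H
        degrees≡ : ∀ {o s} → o ≡ k → s ≡ 3 * k + 2 → 6 * o + 4 ≡ 2 * s
        degrees≡ refl refl = e k
          where
          e : ∀ k → 6 * k + 4 ≡ 2 * (3 * k + 2)
          e = solve-∀
        value : ∀ {o} → o ≡ k → 4 * (o * o) + 4 * 4 + 4 * k ≡ 4 * (k * k) + 12 + (4 * o + 4)
        value refl = e k
          where
          e : ∀ k → 4 * (k * k) + 4 * 4 + 4 * k ≡ 4 * (k * k) + 12 + (4 * k + 4)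
          e = solve-∀
      attains (H , ideal , nearly , inj₂ (o≡ , s≡) , φ) = byRemainder (m≤n⇒∃[o]m+o≡n (≤-trans (m≤m+n 3 65) 68≤k))
        where
        open Degrees H
        degrees≡ : ∀ {k o s r} → 3 + r ≡ k → o ≡ k + 1 → s ≡ 3 * k + 1 → 5 * o + r ≡ 2 * s
        degrees≡ {r = r} refl refl refl = e r
          where
          e : ∀ r → 5 * (3 + r + 1) + r ≡ 2 * (3 * (3 + r) + 1)
          e = solve-∀
        value : ∀ {k o r} → 3 + r ≡ k → o ≡ k + 1 → 3 * (o * o) + r * r + 4 * k ≡ 4 * (k * k) + 12 + (3 * o + r)
        value {r = r} refl refl = e r
          where
          e : ∀ r → 3 * ((3 + r + 1) * (3 + r + 1)) + r * r + 4 * (3 + r) ≡ 4 * ((3 + r) * (3 + r)) + 12 + (3 * (3 + r + 1) + r)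
          e = solve-∀
        remainder : ∀ {k o r} → 68 ≤ k → 3 + r ≡ k → o ≡ k + 1 → 1 ≤ r × r < o
        remainder {r = r} 68≤k refl refl = +-cancelˡ-≤ 3 1 r (≤-trans (m≤m+n 4 64) 68≤k) , ≤-trans (m≤n+m (suc r) 3) (≤-reflexive (e r))
          where
          e : ∀ r → 3 + suc r ≡ 3 + r + 1
          e = solve-∀
        byRemainder : (∃ λ r → 3 + r ≡ k) → 4 * (k * k) + 12 ≤ X + 4 * k
        byRemainder (r , eq) = Converse.attained G min2conn H φ ideal 3 (s≤s z≤n)
          -- The degree sum 6k + 2 equals 5(k + 1) + r for r = k - 3, so on k + 1 vertices the
          -- degrees are 5 and 6.
          (within-unique 5 r (nearlyRegular⇒within nearly) (degrees≡ eq o≡ s≡) (proj₁ (remainder 68≤k eq o≡)) (proj₂ (remainder 68≤k eq o≡)))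
          {k} {12} r (degrees≡ eq o≡ s≡) (value eq o≡)

      private
        e₁ : ∀ X k → 4 * (X + 4 * k) + (16 * k + 16) ≡ 4 * X + 8 * (4 * k + 2)
        e₁ = solve-∀
        e₂ : ∀ k → 4 * (4 * (k * k) + 12) + (16 * k + 16) ≡ (4 * k + 2) * (4 * k + 2) + 60
        e₂ = solve-∀
        o = outcome₂ k n≡ 68≤k
        l = trans (e₁ X k) (cong (λ n → 4 * X + 8 * n) (sym n≡))
        r = trans (e₂ k) (cong (λ n → n * n + 60) (sym n≡))

        subdivided : Structure 4 k ⊎ Structure 3 (k + 1) → Subdivided 4 k ⊎ Subdivided 3 (k + 1)
        subdivided (inj₁ S) = inj₁ (structure⇒subdivided S)
        subdivided (inj₂ S) = inj₂ (structure⇒subdivided S)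

      upper : κ̄ ℚ.≤ bound 8 60
      upper = upperBound o 8 60 (16 * k + 16) l r

      characterisation : κ̄ ≡ bound 8 60 ⇔ Extreme
      characterisation = mk⇔ (extreme ∘ subdivided ∘ equality⇒ o 8 60 (16 * k + 16) l r) (⇒equality o 8 60 (16 * k + 16) l r ∘ attains)

    module Case₃ (n≡ : n ≡ 4 * k + 3) (30≤k : 30 ≤ k) where

      Extreme : Set
      Extreme = ∃ λ H → IdeallyConnected H × NearlyRegular H × (order H ≡ k + 1 × size H ≡ 3 * k + 2) × G ≅ subdivide H

      extreme : Subdivided 3 (k + 1) → Extreme
      extreme S = H S , ideal S ,
        Degrees.within⇒nearlyRegular (H S) {5} (≤-trans (m≤n+m 1 k) (≤-reflexive (sym (order≡ S)))) (degrees-H S) ,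
        (order≡ S , order-k+1 (order≡ S) (trans (sym n≡) (order+size (iso S)))) , iso S

      attains : Extreme → 4 * (k * k) + (4 * k + 2) ≤ X + 4 * k
      attains (H , ideal , nearly , (o≡ , s≡) , φ) = byRemainder (m≤n⇒∃[o]m+o≡n (≤-trans (m≤m+n 1 29) 30≤k))
        where
        open Degrees H
        degrees≡ : ∀ {k o s r} → 1 + r ≡ k → o ≡ k + 1 → s ≡ 3 * k + 2 → 5 * o + r ≡ 2 * s
        degrees≡ {r = r} refl refl refl = e r
          where
          e : ∀ r → 5 * (1 + r + 1) + r ≡ 2 * (3 * (1 + r) + 2)
          e = solve-∀
        value : ∀ {k o r} → 1 + r ≡ k → o ≡ k + 1 → 3 * (o * o) + r * r + 4 * k ≡ 4 * (k * k) + (4 * k + 2) + (3 * o + r)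
        value {r = r} refl refl = e r
          where
          e : ∀ r → 3 * ((1 + r + 1) * (1 + r + 1)) + r * r + 4 * (1 + r) ≡ 4 * ((1 + r) * (1 + r)) + (4 * (1 + r) + 2) + (3 * (1 + r + 1) + r)
          e = solve-∀
        remainder : ∀ {k o r} → 30 ≤ k → 1 + r ≡ k → o ≡ k + 1 → 1 ≤ r × r < o
        remainder {r = r} 30≤k refl refl = s≤s⁻¹ (≤-trans (m≤m+n 2 28) 30≤k) , m≤m+n (suc r) 1
        byRemainder : (∃ λ r → 1 + r ≡ k) → 4 * (k * k) + (4 * k + 2) ≤ X + 4 * k
        byRemainder (r , eq) = Converse.attained G min2conn H φ ideal 3 (s≤s z≤n)
          (within-unique 5 r (nearlyRegular⇒within nearly) (degrees≡ eq o≡ s≡) (proj₁ (remainder 30≤k eq o≡)) (proj₂ (remainder 30≤k eq o≡)))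
          {k} {4 * k + 2} r (degrees≡ eq o≡ s≡) (value eq o≡)

      private
        e₁ : ∀ X k → 4 * (X + 4 * k) + (8 * k + 18) ≡ 4 * X + 6 * (4 * k + 3)
        e₁ = solve-∀
        e₂ : ∀ k → 4 * (4 * (k * k) + (4 * k + 2)) + (8 * k + 18) ≡ (4 * k + 3) * (4 * k + 3) + 17
        e₂ = solve-∀
        o = outcome₃ k n≡ 30≤k
        l = trans (e₁ X k) (cong (λ n → 4 * X + 6 * n) (sym n≡))
        r = trans (e₂ k) (cong (λ n → n * n + 17) (sym n≡))

      upper : κ̄ ℚ.≤ bound 6 17
      upper = upperBound o 6 17 (8 * k + 18) l r

      characterisation : κ̄ ≡ bound 6 17 ⇔ Extreme
      characterisation = mk⇔ (extreme ∘ structure⇒subdivided ∘ equality⇒ o 6 17 (8 * k + 18) l r) (⇒equality o 6 17 (8 * k + 18) l r ∘ attains)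

open import Defs
open import Data.Integer.Base using (+_; _+_; _-_; _*_; _^_)
open import Data.Nat.Base as ℕ using (ℕ)
open import Data.Product.Base using (∃; _×_)
open import Data.Rational.Base as ℚ using (_/_)
open import Data.Sum.Base using (_⊎_)
open import Function.Bundles using (_⇔_)
open import Relation.Binary.PropositionalEquality.Core using (_≡_)
open import Data.Product.Base using (_,_)
open import Relation.Binary.PropositionalEquality.Core using (trans; cong)

theorem2p11 :
  (G : Graph) (min2conn : Minimally2Connected G) →
  let instance
        nontrivial = minimally2Connected⇒nonTrivial G min2conn
        4n[n-1]≢0  = 4n[n∸1]≢0 (order G)
        4[n-1]≢0   = 4[n∸1]≢0 (order G)
      n        = + order G
      4n[n-1]  = 4 ℕ.* order G ℕ.* (order G ℕ.∸ 1)
      4[n-1]   = 4 ℕ.* (order G ℕ.∸ 1)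
      κ̄        = averageConnectivity G
      B₀       = + 2 / 1 ℚ.+ (n - + 2) ^ 2 / 4n[n-1]
      B₁       = + 2 / 1 ℚ.+ (n ^ 2 - + 4 * n) / 4n[n-1]
      B₂       = + 2 / 1 ℚ.+ (n ^ 2 - + 6 * n + + 13) / 4n[n-1]
      B₃       = + 2 / 1 ℚ.+ (n ^ 2 - + 8 * n + + 60) / 4n[n-1]
      B₄       = + 2 / 1 ℚ.+ (n ^ 2 - + 6 * n + + 17) / 4n[n-1]
  in
  (κ̄ ℚ.≤ B₀ × B₀ ℚ.< + 9 / 4)
  ×
  (∀ (k ℓ : ℕ) → order G ≡ 4 ℕ.* k ℕ.+ ℓ → ℓ ℕ.< 4 →
    (k ℕ.≥ 8 → ℓ ≡ 0 →
      κ̄ ℚ.≤ B₁ × B₁ ≡ + 2 / 1 ℚ.+ (n - + 4) / 4[n-1] ×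
      (κ̄ ≡ B₁ ⇔ (∃ λ H → IdeallyConnected H × Regular H 6 × order H ≡ k × G ≅ subdivide H)))
    ×
    (k ℕ.≥ 30 → ℓ ≡ 1 →
      κ̄ ℚ.≤ B₂ ×
      (κ̄ ≡ B₂ ⇔ (∃ λ H → IdeallyConnected H × NearlyRegular H ×
                         (order H ≡ k × size H ≡ 3 ℕ.* k ℕ.+ 1) × G ≅ subdivide H)))
    ×
    (k ℕ.≥ 68 → ℓ ≡ 2 →
      κ̄ ℚ.≤ B₃ ×
      (κ̄ ≡ B₃ ⇔ (∃ λ H → IdeallyConnected H × NearlyRegular H ×
                         ((order H ≡ k × size H ≡ 3 ℕ.* k ℕ.+ 2) ⊎
                          (order H ≡ k ℕ.+ 1 × size H ≡ 3 ℕ.* k ℕ.+ 1)) × G ≅ subdivide H)))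
    ×
    (k ℕ.≥ 30 → ℓ ≡ 3 →
      κ̄ ℚ.≤ B₄ ×
      (κ̄ ≡ B₄ ⇔ (∃ λ H → IdeallyConnected H × NearlyRegular H ×
                         (order H ≡ k ℕ.+ 1 × size H ≡ 3 ℕ.* k ℕ.+ 2) × G ≅ subdivide H))))
theorem2p11 G min2conn = (bound₀ , bound₀<) , λ k ℓ n≡ _ →
  let open Characterisation G min2conn k
      n≡′ : ∀ {ℓ′} → ℓ ≡ ℓ′ → order G ≡ 4 ℕ.* k ℕ.+ ℓ′
      n≡′ ℓ≡ = trans n≡ (cong (4 ℕ.* k ℕ.+_) ℓ≡)
  in
  (λ 8≤k  ℓ≡0 → Case₀.upper (n≡′ ℓ≡0) 8≤k , bound₁≡ , Case₀.characterisation (n≡′ ℓ≡0) 8≤k) ,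
  (λ 30≤k ℓ≡1 → Case₁.upper (n≡′ ℓ≡1) 30≤k , Case₁.characterisation (n≡′ ℓ≡1) 30≤k) ,
  (λ 68≤k ℓ≡2 → Case₂.upper (n≡′ ℓ≡2) 68≤k , Case₂.characterisation (n≡′ ℓ≡2) 68≤k) ,
  (λ 30≤k ℓ≡3 → Case₃.upper (n≡′ ℓ≡3) 30≤k , Case₃.characterisation (n≡′ ℓ≡3) 30≤k)
  where
  open Averages
  open Comparison G min2conn
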